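{- Let $\ell=\ell(k)$ be a function from the positive integers to the positive integers (so $\ell(k)\geq 1$ for all $k$) such that $\ell(k)/k^{6/5}\to 0$ as $k\to\infty$. Then $$\mathrm{ind}(k,\ell(k)) \leq \frac{1}{e} + o_k(1),$$ i.e. there is a function $\varepsilon$ of $k$ with $\varepsilon(k)\to 0$ as $k\to\infty$ such that $\mathrm{ind}(k,\ell(k))\leq 1/e+\varepsilon(k)$ for all $k$.
   Context: All graphs are finite, simple and undirected. For a graph $G$ with at least $k$ vertices, let $X_{G,k}$ be the random variable giving the number of edges of $G$ induced by a subset $A\subseteq V(G)$ chosen uniformly at random among all subsets of $V(G)$ of size $k$. For $n\geq k$ define $$I(n,k,\ell) := \max\{\Pr[X_{G,k}=\ell] : G \text{ is a graph with } n \text{ vertices}\}.$$ For fixed $k,\ell$, the function $I(n,k,\ell)$ is non-increasing in $n$ (by a standard averaging argument), so the limit $$\mathrm{ind}(k,\ell) := \lim_{n\to\infty} I(n,k,\ell)$$ exists. The notation $o_k(1)$ denotes a function of $k$ tending to $0$ as $k\to\infty$. Here $e$ is the base of the natural logarithm. -}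

module Defs where

open import Data.Bool.Base using (Bool; true; false; not; _∧_; _∨_; T)
import Data.Bool.Properties as Bool
open import Data.Fin.Base as Fin using (Fin; zero; suc; punchIn)
import Data.Fin.Properties as Fin
open import Data.Fin.Subset using (Subset; inside; outside; _∈_; ⊥; ∣_∣)
open import Data.Fin.Subset.Properties using (_∈?_; ∣⊥∣≡0)
import Data.Integer.Base as ℤ
import Data.Integer.Properties as ℤ
open import Data.List.Base as List
  using (List; []; _∷_; _++_; length; map; filter; allFin; cartesianProduct; cartesianProductWith)
open import Data.List.Membership.Propositional using () renaming (_∈_ to _∈ₗ_)
open import Data.List.Membership.Propositional.Properties
  using (∈-cartesianProductWith⁺; ∈-filter⁺; ∈-map⁺; ∈-map⁻; ∈-length)
import Data.List.Properties as List
open import Data.List.Relation.Unary.All as All using ([]; _∷_)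
open import Data.List.Relation.Unary.AllPairs using ([]; _∷_)
open import Data.List.Relation.Unary.Any using (here; there)
open import Data.List.Relation.Unary.Unique.Propositional using (Unique)
open import Data.List.Relation.Unary.Unique.Propositional.Properties using (cartesianProductWith⁺)
import Data.Nat.Base as ℕ
open import Data.Nat.Base using (ℕ; zero; suc; _+_; _*_; _^_; _!; _≤_; _<_; z≤n; s≤s; NonZero)
import Data.Nat.Properties as ℕ
open import Data.Nat.Tactic.RingSolver using (solve-∀)
open import Data.Product.Base using (Σ; ∃; ∃-syntax; _×_; _,_; proj₁; proj₂)
open import Data.Rational.Base as ℚ using (ℚ; 0ℚ; 1ℚ; ½; _/_)
import Data.Rational.Properties as ℚ
open import Data.Rational.Solver using () renaming (module +-*-Solver to ℚ-Solver)
import Data.Rational.Unnormalised.Base as ℚᵘ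
import Data.Rational.Unnormalised.Properties as ℚᵘ
open import Data.Sum.Base using (_⊎_; inj₁; inj₂)
open import Data.Unit.Base using (tt)
open import Data.Vec.Base as Vec using (Vec; []; _∷_; lookup; tabulate; insertAt; _[_]≔_)
import Data.Vec.Properties as Vec
open import Function.Base using (_∘_; id)
open import Relation.Binary.Bundles using (module DecTotalOrder)
open import Relation.Binary.Definitions using (tri<; tri≈; tri>)
open import Relation.Binary.PropositionalEquality
open import Relation.Nullary
open import Relation.Nullary.Decidable using (dec-true; dec-false; _×-dec_)
open import Relation.Unary using (Decidable)
open import Algebra.Properties.Semiring.Sum ℕ.+-*-semiring
  using (sum; sum-cong-≗; sum-replicate-zero; sum-remove; ∑-distrib-+; ∑-comm; *-distribˡ-sum; *-distribʳ-sum)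
open import Data.List.Extrema (DecTotalOrder.totalOrder ℚ.≤-decTotalOrder) using (max; xs≤max; argmax-sel)

frac-≤ : ∀ a b c d .{{_ : NonZero b}} .{{_ : NonZero d}} →
         a * d ≤ c * b → (ℤ.+ a / b) ℚ.≤ (ℤ.+ c / d)
frac-≤ a b@(suc _) c d@(suc _) h = ℚ.toℚᵘ-cancel-≤ (begin
  ℚ.toℚᵘ (ℤ.+ a / b)       ≃⟨ ℚ.toℚᵘ-fromℚᵘ (ℤ.+ a ℚᵘ./ b) ⟩
  ℤ.+ a ℚᵘ./ b             ≤⟨ ℚᵘ.*≤* (subst₂ ℤ._≤_ (ℤ.pos-* a d) (ℤ.pos-* c b) (ℤ.+≤+ h)) ⟩
  ℤ.+ c ℚᵘ./ d             ≃⟨ ℚ.toℚᵘ-fromℚᵘ (ℤ.+ c ℚᵘ./ d) ⟨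
  ℚ.toℚᵘ (ℤ.+ c / d)       ∎)
  where open ℚᵘ.≤-Reasoning

frac-≤⁻¹ : ∀ a b c d .{{_ : NonZero b}} .{{_ : NonZero d}} →
           (ℤ.+ a / b) ℚ.≤ (ℤ.+ c / d) → a * d ≤ c * b
frac-≤⁻¹ a b@(suc _) c d@(suc _) h = ℤ.drop‿+≤+
  (subst₂ ℤ._≤_ (sym (ℤ.pos-* a d)) (sym (ℤ.pos-* c b)) (ℚᵘ.drop-*≤* (begin
    ℤ.+ a ℚᵘ./ b           ≃⟨ ℚ.toℚᵘ-fromℚᵘ (ℤ.+ a ℚᵘ./ b) ⟨
    ℚ.toℚᵘ (ℤ.+ a / b)     ≤⟨ ℚ.toℚᵘ-mono-≤ h ⟩
    ℚ.toℚᵘ (ℤ.+ c / d)     ≃⟨ ℚ.toℚᵘ-fromℚᵘ (ℤ.+ c ℚᵘ./ d) ⟩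
    ℤ.+ c ℚᵘ./ d           ∎)))
  where open ℚᵘ.≤-Reasoning

frac-≡ : ∀ a b c d .{{_ : NonZero b}} .{{_ : NonZero d}} →
         a * d ≡ c * b → (ℤ.+ a / b) ≡ (ℤ.+ c / d)
frac-≡ a b c d h = ℚ.≤-antisym (frac-≤ a b c d (ℕ.≤-reflexive h))
                               (frac-≤ c d a b (ℕ.≤-reflexive (sym h)))

frac-+ : ∀ a b c d .{{_ : NonZero b}} .{{_ : NonZero d}} →
         (ℤ.+ a / b) ℚ.+ (ℤ.+ c / d) ≡ (ℤ.+ (a * d + c * b) / (b * d)) {{ℕ.m*n≢0 b d}}
frac-+ a b@(suc _) c d@(suc _) = ℚ.toℚᵘ-injective (begin-equality
  ℚ.toℚᵘ ((ℤ.+ a / b) ℚ.+ (ℤ.+ c / d))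
    ≃⟨ ℚ.toℚᵘ-homo-+ (ℤ.+ a / b) (ℤ.+ c / d) ⟩
  ℚ.toℚᵘ (ℤ.+ a / b) ℚᵘ.+ ℚ.toℚᵘ (ℤ.+ c / d)
    ≃⟨ ℚᵘ.+-cong (ℚ.toℚᵘ-fromℚᵘ (ℤ.+ a ℚᵘ./ b)) (ℚ.toℚᵘ-fromℚᵘ (ℤ.+ c ℚᵘ./ d)) ⟩
  (ℤ.+ a ℚᵘ./ b) ℚᵘ.+ (ℤ.+ c ℚᵘ./ d)
    ≃⟨ ℚᵘ.≃-reflexive (cong (λ z → z ℚᵘ./ (b * d)) (cong₂ ℤ._+_ (sym (ℤ.pos-* a d)) (sym (ℤ.pos-* c b)))) ⟩
  ℤ.+ (a * d + c * b) ℚᵘ./ (b * d)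
    ≃⟨ ℚ.toℚᵘ-fromℚᵘ (ℤ.+ (a * d + c * b) ℚᵘ./ (b * d)) ⟨
  ℚ.toℚᵘ (ℤ.+ (a * d + c * b) / (b * d)) ∎)
  where open ℚᵘ.≤-Reasoning

0≤frac : ∀ a b .{{_ : NonZero b}} → 0ℚ ℚ.≤ (ℤ.+ a / b)
0≤frac a b = frac-≤ 0 1 a b z≤n

IsCauchy : (ℕ → ℚ) → Set
IsCauchy a = ∀ ε → 0ℚ ℚ.< ε →
  ∃[ N ] (∀ m n → N ≤ m → N ≤ n → ℚ.∣ a m ℚ.- a n ∣ ℚ.≤ ε)

-- Reals are given by Cauchy sequences; no quotient is taken, all notions below
-- being invariant under replacing a sequence by an equivalent one, except for
-- the side condition of _÷ᵣ_.
record ℝ : Set where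
  constructor real
  field
    seq    : ℕ → ℚ
    cauchy : IsCauchy seq
open ℝ public

infix 4 _≤ᵣ_

_≤ᵣ_ : ℝ → ℝ → Set
x ≤ᵣ y = ∀ ε → 0ℚ ℚ.< ε → ∃[ N ] (∀ n → N ≤ n → seq x n ℚ.≤ seq y n ℚ.+ ε)

sub-≤ : ∀ {p q r} → p ℚ.≤ q ℚ.+ r → p ℚ.- q ℚ.≤ r
sub-≤ {p} {q} {r} h = subst (p ℚ.- q ℚ.≤_)
  (solve 2 (λ q r → (q :+ r) :- q := r) refl q r) (ℚ.+-monoˡ-≤ (ℚ.- q) h)
  where open ℚ-Solver

sub-≤⁻¹ : ∀ {p q r} → p ℚ.- q ℚ.≤ r → p ℚ.≤ q ℚ.+ r
sub-≤⁻¹ {p} {q} {r} h = subst (ℚ._≤ q ℚ.+ r)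
  (solve 2 (λ p q → q :+ (p :- q) := p) refl p q) (ℚ.+-monoʳ-≤ q h)
  where open ℚ-Solver

neg-sub : ∀ p q → ℚ.- (p ℚ.- q) ≡ q ℚ.- p
neg-sub = solve 2 (λ p q → :- (p :- q) := q :- p) refl
  where open ℚ-Solver

dist-≤ : ∀ {p q r} → p ℚ.≤ q ℚ.+ r → q ℚ.≤ p ℚ.+ r → ℚ.∣ p ℚ.- q ∣ ℚ.≤ r
dist-≤ {p} {q} h₁ h₂ with ℚ.∣p∣≡p∨∣p∣≡-p (p ℚ.- q)
... | inj₁ eq = subst (ℚ._≤ _) (sym eq) (sub-≤ h₁)
... | inj₂ eq = subst (ℚ._≤ _) (sym (trans eq (neg-sub p q))) (sub-≤ h₂)

dist-≤⁻¹ : ∀ {p q r} → ℚ.∣ p ℚ.- q ∣ ℚ.≤ r → p ℚ.≤ q ℚ.+ r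
dist-≤⁻¹ {p} {q} h = sub-≤⁻¹ (ℚ.≤-trans (p≤∣p∣ (p ℚ.- q)) h)
  where
  p≤∣p∣ : ∀ p → p ℚ.≤ ℚ.∣ p ∣
  p≤∣p∣ p with ℚ.≤-total 0ℚ p
  ... | inj₁ 0≤p = ℚ.≤-reflexive (sym (ℚ.0≤p⇒∣p∣≡p 0≤p))
  ... | inj₂ p≤0 = ℚ.≤-trans p≤0 (ℚ.0≤∣p∣ p)

dist-sym : ∀ p q → ℚ.∣ p ℚ.- q ∣ ≡ ℚ.∣ q ℚ.- p ∣
dist-sym p q = trans (sym (ℚ.∣-p∣≡∣p∣ (p ℚ.- q))) (cong ℚ.∣_∣ (neg-sub p q))

small : ∀ C ε → 0ℚ ℚ.< ε → ∃[ N ] (∀ n → N ≤ n → (ℤ.+ C / suc n) ℚ.≤ ε)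
small C ε@(ℚ.mkℚ (ℤ.+ suc p) d _) _ = C * suc d , λ n N≤n →
  subst ((ℤ.+ C / suc n) ℚ.≤_) (ℚ.↥p/↧p≡p ε)
    (frac-≤ C (suc n) (suc p) (suc d)
      (ℕ.≤-trans N≤n (ℕ.≤-trans (ℕ.n≤1+n n) (ℕ.m≤m+n (suc n) (p * suc n)))))
small C (ℚ.mkℚ (ℤ.+ 0) d _) (ℚ.*<* (ℤ.+<+ ()))
small C (ℚ.mkℚ (ℤ.-[1+ p ]) d _) (ℚ.*<* ())

half-pos : ∀ {ε} → 0ℚ ℚ.< ε → 0ℚ ℚ.< ½ ℚ.* ε
half-pos {ε} 0<ε = subst (ℚ._< ½ ℚ.* ε) (ℚ.*-zeroʳ ½) (ℚ.*-monoʳ-<-pos ½ 0<ε)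

half+half : ∀ ε → ½ ℚ.* ε ℚ.+ ½ ℚ.* ε ≡ ε
half+half ε = trans (sym (ℚ.*-distribʳ-+ ε ½ ½)) (ℚ.*-identityˡ ε)

-- A sequence with |a (1 + i) - a i| ≤ C/(1+i) - C/(2+i) is Cauchy.
steps⇒cauchy : ∀ C (a : ℕ → ℚ) →
  (∀ i → a i ℚ.+ (ℤ.+ C / suc (suc i)) ℚ.≤ a (suc i) ℚ.+ (ℤ.+ C / suc i)) →
  (∀ i → a (suc i) ℚ.+ (ℤ.+ C / suc (suc i)) ℚ.≤ a i ℚ.+ (ℤ.+ C / suc i)) →
  IsCauchy a
steps⇒cauchy C a up down ε 0<ε with small C ε 0<ε
... | N , small-N = N , bound
  where
  u : ℕ → ℚ
  u i = ℤ.+ C / suc i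

  0≤u : ∀ i → 0ℚ ℚ.≤ u i
  0≤u i = 0≤frac C (suc i)

  cross : ∀ {p q r s} → p ℚ.+ q ℚ.≤ r ℚ.+ s → p ℚ.- s ℚ.≤ r ℚ.- q
  cross {p} {q} {r} {s} h = subst₂ ℚ._≤_
    (solve 3 (λ p q s → (p :+ q) :+ (:- q :+ :- s) := p :- s) refl p q s)
    (solve 3 (λ r q s → (r :+ s) :+ (:- q :+ :- s) := r :- q) refl r q s)
    (ℚ.+-monoˡ-≤ (ℚ.- q ℚ.+ ℚ.- s) h)
    where open ℚ-Solver

  lower : ∀ {i j} → i ℕ.≤′ j → a i ℚ.- u i ℚ.≤ a j ℚ.- u j
  lower ℕ.≤′-refl           = ℚ.≤-refl
  lower (ℕ.≤′-step {j} i≤j) = ℚ.≤-trans (lower i≤j) (cross {a j} {u (suc j)} {a (suc j)} {u j} (up j))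

  upper : ∀ {i j} → i ℕ.≤′ j → a j ℚ.+ u j ℚ.≤ a i ℚ.+ u i
  upper ℕ.≤′-refl           = ℚ.≤-refl
  upper (ℕ.≤′-step {j} i≤j) = ℚ.≤-trans (down j) (upper i≤j)

  bound′ : ∀ {i j} → N ≤ i → i ≤ j → ℚ.∣ a i ℚ.- a j ∣ ℚ.≤ ε
  bound′ {i} {j} N≤i i≤j = ℚ.≤-trans (dist-≤ {a i} {a j} {u i} low high) (small-N i N≤i)
    where
    low : a i ℚ.≤ a j ℚ.+ u i
    low = subst (a i ℚ.≤_) (ℚ.+-comm (u i) (a j)) (sub-≤⁻¹ {a i} {u i} {a j} (ℚ.≤-trans (lower (ℕ.≤⇒≤′ i≤j))
      (subst (a j ℚ.- u j ℚ.≤_) (ℚ.+-identityʳ (a j))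
        (ℚ.+-monoʳ-≤ (a j) (ℚ.neg-antimono-≤ (0≤u j))))))

    high : a j ℚ.≤ a i ℚ.+ u i
    high = ℚ.≤-trans
      (subst (ℚ._≤ a j ℚ.+ u j) (ℚ.+-identityʳ (a j)) (ℚ.+-monoʳ-≤ (a j) (0≤u j)))
      (upper (ℕ.≤⇒≤′ i≤j))

  bound : ∀ m n → N ≤ m → N ≤ n → ℚ.∣ a m ℚ.- a n ∣ ℚ.≤ ε
  bound m n N≤m N≤n with ℕ.≤-total m n
  ... | inj₁ m≤n = bound′ N≤m m≤n
  ... | inj₂ n≤m = subst (ℚ._≤ ε) (dist-sym (a n) (a m)) (bound′ N≤n n≤m)

infixl 6 _+ᵣ_
infixl 7 _÷ᵣ_

fromℚ : ℚ → ℝ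
fromℚ q = real (λ _ → q) λ ε 0<ε → 0 , λ _ _ _ _ →
  subst (ℚ._≤ ε) (sym (cong ℚ.∣_∣ (ℚ.+-inverseʳ q))) (ℚ.<⇒≤ 0<ε)

_+ᵣ_ : ℝ → ℝ → ℝ
x +ᵣ y = real (λ n → seq x n ℚ.+ seq y n) sum-cauchy
  where
  sum-cauchy : IsCauchy (λ n → seq x n ℚ.+ seq y n)
  sum-cauchy ε 0<ε with cauchy x (½ ℚ.* ε) (half-pos 0<ε) | cauchy y (½ ℚ.* ε) (half-pos 0<ε)
  ... | M , close-x | N , close-y = M ℕ.⊔ N , λ m n K≤m K≤n →
    subst₂ ℚ._≤_
      (cong ℚ.∣_∣ (rearrange (seq x m) (seq y m) (seq x n) (seq y n)))
      (half+half ε)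
      (ℚ.≤-trans (ℚ.∣p+q∣≤∣p∣+∣q∣ (seq x m ℚ.- seq x n) (seq y m ℚ.- seq y n))
        (ℚ.+-mono-≤
          (close-x m n (ℕ.≤-trans (ℕ.m≤m⊔n M N) K≤m) (ℕ.≤-trans (ℕ.m≤m⊔n M N) K≤n))
          (close-y m n (ℕ.≤-trans (ℕ.m≤n⊔m M N) K≤m) (ℕ.≤-trans (ℕ.m≤n⊔m M N) K≤n))))
    where
    open ℚ-Solver
    rearrange : ∀ p q r s → (p ℚ.- r) ℚ.+ (q ℚ.- s) ≡ (p ℚ.+ q) ℚ.- (r ℚ.+ s)
    rearrange = solve 4 (λ p q r s → (p :- r) :+ (q :- s) := (p :+ q) :- (r :+ s)) refl

1≤⇒nonZero : ∀ {p} → 1ℚ ℚ.≤ p → ℚ.NonZero p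
1≤⇒nonZero 1≤p = ℚ.>-nonZero (ℚ.<-≤-trans (ℚ.positive⁻¹ 1ℚ) 1≤p)

recip-pos : ∀ p .{{_ : ℚ.NonZero p}} → .(ℚ.Positive p) → ℚ.Positive (ℚ.1/ p)
recip-pos (ℚ.mkℚ ℤ.+[1+ _ ] _ _) _ = _

recip≤1 : ∀ p .{{_ : ℚ.NonZero p}} → 1ℚ ℚ.≤ p → ℚ.∣ ℚ.1/ p ∣ ℚ.≤ 1ℚ
recip≤1 p 1≤p = subst (ℚ._≤ 1ℚ) (sym (ℚ.0≤p⇒∣p∣≡p 0≤1/p))
    (subst₂ ℚ._≤_ (ℚ.*-identityʳ (ℚ.1/ p)) (ℚ.*-inverseˡ p)
      (ℚ.*-monoˡ-≤-nonNeg (ℚ.1/ p) {{ℚ.nonNegative 0≤1/p}} 1≤p))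
  where
  p>0 : ℚ.Positive p
  p>0 = ℚ.positive (ℚ.<-≤-trans (ℚ.positive⁻¹ 1ℚ) 1≤p)
  0≤1/p : 0ℚ ℚ.≤ ℚ.1/ p
  0≤1/p = ℚ.<⇒≤ (ℚ.positive⁻¹ (ℚ.1/ p) {{recip-pos p p>0}})

dist-quot : ∀ q y z .{{_ : ℚ.NonZero y}} .{{_ : ℚ.NonZero z}} → 1ℚ ℚ.≤ y → 1ℚ ℚ.≤ z →
            ℚ.∣ q ℚ.÷ y ℚ.- q ℚ.÷ z ∣ ℚ.≤ ℚ.∣ q ∣ ℚ.* ℚ.∣ z ℚ.- y ∣
dist-quot q y z 1≤y 1≤z = subst (ℚ._≤ ℚ.∣ q ∣ ℚ.* D) (sym eq)
    (ℚ.*-monoˡ-≤-nonNeg ℚ.∣ q ∣ {{ℚ.∣-∣-nonNeg q}}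
      (subst (ℚ.∣ 1/y ∣ ℚ.* (ℚ.∣ 1/z ∣ ℚ.* D) ℚ.≤_) (trans (ℚ.*-identityˡ (1ℚ ℚ.* D)) (ℚ.*-identityˡ D))
        (ℚ.≤-trans
          (ℚ.*-monoʳ-≤-nonNeg (ℚ.∣ 1/z ∣ ℚ.* D)
            {{ℚ.nonNeg*nonNeg⇒nonNeg ℚ.∣ 1/z ∣ {{ℚ.∣-∣-nonNeg 1/z}} D {{D≥0}}}} (recip≤1 y 1≤y))
          (ℚ.*-monoˡ-≤-nonNeg 1ℚ (ℚ.*-monoʳ-≤-nonNeg D {{D≥0}} (recip≤1 z 1≤z))))))
  where
  1/y = ℚ.1/ y
  1/z = ℚ.1/ z
  D = ℚ.∣ z ℚ.- y ∣
  D≥0 : ℚ.NonNegative D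
  D≥0 = ℚ.∣-∣-nonNeg (z ℚ.- y)

  expand : q ℚ.÷ y ℚ.- q ℚ.÷ z ≡ q ℚ.* (1/y ℚ.* (1/z ℚ.* (z ℚ.- y)))
  expand = begin
    q ℚ.* 1/y ℚ.- q ℚ.* 1/z
      ≡⟨ solve 3 (λ q r s → q :* r :- q :* s := q :* (r :* con 1ℚ :- s :* con 1ℚ)) refl q 1/y 1/z ⟩
    q ℚ.* (1/y ℚ.* 1ℚ ℚ.- 1/z ℚ.* 1ℚ)
      ≡⟨ cong₂ (λ s t → q ℚ.* (1/y ℚ.* s ℚ.- 1/z ℚ.* t)) (sym (ℚ.*-inverseˡ z)) (sym (ℚ.*-inverseˡ y)) ⟩
    q ℚ.* (1/y ℚ.* (1/z ℚ.* z) ℚ.- 1/z ℚ.* (1/y ℚ.* y))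
      ≡⟨ solve 5 (λ q r s y z → q :* (r :* (s :* z) :- s :* (r :* y)) := q :* (r :* (s :* (z :- y)))) refl q 1/y 1/z y z ⟩
    q ℚ.* (1/y ℚ.* (1/z ℚ.* (z ℚ.- y))) ∎
    where
    open ≡-Reasoning
    open ℚ-Solver

  eq : ℚ.∣ q ℚ.÷ y ℚ.- q ℚ.÷ z ∣ ≡ ℚ.∣ q ∣ ℚ.* (ℚ.∣ 1/y ∣ ℚ.* (ℚ.∣ 1/z ∣ ℚ.* D))
  eq = trans (cong ℚ.∣_∣ expand)
    (trans (ℚ.∣p*q∣≡∣p∣*∣q∣ q _) (cong (ℚ.∣ q ∣ ℚ.*_)
      (trans (ℚ.∣p*q∣≡∣p∣*∣q∣ 1/y _) (cong (ℚ.∣ 1/y ∣ ℚ.*_) (ℚ.∣p*q∣≡∣p∣*∣q∣ 1/z _)))))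

-- The quotient q/x. Division is only needed for denominators all of whose
-- approximations are at least 1.
_÷ᵣ_ : ℚ → (x : ℝ) → .(1≤x : ∀ n → 1ℚ ℚ.≤ seq x n) → ℝ
(q ÷ᵣ x) 1≤x = real quot quot-cauchy
  where
  quot : ℕ → ℚ
  quot n = (q ℚ.÷ seq x n) {{1≤⇒nonZero (1≤x n)}}

  1≤seq : ∀ n → 1ℚ ℚ.≤ seq x n
  1≤seq n = recompute (1ℚ ℚ.≤? seq x n) (1≤x n)

  quot-cauchy : IsCauchy quot
  quot-cauchy ε 0<ε = proj₁ close , λ m n N≤m N≤n → ℚ.≤-trans (dist-quot q (seq x m) (seq x n) {{1≤⇒nonZero (1≤x m)}} {{1≤⇒nonZero (1≤x n)}} (1≤seq m) (1≤seq n)) (begin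
      ℚ.∣ q ∣ ℚ.* ℚ.∣ seq x n ℚ.- seq x m ∣
        ≤⟨ ℚ.*-monoʳ-≤-nonNeg _ {{ℚ.∣-∣-nonNeg (seq x n ℚ.- seq x m)}} ∣q∣≤b ⟩
      b ℚ.* ℚ.∣ seq x n ℚ.- seq x m ∣
        ≤⟨ ℚ.*-monoˡ-≤-nonNeg b {{ℚ.pos⇒nonNeg b}} (proj₂ close n m N≤n N≤m) ⟩
      b ℚ.* (ℚ.1/ b ℚ.* ε)
        ≡⟨ trans (sym (ℚ.*-assoc b (ℚ.1/ b) ε)) (cong (ℚ._* ε) (ℚ.*-inverseʳ b)) ⟩
      1ℚ ℚ.* ε
        ≡⟨ ℚ.*-identityˡ ε ⟩
      ε ∎)
    where
    open ℚ.≤-Reasoning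
    b = ℚ.∣ q ∣ ℚ.+ 1ℚ
    ∣q∣≤b : ℚ.∣ q ∣ ℚ.≤ b
    ∣q∣≤b = subst (ℚ._≤ b) (ℚ.+-identityʳ ℚ.∣ q ∣) (ℚ.+-monoʳ-≤ ℚ.∣ q ∣ (ℚ.nonNegative⁻¹ 1ℚ))
    instance
      b>0 : ℚ.Positive b
      b>0 = ℚ.nonNeg+pos⇒pos ℚ.∣ q ∣ {{ℚ.∣-∣-nonNeg q}} 1ℚ
      b≢0 : ℚ.NonZero b
      b≢0 = ℚ.pos⇒nonZero b
    0<ε/b : 0ℚ ℚ.< ℚ.1/ b ℚ.* ε
    0<ε/b = subst (ℚ._< ℚ.1/ b ℚ.* ε) (ℚ.*-zeroʳ (ℚ.1/ b))
      (ℚ.*-monoʳ-<-pos (ℚ.1/ b) {{recip-pos b b>0}} 0<ε)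
    close = cauchy x (ℚ.1/ b ℚ.* ε) 0<ε/b

infix 4 _⟶_

-- Convergence as n → ∞ of a function of the natural numbers n ≥ k₀.
_⟶_ : ∀ {k₀} → (∀ n → .(k₀ ≤ n) → ℝ) → ℝ → Set
_⟶_ {k₀} f L = ∀ ε → 0ℚ ℚ.< ε → ∃[ N ] (∀ n .(k₀≤n : k₀ ≤ n) → N ≤ n →
  f n k₀≤n ≤ᵣ L +ᵣ fromℚ ε × L ≤ᵣ f n k₀≤n +ᵣ fromℚ ε)

-- The partial sums 1/0! + ... + 1/n! of the series for e.
expSum : ℕ → ℚ
expSum zero    = 1ℚ
expSum (suc n) = expSum n ℚ.+ (ℤ.+ 1 / (suc n !)) {{suc n ℕ.!≢0}}

fact-bound : ∀ i → suc (suc i) ≤ 3 * (i !)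
fact-bound zero          = s≤s (s≤s z≤n)
fact-bound (suc zero)    = s≤s (s≤s (s≤s z≤n))
fact-bound (suc (suc i)) = begin
  4 + i                    ≤⟨ s≤s (fact-bound (suc i)) ⟩
  1 + 3 * F                ≡⟨ ℕ.+-comm 1 (3 * F) ⟩
  3 * F + 1                ≤⟨ ℕ.+-monoʳ-≤ (3 * F) (ℕ.>-nonZero⁻¹ (3 * F) {{ℕ.m*n≢0 3 F {{_}} {{suc i ℕ.!≢0}}}}) ⟩
  3 * F + 3 * F            ≤⟨ ℕ.m≤m+n _ (i * (3 * F)) ⟩
  3 * F + 3 * F + i * (3 * F) ≡⟨ lem i F ⟩
  3 * ((2 + i) * F)        ∎
  where
  open ℕ.≤-Reasoning
  F = suc i !
  lem : ∀ i F → 3 * F + 3 * F + i * (3 * F) ≡ 3 * ((2 + i) * F)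
  lem = solve-∀

expSum-cauchy : IsCauchy expSum
expSum-cauchy = steps⇒cauchy 3 expSum up down
  where
  open ℚ.≤-Reasoning
  t : ℕ → ℚ
  t i = (ℤ.+ 1 / (suc i !)) {{suc i ℕ.!≢0}}

  0≤t : ∀ i → 0ℚ ℚ.≤ t i
  0≤t i = 0≤frac 1 (suc i !) {{suc i ℕ.!≢0}}

  u-anti : ∀ i → (ℤ.+ 3 / suc (suc i)) ℚ.≤ (ℤ.+ 3 / suc i)
  u-anti i = frac-≤ 3 (suc (suc i)) 3 (suc i) (ℕ.*-monoʳ-≤ 3 (ℕ.n≤1+n (suc i)))

  up : ∀ i → expSum i ℚ.+ (ℤ.+ 3 / suc (suc i)) ℚ.≤ expSum (suc i) ℚ.+ (ℤ.+ 3 / suc i)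
  up i = ℚ.+-mono-≤
    (subst (ℚ._≤ expSum (suc i)) (ℚ.+-identityʳ (expSum i)) (ℚ.+-monoʳ-≤ (expSum i) (0≤t i)))
    (u-anti i)

  step : ∀ i → t i ℚ.+ (ℤ.+ 3 / suc (suc i)) ℚ.≤ (ℤ.+ 3 / suc i)
  step i = subst (ℚ._≤ (ℤ.+ 3 / suc i)) (sym (frac-+ 1 F 3 (2 + i) {{F≢0}}))
      (frac-≤ (1 * (2 + i) + 3 * F) (F * (2 + i)) 3 (suc i) {{ℕ.m*n≢0 F (2 + i) {{F≢0}}}} (arith (i !) (fact-bound i)))
    where
    F = suc i !
    F≢0 = suc i ℕ.!≢0
    module N = ℕ.≤-Reasoning
    arith : ∀ f → 2 + i ≤ 3 * f →
            (1 * (2 + i) + 3 * (suc i * f)) * suc i ≤ 3 * ((suc i * f) * (2 + i))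
    arith f h = N.begin
      (1 * (2 + i) + 3 * (suc i * f)) * suc i  N.≤⟨ ℕ.*-monoˡ-≤ (suc i) (ℕ.+-monoˡ-≤ (3 * (suc i * f)) (ℕ.*-monoʳ-≤ 1 h)) ⟩
      (1 * (3 * f) + 3 * (suc i * f)) * suc i  N.≡⟨ lem i f ⟩
      3 * ((suc i * f) * (2 + i))              N.∎
      where
      lem : ∀ i f → (1 * (3 * f) + 3 * (suc i * f)) * suc i ≡ 3 * ((suc i * f) * (2 + i))
      lem = solve-∀

  down : ∀ i → expSum (suc i) ℚ.+ (ℤ.+ 3 / suc (suc i)) ℚ.≤ expSum i ℚ.+ (ℤ.+ 3 / suc i)
  down i = subst (ℚ._≤ expSum i ℚ.+ (ℤ.+ 3 / suc i)) (sym (ℚ.+-assoc (expSum i) (t i) (ℤ.+ 3 / suc (suc i))))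
    (ℚ.+-monoʳ-≤ (expSum i) (step i))

1≤expSum : ∀ n → 1ℚ ℚ.≤ expSum n
1≤expSum zero    = ℚ.≤-refl
1≤expSum (suc n) = ℚ.≤-trans (1≤expSum n)
  (subst (ℚ._≤ expSum (suc n)) (ℚ.+-identityʳ (expSum n))
    (ℚ.+-monoʳ-≤ (expSum n) (0≤frac 1 (suc n !) {{suc n ℕ.!≢0}})))

e : ℝ
e = real expSum expSum-cauchy

1/e : ℝ
1/e = (1ℚ ÷ᵣ e) 1≤expSum

-- ⌊ m ^ (1/d) ⌋
⌊root⌋ : ℕ → ℕ → ℕ
⌊root⌋ d zero    = 0
⌊root⌋ d (suc m) with suc (⌊root⌋ d m) ^ d ℕ.≤? suc m
... | yes _ = suc (⌊root⌋ d m)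
... | no  _ = ⌊root⌋ d m

⌊root⌋-≤ : ∀ d m .{{_ : NonZero d}} → ⌊root⌋ d m ^ d ≤ m
⌊root⌋-≤ (suc d) zero = z≤n
⌊root⌋-≤ d (suc m) with suc (⌊root⌋ d m) ^ d ℕ.≤? suc m
... | yes h = h
... | no  _ = ℕ.m≤n⇒m≤1+n (⌊root⌋-≤ d m)

⌊root⌋-> : ∀ d m .{{_ : NonZero d}} → m < suc (⌊root⌋ d m) ^ d
⌊root⌋-> d zero = ℕ.m^n>0 1 d
⌊root⌋-> d (suc m) with suc (⌊root⌋ d m) ^ d ℕ.≤? suc m
... | yes _ = ℕ.≤-<-trans (⌊root⌋-> d m) (ℕ.^-monoˡ-< d (ℕ.n<1+n (suc (⌊root⌋ d m))))
... | no  h = ℕ.≰⇒> h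

-- m ^ (1/d), the n-th approximation being its truncation to a multiple of 1/(1+n).
rootSeq : ℕ → ℕ → ℕ → ℚ
rootSeq d m n = ℤ.+ ⌊root⌋ d (m * suc n ^ d) / suc n

^-distribʳ-* : ∀ d a b → (a * b) ^ d ≡ a ^ d * b ^ d
^-distribʳ-* zero    a b = refl
^-distribʳ-* (suc d) a b = trans (cong ((a * b) *_) (^-distribʳ-* d a b)) (lem a b (a ^ d) (b ^ d))
  where
  lem : ∀ a b x y → (a * b) * (x * y) ≡ (a * x) * (b * y)
  lem = solve-∀

^-cancelˡ-< : ∀ d {a b} → a ^ d < b ^ d → a < b
^-cancelˡ-< d {a} {b} h with a ℕ.<? b
... | yes a<b = a<b
... | no  a≮b = contradiction h (ℕ.≤⇒≯ (ℕ.^-monoˡ-≤ d (ℕ.≮⇒≥ a≮b)))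

rootSeq-cauchy : ∀ d m .{{_ : NonZero d}} → IsCauchy (rootSeq d m)
rootSeq-cauchy d m ε 0<ε with small 1 ε 0<ε
... | N , small-N = N , λ i j N≤i N≤j → dist-≤
        (ℚ.≤-trans (close i j) (ℚ.+-monoʳ-≤ (rootSeq d m j) (small-N j N≤j)))
        (ℚ.≤-trans (close j i) (ℚ.+-monoʳ-≤ (rootSeq d m i) (small-N i N≤i)))
  where
  r : ℕ → ℕ
  r i = ⌊root⌋ d (m * suc i ^ d)

  cross : ∀ i j → r i * suc j < suc (r j) * suc i
  cross i j = ^-cancelˡ-< d (begin-strict
    (r i * suc j) ^ d            ≡⟨ ^-distribʳ-* d (r i) (suc j) ⟩
    r i ^ d * suc j ^ d          ≤⟨ ℕ.*-monoˡ-≤ (suc j ^ d) (⌊root⌋-≤ d (m * suc i ^ d)) ⟩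
    m * suc i ^ d * suc j ^ d    ≡⟨ lem m (suc i ^ d) (suc j ^ d) ⟩
    m * suc j ^ d * suc i ^ d    <⟨ ℕ.*-monoˡ-< (suc i ^ d) {{ℕ.m^n≢0 (suc i) d}} (⌊root⌋-> d (m * suc j ^ d)) ⟩
    suc (r j) ^ d * suc i ^ d    ≡⟨ ^-distribʳ-* d (suc (r j)) (suc i) ⟨
    (suc (r j) * suc i) ^ d      ∎)
    where
    open ℕ.≤-Reasoning
    lem : ∀ a b c → a * b * c ≡ a * c * b
    lem = solve-∀

  close : ∀ i j → rootSeq d m i ℚ.≤ rootSeq d m j ℚ.+ (ℤ.+ 1 / suc j)
  close i j = subst (rootSeq d m i ℚ.≤_) eq
      (frac-≤ (r i) (suc i) (suc (r j)) (suc j) (ℕ.<⇒≤ (cross i j)))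
    where
    lem : ∀ a b → suc a * (b * b) ≡ (a * b + 1 * b) * b
    lem = solve-∀
    eq : ℤ.+ suc (r j) / suc j ≡ rootSeq d m j ℚ.+ (ℤ.+ 1 / suc j)
    eq = trans (frac-≡ (suc (r j)) (suc j) (r j * suc j + 1 * suc j) (suc j * suc j) (lem (r j) (suc j)))
               (sym (frac-+ (r j) (suc j) 1 (suc j)))

root : ∀ d → .{{NonZero d}} → ℕ → ℝ
root d m = real (rootSeq d m) (rootSeq-cauchy d m)

1≤root : ∀ d m .{{_ : NonZero d}} → .(1 ≤ m) → ∀ n → 1ℚ ℚ.≤ seq (root d m) n
1≤root d m 1≤m n = frac-≤ 1 1 r (suc n)
    (subst₂ _≤_ (sym (ℕ.*-identityˡ (suc n))) (sym (ℕ.*-identityʳ r))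
      (ℕ.≤-pred (^-cancelˡ-< d (ℕ.≤-<-trans
        (ℕ.m≤n*m (suc n ^ d) m {{ℕ.>-nonZero 1≤m}})
        (⌊root⌋-> d (m * suc n ^ d))))))
  where
  r = ⌊root⌋ d (m * suc n ^ d)

infix 8 _^6/5

_^6/5 : ℕ → ℝ
k ^6/5 = root 5 (k ^ 6)

1≤k^6/5 : ∀ k → .(1 ≤ k) → ∀ n → 1ℚ ℚ.≤ seq (k ^6/5) n
1≤k^6/5 k 1≤k = 1≤root 5 (k ^ 6) (ℕ.m^n>0 k {{ℕ.>-nonZero 1≤k}} 6)

-- The vertex set of a graph on n vertices is taken to be Fin n.
record Graph (n : ℕ) : Set where
  field
    adj        : Fin n → Fin n → Bool
    adj-sym    : ∀ i j → adj i j ≡ adj j i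
    adj-irrefl : ∀ i → adj i i ≡ false
open Graph public

-- The condition i < j below counts each undirected edge once.
IsInducedEdge : ∀ {n} → Graph n → Subset n → Fin n × Fin n → Set
IsInducedEdge G A (i , j) = i Fin.< j × i ∈ A × j ∈ A × adj G i j ≡ true

isInducedEdge? : ∀ {n} (G : Graph n) A → Decidable (IsInducedEdge G A)
isInducedEdge? G A (i , j) = (i Fin.<? j) ×-dec (i ∈? A) ×-dec (j ∈? A) ×-dec (adj G i j Bool.≟ true)

inducedEdges : ∀ {n} → Graph n → Subset n → List (Fin n × Fin n)
inducedEdges {n} G A = filter (isInducedEdge? G A) (cartesianProduct (allFin n) (allFin n))

e[_,_] : ∀ {n} → Graph n → Subset n → ℕ
e[ G , A ] = length (inducedEdges G A)

vectors : ∀ {A : Set} → List A → ∀ n → List (Vec A n)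
vectors xs zero    = [] ∷ []
vectors xs (suc n) = cartesianProductWith _∷_ xs (vectors xs n)

∈-vectors : ∀ {A : Set} {xs : List A} → (∀ x → x ∈ₗ xs) → ∀ {n} (v : Vec A n) → v ∈ₗ vectors xs n
∈-vectors all []      = here refl
∈-vectors all (x ∷ v) = ∈-cartesianProductWith⁺ _∷_ (all x) (∈-vectors all v)

allSubsets : ∀ n → List (Subset n)
allSubsets = vectors (outside ∷ inside ∷ [])

∈-allSubsets : ∀ {n} (A : Subset n) → A ∈ₗ allSubsets n
∈-allSubsets = ∈-vectors λ { outside → here refl ; inside → there (here refl) }

allSubsets-unique : ∀ n → Unique (allSubsets n)
allSubsets-unique zero    = [] ∷ []
allSubsets-unique (suc n) = cartesianProductWith⁺ _∷_ Vec.∷-injective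
  (((λ ()) ∷ []) ∷ [] ∷ []) (allSubsets-unique n)

kSubsets : ∀ n → ℕ → List (Subset n)
kSubsets n k = filter (λ A → ∣ A ∣ ℕ.≟ k) (allSubsets n)

∈-kSubsets : ∀ {n} (A : Subset n) → A ∈ₗ kSubsets n ∣ A ∣
∈-kSubsets A = ∈-filter⁺ (λ B → ∣ B ∣ ℕ.≟ ∣ A ∣) (∈-allSubsets A) refl

subsetOfSize : ∀ {n k} → k ≤ n → ∃[ A ] (∣_∣ {n} A ≡ k)
subsetOfSize {n} z≤n   = ⊥ , ∣⊥∣≡0 n
subsetOfSize (s≤s k≤n) = let A , eq = subsetOfSize k≤n in inside ∷ A , cong suc eq

kSubsets-nonZero : ∀ {n k} → k ≤ n → NonZero (length (kSubsets n k))
kSubsets-nonZero k≤n with subsetOfSize k≤n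
... | A , refl = ℕ.>-nonZero (∈-length (∈-kSubsets A))

#[_,_,_] : ∀ {n} → Graph n → ℕ → ℕ → ℕ
#[_,_,_] {n} G k ℓ = length (filter (λ A → e[ G , A ] ℕ.≟ ℓ) (kSubsets n k))

-- Pr[X_{G,k} = ℓ] under the uniform distribution on k-element sets of vertices,
-- each of which occurs exactly once in kSubsets n k (see allSubsets-unique).
Pr : ∀ {n} → Graph n → (k ℓ : ℕ) → .(k ≤ n) → ℚ
Pr {n} G k ℓ k≤n = (ℤ.+ #[ G , k , ℓ ] / length (kSubsets n k)) {{kSubsets-nonZero k≤n}}

-- The graph whose edges ij, i < j, are given by the entries of M above the diagonal.
fromMatrix : ∀ {n} → Vec (Vec Bool n) n → Graph n
fromMatrix {n} M = record
  { adj        = λ i j → above i j ∨ above j i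
  ; adj-sym    = λ i j → Bool.∨-comm (above i j) (above j i)
  ; adj-irrefl = λ i → trans (Bool.∨-idem (above i i))
      (cong (_∧ lookup (lookup M i) i) (dec-false (i Fin.<? i) (Fin.<-irrefl refl)))
  }
  where
  above : Fin n → Fin n → Bool
  above i j = does (i Fin.<? j) ∧ lookup (lookup M i) j

allGraphs : ∀ n → List (Graph n)
allGraphs n = map fromMatrix (vectors (vectors (false ∷ true ∷ []) n) n)

allGraphs-complete : ∀ {n} (G : Graph n) →
  ∃[ H ] (H ∈ₗ allGraphs n × (∀ i j → adj G i j ≡ adj H i j))
allGraphs-complete {n} G = fromMatrix M , ∈-map⁺ fromMatrix (∈-vectors (∈-vectors ∈-bools) M) , agree
  where
  ∈-bools : ∀ b → b ∈ₗ (false ∷ true ∷ [])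
  ∈-bools false = here refl
  ∈-bools true  = there (here refl)

  M : Vec (Vec Bool n) n
  M = tabulate λ i → tabulate (adj G i)

  entry : ∀ i j → lookup (lookup M i) j ≡ adj G i j
  entry i j = trans (cong (λ r → lookup r j) (Vec.lookup∘tabulate (λ i → tabulate (adj G i)) i))
                    (Vec.lookup∘tabulate (adj G i) j)

  agree : ∀ i j → adj G i j ≡ adj (fromMatrix M) i j
  agree i j rewrite entry i j | entry j i with Fin.<-cmp i j
  ... | tri< i<j _ i≯j rewrite dec-true (i Fin.<? j) i<j | dec-false (j Fin.<? i) i≯j =
        sym (Bool.∨-identityʳ (adj G i j))
  ... | tri≈ i≮j refl _ rewrite dec-false (i Fin.<? i) i≮j = adj-irrefl G i
  ... | tri> i≮j _ j<i rewrite dec-false (i Fin.<? j) i≮j | dec-true (j Fin.<? i) j<i = adj-sym G i j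

-- Starting the maximum at 0 is harmless: the probabilities are nonnegative,
-- and there is at least one graph (see I-attained).
I : (n k ℓ : ℕ) → .(k ≤ n) → ℚ
I n k ℓ k≤n = max 0ℚ (map (λ G → Pr G k ℓ k≤n) (allGraphs n))

bit : Bool → ℕ
bit false = 0
bit true  = 1

sumL : ∀ {A : Set} → (A → ℕ) → List A → ℕ
sumL f []       = 0
sumL f (x ∷ xs) = f x + sumL f xs

sumL-cong : ∀ {A : Set} {f g : A → ℕ} → (∀ x → f x ≡ g x) → ∀ xs → sumL f xs ≡ sumL g xs
sumL-cong f≗g []       = refl
sumL-cong f≗g (x ∷ xs) = cong₂ _+_ (f≗g x) (sumL-cong f≗g xs)

sumL-++ : ∀ {A : Set} (f : A → ℕ) xs ys → sumL f (xs ++ ys) ≡ sumL f xs + sumL f ys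
sumL-++ f []       ys = refl
sumL-++ f (x ∷ xs) ys = trans (cong (f x +_) (sumL-++ f xs ys)) (sym (ℕ.+-assoc (f x) _ _))

sumL-map : ∀ {A B : Set} (f : B → ℕ) (g : A → B) xs → sumL f (map g xs) ≡ sumL (f ∘ g) xs
sumL-map f g []       = refl
sumL-map f g (x ∷ xs) = cong (f (g x) +_) (sumL-map f g xs)

sumL-cartesian : ∀ {A B C : Set} (f : C → ℕ) (g : A → B → C) xs ys →
  sumL f (cartesianProductWith g xs ys) ≡ sumL (λ x → sumL (λ y → f (g x y)) ys) xs
sumL-cartesian f g []       ys = refl
sumL-cartesian f g (x ∷ xs) ys = trans (sumL-++ f (map (g x) ys) _)
  (cong₂ _+_ (sumL-map f (g x) ys) (sumL-cartesian f g xs ys))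

sumL-tabulate : ∀ {A : Set} (f : A → ℕ) {n} (g : Fin n → A) →
  sumL f (List.tabulate g) ≡ sum (λ i → f (g i))
sumL-tabulate f {zero}  g = refl
sumL-tabulate f {suc n} g = cong (f (g zero) +_) (sumL-tabulate f (g ∘ suc))

sumL-filter : ∀ {A : Set} {P : A → Set} (P? : Decidable P) (f : A → ℕ) xs →
  sumL f (filter P? xs) ≡ sumL (λ x → bit (does (P? x)) * f x) xs
sumL-filter P? f [] = refl
sumL-filter P? f (x ∷ xs) with does (P? x)
... | true  = cong₂ _+_ (sym (ℕ.+-identityʳ (f x))) (sumL-filter P? f xs)
... | false = sumL-filter P? f xs

length-sumL : ∀ {A : Set} (xs : List A) → length xs ≡ sumL (λ _ → 1) xs
length-sumL []       = refl
length-sumL (x ∷ xs) = cong suc (length-sumL xs)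

length-filter : ∀ {A : Set} {P : A → Set} (P? : Decidable P) xs →
  length (filter P? xs) ≡ sumL (λ x → bit (does (P? x))) xs
length-filter P? xs = trans (length-sumL (filter P? xs))
  (trans (sumL-filter P? (λ _ → 1) xs) (sumL-cong (λ x → ℕ.*-identityʳ _) xs))

-- The sum of f over all subsets of Fin n.
∑⊆ : ∀ n → (Subset n → ℕ) → ℕ
∑⊆ zero    f = f []
∑⊆ (suc n) f = ∑⊆ n (f ∘ (outside ∷_)) + ∑⊆ n (f ∘ (inside ∷_))

sumL-allSubsets : ∀ n f → sumL f (allSubsets n) ≡ ∑⊆ n f
sumL-allSubsets zero    f = ℕ.+-identityʳ (f [])
sumL-allSubsets (suc n) f = trans (sumL-cartesian f _∷_ (outside ∷ inside ∷ []) (allSubsets n))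
  (cong₂ _+_ (sumL-allSubsets n _) (trans (ℕ.+-identityʳ _) (sumL-allSubsets n _)))

∑⊆-cong : ∀ n {f g : Subset n → ℕ} → (∀ A → f A ≡ g A) → ∑⊆ n f ≡ ∑⊆ n g
∑⊆-cong zero    h = h []
∑⊆-cong (suc n) h = cong₂ _+_ (∑⊆-cong n (h ∘ (outside ∷_))) (∑⊆-cong n (h ∘ (inside ∷_)))

∑⊆-mono : ∀ n {f g : Subset n → ℕ} → (∀ A → f A ≤ g A) → ∑⊆ n f ≤ ∑⊆ n g
∑⊆-mono zero    h = h []
∑⊆-mono (suc n) h = ℕ.+-mono-≤ (∑⊆-mono n (h ∘ (outside ∷_))) (∑⊆-mono n (h ∘ (inside ∷_)))

∑⊆-+ : ∀ n (f g : Subset n → ℕ) → ∑⊆ n (λ A → f A + g A) ≡ ∑⊆ n f + ∑⊆ n g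
∑⊆-+ zero    f g = refl
∑⊆-+ (suc n) f g = trans (cong₂ _+_ (∑⊆-+ n _ _) (∑⊆-+ n _ _))
    (lem (∑⊆ n (f ∘ (outside ∷_))) (∑⊆ n (g ∘ (outside ∷_))) (∑⊆ n (f ∘ (inside ∷_))) (∑⊆ n (g ∘ (inside ∷_))))
  where
  lem : ∀ a b c d → (a + b) + (c + d) ≡ (a + c) + (b + d)
  lem = solve-∀

∑⊆-0 : ∀ n → ∑⊆ n (λ _ → 0) ≡ 0
∑⊆-0 zero    = refl
∑⊆-0 (suc n) = cong₂ _+_ (∑⊆-0 n) (∑⊆-0 n)

∑⊆-* : ∀ n c (f : Subset n → ℕ) → ∑⊆ n (λ A → c * f A) ≡ c * ∑⊆ n f
∑⊆-* zero    c f = refl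
∑⊆-* (suc n) c f = trans (cong₂ _+_ (∑⊆-* n c _) (∑⊆-* n c _)) (sym (ℕ.*-distribˡ-+ c _ _))

sum-∑⊆ : ∀ {m} n (f : Fin m → Subset n → ℕ) →
  sum (λ v → ∑⊆ n (f v)) ≡ ∑⊆ n (λ A → sum (λ v → f v A))
sum-∑⊆ {zero}  n f = sym (∑⊆-0 n)
sum-∑⊆ {suc m} n f = trans (cong (∑⊆ n (f zero) +_) (sum-∑⊆ n (f ∘ suc)))
  (sym (∑⊆-+ n (f zero) (λ A → sum (λ v → f (suc v) A))))

-- Sums over the sets avoiding v, resp. containing v.
∑⊆-insert : ∀ n (v : Fin (suc n)) (f : Subset (suc n) → ℕ) →
  ∑⊆ n (λ B → f (insertAt B v outside)) ≡ ∑⊆ (suc n) (λ A → bit (not (lookup A v)) * f A)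
∑⊆-insert n zero f = trans (sym (ℕ.+-identityʳ _))
  (cong₂ _+_ (∑⊆-cong n (λ A → sym (ℕ.+-identityʳ _))) (sym (∑⊆-0 n)))
∑⊆-insert (suc n) (suc v) f = cong₂ _+_
  (∑⊆-insert n v (f ∘ (outside ∷_))) (∑⊆-insert n v (f ∘ (inside ∷_)))

∑⊆-update : ∀ n (v : Fin n) (f : Subset n → ℕ) →
  ∑⊆ n (λ B → bit (not (lookup B v)) * f (B [ v ]≔ inside)) ≡ ∑⊆ n (λ A → bit (lookup A v) * f A)
∑⊆-update (suc n) zero f = trans (cong (∑⊆ n (λ B → f (inside ∷ B) + 0) +_) (∑⊆-0 n))
  (trans (ℕ.+-comm _ 0) (cong (_+ ∑⊆ n (λ B → f (inside ∷ B) + 0)) (sym (∑⊆-0 n))))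
∑⊆-update (suc n) (suc v) f = cong₂ _+_
  (∑⊆-update n v (f ∘ (outside ∷_))) (∑⊆-update n v (f ∘ (inside ∷_)))

sum-inside : ∀ {n} (A : Subset n) → sum (λ v → bit (lookup A v)) ≡ ∣ A ∣
sum-inside []            = refl
sum-inside (outside ∷ A) = sum-inside A
sum-inside (inside ∷ A)  = cong suc (sum-inside A)

sum-outside : ∀ {n} (A : Subset n) → sum (λ v → bit (not (lookup A v))) + ∣ A ∣ ≡ n
sum-outside []            = refl
sum-outside (outside ∷ A) = cong suc (sum-outside A)
sum-outside (inside ∷ A)  = trans (ℕ.+-suc _ ∣ A ∣) (cong suc (sum-outside A))

size-insert : ∀ {n} (B : Subset n) v → ∣ insertAt B v outside ∣ ≡ ∣ B ∣
size-insert B             zero    = refl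
size-insert (outside ∷ B) (suc v) = size-insert B v
size-insert (inside ∷ B)  (suc v) = cong suc (size-insert B v)

size-update : ∀ {n} (B : Subset n) v → lookup B v ≡ outside → ∣ B [ v ]≔ inside ∣ ≡ suc ∣ B ∣
size-update (outside ∷ B) zero    _ = refl
size-update (outside ∷ B) (suc v) h = size-update B v h
size-update (inside ∷ B)  (suc v) h = cong suc (size-update B v h)

does-∈? : ∀ {n} i (A : Subset n) → does (i ∈? A) ≡ lookup A i
does-∈? zero    (inside ∷ A)  = refl
does-∈? zero    (outside ∷ A) = refl
does-∈? (suc i) (x ∷ A)       = does-∈? i A

does-≟true : ∀ b → does (b Bool.≟ true) ≡ b
does-≟true false = refl
does-≟true true  = refl

bit-∧ : ∀ a b → bit (a ∧ b) ≡ bit a * bit b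
bit-∧ false b = refl
bit-∧ true  b = sym (ℕ.+-identityʳ (bit b))

-- Twice the number of induced edges, as a quadratic form.
form : ∀ {n} → (Fin n → Fin n → ℕ) → (Fin n → ℕ) → ℕ
form a x = sum λ i → sum λ j → x i * (x j * a i j)

form-cong : ∀ {n} {a b : Fin n → Fin n → ℕ} {x y : Fin n → ℕ} →
  (∀ i j → a i j ≡ b i j) → (∀ i → x i ≡ y i) → form a x ≡ form b y
form-cong a≗b x≗y = sum-cong-≗ λ i → sum-cong-≗ λ j →
  cong₂ _*_ (x≗y i) (cong₂ _*_ (x≗y j) (a≗b i j))

weight : ∀ {n} → Graph n → Fin n → Fin n → ℕ
weight G i j = bit (adj G i j)

indicator : ∀ {n} → Subset n → Fin n → ℕ
indicator A i = bit (lookup A i)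

double-e : ∀ {n} (G : Graph n) A → e[ G , A ] + e[ G , A ] ≡ form (weight G) (indicator A)
double-e {n} G A = begin
    e[ G , A ] + e[ G , A ]
      ≡⟨ cong₂ _+_ count (trans count (∑-comm w)) ⟩
    sum (λ i → sum (λ j → w i j)) + sum (λ i → sum (λ j → w j i))
      ≡⟨ ∑-distrib-+ (λ i → sum (λ j → w i j)) (λ i → sum (λ j → w j i)) ⟨
    sum (λ i → sum (λ j → w i j) + sum (λ j → w j i))
      ≡⟨ sum-cong-≗ (λ i → ∑-distrib-+ (λ j → w i j) (λ j → w j i)) ⟨
    sum (λ i → sum (λ j → w i j + w j i))
      ≡⟨ sum-cong-≗ (λ i → sum-cong-≗ (λ j → both i j)) ⟩
    form (weight G) (indicator A) ∎
  where
  open ≡-Reasoning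
  w : Fin n → Fin n → ℕ
  w i j = bit (does (isInducedEdge? G A (i , j)))

  count : e[ G , A ] ≡ sum (λ i → sum (λ j → w i j))
  count = trans (length-filter (isInducedEdge? G A) (cartesianProduct (allFin n) (allFin n)))
    (trans (sumL-cartesian _ _,_ (allFin n) (allFin n))
      (trans (sumL-tabulate (λ i → sumL (w i) (allFin n)) {n} id) (sum-cong-≗ (λ i → sumL-tabulate (w i) {n} id))))

  prod : Fin n → Fin n → ℕ
  prod i j = bit (lookup A i) * (bit (lookup A j) * bit (adj G i j))

  bits : ∀ i j → bit (does (i ∈? A) ∧ does (j ∈? A) ∧ does (adj G i j Bool.≟ true)) ≡ prod i j
  bits i j rewrite does-∈? i A | does-∈? j A | does-≟true (adj G i j) =
    trans (bit-∧ (lookup A i) _) (cong (bit (lookup A i) *_) (bit-∧ (lookup A j) (adj G i j)))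

  prod-sym : ∀ i j → prod j i ≡ prod i j
  prod-sym i j rewrite adj-sym G j i = lem (bit (lookup A j)) (bit (lookup A i)) (bit (adj G i j))
    where
    lem : ∀ a b c → a * (b * c) ≡ b * (a * c)
    lem = solve-∀

  w-< : ∀ i j → i Fin.< j → w i j ≡ prod i j
  w-< i j i<j rewrite dec-true (i Fin.<? j) i<j = bits i j

  w-≮ : ∀ i j → ¬ (i Fin.< j) → w i j ≡ 0
  w-≮ i j i≮j rewrite dec-false (i Fin.<? j) i≮j = refl

  both : ∀ i j → w i j + w j i ≡ prod i j
  both i j with Fin.<-cmp i j
  ... | tri< i<j _ i≯j = trans (cong₂ _+_ (w-< i j i<j) (w-≮ j i i≯j)) (ℕ.+-identityʳ _)
  ... | tri> i≮j _ j<i = trans (cong₂ _+_ (w-≮ i j i≮j) (w-< j i j<i)) (prod-sym i j)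
  ... | tri≈ i≮i refl _ = trans (cong₂ _+_ (w-≮ i i i≮i) (w-≮ i i i≮i)) (sym zero-prod)
    where
    zero-prod : prod i i ≡ 0
    zero-prod rewrite adj-irrefl G i | ℕ.*-zeroʳ (bit (lookup A i)) = ℕ.*-zeroʳ (bit (lookup A i))

e-by-form : ∀ {m n} (G : Graph m) A (H : Graph n) B →
  form (weight G) (indicator A) ≡ form (weight H) (indicator B) → e[ G , A ] ≡ e[ H , B ]
e-by-form G A H B eq = ℕ.*-cancelˡ-≡ e[ G , A ] e[ H , B ] 2
  (trans (twice e[ G , A ]) (trans (trans (double-e G A) (trans eq (sym (double-e H B)))) (sym (twice e[ H , B ]))))
  where
  twice : ∀ m → 2 * m ≡ m + m
  twice m = cong (m +_) (ℕ.+-identityʳ m)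

e-cong : ∀ {n} (G H : Graph n) → (∀ i j → adj G i j ≡ adj H i j) → ∀ A → e[ G , A ] ≡ e[ H , A ]
e-cong G H agree A = e-by-form G A H A (form-cong {x = indicator A} (λ i j → cong bit (agree i j)) (λ _ → refl))

#-∑⊆ : ∀ {n} (G : Graph n) k ℓ →
  #[ G , k , ℓ ] ≡ ∑⊆ n (λ A → bit (does (∣ A ∣ ℕ.≟ k)) * bit (does (e[ G , A ] ℕ.≟ ℓ)))
#-∑⊆ {n} G k ℓ = trans (length-filter (λ A → e[ G , A ] ℕ.≟ ℓ) (kSubsets n k))
  (trans (sumL-filter (λ A → ∣ A ∣ ℕ.≟ k) _ (allSubsets n)) (sumL-allSubsets n _))

kSubsets-∑⊆ : ∀ n k → length (kSubsets n k) ≡ ∑⊆ n (λ A → bit (does (∣ A ∣ ℕ.≟ k)))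
kSubsets-∑⊆ n k = trans (length-filter (λ A → ∣ A ∣ ℕ.≟ k) (allSubsets n)) (sumL-allSubsets n _)

#-cong : ∀ {n} (G H : Graph n) → (∀ i j → adj G i j ≡ adj H i j) → ∀ k ℓ → #[ G , k , ℓ ] ≡ #[ H , k , ℓ ]
#-cong {n} G H agree k ℓ = trans (#-∑⊆ G k ℓ) (trans
  (∑⊆-cong n (λ A → cong (λ m → bit (does (∣ A ∣ ℕ.≟ k)) * bit (does (m ℕ.≟ ℓ))) (e-cong G H agree A)))
  (sym (#-∑⊆ H k ℓ)))

max-map-upper : ∀ {A : Set} (f : A → ℚ) {x xs} → x ∈ₗ xs → f x ℚ.≤ max 0ℚ (map f xs)
max-map-upper f {xs = xs} x∈ = All.lookup (xs≤max 0ℚ (map f xs)) (∈-map⁺ f x∈)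

max-map-attained : ∀ {A : Set} (f : A → ℚ) {xs} → (∀ x → 0ℚ ℚ.≤ f x) → ∀ {x} → x ∈ₗ xs →
  ∃[ y ] (f y ≡ max 0ℚ (map f xs))
max-map-attained f {xs} 0≤f {x} x∈ with argmax-sel id 0ℚ (map f xs)
... | inj₂ max∈  = let y , _ , eq = ∈-map⁻ f max∈ in y , sym eq
... | inj₁ max≡0 = x , ℚ.≤-antisym (max-map-upper f x∈) (subst (ℚ._≤ f x) (sym max≡0) (0≤f x))

Pr-cong : ∀ {n} (G H : Graph n) → (∀ i j → adj G i j ≡ adj H i j) →
  ∀ k ℓ .(k≤n : k ≤ n) → Pr G k ℓ k≤n ≡ Pr H k ℓ k≤n
Pr-cong {n} G H agree k ℓ k≤n =
  cong (λ c → (ℤ.+ c / length (kSubsets n k)) {{kSubsets-nonZero k≤n}}) (#-cong G H agree k ℓ)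

I-upper : ∀ {n} (G : Graph n) k ℓ .(k≤n : k ≤ n) → Pr G k ℓ k≤n ℚ.≤ I n k ℓ k≤n
I-upper {n} G k ℓ k≤n =
  let H , H∈ , agree = allGraphs-complete G in
  ℚ.≤-trans (ℚ.≤-reflexive (Pr-cong G H agree k ℓ k≤n)) (max-map-upper (λ G → Pr G k ℓ k≤n) H∈)

0≤Pr : ∀ {n} (G : Graph n) k ℓ .(k≤n : k ≤ n) → 0ℚ ℚ.≤ Pr G k ℓ k≤n
0≤Pr {n} G k ℓ k≤n = 0≤frac #[ G , k , ℓ ] (length (kSubsets n k)) {{kSubsets-nonZero k≤n}}

abstract
  I-attained : ∀ n k ℓ .(k≤n : k ≤ n) → Σ (Graph n) λ G → Pr G k ℓ k≤n ≡ I n k ℓ k≤n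
  I-attained n k ℓ k≤n = max-map-attained (λ G → Pr G k ℓ k≤n) (λ G → 0≤Pr G k ℓ k≤n)
      (proj₁ (proj₂ (allGraphs-complete edgeless)))
    where
    edgeless : Graph n
    edgeless = record { adj = λ _ _ → false ; adj-sym = λ _ _ → refl ; adj-irrefl = λ _ → refl }

delete : ∀ {n} → Graph (suc n) → Fin (suc n) → Graph n
delete G v = record
  { adj        = λ i j → adj G (punchIn v i) (punchIn v j)
  ; adj-sym    = λ i j → adj-sym G (punchIn v i) (punchIn v j)
  ; adj-irrefl = λ i → adj-irrefl G (punchIn v i)
  }

-- Adds a new vertex zero with the same neighbours as v, and not adjacent to v.
duplicate : ∀ {n} → Graph n → Fin n → Graph (suc n)
duplicate {n} G v = record
  { adj        = λ i j → adj G (orig i) (orig j)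
  ; adj-sym    = λ i j → adj-sym G (orig i) (orig j)
  ; adj-irrefl = λ i → adj-irrefl G (orig i)
  }
  where
  orig : Fin (suc n) → Fin n
  orig zero    = v
  orig (suc i) = i

sum-0 : ∀ n → sum {n} (λ _ → 0) ≡ 0
sum-0 = sum-replicate-zero

e-delete : ∀ {n} (G : Graph (suc n)) v B → e[ delete G v , B ] ≡ e[ G , insertAt B v outside ]
e-delete {n} G v B = e-by-form (delete G v) B G (insertAt B v outside) (sym (begin
    form a x
      ≡⟨ sum-remove {i = v} (λ i → sum (λ j → x i * (x j * a i j))) ⟩
    sum (λ j → x v * (x j * a v j)) + sum (λ i → sum (λ j → x (punchIn v i) * (x j * a (punchIn v i) j)))
      ≡⟨ cong₂ _+_ (trans (sum-cong-≗ (λ j → cong (_* (x j * a v j)) xv≡0)) (sum-0 (suc n)))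
                   (sum-cong-≗ row) ⟩
    form (weight (delete G v)) (indicator B) ∎))
  where
  open ≡-Reasoning
  a = weight G
  x = indicator (insertAt B v outside)

  xv≡0 : x v ≡ 0
  xv≡0 = cong bit (Vec.insertAt-lookup B v outside)

  xpunch : ∀ i → x (punchIn v i) ≡ indicator B i
  xpunch i = cong bit (Vec.insertAt-punchIn B v outside i)

  row : ∀ i → sum (λ j → x (punchIn v i) * (x j * a (punchIn v i) j)) ≡
              sum (λ j → indicator B i * (indicator B j * a (punchIn v i) (punchIn v j)))
  row i = trans (sum-remove {i = v} (λ j → x (punchIn v i) * (x j * a (punchIn v i) j)))
    (cong₂ _+_
      (trans (cong (λ t → x (punchIn v i) * (t * a (punchIn v i) v)) xv≡0) (ℕ.*-zeroʳ (x (punchIn v i))))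
      (sum-cong-≗ (λ j → cong₂ (λ s t → s * (t * a (punchIn v i) (punchIn v j))) (xpunch i) (xpunch j))))

e-duplicate-outside : ∀ {n} (G : Graph n) v B → e[ duplicate G v , outside ∷ B ] ≡ e[ G , B ]
e-duplicate-outside {n} G v B = e-by-form (duplicate G v) (outside ∷ B) G B
  (trans (cong (_+ rest) (sum-0 n)) (sum-cong-≗ λ i →
    cong (_+ sum (λ j → indicator B i * (indicator B j * weight G i j))) (ℕ.*-zeroʳ (indicator B i))))
  where
  rest : ℕ
  rest = sum (λ i → indicator B i * 0 + sum (λ j → indicator B i * (indicator B j * weight G i j)))

δ : ∀ {n} → Fin n → Fin n → ℕ
δ zero    zero    = 1
δ zero    (suc j) = 0
δ (suc i) zero    = 0
δ (suc i) (suc j) = δ i j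

sum-δ : ∀ {n} (v : Fin n) (f : Fin n → ℕ) → sum (λ i → δ v i * f i) ≡ f v
sum-δ {suc n} zero    f = trans (cong₂ _+_ (ℕ.+-identityʳ (f zero)) (sum-0 n)) (ℕ.+-identityʳ (f zero))
sum-δ {suc n} (suc v) f = sum-δ v (f ∘ suc)

indicator-update : ∀ {n} (B : Subset n) v → lookup B v ≡ outside →
  ∀ i → indicator (B [ v ]≔ inside) i ≡ δ v i + indicator B i
indicator-update (outside ∷ B) zero    _ zero    = refl
indicator-update (outside ∷ B) zero    _ (suc i) = refl
indicator-update (x ∷ B)       (suc v) h zero    = refl
indicator-update (x ∷ B)       (suc v) h (suc i) = indicator-update B v h i

e-duplicate-inside : ∀ {n} (G : Graph n) v B → lookup B v ≡ outside →
  e[ duplicate G v , inside ∷ B ] ≡ e[ G , B [ v ]≔ inside ]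
e-duplicate-inside {n} G v B v∉B = e-by-form (duplicate G v) (inside ∷ B) G (B [ v ]≔ inside) (sym (begin
    form a (indicator (B [ v ]≔ inside))
      ≡⟨ form-cong {a = a} (λ _ _ → refl) (indicator-update B v v∉B) ⟩
    sum (λ i → sum (λ j → (δ v i + x i) * ((δ v j + x j) * a i j)))
      ≡⟨ sum-cong-≗ (λ i → trans (sum-cong-≗ (λ j → lem (δ v i + x i) (δ v j) (x j) (a i j)))
           (trans (∑-distrib-+ (λ j → δ v j * ((δ v i + x i) * a i j)) (λ j → (δ v i + x i) * (x j * a i j)))
                  (cong (_+ sum (λ j → (δ v i + x i) * (x j * a i j))) (sum-δ v (λ j → (δ v i + x i) * a i j))))) ⟩
    sum (λ i → (δ v i + x i) * a i v + sum (λ j → (δ v i + x i) * (x j * a i j)))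
      ≡⟨ sum-cong-≗ (λ i → trans
           (cong ((δ v i + x i) * a i v +_) (sym (*-distribˡ-sum (δ v i + x i) (λ j → x j * a i j))))
           (lem₂ (δ v i) (x i) (a i v) (sum (λ j → x j * a i j)))) ⟩
    sum (λ i → δ v i * (a i v + sum (λ j → x j * a i j)) + (x i * a i v + x i * sum (λ j → x j * a i j)))
      ≡⟨ trans (∑-distrib-+ (λ i → δ v i * (a i v + sum (λ j → x j * a i j))) _)
           (cong₂ _+_ (sum-δ v (λ i → a i v + sum (λ j → x j * a i j))) (sum-cong-≗ (λ i →
             cong₂ _+_ (cong (x i *_) (sym (ℕ.+-identityʳ (a i v)))) (*-distribˡ-sum (x i) (λ j → x j * a i j))))) ⟩
    (a v v + sum (λ j → x j * a v j)) + sum (λ i → x i * (a i v + 0) + sum (λ j → x i * (x j * a i j)))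
      ≡⟨ cong (_+ sum (λ i → x i * (a i v + 0) + sum (λ j → x i * (x j * a i j))))
           (cong₂ _+_ (lem₃ (a v v)) (sum-cong-≗ (λ j → sym (ℕ.+-identityʳ (x j * a v j))))) ⟩
    form (weight (duplicate G v)) (indicator (inside ∷ B)) ∎))
  where
  open ≡-Reasoning
  a = weight G
  x = indicator B
  lem : ∀ s d y c → s * ((d + y) * c) ≡ d * (s * c) + s * (y * c)
  lem = solve-∀
  lem₂ : ∀ d y c t → (d + y) * c + (d + y) * t ≡ d * (c + t) + (y * c + y * t)
  lem₂ = solve-∀
  lem₃ : ∀ c → c ≡ 1 * (1 * c)
  lem₃ = solve-∀

-- Averaging over the deleted vertex.
∑-delete : ∀ n k (f : Subset (suc n) → ℕ) → (∀ A → f A * ∣ A ∣ ≡ f A * k) →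
  sum (λ v → ∑⊆ n (λ B → f (insertAt B v outside))) + k * ∑⊆ (suc n) f ≡ suc n * ∑⊆ (suc n) f
∑-delete n k f size = begin
    sum (λ v → ∑⊆ n (λ B → f (insertAt B v outside))) + k * ∑⊆ (suc n) f
      ≡⟨ cong₂ _+_ (trans (sum-cong-≗ {suc n} (λ v → ∑⊆-insert n v f)) (sum-∑⊆ (suc n) (λ v A → bit (not (lookup A v)) * f A))) (sym (∑⊆-* (suc n) k f)) ⟩
    ∑⊆ (suc n) (λ A → sum (λ v → bit (not (lookup A v)) * f A)) + ∑⊆ (suc n) (λ A → k * f A)
      ≡⟨ ∑⊆-+ (suc n) (λ A → sum (λ v → bit (not (lookup A v)) * f A)) (λ A → k * f A) ⟨
    ∑⊆ (suc n) (λ A → sum (λ v → bit (not (lookup A v)) * f A) + k * f A)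
      ≡⟨ ∑⊆-cong (suc n) pointwise ⟩
    ∑⊆ (suc n) (λ A → suc n * f A)
      ≡⟨ ∑⊆-* (suc n) (suc n) f ⟩
    suc n * ∑⊆ (suc n) f ∎
  where
  open ≡-Reasoning
  pointwise : ∀ A → sum (λ v → bit (not (lookup A v)) * f A) + k * f A ≡ suc n * f A
  pointwise A = begin
    sum (λ v → bit (not (lookup A v)) * f A) + k * f A
      ≡⟨ cong₂ _+_ (sym (*-distribʳ-sum (f A) (λ v → bit (not (lookup A v)))))
                   (trans (ℕ.*-comm k (f A)) (trans (sym (size A)) (ℕ.*-comm (f A) ∣ A ∣))) ⟩
    sum (λ v → bit (not (lookup A v))) * f A + ∣ A ∣ * f A
      ≡⟨ ℕ.*-distribʳ-+ (f A) (sum (λ v → bit (not (lookup A v)))) ∣ A ∣ ⟨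
    (sum (λ v → bit (not (lookup A v))) + ∣ A ∣) * f A
      ≡⟨ cong (_* f A) (sum-outside A) ⟩
    suc n * f A ∎

size-bit : ∀ m k → bit (does (m ℕ.≟ k)) * m ≡ bit (does (m ℕ.≟ k)) * k
size-bit m k with m ℕ.≡ᵇ k in eq
... | true  = cong (1 *_) (ℕ.≡ᵇ⇒≡ m k (subst T (sym eq) tt))
... | false = refl

size-bit′ : ∀ m k c → (bit (does (m ℕ.≟ k)) * c) * m ≡ (bit (does (m ℕ.≟ k)) * c) * k
size-bit′ m k c = trans (lem (bit (does (m ℕ.≟ k))) c m)
    (trans (cong (_* c) (size-bit m k)) (sym (lem (bit (does (m ℕ.≟ k))) c k)))
  where
  lem : ∀ b c m → (b * c) * m ≡ (b * m) * c
  lem = solve-∀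

#-delete : ∀ {n} (G : Graph (suc n)) k ℓ →
  sum (λ v → #[ delete G v , k , ℓ ]) + k * #[ G , k , ℓ ] ≡ suc n * #[ G , k , ℓ ]
#-delete {n} G k ℓ = trans
    (cong₂ (λ s t → s + k * t) (sum-cong-≗ deleted) (#-∑⊆ G k ℓ))
    (trans (∑-delete n k f (λ A → size-bit′ ∣ A ∣ k (bit (does (e[ G , A ] ℕ.≟ ℓ)))))
      (cong (suc n *_) (sym (#-∑⊆ G k ℓ))))
  where
  f : Subset (suc n) → ℕ
  f A = bit (does (∣ A ∣ ℕ.≟ k)) * bit (does (e[ G , A ] ℕ.≟ ℓ))

  deleted : ∀ v → #[ delete G v , k , ℓ ] ≡ ∑⊆ n (λ B → f (insertAt B v outside))
  deleted v = trans (#-∑⊆ (delete G v) k ℓ) (∑⊆-cong n λ B →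
    cong₂ (λ s t → bit (does (s ℕ.≟ k)) * bit (does (t ℕ.≟ ℓ))) (sym (size-insert B v)) (e-delete G v B))

-- (n + 1) C(n,k) + k C(n+1,k) = (n + 1) C(n+1,k)
kSubsets-delete : ∀ n k → suc n * length (kSubsets n k) + k * length (kSubsets (suc n) k) ≡
                          suc n * length (kSubsets (suc n) k)
kSubsets-delete n k = trans
    (cong₂ (λ s t → s + k * t)
      (trans (sym (sum-const (suc n) (length (kSubsets n k)))) (sum-cong-≗ deleted)) (kSubsets-∑⊆ (suc n) k))
    (trans (∑-delete n k f (λ A → size-bit ∣ A ∣ k)) (cong (suc n *_) (sym (kSubsets-∑⊆ (suc n) k))))
  where
  f : Subset (suc n) → ℕ
  f A = bit (does (∣ A ∣ ℕ.≟ k))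

  sum-const : ∀ m c → sum {m} (λ _ → c) ≡ m * c
  sum-const zero    c = refl
  sum-const (suc m) c = cong (c +_) (sum-const m c)

  deleted : ∀ v → length (kSubsets n k) ≡ ∑⊆ n (λ B → f (insertAt B v outside))
  deleted v = trans (kSubsets-∑⊆ n k) (∑⊆-cong n λ B →
    cong (λ s → bit (does (s ℕ.≟ k))) (sym (size-insert B v)))

-- Averaging over the duplicated vertex.
#-duplicate : ∀ {n} (G : Graph n) k ℓ →
  (n + k) * #[ G , k , ℓ ] ≤ sum (λ v → #[ duplicate G v , k , ℓ ])
#-duplicate {n} G k ℓ = begin
    (n + k) * #[ G , k , ℓ ]
      ≡⟨ trans (cong ((n + k) *_) (#-∑⊆ G k ℓ)) (sym (∑⊆-* n (n + k) f)) ⟩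
    ∑⊆ n (λ A → (n + k) * f A)
      ≡⟨ ∑⊆-cong n pointwise ⟩
    ∑⊆ n (λ A → sum {n} (λ v → f A + bit (lookup A v) * f A))
      ≡⟨ sum-∑⊆ n (λ v A → f A + bit (lookup A v) * f A) ⟨
    sum (λ v → ∑⊆ n (λ A → f A + bit (lookup A v) * f A))
      ≡⟨ sum-cong-≗ (λ v → trans (∑⊆-+ n f (λ A → bit (lookup A v) * f A))
           (cong (∑⊆ n f +_) (sym (∑⊆-update n v f)))) ⟩
    sum (λ v → ∑⊆ n f + ∑⊆ n (λ B → bit (not (lookup B v)) * f (B [ v ]≔ inside)))
      ≤⟨ sum-mono (λ v → ℕ.+-mono-≤
           (ℕ.≤-reflexive (∑⊆-cong n (λ B → cong (λ m → bit (does (∣ B ∣ ℕ.≟ k)) * bit (does (m ℕ.≟ ℓ)))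
             (sym (e-duplicate-outside G v B)))))
           (∑⊆-mono n (new v))) ⟩
    sum (λ v → ∑⊆ (suc n) (g v))
      ≡⟨ sum-cong-≗ (λ v → #-∑⊆ (duplicate G v) k ℓ) ⟨
    sum (λ v → #[ duplicate G v , k , ℓ ]) ∎
  where
  open ℕ.≤-Reasoning
  f : Subset n → ℕ
  f A = bit (does (∣ A ∣ ℕ.≟ k)) * bit (does (e[ G , A ] ℕ.≟ ℓ))

  g : Fin n → Subset (suc n) → ℕ
  g v A = bit (does (∣ A ∣ ℕ.≟ k)) * bit (does (e[ duplicate G v , A ] ℕ.≟ ℓ))

  sum-mono : ∀ {m} {s t : Fin m → ℕ} → (∀ i → s i ≤ t i) → sum s ≤ sum t
  sum-mono {zero}  h = z≤n
  sum-mono {suc m} h = ℕ.+-mono-≤ (h zero) (sum-mono (h ∘ suc))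

  sum-const : ∀ m c → sum {m} (λ _ → c) ≡ m * c
  sum-const zero    c = refl
  sum-const (suc m) c = cong (c +_) (sum-const m c)

  pointwise : ∀ A → (n + k) * f A ≡ sum {n} (λ v → f A + bit (lookup A v) * f A)
  pointwise A = sym (trans (∑-distrib-+ {n} (λ _ → f A) (λ v → bit (lookup A v) * f A))
    (trans (cong₂ _+_ (sum-const n (f A))
      (trans (sym (*-distribʳ-sum (f A) (λ v → bit (lookup A v))))
        (trans (cong (_* f A) (sum-inside A))
          (trans (ℕ.*-comm ∣ A ∣ (f A)) (trans (size-bit′ ∣ A ∣ k _) (ℕ.*-comm (f A) k))))))
      (sym (ℕ.*-distribʳ-+ (f A) n k))))

  new : ∀ v B → bit (not (lookup B v)) * f (B [ v ]≔ inside) ≤ g v (inside ∷ B)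
  new v B with lookup B v in v∈?B
  ... | inside  = z≤n
  ... | outside = ℕ.≤-reflexive (trans (ℕ.+-identityʳ _)
    (cong₂ (λ s t → bit (does (s ℕ.≟ k)) * bit (does (t ℕ.≟ ℓ)))
      (size-update B v v∈?B) (sym (e-duplicate-inside G v B v∈?B))))

sum-≤ : ∀ n c (s : Fin n → ℕ) → (∀ i → s i ≤ c) → sum s ≤ n * c
sum-≤ zero    c s h = z≤n
sum-≤ (suc n) c s h = ℕ.+-mono-≤ (h zero) (sum-≤ n c (s ∘ suc) (h ∘ suc))

#≤kSubsets : ∀ {n} (G : Graph n) k ℓ → #[ G , k , ℓ ] ≤ length (kSubsets n k)
#≤kSubsets {n} G k ℓ = List.length-filter (λ A → e[ G , A ] ℕ.≟ ℓ) (kSubsets n k)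

extremal : ∀ n k ℓ → .(k ≤ n) → Graph n
extremal n k ℓ k≤n = proj₁ (I-attained n k ℓ k≤n)

extremal-max : ∀ {n} (G : Graph n) k ℓ .(k≤n : k ≤ n) → #[ G , k , ℓ ] ≤ #[ extremal n k ℓ k≤n , k , ℓ ]
extremal-max {n} G k ℓ k≤n = ℕ.*-cancelʳ-≤ _ _ K {{K≢0}}
    (frac-≤⁻¹ #[ G , k , ℓ ] K #[ extremal n k ℓ k≤n , k , ℓ ] K {{K≢0}} {{K≢0}}
      (subst (Pr G k ℓ k≤n ℚ.≤_) (sym (proj₂ (I-attained n k ℓ k≤n))) (I-upper G k ℓ k≤n)))
  where
  K = length (kSubsets n k)
  K≢0 : NonZero K
  K≢0 = kSubsets-nonZero (recompute (k ℕ.≤? n) k≤n)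

cross-arith : ∀ k i c₀ c₁ K₀ K₁ → suc (k + i) * K₀ ≡ suc i * K₁ →
  (k + i + k) * c₀ ≤ (k + i) * c₁ → c₀ ≤ K₀ →
  c₀ * K₁ * (suc i * (2 + i)) ≤ c₁ * K₀ * (suc i * (2 + i)) + (2 + k * k) * (K₀ * K₁)
cross-arith zero zero c₀ c₁ K₀ K₁ _ _ c₀≤K₀ = begin
  c₀ * K₁ * 2                    ≤⟨ ℕ.*-monoˡ-≤ 2 (ℕ.*-monoˡ-≤ K₁ c₀≤K₀) ⟩
  K₀ * K₁ * 2                    ≡⟨ ℕ.*-comm (K₀ * K₁) 2 ⟩
  2 * (K₀ * K₁)                  ≤⟨ ℕ.m≤n+m (2 * (K₀ * K₁)) (c₁ * K₀ * 2) ⟩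
  c₁ * K₀ * 2 + 2 * (K₀ * K₁)    ∎
  where open ℕ.≤-Reasoning
cross-arith zero (suc i) c₀ c₁ K₀ K₁ K-eq c-le _ = begin
  c₀ * K₁ * X                    ≡⟨ cong (λ K → c₀ * K * X) K₀≡K₁ ⟨
  c₀ * K₀ * X                    ≤⟨ ℕ.*-monoˡ-≤ X (ℕ.*-monoˡ-≤ K₀ c₀≤c₁) ⟩
  c₁ * K₀ * X                    ≤⟨ ℕ.m≤m+n _ _ ⟩
  c₁ * K₀ * X + 2 * (K₀ * K₁)    ∎
  where
  open ℕ.≤-Reasoning
  X = suc (suc i) * (3 + i)
  K₀≡K₁ : K₀ ≡ K₁
  K₀≡K₁ = ℕ.*-cancelˡ-≡ K₀ K₁ (2 + i) K-eq
  c₀≤c₁ : c₀ ≤ c₁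
  c₀≤c₁ = ℕ.*-cancelˡ-≤ (suc i) (subst (λ m → m * c₀ ≤ suc i * c₁) (ℕ.+-identityʳ (suc i)) c-le)
cross-arith k@(suc k′) i c₀ c₁ K₀ K₁ K-eq c-le c₀≤K₀ = ℕ.*-cancelˡ-≤ n (begin
  n * (c₀ * K₁ * (suc i * (2 + i)))
    ≡⟨ lem₁ n c₀ K₁ (suc i) (2 + i) ⟩
  n * c₀ * (2 + i) * (suc i * K₁)
    ≡⟨ cong (n * c₀ * (2 + i) *_) K-eq ⟨
  n * c₀ * (2 + i) * (suc n * K₀)
    ≤⟨ ℕ.m≤m+n _ (k * (c₀ * K₀ * (2 + i))) ⟩
  n * c₀ * (2 + i) * (suc n * K₀) + k * (c₀ * K₀ * (2 + i))
    ≡⟨ lem₂ k i c₀ K₀ ⟩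
  (n + k) * c₀ * K₀ * (suc i * (2 + i)) + k * k * (c₀ * ((2 + i) * K₀))
    ≤⟨ ℕ.+-mono-≤ (ℕ.*-monoˡ-≤ (suc i * (2 + i)) (ℕ.*-monoˡ-≤ K₀ c-le))
         (ℕ.*-monoʳ-≤ (k * k) (ℕ.*-mono-≤ c₀≤K₀ small-K)) ⟩
  n * c₁ * K₀ * (suc i * (2 + i)) + k * k * (K₀ * (n * K₁))
    ≤⟨ ℕ.m≤m+n _ (2 * (n * (K₀ * K₁))) ⟩
  n * c₁ * K₀ * (suc i * (2 + i)) + k * k * (K₀ * (n * K₁)) + 2 * (n * (K₀ * K₁))
    ≡⟨ lem₃ n k c₁ K₀ K₁ (suc i * (2 + i)) ⟩
  n * (c₁ * K₀ * (suc i * (2 + i)) + (2 + k * k) * (K₀ * K₁)) ∎)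
  where
  open ℕ.≤-Reasoning
  n = k + i
  small-K : (2 + i) * K₀ ≤ n * K₁
  small-K = begin
    (2 + i) * K₀   ≤⟨ ℕ.*-monoˡ-≤ K₀ (s≤s (s≤s (ℕ.m≤n+m i k′))) ⟩
    suc n * K₀     ≡⟨ K-eq ⟩
    suc i * K₁     ≤⟨ ℕ.*-monoˡ-≤ K₁ (s≤s (ℕ.m≤n+m i k′)) ⟩
    n * K₁         ∎
  lem₁ : ∀ n c K a b → n * (c * K * (a * b)) ≡ n * c * b * (a * K)
  lem₁ = solve-∀
  lem₂ : ∀ k i c K →
    (k + i) * c * (2 + i) * (suc (k + i) * K) + k * (c * K * (2 + i)) ≡
    (k + i + k) * c * K * (suc i * (2 + i)) + k * k * (c * ((2 + i) * K))
  lem₂ = solve-∀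
  lem₃ : ∀ n k c K L X → n * c * K * X + k * k * (K * (n * L)) + 2 * (n * (K * L)) ≡
                         n * (c * K * X + (2 + k * k) * (K * L))
  lem₃ = solve-∀

delete-bound : ∀ {n} (G : Graph (suc n)) k ℓ c → (∀ H → #[ H , k , ℓ ] ≤ c) →
  suc n * #[ G , k , ℓ ] ≤ suc n * c + k * #[ G , k , ℓ ]
delete-bound {n} G k ℓ c h = ℕ.≤-trans (ℕ.≤-reflexive (sym (#-delete G k ℓ)))
  (ℕ.+-monoˡ-≤ (k * #[ G , k , ℓ ]) (sum-≤ (suc n) c (λ v → #[ delete G v , k , ℓ ]) (λ v → h (delete G v))))

duplicate-bound : ∀ {n} (G : Graph n) k ℓ c → (∀ H → #[ H , k , ℓ ] ≤ c) →
  (n + k) * #[ G , k , ℓ ] ≤ n * c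
duplicate-bound {n} G k ℓ c h = ℕ.≤-trans (#-duplicate G k ℓ)
  (sum-≤ n c (λ v → #[ duplicate G v , k , ℓ ]) (λ v → h (duplicate G v)))

-- Numerator and denominator of I; abstract so that the fractions below are not evaluated.
abstract
  num : ∀ n k → ℕ → .(k ≤ n) → ℕ
  num n k ℓ k≤n = #[ extremal n k ℓ k≤n , k , ℓ ]

  den : ℕ → ℕ → ℕ
  den n k = length (kSubsets n k)

  den≢0 : ∀ {n k} → k ≤ n → NonZero (den n k)
  den≢0 = kSubsets-nonZero

  I-frac : ∀ n k ℓ .(k≤n : k ≤ n) .{{_ : NonZero (den n k)}} →
    (ℤ.+ num n k ℓ k≤n / den n k) ≡ I n k ℓ k≤n
  I-frac n k ℓ k≤n = proj₂ (I-attained n k ℓ k≤n)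

  num≤den : ∀ n k ℓ .(k≤n : k ≤ n) → num n k ℓ k≤n ≤ den n k
  num≤den n k ℓ k≤n = #≤kSubsets (extremal n k ℓ k≤n) k ℓ

  den-step : ∀ n k → suc n * den n k + k * den (suc n) k ≡ suc n * den (suc n) k
  den-step = kSubsets-delete

  num-max : ∀ {n} (G : Graph n) k ℓ .(k≤n : k ≤ n) → #[ G , k , ℓ ] ≤ num n k ℓ k≤n
  num-max = extremal-max

  num-attained : ∀ n k ℓ .(k≤n : k ≤ n) → Σ (Graph n) λ G → #[ G , k , ℓ ] ≡ num n k ℓ k≤n
  num-attained n k ℓ k≤n = extremal n k ℓ k≤n , refl

num-down : ∀ n k ℓ .(p : k ≤ n) .(q : k ≤ suc n) →
  suc n * num (suc n) k ℓ q ≤ suc n * num n k ℓ p + k * num (suc n) k ℓ q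
num-down n k ℓ p q = let G , eq = num-attained (suc n) k ℓ q in
  subst (λ c → suc n * c ≤ suc n * num n k ℓ p + k * c) eq
    (delete-bound G k ℓ (num n k ℓ p) (λ H → num-max H k ℓ p))

num-up : ∀ n k ℓ .(p : k ≤ n) .(q : k ≤ suc n) → (n + k) * num n k ℓ p ≤ n * num (suc n) k ℓ q
num-up n k ℓ p q = let G , eq = num-attained n k ℓ p in
  subst (λ c → (n + k) * c ≤ n * num (suc n) k ℓ q) eq
    (duplicate-bound G k ℓ (num (suc n) k ℓ q) (λ H → num-max H k ℓ q))

cross-antitone : ∀ k i c₀ c₁ K₀ K₁ → suc (k + i) * K₀ ≡ suc i * K₁ →
  suc i * c₁ ≤ suc (k + i) * c₀ → c₁ * K₀ ≤ c₀ * K₁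
cross-antitone k i c₀ c₁ K₀ K₁ K-eq c-le = ℕ.*-cancelˡ-≤ (suc i) (begin
  suc i * (c₁ * K₀)         ≡⟨ ℕ.*-assoc (suc i) c₁ K₀ ⟨
  suc i * c₁ * K₀           ≤⟨ ℕ.*-monoˡ-≤ K₀ c-le ⟩
  suc (k + i) * c₀ * K₀     ≡⟨ lem (suc (k + i)) c₀ K₀ ⟩
  c₀ * (suc (k + i) * K₀)   ≡⟨ cong (c₀ *_) K-eq ⟩
  c₀ * (suc i * K₁)         ≡⟨ lem′ c₀ (suc i) K₁ ⟩
  suc i * (c₀ * K₁)         ∎)
  where
  open ℕ.≤-Reasoning
  lem : ∀ a b c → a * b * c ≡ b * (a * c)
  lem = solve-∀
  lem′ : ∀ a b c → a * (b * c) ≡ b * (a * c)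
  lem′ = solve-∀

split : ∀ k i m → suc (k + i) * m ≡ suc i * m + k * m
split = solve-∀

frac-slow : ∀ i C c₀ c₁ K₀ K₁ .{{_ : NonZero K₀}} .{{_ : NonZero K₁}} →
  c₀ * K₁ * (suc i * (2 + i)) ≤ c₁ * K₀ * (suc i * (2 + i)) + C * (K₀ * K₁) →
  (ℤ.+ c₀ / K₀) ℚ.+ (ℤ.+ C / suc (suc i)) ℚ.≤ (ℤ.+ c₁ / K₁) ℚ.+ (ℤ.+ C / suc i)
frac-slow i C c₀ c₁ K₀ K₁ h = subst₂ ℚ._≤_
    (sym (frac-+ c₀ K₀ C (2 + i))) (sym (frac-+ c₁ K₁ C (suc i)))
    (frac-≤ (c₀ * (2 + i) + C * K₀) (K₀ * (2 + i)) (c₁ * suc i + C * K₁) (K₁ * suc i)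
      {{ℕ.m*n≢0 K₀ (2 + i)}} {{ℕ.m*n≢0 K₁ (suc i)}} cross)
  where
  open ℕ.≤-Reasoning
  lem : ∀ c i C K L → (c * (2 + i) + C * K) * (L * suc i) ≡ c * L * (suc i * (2 + i)) + C * (K * L) * suc i
  lem = solve-∀
  lem′ : ∀ c i C K L → c * K * (suc i * (2 + i)) + C * (K * L) + C * (K * L) * suc i ≡ (c * suc i + C * L) * (K * (2 + i))
  lem′ = solve-∀
  cross : (c₀ * (2 + i) + C * K₀) * (K₁ * suc i) ≤ (c₁ * suc i + C * K₁) * (K₀ * (2 + i))
  cross = begin
    (c₀ * (2 + i) + C * K₀) * (K₁ * suc i)
      ≡⟨ lem c₀ i C K₀ K₁ ⟩
    c₀ * K₁ * (suc i * (2 + i)) + C * (K₀ * K₁) * suc i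
      ≤⟨ ℕ.+-monoˡ-≤ (C * (K₀ * K₁) * suc i) h ⟩
    c₁ * K₀ * (suc i * (2 + i)) + C * (K₀ * K₁) + C * (K₀ * K₁) * suc i
      ≡⟨ lem′ c₁ i C K₀ K₁ ⟩
    (c₁ * suc i + C * K₁) * (K₀ * (2 + i)) ∎

module _ (k ℓ i : ℕ) .(p : k ≤ k + i) .(q : k ≤ suc (k + i)) where
  private
    c₀ = num (k + i) k ℓ p
    c₁ = num (suc (k + i)) k ℓ q
    K₀ = den (k + i) k
    K₁ = den (suc (k + i)) k
    instance
      K₀≢0 : NonZero K₀
      K₀≢0 = den≢0 (ℕ.m≤m+n k i)
      K₁≢0 : NonZero K₁
      K₁≢0 = den≢0 (ℕ.m≤n⇒m≤1+n (ℕ.m≤m+n k i))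

    K-eq : suc (k + i) * K₀ ≡ suc i * K₁
    K-eq = ℕ.+-cancelʳ-≡ (k * K₁) (suc (k + i) * K₀) (suc i * K₁) (trans (den-step (k + i) k) (split k i K₁))

    c-down : suc i * c₁ ≤ suc (k + i) * c₀
    c-down = ℕ.+-cancelʳ-≤ (k * c₁) (suc i * c₁) (suc (k + i) * c₀)
      (subst (_≤ suc (k + i) * c₀ + k * c₁) (split k i c₁) (num-down (k + i) k ℓ p q))

  I-antitone : I (suc (k + i)) k ℓ q ℚ.≤ I (k + i) k ℓ p
  I-antitone = subst₂ ℚ._≤_ (I-frac (suc (k + i)) k ℓ q) (I-frac (k + i) k ℓ p)
    (frac-≤ c₁ K₁ c₀ K₀ (cross-antitone k i c₀ c₁ K₀ K₁ K-eq c-down))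

  I-slow : I (k + i) k ℓ p ℚ.+ (ℤ.+ (2 + k * k) / suc (suc i)) ℚ.≤
           I (suc (k + i)) k ℓ q ℚ.+ (ℤ.+ (2 + k * k) / suc i)
  I-slow = subst₂ (λ x y → x ℚ.+ (ℤ.+ (2 + k * k) / suc (suc i)) ℚ.≤ y ℚ.+ (ℤ.+ (2 + k * k) / suc i))
    (I-frac (k + i) k ℓ p) (I-frac (suc (k + i)) k ℓ q)
    (frac-slow i (2 + k * k) c₀ c₁ K₀ K₁
      (cross-arith k i c₀ c₁ K₀ K₁ K-eq (num-up (k + i) k ℓ p q) (num≤den (k + i) k ℓ p)))

I-cong : ∀ k ℓ {m n} .(k≤m : k ≤ m) .(k≤n : k ≤ n) → m ≡ n → I m k ℓ k≤m ≡ I n k ℓ k≤n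
I-cong k ℓ k≤m k≤n refl = refl

I-cauchy : ∀ k ℓ → IsCauchy (λ i → I (k + i) k ℓ (ℕ.m≤m+n k i))
I-cauchy k ℓ = steps⇒cauchy (2 + k * k) (λ i → I (k + i) k ℓ (ℕ.m≤m+n k i)) up down
  where
  a : ℕ → ℚ
  a i = I (k + i) k ℓ (ℕ.m≤m+n k i)

  shift : ∀ i → I (suc (k + i)) k ℓ (ℕ.m≤n⇒m≤1+n (ℕ.m≤m+n k i)) ≡ a (suc i)
  shift i = I-cong k ℓ (ℕ.m≤n⇒m≤1+n (ℕ.m≤m+n k i)) (ℕ.m≤m+n k (suc i)) (sym (ℕ.+-suc k i))

  up : ∀ i → a i ℚ.+ (ℤ.+ (2 + k * k) / suc (suc i)) ℚ.≤ a (suc i) ℚ.+ (ℤ.+ (2 + k * k) / suc i)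
  up i = subst (λ q → a i ℚ.+ (ℤ.+ (2 + k * k) / suc (suc i)) ℚ.≤ q ℚ.+ (ℤ.+ (2 + k * k) / suc i))
    (shift i) (I-slow k ℓ i (ℕ.m≤m+n k i) (ℕ.m≤n⇒m≤1+n (ℕ.m≤m+n k i)))

  down : ∀ i → a (suc i) ℚ.+ (ℤ.+ (2 + k * k) / suc (suc i)) ℚ.≤ a i ℚ.+ (ℤ.+ (2 + k * k) / suc i)
  down i = ℚ.+-mono-≤ (subst (ℚ._≤ a i) (shift i) (I-antitone k ℓ i (ℕ.m≤m+n k i) (ℕ.m≤n⇒m≤1+n (ℕ.m≤m+n k i))))
    (frac-≤ (2 + k * k) (suc (suc i)) (2 + k * k) (suc i) (ℕ.*-monoʳ-≤ (2 + k * k) (ℕ.n≤1+n (suc i))))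

-- lim I(n,k,ℓ) as n → ∞, represented by the sequence n = k, k + 1, ... itself;
-- I⟶ind verifies that it is the limit.
ind : ℕ → ℕ → ℝ
ind k ℓ = real (λ i → I (k + i) k ℓ (ℕ.m≤m+n k i)) (I-cauchy k ℓ)

cauchy-close : ∀ x ε N → (∀ m n → N ≤ m → N ≤ n → ℚ.∣ seq x m ℚ.- seq x n ∣ ℚ.≤ ε) →
  ∀ i q → N ≤ i → seq x i ≡ q →
  fromℚ q ≤ᵣ x +ᵣ fromℚ ε × x ≤ᵣ fromℚ q +ᵣ fromℚ ε
cauchy-close x ε N close i q N≤i refl =
    (λ η 0<η → N , λ j N≤j → weaken {q} {seq x j ℚ.+ ε} η 0<η (dist-≤⁻¹ {q} {seq x j} {ε} (close i j N≤i N≤j))) ,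
    (λ η 0<η → N , λ j N≤j → weaken {seq x j} {q ℚ.+ ε} η 0<η (dist-≤⁻¹ {seq x j} {q} {ε} (close j i N≤j N≤i)))
  where
  weaken : ∀ {p q} η → 0ℚ ℚ.< η → p ℚ.≤ q → p ℚ.≤ q ℚ.+ η
  weaken {p} {q} η 0<η p≤q = ℚ.≤-trans p≤q
    (subst (ℚ._≤ q ℚ.+ η) (ℚ.+-identityʳ q) (ℚ.+-monoʳ-≤ q (ℚ.<⇒≤ 0<η)))

I⟶ind : ∀ k ℓ → (λ n k≤n → fromℚ (I n k ℓ k≤n)) ⟶ ind k ℓ
I⟶ind k ℓ ε 0<ε = let N , close = cauchy (ind k ℓ) ε 0<ε in
  k + N , λ n k≤n k+N≤n →
    let k+i≡n = ℕ.m+[n∸m]≡n (ℕ.≤-trans (ℕ.m≤m+n k N) k+N≤n) in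
    cauchy-close (ind k ℓ) ε N close (n ℕ.∸ k) (I n k ℓ k≤n)
      (ℕ.+-cancelˡ-≤ k N (n ℕ.∸ k) (subst (k + N ≤_) (sym k+i≡n) k+N≤n))
      (I-cong k ℓ (ℕ.m≤m+n k (n ℕ.∸ k)) k≤n k+i≡n)

{-# OPTIONS --safe #-}
module Submission where

-- Replace the k-set by k independent uniform vertices, added one at a time; the difference vanishes
-- as n → ∞. Call a vertex blocked if adding it would raise the number of edges to ℓ or more. Removing
-- the vertex that does so from a sequence with ℓ edges whose last vertex is isolated leaves a sequence
-- without blocked vertices. If b_i is the proportion of vertices blocked at time i and D the event that
-- no blocked vertex is added, the probability of such sequences is therefore at most E[1_D ∑ b_i]. Since
-- E[1_D ∏ 1/(1 - b_i)] ≤ 1, AM-GM bounds it by ((k - 1)/k)^k ≤ 1/e. In the same way the last vertex has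
-- exactly d ≥ 1 neighbours with probability at most 1/e + o(1).
--
-- It remains to find one d such that the last vertex has d neighbours in almost all sequences with ℓ
-- edges. Otherwise there is a t such that, among the sequences with ℓ edges, those where it has fewer
-- than t neighbours and those where it has at least t are both likely. Let y be the sequence without its
-- last s vertices. By anticoncentration of the sum of the degrees of these s vertices into y, almost
-- all vertices have fewer than t neighbours in y (y is low) or almost all have at least t (y is high).
-- Let a vertex be light if its degree in G is less than n/g. The number of edges between light vertices
-- of y plus the sum of max(0, t - light degree) over the light vertices of y is at least about ℓ + k for
-- low y and at most about ℓ for high y, but it is concentrated by the Efron–Stein inequality. This
-- works for g of order t and s of order t², where t is of order ℓ/k; the last s vertices span an edge
-- with probability O(s²ℓ/k²), which is where ℓ = o(k^(6/5)) is needed.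

open import Defs
open import Data.Bool.Base using (Bool; true; false; not)
open import Data.Fin.Base using (Fin; zero; suc)
open import Data.Fin.Subset using (Subset; inside; outside; ∣_∣; ⊥)
open import Data.Fin.Subset.Properties using (∣⊥∣≡0)
import Data.Integer.Properties as ℤ
open import Data.List.Base using (List; []; _∷_; _++_; length)
open import Data.List.Properties using (++-identityʳ)
open import Data.List.Relation.Binary.Permutation.Propositional as ↭ using (_↭_; ↭-sym)
open import Data.List.Relation.Binary.Permutation.Propositional.Properties using (shift; ++⁺ʳ)
open import Data.Nat.Base hiding (_/_)
import Data.Nat.Base as ℕ
open import Data.Nat.DivMod using (m≡m%n+[m/n]*n; m%n<n; m/n*n≤m; m<n⇒m/n≡0)
open import Data.Nat.Properties
open import Algebra.Properties.Semiring.Sum +-*-semiring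
  using (sum; sum-cong-≗; ∑-distrib-+; ∑-comm; *-distribˡ-sum; *-distribʳ-sum)
open import Data.Nat.Tactic.RingSolver using (solve-∀)
open import Data.Product.Base using (Σ; ∃; _×_; _,_; proj₁; proj₂)
open import Data.Rational.Base using (0ℚ; 1ℚ; ½; _/_)
import Data.Rational.Base as ℚ
import Data.Rational.Properties as ℚ
open import Data.Rational.Solver using () renaming (module +-*-Solver to ℚ-Solver)
import Data.Rational.Unnormalised.Base as ℚᵘ
import Data.Rational.Unnormalised.Properties as ℚᵘ
open import Data.Sum.Base using (_⊎_; inj₁; inj₂)
open import Data.Vec.Base using (lookup; _[_]≔_) renaming ([] to []ᵛ; _∷_ to _∷ᵛ_)
open import Data.Vec.Properties using (lookup-replicate)
open import Function.Base using (_∘_; id)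
open import Relation.Binary.PropositionalEquality hiding ([_]; J)
open import Relation.Nullary
open import Relation.Nullary.Decidable using (dec-true; dec-false)

-- Sums over sequences of vertices

-- The scales are forced as follows. Let T bound t, so that T is of order mℓ/k, where 1/m is the
-- probability one may lose, and let K be the length of y. In a high sequence every poor light entry
-- costs `F t` up to t, and there are about K/g of them; the variance of `F t` is governed by light
-- degrees, at most n/g. Both need g large compared with T. A low sequence has O(gT) heavy entries,
-- and each of its rich entries, about K/g′ of them, may cost that many edges, so g′ must be of
-- order gT. Anticoncentration of the degree sum needs s large compared with g′, hence s of order
-- T². The probability s²ℓ/k² of an edge among the last s vertices is then of order T⁵/k, and T⁵
-- small compared with k means ℓ⁵ small compared with k⁶.
--
-- All inequalities stay in ℕ: probabilities are counts of sequences, denominators are cleared, and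
-- negative terms are moved to the other side. The resulting probability bounds for sequences do not
-- depend on n.

∑-mono : ∀ {n} {s t : Fin n → ℕ} → (∀ i → s i ≤ t i) → sum s ≤ sum t
∑-mono {zero}  h = z≤n
∑-mono {suc n} h = +-mono-≤ (h zero) (∑-mono (h ∘ suc))

∑-const : ∀ n c → sum {n} (λ _ → c) ≡ n * c
∑-const zero    c = refl
∑-const (suc n) c = cong (c +_) (∑-const n c)

⟦_⟧ : ∀ {P : Set} → Dec P → ℕ
⟦ p ⟧ = bit (does p)

bit≤1 : ∀ b → bit b ≤ 1
bit≤1 false = z≤n
bit≤1 true  = ≤-refl

bit-idem : ∀ b → bit b * bit b ≡ bit b
bit-idem false = refl
bit-idem true  = refl

bit+not : ∀ b → bit b + bit (not b) ≡ 1
bit+not false = refl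
bit+not true  = refl

⟦⟧-yes : ∀ {P : Set} (p : Dec P) → P → ⟦ p ⟧ ≡ 1
⟦⟧-yes (yes _) _ = refl
⟦⟧-yes (no ¬P) P = contradiction P ¬P

⟦⟧-no : ∀ {P : Set} (p : Dec P) → ¬ P → ⟦ p ⟧ ≡ 0
⟦⟧-no (yes P) ¬P = contradiction P ¬P
⟦⟧-no (no _)  _  = refl

⟦⟧*-≤ : ∀ {P : Set} (p : Dec P) {x y} → (P → x ≤ y) → ⟦ p ⟧ * x ≤ y
⟦⟧*-≤ (yes P) {x} {y} h = subst (_≤ y) (sym (+-identityʳ x)) (h P)
⟦⟧*-≤ (no _)          h = z≤n

⟦⟧-≤ : ∀ {P : Set} (p : Dec P) {y} → (P → 1 ≤ y) → ⟦ p ⟧ ≤ y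
⟦⟧-≤ p {y} h = subst (_≤ y) (*-identityʳ ⟦ p ⟧) (⟦⟧*-≤ p h)

⟦⟧-mono : ∀ {P Q : Set} (p : Dec P) (q : Dec Q) → (P → Q) → ⟦ p ⟧ ≤ ⟦ q ⟧
⟦⟧-mono p q h = ⟦⟧-≤ p (λ P → ≤-reflexive (sym (⟦⟧-yes q (h P))))

⟦⟧-¬ : ∀ {P Q : Set} (p : Dec P) (q : Dec Q) → (P → ¬ Q) → (¬ Q → P) → ⟦ p ⟧ + ⟦ q ⟧ ≡ 1
⟦⟧-¬ (yes P) (yes Q) f g = contradiction Q (f P)
⟦⟧-¬ (yes _) (no _)  f g = refl
⟦⟧-¬ (no _)  (yes _) f g = refl
⟦⟧-¬ (no ¬P) (no ¬Q) f g = contradiction (g ¬Q) ¬P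

-- Markov's inequality before averaging over c; integrality turns `X < c` into the factor `suc X`.
markov : ∀ X c → ⟦ X <? c ⟧ * suc X ≤ c
markov X c = ⟦⟧*-≤ (X <? c) id

sumL-+ : ∀ {A : Set} (f g : A → ℕ) xs → sumL (λ x → f x + g x) xs ≡ sumL f xs + sumL g xs
sumL-+ f g []       = refl
sumL-+ f g (x ∷ xs) = trans (cong (f x + g x +_) (sumL-+ f g xs)) (lem (f x) (g x) (sumL f xs) (sumL g xs))
  where
  lem : ∀ a b c d → a + b + (c + d) ≡ a + c + (b + d)
  lem = solve-∀

sumL-mono : ∀ {A : Set} {f g : A → ℕ} → (∀ x → f x ≤ g x) → ∀ xs → sumL f xs ≤ sumL g xs
sumL-mono h []       = z≤n
sumL-mono h (x ∷ xs) = +-mono-≤ (h x) (sumL-mono h xs)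

sumL-* : ∀ {A : Set} c (f : A → ℕ) xs → sumL (λ x → c * f x) xs ≡ c * sumL f xs
sumL-* c f []       = sym (*-zeroʳ c)
sumL-* c f (x ∷ xs) = trans (cong (c * f x +_) (sumL-* c f xs)) (sym (*-distribˡ-+ c (f x) _))

sumL-↭ : ∀ {A : Set} (f : A → ℕ) {xs ys} → xs ↭ ys → sumL f xs ≡ sumL f ys
sumL-↭ f ↭.refl                   = refl
sumL-↭ f (↭.prep x p)             = cong (f x +_) (sumL-↭ f p)
sumL-↭ f (↭.swap {xs} {ys} x y p) = trans (cong (λ s → f x + (f y + s)) (sumL-↭ f p)) (lem (f x) (f y) (sumL f ys))
  where
  lem : ∀ a b c → a + (b + c) ≡ b + (a + c)
  lem = solve-∀
sumL-↭ f (↭.trans p q)            = trans (sumL-↭ f p) (sumL-↭ f q)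

sumL-sum : ∀ {A : Set} {n} (f : A → Fin n → ℕ) xs →
  sumL (λ x → sum (f x)) xs ≡ sum (λ v → sumL (λ x → f x v) xs)
sumL-sum {n = n} f []       = sym (trans (∑-const n 0) (*-zeroʳ n))
sumL-sum         f (x ∷ xs) = trans (cong (sum (f x) +_) (sumL-sum f xs)) (sym (∑-distrib-+ (f x) _))

-- Divided by n ^ k, this is the expectation of f for k independent uniform vertices.
∑Seq : ∀ {n} → ℕ → (List (Fin n) → ℕ) → ℕ
∑Seq zero    f = f []
∑Seq (suc k) f = sum λ v → ∑Seq k λ a → f (v ∷ a)

∑Seq-mono : ∀ {n} k {f g : List (Fin n) → ℕ} → (∀ a → length a ≡ k → f a ≤ g a) → ∑Seq k f ≤ ∑Seq k g
∑Seq-mono zero    h = h [] refl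
∑Seq-mono (suc k) h = ∑-mono λ v → ∑Seq-mono k λ a eq → h (v ∷ a) (cong suc eq)

∑Seq-cong : ∀ {n} k {f g : List (Fin n) → ℕ} → (∀ a → f a ≡ g a) → ∑Seq k f ≡ ∑Seq k g
∑Seq-cong zero    h = h []
∑Seq-cong (suc k) h = sum-cong-≗ λ v → ∑Seq-cong k λ a → h (v ∷ a)

∑Seq-+ : ∀ {n} k (f g : List (Fin n) → ℕ) → ∑Seq k (λ a → f a + g a) ≡ ∑Seq k f + ∑Seq k g
∑Seq-+ zero    f g = refl
∑Seq-+ (suc k) f g = trans (sum-cong-≗ λ v → ∑Seq-+ k (λ a → f (v ∷ a)) (λ a → g (v ∷ a)))
  (∑-distrib-+ (λ v → ∑Seq k (λ a → f (v ∷ a))) _)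

∑Seq-* : ∀ {n} k c (f : List (Fin n) → ℕ) → ∑Seq k (λ a → c * f a) ≡ c * ∑Seq k f
∑Seq-* zero    c f = refl
∑Seq-* (suc k) c f = trans (sum-cong-≗ λ v → ∑Seq-* k c (λ a → f (v ∷ a)))
  (sym (*-distribˡ-sum c (λ v → ∑Seq k (λ a → f (v ∷ a)))))

∑Seq-*ʳ : ∀ {n} k c (f : List (Fin n) → ℕ) → ∑Seq k (λ a → f a * c) ≡ ∑Seq k f * c
∑Seq-*ʳ k c f = trans (∑Seq-cong k λ a → *-comm (f a) c) (trans (∑Seq-* k c f) (*-comm c _))

∑Seq-const : ∀ {n} k c → ∑Seq {n} k (λ _ → c) ≡ n ^ k * c
∑Seq-const     zero    c = sym (+-identityʳ c)
∑Seq-const {n} (suc k) c = trans (sum-cong-≗ {n} λ _ → ∑Seq-const {n} k c) (trans (∑-const n (n ^ k * c)) (sym (*-assoc n _ c)))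

∑Seq-sum : ∀ {n m} k (f : List (Fin n) → Fin m → ℕ) →
  ∑Seq k (λ a → sum (f a)) ≡ sum (λ v → ∑Seq k (λ a → f a v))
∑Seq-sum zero    f = refl
∑Seq-sum (suc k) f = trans (sum-cong-≗ λ v → ∑Seq-sum k (λ a → f (v ∷ a)))
  (∑-comm (λ v w → ∑Seq k (λ a → f (v ∷ a) w)))

∑Seq-comm : ∀ {m n} j k (f : List (Fin m) → List (Fin n) → ℕ) →
  ∑Seq j (λ a → ∑Seq k (f a)) ≡ ∑Seq k (λ b → ∑Seq j (λ a → f a b))
∑Seq-comm zero    k f = refl
∑Seq-comm (suc j) k f = trans (sum-cong-≗ λ v → ∑Seq-comm j k (λ a → f (v ∷ a)))
  (sym (∑Seq-sum k (λ b v → ∑Seq j (λ a → f (v ∷ a) b))))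

∑Seq-++ : ∀ {n} j k (f : List (Fin n) → ℕ) → ∑Seq (j + k) f ≡ ∑Seq j (λ a → ∑Seq k (λ b → f (a ++ b)))
∑Seq-++ zero    k f = refl
∑Seq-++ (suc j) k f = sum-cong-≗ λ v → ∑Seq-++ j k (λ a → f (v ∷ a))

-- Sequences grow at the front, so the entry next to `t` is the one added first. This exposes the
-- first addition, whereas the definition of `∑Seq` exposes the last one.
∑Seq-snoc : ∀ {n} k (f : List (Fin n) → ℕ) (t : List (Fin n)) →
  ∑Seq (suc k) (λ c → f (c ++ t)) ≡ sum (λ u → ∑Seq k (λ c → f (c ++ u ∷ t)))
∑Seq-snoc zero    f t = refl
∑Seq-snoc (suc k) f t = trans (sum-cong-≗ λ v → ∑Seq-snoc k (λ a → f (v ∷ a)) t)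
  (∑-comm (λ v u → ∑Seq k (λ c → f (v ∷ c ++ u ∷ t))))

module _ {n : ℕ} where

  Invariant : (List (Fin n) → ℕ) → Set
  Invariant f = ∀ {a b} → a ↭ b → f a ≡ f b

  -- A sum over the positions of the sequence: `φ` receives the entry at the position and the list
  -- of the remaining entries.
  pick : (Fin n → List (Fin n) → ℕ) → List (Fin n) → ℕ
  pick φ []      = 0
  pick φ (v ∷ a) = φ v a + pick (λ u r → φ u (v ∷ r)) a

  -- Whichever of the `suc k` positions is singled out, its entry and the rest are a uniform vertex
  -- and an independent uniform sequence.
  ∑Seq-pick : ∀ k φ → ∑Seq (suc k) (pick φ) ≡ suc k * sum (λ u → ∑Seq k (φ u))
  ∑Seq-pick k φ = trans
    (trans (sum-cong-≗ λ v → ∑Seq-+ k (φ v) (pick (λ u r → φ u (v ∷ r))))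
      (∑-distrib-+ (λ v → ∑Seq k (φ v)) (λ v → ∑Seq k (pick (λ u r → φ u (v ∷ r))))))
    (cong (sum (λ u → ∑Seq k (φ u)) +_) (rest k φ))
    where
    rest : ∀ k φ → sum (λ v → ∑Seq k (pick (λ u r → φ u (v ∷ r)))) ≡ k * sum (λ u → ∑Seq k (φ u))
    rest zero    φ = trans (∑-const n 0) (*-zeroʳ n)
    rest (suc k) φ = trans (sum-cong-≗ λ v → ∑Seq-pick k (λ u r → φ u (v ∷ r)))
      (trans (sym (*-distribˡ-sum (suc k) (λ v → sum (λ u → ∑Seq k (λ r → φ u (v ∷ r))))))
        (cong (suc k *_) (∑-comm (λ v u → ∑Seq k (λ r → φ u (v ∷ r))))))

  pick-sumL : ∀ (ψ : Fin n → List (Fin n) → ℕ) → (∀ u → Invariant (ψ u)) →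
    ∀ a → pick (λ u r → ψ u (u ∷ r)) a ≡ sumL (λ u → ψ u a) a
  pick-sumL ψ inv a = general (λ u r → ψ u (u ∷ r)) ψ (λ u r b p → inv u (↭-sym p)) a
    where
    general : ∀ (φ ψ : Fin n → List (Fin n) → ℕ) → (∀ u r b → b ↭ u ∷ r → φ u r ≡ ψ u b) →
      ∀ a → pick φ a ≡ sumL (λ u → ψ u a) a
    general φ ψ h []      = refl
    general φ ψ h (v ∷ a) = cong₂ _+_ (h v a (v ∷ a) ↭.refl)
      (general (λ u r → φ u (v ∷ r)) (λ u b → ψ u (v ∷ b))
        (λ u r b p → h u (v ∷ r) (v ∷ b) (↭.trans (↭.prep v p) (↭.swap v u ↭.refl))) a)

  -- Exchangeability: invariance allows every entry to be moved to the front, where it is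
  -- independent of the others. Nearly all first moment computations below go through this identity.
  ∑Seq-sumL : ∀ k (ψ : Fin n → List (Fin n) → ℕ) → (∀ u → Invariant (ψ u)) →
    ∑Seq (suc k) (λ a → sumL (λ u → ψ u a) a) ≡ suc k * sum (λ u → ∑Seq k (λ r → ψ u (u ∷ r)))
  ∑Seq-sumL k ψ inv = trans (∑Seq-cong (suc k) λ a → sym (pick-sumL ψ inv a))
    (∑Seq-pick k (λ u r → ψ u (u ∷ r)))

module _ {n : ℕ} (ω : Fin n → Fin n → ℕ) where

  deg : List (Fin n) → Fin n → ℕ
  deg a v = sumL (ω v) a

  edges : List (Fin n) → ℕ
  edges []      = 0
  edges (v ∷ a) = deg a v + edges a

  deg-↭ : ∀ v → Invariant (λ a → deg a v)
  deg-↭ v = sumL-↭ (ω v)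

  deg-∷ : ∀ u a v → deg a v ≤ deg (u ∷ a) v
  deg-∷ u a v = m≤n+m _ (ω v u)

  deg-++ : ∀ x y v → deg (x ++ y) v ≡ deg x v + deg y v
  deg-++ x y v = sumL-++ (ω v) x y

  edges-++ : ∀ x y → edges (x ++ y) ≡ edges x + sumL (deg y) x + edges y
  edges-++ []      y = refl
  edges-++ (v ∷ x) y = trans (cong₂ _+_ (deg-++ x y v) (edges-++ x y))
      (lem (deg x v) (deg y v) (edges x) (sumL (deg y) x) (edges y))
    where
    lem : ∀ a b c d e → a + b + (c + d + e) ≡ a + c + (b + d) + e
    lem = solve-∀

  module _ (ω-sym : ∀ u v → ω u v ≡ ω v u) where

    edges-↭ : Invariant edges
    edges-↭ ↭.refl           = refl
    edges-↭ (↭.prep x p)     = cong₂ _+_ (deg-↭ x p) (edges-↭ p)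
    edges-↭ (↭.swap {xs} {ys} x y p) = trans
        (cong₂ (λ s t → s + t) (cong₂ _+_ (ω-sym x y) (deg-↭ x p)) (cong₂ _+_ (deg-↭ y p) (edges-↭ p)))
        (lem (ω y x) (deg ys x) (deg ys y) (edges ys))
      where
      lem : ∀ a b c d → a + b + (c + d) ≡ a + c + (b + d)
      lem = solve-∀
    edges-↭ (↭.trans p q)    = trans (edges-↭ p) (edges-↭ q)

    module _ (ω-irrefl : ∀ v → ω v v ≡ 0) where

      deg-self : ∀ v a → deg (v ∷ a) v ≡ deg a v
      deg-self v a = cong (_+ deg a v) (ω-irrefl v)

      handshake : ∀ a → sumL (deg a) a ≡ 2 * edges a
      handshake []      = refl
      handshake (v ∷ a) = trans
          (cong₂ _+_ (deg-self v a)
            (trans (sumL-+ (λ u → ω u v) (deg a) a)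
              (cong₂ _+_ (sumL-cong (λ u → ω-sym u v) a) (handshake a))))
          (lem (deg a v) (edges a))
        where
        lem : ∀ d e → d + (d + 2 * e) ≡ 2 * (d + e)
        lem = solve-∀

-- Sequences with exactly one blocked vertex

dist²-expand : ∀ x y → ∣ x - y ∣ * ∣ x - y ∣ + 2 * (x * y) ≡ x * x + y * y
dist²-expand x y with ≤-total x y
... | inj₁ x≤y = subst (λ z → ∣ x - z ∣ * ∣ x - z ∣ + 2 * (x * z) ≡ x * x + z * z) (m+[n∸m]≡n x≤y)
  (trans (cong (λ d → d * d + 2 * (x * (x + (y ∸ x)))) (trans (∣-∣-comm x _) (∣m+n-m∣≡n x (y ∸ x)))) (lem x (y ∸ x)))
  where
  ∣m+n-m∣≡n : ∀ m n → ∣ m + n - m ∣ ≡ n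
  ∣m+n-m∣≡n m n = trans (∣-∣-comm (m + n) m) (∣m-m+n∣≡n m n)
  lem : ∀ x d → d * d + 2 * (x * (x + d)) ≡ x * x + (x + d) * (x + d)
  lem = solve-∀
... | inj₂ y≤x = subst (λ z → ∣ z - y ∣ * ∣ z - y ∣ + 2 * (z * y) ≡ z * z + y * y) (m+[n∸m]≡n y≤x)
  (trans (cong (λ d → d * d + 2 * ((y + (x ∸ y)) * y)) (trans (∣-∣-comm (y + (x ∸ y)) y) (∣m-m+n∣≡n y (x ∸ y)))) (lem y (x ∸ y)))
  where
  lem : ∀ y d → d * d + 2 * ((y + d) * y) ≡ (y + d) * (y + d) + y * y
  lem = solve-∀

2xy≤x²+y² : ∀ x y → 2 * (x * y) ≤ x * x + y * y
2xy≤x²+y² x y = ≤-trans (m≤n+m _ (∣ x - y ∣ * ∣ x - y ∣)) (≤-reflexive (dist²-expand x y))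

-- Convexity: the power `a ^ suc m` lies above its tangent at `c`.
bernoulli : ∀ m a c → suc m * (c ^ m * a) ≤ a ^ suc m + m * c ^ suc m
bernoulli zero    a c = ≤-reflexive (lem a)
  where
  lem : ∀ a → 1 * (1 * a) ≡ a * 1 + 0
  lem = solve-∀
bernoulli (suc m) a c = +-cancelʳ-≤ (m * (c * c ^ m * a)) _ _ (begin
    suc (suc m) * (c * c ^ m * a) + m * (c * c ^ m * a)
      ≡⟨ lem₁ m (c ^ m) a c ⟩
    suc m * c ^ m * (2 * (a * c))
      ≤⟨ *-monoʳ-≤ (suc m * c ^ m) (2xy≤x²+y² a c) ⟩
    suc m * c ^ m * (a * a + c * c)
      ≡⟨ lem₂ m (c ^ m) a c ⟩
    a * (suc m * (c ^ m * a)) + suc m * (c * (c * c ^ m))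
      ≤⟨ +-monoˡ-≤ (suc m * (c * (c * c ^ m))) (*-monoʳ-≤ a (bernoulli m a c)) ⟩
    a * (a ^ suc m + m * c ^ suc m) + suc m * (c * (c * c ^ m))
      ≡⟨ lem₃ m (a ^ suc m) (c ^ m) a c ⟩
    a * a ^ suc m + suc m * (c * (c * c ^ m)) + m * (c * c ^ m * a) ∎)
  where
  open ≤-Reasoning
  lem₁ : ∀ m p a c → suc (suc m) * (c * p * a) + m * (c * p * a) ≡ suc m * p * (2 * (a * c))
  lem₁ = solve-∀
  lem₂ : ∀ m p a c → suc m * p * (a * a + c * c) ≡ a * (suc m * (p * a)) + suc m * (c * (c * p))
  lem₂ = solve-∀
  lem₃ : ∀ m q p a c → a * (q + m * (c * p)) + suc m * (c * (c * p)) ≡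
                       a * q + suc m * (c * (c * p)) + m * (c * p * a)
  lem₃ = solve-∀

-- The AM-GM inequality for x and m copies of y / m.
amgm : ∀ m .{{_ : NonZero m}} x y → x * y ^ m * suc m ^ suc m ≤ (x + y) ^ suc m * m ^ m
amgm m x y = *-cancelˡ-≤ m (+-cancelʳ-≤ (m * c ^ suc m) _ _ (begin
    m * (x * y ^ m * (suc m * suc m ^ m)) + m * (c * c ^ m)
      ≡⟨ cong (λ z → m * (x * y ^ m * (suc m * suc m ^ m)) + m * (c * z)) (^-distribʳ-* m (suc m) y) ⟩
    m * (x * y ^ m * (suc m * suc m ^ m)) + m * (suc m * y * (suc m ^ m * y ^ m))
      ≡⟨ lem₁ m x y (y ^ m) (suc m ^ m) ⟩
    suc m * (suc m ^ m * y ^ m * (m * (x + y)))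
      ≡⟨ cong (λ z → suc m * (z * (m * (x + y)))) (^-distribʳ-* m (suc m) y) ⟨
    suc m * (c ^ m * (m * (x + y)))
      ≤⟨ bernoulli m (m * (x + y)) c ⟩
    m * (x + y) * (m * (x + y)) ^ m + m * c ^ suc m
      ≡⟨ cong (_+ m * c ^ suc m) (trans (cong (m * (x + y) *_) (^-distribʳ-* m m (x + y))) (lem₂ m (x + y) (m ^ m) ((x + y) ^ m))) ⟩
    m * ((x + y) ^ suc m * m ^ m) + m * c ^ suc m ∎))
  where
  open ≤-Reasoning
  -- Both arguments of `bernoulli` are scaled by m(m + 1) to clear denominators: `m * (x + y)` comes
  -- from the mean (x + y)/(m + 1), and `c` from the repeated number y/m.
  c = suc m * y
  lem₁ : ∀ m x y p q → m * (x * p * (suc m * q)) + m * (suc m * y * (q * p)) ≡ suc m * (q * p * (m * (x + y)))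
  lem₁ = solve-∀
  lem₂ : ∀ m s p q → m * s * (p * q) ≡ m * (s * q * p)
  lem₂ = solve-∀

module _ {n : ℕ} (β : List (Fin n) → Fin n → Bool) where

  blocked : List (Fin n) → ℕ
  blocked t = sum λ u → bit (β t u)

  private
    free : List (Fin n) → Fin n → ℕ
    free t u = bit (not (β t u))

    free+blocked : ∀ t → sum (free t) + blocked t ≡ n
    free+blocked t = trans (sym (∑-distrib-+ (free t) (λ u → bit (β t u))))
      (trans (sum-cong-≗ {n} (λ u → trans (+-comm (free t u) _) (bit+not (β t u)))) (trans (∑-const n 1) (*-identityʳ n)))

  -- Sequences grow at the front. The weight of an unblocked sequence is B plus the
  -- number of vertices blocked at the times of its growth.
  unblockedCount : ℕ → List (Fin n) → ℕ
  unblockedCount zero    t = 1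
  unblockedCount (suc r) t = sum λ u → free t u * unblockedCount r (u ∷ t)

  weightedCount : ℕ → List (Fin n) → ℕ → ℕ
  weightedCount zero    t B = B
  weightedCount (suc r) t B = sum λ u → free t u * weightedCount r (u ∷ t) (B + blocked t)

  -- Free and blocked vertices number n together, so `x + y` below is the same for every `t`, and
  -- AM-GM for x and m copies of y/m closes the induction. The parameter B carries the weight
  -- already collected; for B = 0 the bound is the factor (r/(r + 1))^(r + 1) that leads to 1/e.
  weightedCount-bound : ∀ r t B → suc r ^ suc r * weightedCount r t B ≤ (r * n + B) ^ suc r
  weightedCount-bound zero    t B = ≤-reflexive (lem B)
    where
    lem : ∀ B → 1 * 1 * B ≡ B * 1
    lem = solve-∀
  weightedCount-bound (suc r) t B = *-cancelʳ-≤ _ _ (m ^ m) {{m^n≢0 m m}} (begin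
      suc m ^ suc m * weightedCount m t B * m ^ m
        ≡⟨ lem₁ (suc m ^ suc m) (weightedCount m t B) (m ^ m) ⟩
      suc m ^ suc m * (m ^ m * weightedCount m t B)
        ≤⟨ *-monoʳ-≤ (suc m ^ suc m) step ⟩
      suc m ^ suc m * (x * y ^ m)
        ≡⟨ *-comm (suc m ^ suc m) (x * y ^ m) ⟩
      x * y ^ m * suc m ^ suc m
        ≤⟨ amgm m x y ⟩
      (x + y) ^ suc m * m ^ m
        ≡⟨ cong (λ z → z ^ suc m * m ^ m) (trans (lem₂ x (r * n) B (blocked t)) (cong (λ z → z + r * n + B) (free+blocked t))) ⟩
      (m * n + B) ^ suc m * m ^ m ∎)
    where
    open ≤-Reasoning
    m = suc r
    x = sum (free t)
    y = r * n + (B + blocked t)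
    lem₁ : ∀ a b c → a * b * c ≡ a * (c * b)
    lem₁ = solve-∀
    lem₂ : ∀ x p B b → x + (p + (B + b)) ≡ x + b + p + B
    lem₂ = solve-∀
    lem₃ : ∀ a b c → a * (b * c) ≡ b * (a * c)
    lem₃ = solve-∀
    step : m ^ m * weightedCount m t B ≤ x * y ^ m
    step = begin
      m ^ m * weightedCount m t B
        ≡⟨ *-distribˡ-sum (m ^ m) (λ u → free t u * weightedCount r (u ∷ t) (B + blocked t)) ⟩
      sum (λ u → m ^ m * (free t u * weightedCount r (u ∷ t) (B + blocked t)))
        ≤⟨ ∑-mono (λ u → ≤-trans (≤-reflexive (lem₃ (m ^ m) (free t u) _))
             (*-monoʳ-≤ (free t u) (weightedCount-bound r (u ∷ t) (B + blocked t)))) ⟩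
      sum (λ u → free t u * y ^ m)
        ≡⟨ *-distribʳ-sum (y ^ m) (free t) ⟨
      x * y ^ m ∎

  -- The sequences with one blocked vertex, added before the last one, which become
  -- unblocked if that vertex is removed.
  onceBlockedCount : ℕ → List (Fin n) → ℕ
  onceBlockedCount zero          t = 0
  onceBlockedCount (suc zero)    t = 0
  onceBlockedCount (suc (suc r)) t = blocked t * unblockedCount (suc r) t +
    sum (λ u → free t u * onceBlockedCount (suc r) (u ∷ t))

  -- Double counting: the weight collected along an unblocked sequence is the number of ways to
  -- choose a time and a vertex blocked at that time, and inserting this vertex there gives the
  -- sequences with one blocked vertex.
  weightedCount-split : ∀ r t B →
    weightedCount r t B ≡ B * unblockedCount r t + onceBlockedCount (suc r) t
  weightedCount-split zero    t B = trans (sym (*-identityʳ B)) (sym (+-identityʳ _))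
  weightedCount-split (suc r) t B = begin
      sum (λ u → free t u * weightedCount r (u ∷ t) (B + b))
        ≡⟨ sum-cong-≗ (λ u → trans (cong (free t u *_) (weightedCount-split r (u ∷ t) (B + b)))
             (lem (free t u) (B + b) (unblockedCount r (u ∷ t)) (onceBlockedCount (suc r) (u ∷ t)))) ⟩
      sum (λ u → (B + b) * (free t u * unblockedCount r (u ∷ t)) + free t u * onceBlockedCount (suc r) (u ∷ t))
        ≡⟨ ∑-distrib-+ (λ u → (B + b) * (free t u * unblockedCount r (u ∷ t))) _ ⟩
      sum (λ u → (B + b) * (free t u * unblockedCount r (u ∷ t))) + O
        ≡⟨ cong (_+ O) (sym (*-distribˡ-sum (B + b) (λ u → free t u * unblockedCount r (u ∷ t)))) ⟩
      (B + b) * U + O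
        ≡⟨ trans (cong (_+ O) (*-distribʳ-+ U B b)) (+-assoc (B * U) (b * U) O) ⟩
      B * U + (b * U + O) ∎
    where
    open ≡-Reasoning
    b = blocked t
    U = unblockedCount (suc r) t
    O = sum (λ u → free t u * onceBlockedCount (suc r) (u ∷ t))
    lem : ∀ f c x y → f * (c * x + y) ≡ c * (f * x) + f * y
    lem = solve-∀

  onceBlockedCount-bound : ∀ r → suc r ^ suc r * onceBlockedCount (suc r) [] ≤ (r * n) ^ suc r
  onceBlockedCount-bound r = subst₂ (λ x y → suc r ^ suc r * x ≤ y ^ suc r)
    (weightedCount-split r [] 0) (+-identityʳ (r * n)) (weightedCount-bound r [] 0)

module _ {n : ℕ} (Φ : List (Fin n) → ℕ) (θ : ℕ)
  (Φ-mono  : ∀ u t → Φ t ≤ Φ (u ∷ t))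
  (Φ-super : ∀ c u t → Φ (c ++ t) + Φ (u ∷ t) ≤ Φ (c ++ u ∷ t) + Φ t)
  where

  -- The vertex added last is the head; it is added when Φ has the value θ already and leaves it
  -- there. For the number of edges this is an isolated last vertex.
  settled : List (Fin n) → ℕ
  settled []      = 0
  settled (v ∷ a) = ⟦ Φ a ≟ θ ⟧ * ⟦ Φ (v ∷ a) ≟ θ ⟧

  private
    β : List (Fin n) → Fin n → Bool
    β t u = does (θ ≤? Φ (u ∷ t))

    Φ-mono-++ : ∀ c t → Φ t ≤ Φ (c ++ t)
    Φ-mono-++ []      t = ≤-refl
    Φ-mono-++ (u ∷ c) t = ≤-trans (Φ-mono-++ c t) (Φ-mono u (c ++ t))

    below : ∀ r t → Φ t < θ → ∑Seq r (λ c → ⟦ Φ (c ++ t) <? θ ⟧) ≤ unblockedCount β r t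
    below zero    t h = bit≤1 (does (Φ t <? θ))
    below (suc r) t h = ≤-trans (≤-reflexive (∑Seq-snoc r (λ c → ⟦ Φ c <? θ ⟧) t)) (∑-mono step)
      where
      step : ∀ u → ∑Seq r (λ c → ⟦ Φ (c ++ u ∷ t) <? θ ⟧) ≤ bit (not (β t u)) * unblockedCount β r (u ∷ t)
      step u with θ ≤? Φ (u ∷ t)
      ... | no θ≰ rewrite dec-false (θ ≤? Φ (u ∷ t)) θ≰ = ≤-trans (below r (u ∷ t) (≰⇒> θ≰)) (≤-reflexive (sym (+-identityʳ _)))
      ... | yes θ≤ = ≤-trans
        (∑Seq-mono r {g = λ _ → 0} λ c _ → ≤-reflexive (⟦⟧-no (Φ (c ++ u ∷ t) <? θ) (≤⇒≯ (≤-trans θ≤ (Φ-mono-++ c (u ∷ t))))))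
        (≤-trans (≤-reflexive (trans (∑Seq-const r 0) (*-zeroʳ (n ^ r)))) z≤n)

    -- The first vertex that brings Φ to θ or more is blocked, and a settled sequence contains it
    -- before its last vertex. Deleting it gives a sequence staying below θ, hence an unblocked one.
    settled-below : ∀ r t → Φ t < θ → ∑Seq (suc r) (λ c → settled (c ++ t)) ≤ onceBlockedCount β (suc r) t
    settled-below zero    t h = ≤-reflexive (trans
      (sum-cong-≗ {n} (λ u → cong (_* ⟦ Φ (u ∷ t) ≟ θ ⟧) (⟦⟧-no (Φ t ≟ θ) (<⇒≢ h)))) (trans (∑-const n 0) (*-zeroʳ n)))
    settled-below (suc r) t h = begin
        ∑Seq (suc (suc r)) (λ c → settled (c ++ t))
          ≡⟨ ∑Seq-snoc (suc r) settled t ⟩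
        sum (λ u → ∑Seq (suc r) (λ c → settled (c ++ u ∷ t)))
          ≤⟨ ∑-mono step ⟩
        sum (λ u → bit (β t u) * U + bit (not (β t u)) * onceBlockedCount β (suc r) (u ∷ t))
          ≡⟨ ∑-distrib-+ (λ u → bit (β t u) * U) _ ⟩
        sum (λ u → bit (β t u) * U) + sum (λ u → bit (not (β t u)) * onceBlockedCount β (suc r) (u ∷ t))
          ≡⟨ cong (_+ sum (λ u → bit (not (β t u)) * onceBlockedCount β (suc r) (u ∷ t))) (sym (*-distribʳ-sum U (λ u → bit (β t u)))) ⟩
        onceBlockedCount β (suc (suc r)) t ∎
      where
      open ≤-Reasoning
      U = unblockedCount β (suc r) t
      -- By `Φ-super`, deleting u from the whole sequence lowers Φ at least as much as deleting it
      -- from `u ∷ t`, where the loss is positive because `Φ t < θ ≤ Φ (u ∷ t)`.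
      once : ∀ u c v → θ ≤ Φ (u ∷ t) → settled (v ∷ c ++ u ∷ t) ≤ ⟦ Φ (v ∷ c ++ t) <? θ ⟧
      once u c v θ≤ = ≤-trans (*-monoˡ-≤ _ (bit≤1 (does (Φ (c ++ u ∷ t) ≟ θ)))) (≤-trans (≤-reflexive (+-identityʳ _))
        (⟦⟧-mono (Φ (v ∷ c ++ u ∷ t) ≟ θ) (Φ (v ∷ c ++ t) <? θ) λ eq → ≰⇒> λ θ≤′ →
          <-irrefl refl (<-≤-trans (+-mono-≤-< θ≤′ (<-≤-trans h θ≤))
            (subst (λ z → Φ (v ∷ c ++ t) + Φ (u ∷ t) ≤ z + Φ t) eq (Φ-super (v ∷ c) u t)))))
      step : ∀ u → ∑Seq (suc r) (λ c → settled (c ++ u ∷ t)) ≤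
                   bit (β t u) * U + bit (not (β t u)) * onceBlockedCount β (suc r) (u ∷ t)
      step u with θ ≤? Φ (u ∷ t)
      ... | no θ≰ rewrite dec-false (θ ≤? Φ (u ∷ t)) θ≰ = ≤-trans (settled-below r (u ∷ t) (≰⇒> θ≰)) (≤-reflexive (sym (+-identityʳ _)))
      ... | yes θ≤ rewrite dec-true (θ ≤? Φ (u ∷ t)) θ≤ = ≤-trans (∑-mono λ v → ∑Seq-mono r λ c _ → once u c v θ≤)
        (≤-trans (below (suc r) t h) (≤-reflexive (lem U)))
        where
        lem : ∀ x → x ≡ 1 * x + 0
        lem = solve-∀

  settled-bound : ∀ r → Φ [] < θ → suc r ^ suc r * ∑Seq (suc r) settled ≤ (r * n) ^ suc r
  settled-bound r h = ≤-trans (*-monoʳ-≤ (suc r ^ suc r) (subst (_≤ onceBlockedCount β (suc r) [])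
      (∑Seq-cong (suc r) λ c → cong settled (++-identityʳ c)) (settled-below r [] h)))
    (onceBlockedCount-bound β r)

-- Moments and anticoncentration

module _ {n : ℕ} (g : Fin n → ℕ) where

  private X = sum g

  ∑Seq-sumL-mean : ∀ k → n * ∑Seq k (sumL g) ≡ n ^ k * (k * X)
  ∑Seq-sumL-mean zero    = *-zeroʳ n
  ∑Seq-sumL-mean (suc k) = begin
      n * sum (λ v → ∑Seq k (λ a → g v + sumL g a))
        ≡⟨ cong (n *_) (sum-cong-≗ λ v → trans (∑Seq-+ k (λ _ → g v) (sumL g)) (cong (_+ M) (∑Seq-const k (g v)))) ⟩
      n * sum (λ v → n ^ k * g v + M)
        ≡⟨ cong (n *_) (∑-distrib-+ (λ v → n ^ k * g v) (λ _ → M)) ⟩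
      n * (sum (λ v → n ^ k * g v) + sum {n} (λ _ → M))
        ≡⟨ cong (n *_) (cong₂ _+_ (sym (*-distribˡ-sum (n ^ k) g)) (∑-const n M)) ⟩
      n * (n ^ k * X + n * M)
        ≡⟨ cong (λ z → n * (n ^ k * X + z)) (∑Seq-sumL-mean k) ⟩
      n * (n ^ k * X + n ^ k * (k * X))
        ≡⟨ lem n (n ^ k) k X ⟩
      n * n ^ k * (suc k * X) ∎
    where
    open ≡-Reasoning
    M = ∑Seq k (sumL g)
    lem : ∀ n p k X → n * (p * X + p * (k * X)) ≡ n * p * (suc k * X)
    lem = solve-∀

  module _ (g-idem : ∀ v → g v * g v ≡ g v) where

    ∑Seq-sumL-square : ∀ k → n * n * ∑Seq k (λ a → sumL g a * sumL g a) + n ^ k * (k * (X * X)) ≡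
                             n ^ k * (k * (n * X) + k * k * (X * X))
    ∑Seq-sumL-square zero    = trans (+-identityʳ _) (*-zeroʳ (n * n))
    ∑Seq-sumL-square (suc k) = begin
        n * n * sum (λ v → ∑Seq k (λ a → (g v + sumL g a) * (g v + sumL g a))) + n * n ^ k * (suc k * (X * X))
          ≡⟨ cong (λ z → n * n * z + n * n ^ k * (suc k * (X * X))) first ⟩
        n * n * (n ^ k * X + 2 * X * M + n * M₂) + n * n ^ k * (suc k * (X * X))
          ≡⟨ lem₁ n (n ^ k) k X M M₂ ⟩
        n * n * (n ^ k * X) + n * (2 * X) * (n * M) + n * (n * n * M₂ + n ^ k * (k * (X * X))) + n * n ^ k * (X * X)
          ≡⟨ cong₂ (λ y z → n * n * (n ^ k * X) + n * (2 * X) * y + n * z + n * n ^ k * (X * X))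
               (∑Seq-sumL-mean k) (∑Seq-sumL-square k) ⟩
        n * n * (n ^ k * X) + n * (2 * X) * (n ^ k * (k * X)) + n * (n ^ k * (k * (n * X) + k * k * (X * X))) + n * n ^ k * (X * X)
          ≡⟨ lem₂ n (n ^ k) k X ⟩
        n * n ^ k * (suc k * (n * X) + suc k * suc k * (X * X)) ∎
      where
      open ≡-Reasoning
      M = ∑Seq k (sumL g)
      M₂ = ∑Seq k (λ a → sumL g a * sumL g a)
      lem₁ : ∀ n p k X M M₂ → n * n * (p * X + 2 * X * M + n * M₂) + n * p * (suc k * (X * X)) ≡
        n * n * (p * X) + n * (2 * X) * (n * M) + n * (n * n * M₂ + p * (k * (X * X))) + n * p * (X * X)
      lem₁ = solve-∀
      lem₂ : ∀ n p k X → n * n * (p * X) + n * (2 * X) * (p * (k * X)) +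
        n * (p * (k * (n * X) + k * k * (X * X))) + n * p * (X * X) ≡
        n * p * (suc k * (n * X) + suc k * suc k * (X * X))
      lem₂ = solve-∀
      lem₃ : ∀ a m → (a + m) * (a + m) ≡ a * a + 2 * a * m + m * m
      lem₃ = solve-∀
      point : ∀ v → ∑Seq k (λ a → (g v + sumL g a) * (g v + sumL g a)) ≡ n ^ k * g v + g v * (2 * M) + M₂
      point v = trans (∑Seq-cong k λ a → lem₃ (g v) (sumL g a))
        (trans (∑Seq-+ k (λ a → g v * g v + 2 * g v * sumL g a) (λ a → sumL g a * sumL g a))
          (cong (_+ M₂) (trans (∑Seq-+ k (λ _ → g v * g v) (λ a → 2 * g v * sumL g a))
            (cong₂ _+_ (trans (∑Seq-const k (g v * g v)) (cong (n ^ k *_) (g-idem v)))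
              (trans (∑Seq-* k (2 * g v) (sumL g)) (lem₄ (g v) M))))))
        where
        lem₄ : ∀ a m → 2 * a * m ≡ a * (2 * m)
        lem₄ = solve-∀
      first : sum (λ v → ∑Seq k (λ a → (g v + sumL g a) * (g v + sumL g a))) ≡ n ^ k * X + 2 * X * M + n * M₂
      first = trans (sum-cong-≗ point) (trans (∑-distrib-+ (λ v → n ^ k * g v + g v * (2 * M)) (λ _ → M₂))
        (cong₂ _+_ (trans (∑-distrib-+ (λ v → n ^ k * g v) (λ v → g v * (2 * M)))
          (cong₂ _+_ (sym (*-distribˡ-sum (n ^ k) g)) (trans (sym (*-distribʳ-sum (2 * M) g)) (lem₅ X M))))
          (∑-const n M₂)))
        where
        lem₅ : ∀ X M → X * (2 * M) ≡ 2 * X * M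
        lem₅ = solve-∀

    -- The binomial variance kp(1 - p) for p = X/n, multiplied by n² and by the number of sequences.
    ∑Seq-sumL-variance : ∀ k → ∑Seq k (λ a → ∣ n * sumL g a - k * X ∣ * ∣ n * sumL g a - k * X ∣) + n ^ k * (k * (X * X)) ≡
                               n ^ k * (k * (n * X))
    ∑Seq-sumL-variance k = +-cancelʳ-≡ (2 * (n ^ k * (k * k * (X * X)))) _ _ (begin
        D + n ^ k * (k * (X * X)) + 2 * (n ^ k * (k * k * (X * X)))
          ≡⟨ lem₁ D (n ^ k) k X ⟩
        D + 2 * (k * X) * (n ^ k * (k * X)) + n ^ k * (k * (X * X))
          ≡⟨ cong (λ z → D + 2 * (k * X) * z + n ^ k * (k * (X * X))) (∑Seq-sumL-mean k) ⟨
        D + 2 * (k * X) * (n * M) + n ^ k * (k * (X * X))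
          ≡⟨ cong (_+ n ^ k * (k * (X * X))) expand ⟩
        n * n * M₂ + n ^ k * (k * X * (k * X)) + n ^ k * (k * (X * X))
          ≡⟨ lem₂ (n * n * M₂) (n ^ k) k X ⟩
        (n * n * M₂ + n ^ k * (k * (X * X))) + n ^ k * (k * k * (X * X))
          ≡⟨ cong (_+ n ^ k * (k * k * (X * X))) (∑Seq-sumL-square k) ⟩
        n ^ k * (k * (n * X) + k * k * (X * X)) + n ^ k * (k * k * (X * X))
          ≡⟨ lem₃ (n ^ k) k (n * X) (X * X) ⟩
        n ^ k * (k * (n * X)) + 2 * (n ^ k * (k * k * (X * X))) ∎)
      where
      open ≡-Reasoning
      d : List (Fin n) → ℕ
      d a = ∣ n * sumL g a - k * X ∣ * ∣ n * sumL g a - k * X ∣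
      D = ∑Seq k d
      M = ∑Seq k (sumL g)
      M₂ = ∑Seq k (λ a → sumL g a * sumL g a)
      lem₁ : ∀ D p k X → D + p * (k * (X * X)) + 2 * (p * (k * k * (X * X))) ≡
                         D + 2 * (k * X) * (p * (k * X)) + p * (k * (X * X))
      lem₁ = solve-∀
      lem₂ : ∀ A p k X → A + p * (k * X * (k * X)) + p * (k * (X * X)) ≡ (A + p * (k * (X * X))) + p * (k * k * (X * X))
      lem₂ = solve-∀
      lem₃ : ∀ p k Y Z → p * (k * Y + k * k * Z) + p * (k * k * Z) ≡ p * (k * Y) + 2 * (p * (k * k * Z))
      lem₃ = solve-∀
      lem₄ : ∀ n s kX → 2 * (n * s * kX) ≡ 2 * kX * n * s
      lem₄ = solve-∀
      lem₅ : ∀ n s kX → n * s * (n * s) + kX * kX ≡ n * n * (s * s) + kX * kX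
      lem₅ = solve-∀
      expand : D + 2 * (k * X) * (n * M) ≡ n * n * M₂ + n ^ k * (k * X * (k * X))
      expand = trans (cong (D +_) (trans (sym (*-assoc (2 * (k * X)) n M)) (sym (∑Seq-* k (2 * (k * X) * n) (sumL g)))))
        (trans (sym (∑Seq-+ k d (λ a → 2 * (k * X) * n * sumL g a)))
          (trans (∑Seq-cong k λ a → trans (cong (d a +_) (sym (lem₄ n (sumL g a) (k * X))))
              (trans (dist²-expand (n * sumL g a) (k * X)) (lem₅ n (sumL g a) (k * X))))
            (trans (∑Seq-+ k (λ a → n * n * (sumL g a * sumL g a)) (λ _ → k * X * (k * X)))
              (cong₂ _+_ (∑Seq-* k (n * n) (λ a → sumL g a * sumL g a)) (∑Seq-const k (k * X * (k * X)))))))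

-- From 2M(x - y) ≤ (x - y)² + M². After averaging, a suitable M makes this a substitute for the
-- Cauchy-Schwarz inequality without square roots.
tangent : ∀ M x y → 2 * M * x ≤ ∣ x - y ∣ * ∣ x - y ∣ + M * M + 2 * M * y
tangent M x y = ≤-trans (*-monoʳ-≤ (2 * M) (m≤∣m-n∣+n x y)) (begin
    2 * M * (∣ x - y ∣ + y)           ≡⟨ lem M ∣ x - y ∣ y ⟩
    2 * (∣ x - y ∣ * M) + 2 * M * y   ≤⟨ +-monoˡ-≤ (2 * M * y) (2xy≤x²+y² ∣ x - y ∣ M) ⟩
    ∣ x - y ∣ * ∣ x - y ∣ + M * M + 2 * M * y ∎)
  where
  open ≤-Reasoning
  lem : ∀ M d y → 2 * M * (d + y) ≡ 2 * (d * M) + 2 * M * y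
  lem = solve-∀

-- Anticoncentration of the sum of h over independent uniform vertices: the sum jumps when a
-- vertex below the threshold t is exchanged for one above it, so the covariance of the number of vertices
-- above t with the events that the sum exceeds c or is at least c is bounded below by the probability
-- that the sum is c, whereas it is at most the standard deviation of that number.
module _ {n : ℕ} (h : Fin n → ℕ) (t : ℕ) where

  above beneath : Fin n → ℕ
  above  v = ⟦ t ≤? h v ⟧
  beneath v = ⟦ h v <? t ⟧

  above+below : ∀ v → above v + beneath v ≡ 1
  above+below v = ⟦⟧-¬ (t ≤? h v) (h v <? t) ≤⇒≯ ≮⇒≥

  ∑above+∑below : sum above + sum beneath ≡ n
  ∑above+∑below = trans (sym (∑-distrib-+ above beneath)) (trans (sum-cong-≗ above+below) (trans (∑-const n 1) (*-identityʳ n)))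

  private
    H = sum above
    L = sum beneath

    above*below-mono : ∀ u v {x y} → (t ≤ h u → h v < t → x ≤ y) → above u * (beneath v * x) ≤ above u * (beneath v * y)
    above*below-mono u v {x} {y} f with t ≤? h u | h v <? t
    ... | yes p | yes q = subst₂ _≤_ (sym (lem x)) (sym (lem y)) (f p q)
      where
      lem : ∀ x → ⟦ t ≤? h u ⟧ * (⟦ h v <? t ⟧ * x) ≡ x
      lem x rewrite ⟦⟧-yes (t ≤? h u) p | ⟦⟧-yes (h v <? t) q = trans (+-identityʳ _) (+-identityʳ x)
    ... | no ¬p | _ rewrite ⟦⟧-no (t ≤? h u) ¬p = z≤n
    ... | _ | no ¬q rewrite ⟦⟧-no (h v <? t) ¬q | *-zeroʳ (above u) = z≤n

    -- The difference of the outer terms is the sum of `A u - A v` over u above and arbitrary v.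
    -- Pairs with both vertices above cancel by symmetry; the other pairs gain at least the jump.
    exchange : ∀ (A : Fin n → ℕ) (J : Fin n → Fin n → ℕ) →
      (∀ u v → t ≤ h u → h v < t → A v + J u v ≤ A u) →
      H * sum A + sum (λ u → sum (λ v → above u * (beneath v * J u v))) ≤ n * sum (λ u → above u * A u)
    exchange A J jump = begin
        H * sum A + S (λ u v → above u * (beneath v * J u v))
          ≡⟨ cong (_+ S (λ u v → above u * (beneath v * J u v))) (trans (S-* above A) (S-cong (λ u v → trans (cong (λ z → above u * (z * A v)) (sym (above+below v))) (lem₁ (above u) (above v) (beneath v) (A v))))) ⟩
        S (λ u v → above u * (above v * A v) + above u * (beneath v * A v)) + S (λ u v → above u * (beneath v * J u v))
          ≡⟨ cong (_+ S (λ u v → above u * (beneath v * J u v))) (S-+ (λ u v → above u * (above v * A v)) _) ⟩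
        S (λ u v → above u * (above v * A v)) + S (λ u v → above u * (beneath v * A v)) + S (λ u v → above u * (beneath v * J u v))
          ≡⟨ trans (+-assoc (S (λ u v → above u * (above v * A v))) _ _) (cong₂ _+_ swap (sym (S-+ (λ u v → above u * (beneath v * A v)) _))) ⟩
        S (λ u v → above u * (above v * A u)) + S (λ u v → above u * (beneath v * A v) + above u * (beneath v * J u v))
          ≤⟨ +-monoʳ-≤ (S (λ u v → above u * (above v * A u))) (S-mono λ u v → ≤-trans (≤-reflexive (lem₂ (above u) (beneath v) (A v) (J u v))) (above*below-mono u v (jump u v))) ⟩
        S (λ u v → above u * (above v * A u)) + S (λ u v → above u * (beneath v * A u))
          ≡⟨ S-+ (λ u v → above u * (above v * A u)) _ ⟨
        S (λ u v → above u * (above v * A u) + above u * (beneath v * A u))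
          ≡⟨ S-cong (λ u v → trans (sym (lem₁ (above u) (above v) (beneath v) (A u))) (cong (λ z → above u * (z * A u)) (above+below v))) ⟩
        S (λ u v → above u * (1 * A u))
          ≡⟨ sum-cong-≗ (λ u → trans (∑-const n (above u * (1 * A u))) (cong (λ z → n * (above u * z)) (+-identityʳ (A u)))) ⟩
        sum (λ u → n * (above u * A u))
          ≡⟨ *-distribˡ-sum n (λ u → above u * A u) ⟨
        n * sum (λ u → above u * A u) ∎
      where
      open ≤-Reasoning
      S : (Fin n → Fin n → ℕ) → ℕ
      S f = sum (λ u → sum (λ v → f u v))
      S-cong : ∀ {f g : Fin n → Fin n → ℕ} → (∀ u v → f u v ≡ g u v) → S f ≡ S g
      S-cong f≗g = sum-cong-≗ λ u → sum-cong-≗ (f≗g u)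
      S-mono : ∀ {f g : Fin n → Fin n → ℕ} → (∀ u v → f u v ≤ g u v) → S f ≤ S g
      S-mono f≤g = ∑-mono λ u → ∑-mono (f≤g u)
      S-+ : ∀ f g → S (λ u v → f u v + g u v) ≡ S f + S g
      S-+ f g = trans (sum-cong-≗ λ u → ∑-distrib-+ (f u) (g u)) (∑-distrib-+ (λ u → sum (f u)) (λ u → sum (g u)))
      S-* : ∀ (f g : Fin n → ℕ) → sum f * sum g ≡ S (λ u v → f u * (1 * g v))
      S-* f g = trans (*-distribʳ-sum (sum g) f) (sum-cong-≗ λ u → trans (*-distribˡ-sum (f u) g)
        (sum-cong-≗ λ v → cong (f u *_) (sym (+-identityʳ (g v)))))
      lem₁ : ∀ a b c x → a * ((b + c) * x) ≡ a * (b * x) + a * (c * x)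
      lem₁ = solve-∀
      lem₂ : ∀ a b x y → a * (b * x) + a * (b * y) ≡ a * (b * (x + y))
      lem₂ = solve-∀
      swap : S (λ u v → above u * (above v * A v)) ≡ S (λ u v → above u * (above v * A u))
      swap = trans (∑-comm (λ u v → above u * (above v * A v)))
        (S-cong λ u v → lem₃ (above v) (above u) (A u))
        where
        lem₃ : ∀ a b x → a * (b * x) ≡ b * (a * x)
        lem₃ = solve-∀

    N : List (Fin n) → ℕ
    N = sumL above

    module _ (r : ℕ) where
      s = suc r
      -- By exchangeability the covariance of `N` with `f` is `s` times the covariance at one
      -- position, which `exchange` bounds below; `tangent` bounds it above by the variance of `N`.
      covariance : ∀ M (f : List (Fin n) → ℕ) (J : Fin n → Fin n → List (Fin n) → ℕ) →
        Invariant f → (∀ a → f a ≤ 1) →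
        (∀ u v a → t ≤ h u → h v < t → f (v ∷ a) + J u v a ≤ f (u ∷ a)) →
        2 * M * (s * ∑Seq r (λ a → sum (λ u → sum (λ v → above u * (beneath v * J u v a))))) ≤
        n ^ s * (s * (H * L)) + n ^ s * (M * M)
      covariance M f J f-inv f≤1 jump = +-cancelʳ-≤ (2 * M * (s * (H * ∑Seq s f))) _ _ (begin
          2 * M * (s * JJ) + 2 * M * (s * (H * ∑Seq s f))
            ≡⟨ lem₁ M s JJ (H * ∑Seq s f) ⟩
          2 * M * (s * (H * ∑Seq s f + JJ))
            ≤⟨ *-monoʳ-≤ (2 * M) (*-monoʳ-≤ s lower) ⟩
          2 * M * (s * (n * ∑Seq r (λ a → sum (λ u → above u * f (u ∷ a)))))
            ≡⟨ cong (2 * M *_) (lem₂ s n _) ⟩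
          2 * M * (n * (s * ∑Seq r (λ a → sum (λ u → above u * f (u ∷ a)))))
            ≡⟨ cong (λ z → 2 * M * (n * z)) picked ⟨
          2 * M * (n * ∑Seq s (λ a → N a * f a))
            ≤⟨ upper ⟩
          D + n ^ s * (M * M) + 2 * M * (s * H) * ∑Seq s f
            ≡⟨ cong₂ (λ x y → x + n ^ s * (M * M) + y) variance (lem₃ M s H (∑Seq s f)) ⟩
          n ^ s * (s * (H * L)) + n ^ s * (M * M) + 2 * M * (s * (H * ∑Seq s f)) ∎)
        where
        open ≤-Reasoning
        d : List (Fin n) → ℕ
        d a = ∣ n * N a - s * H ∣ * ∣ n * N a - s * H ∣
        D = ∑Seq s d
        JJ = ∑Seq r (λ a → sum (λ u → sum (λ v → above u * (beneath v * J u v a))))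
        lem₁ : ∀ M s J F → 2 * M * (s * J) + 2 * M * (s * F) ≡ 2 * M * (s * (F + J))
        lem₁ = solve-∀
        lem₂ : ∀ s n x → s * (n * x) ≡ n * (s * x)
        lem₂ = solve-∀
        lem₃ : ∀ M s H x → 2 * M * (s * H) * x ≡ 2 * M * (s * (H * x))
        lem₃ = solve-∀
        variance : D ≡ n ^ s * (s * (H * L))
        variance = +-cancelʳ-≡ (n ^ s * (s * (H * H))) _ _ (trans
          (∑Seq-sumL-variance above (λ v → bit-idem (does (t ≤? h v))) s)
          (trans (cong (λ z → n ^ s * (s * (z * H))) (sym ∑above+∑below)) (lem (n ^ s) s H L)))
          where
          lem : ∀ p s H L → p * (s * ((H + L) * H)) ≡ p * (s * (H * L)) + p * (s * (H * H))
          lem = solve-∀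
        picked : ∑Seq s (λ a → N a * f a) ≡ s * ∑Seq r (λ a → sum (λ u → above u * f (u ∷ a)))
        picked = trans (∑Seq-cong s λ a → trans (*-comm (N a) (f a)) (trans (sym (sumL-* (f a) above a)) (sumL-cong (λ u → *-comm (f a) (above u)) a)))
          (trans (∑Seq-sumL r (λ u a → above u * f a) (λ u p → cong (above u *_) (f-inv p)))
            (cong (s *_) (sym (∑Seq-sum r (λ a u → above u * f (u ∷ a))))))
        lower : H * ∑Seq s f + JJ ≤ n * ∑Seq r (λ a → sum (λ u → above u * f (u ∷ a)))
        lower = begin
          H * ∑Seq s f + JJ
            ≡⟨ cong (λ z → H * z + JJ) (∑Seq-sum r (λ a v → f (v ∷ a))) ⟨
          H * ∑Seq r (λ a → sum (λ v → f (v ∷ a))) + JJ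
            ≡⟨ cong (_+ JJ) (sym (∑Seq-* r H (λ a → sum (λ v → f (v ∷ a))))) ⟩
          ∑Seq r (λ a → H * sum (λ v → f (v ∷ a))) + JJ
            ≡⟨ ∑Seq-+ r (λ a → H * sum (λ v → f (v ∷ a))) _ ⟨
          ∑Seq r (λ a → H * sum (λ v → f (v ∷ a)) + sum (λ u → sum (λ v → above u * (beneath v * J u v a))))
            ≤⟨ ∑Seq-mono r (λ a _ → exchange (λ v → f (v ∷ a)) (λ u v → J u v a) (λ u v → jump u v a)) ⟩
          ∑Seq r (λ a → n * sum (λ u → above u * f (u ∷ a)))
            ≡⟨ ∑Seq-* r n (λ a → sum (λ u → above u * f (u ∷ a))) ⟩
          n * ∑Seq r (λ a → sum (λ u → above u * f (u ∷ a))) ∎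
        point : ∀ a → 2 * M * (n * (N a * f a)) ≤ d a + M * M + 2 * M * (s * H) * f a
        point a = begin
          2 * M * (n * (N a * f a))
            ≡⟨ lem M n (N a) (f a) ⟩
          f a * (2 * M * (n * N a))
            ≤⟨ *-monoʳ-≤ (f a) (tangent M (n * N a) (s * H)) ⟩
          f a * (d a + M * M + 2 * M * (s * H))
            ≡⟨ *-distribˡ-+ (f a) (d a + M * M) _ ⟩
          f a * (d a + M * M) + f a * (2 * M * (s * H))
            ≤⟨ +-mono-≤ (*-monoˡ-≤ (d a + M * M) (f≤1 a)) (≤-reflexive (*-comm (f a) _)) ⟩
          1 * (d a + M * M) + 2 * M * (s * H) * f a
            ≡⟨ cong (_+ 2 * M * (s * H) * f a) (+-identityʳ (d a + M * M)) ⟩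
          d a + M * M + 2 * M * (s * H) * f a ∎
          where
          lem : ∀ M n x y → 2 * M * (n * (x * y)) ≡ y * (2 * M * (n * x))
          lem = solve-∀
        upper : 2 * M * (n * ∑Seq s (λ a → N a * f a)) ≤ D + n ^ s * (M * M) + 2 * M * (s * H) * ∑Seq s f
        upper = begin
          2 * M * (n * ∑Seq s (λ a → N a * f a))
            ≡⟨ trans (cong (2 * M *_) (sym (∑Seq-* s n (λ a → N a * f a)))) (sym (∑Seq-* s (2 * M) (λ a → n * (N a * f a)))) ⟩
          ∑Seq s (λ a → 2 * M * (n * (N a * f a)))
            ≤⟨ ∑Seq-mono s (λ a _ → point a) ⟩
          ∑Seq s (λ a → d a + M * M + 2 * M * (s * H) * f a)
            ≡⟨ ∑Seq-+ s (λ a → d a + M * M) (λ a → 2 * M * (s * H) * f a) ⟩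
          ∑Seq s (λ a → d a + M * M) + ∑Seq s (λ a → 2 * M * (s * H) * f a)
            ≡⟨ cong₂ _+_ (trans (∑Seq-+ s d (λ _ → M * M)) (cong (D +_) (∑Seq-const {n} s (M * M)))) (∑Seq-* s (2 * M * (s * H)) f) ⟩
          D + n ^ s * (M * M) + 2 * M * (s * H) * ∑Seq s f ∎

      -- With M = Qn, both terms on the right of the covariance bound are at most n^s times
      -- `s * Y * n`, which leaves the probability bound 1/Q.
      one-side : ∀ Q B Y Z .{{_ : NonZero n}} .{{_ : NonZero Q}} → Q * Q * n ≤ s * Y → Y * Z ≤ Y * n →
        2 * (Q * n) * (s * (Y * B)) ≤ n ^ s * (s * (Y * Z)) + n ^ s * (Q * n * (Q * n)) → Q * B ≤ n ^ s
      one-side Q B Y Z hY hZ hB = *-cancelˡ-≤ (2 * n * (s * Y)) {{m*n≢0 (2 * n) (s * Y) {{m*n≢0 2 n}} {{≢-nonZero sY≢0}}}} (begin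
          2 * n * (s * Y) * (Q * B)
            ≡⟨ lem₁ n s Y Q B ⟩
          2 * (Q * n) * (s * (Y * B))
            ≤⟨ hB ⟩
          n ^ s * (s * (Y * Z)) + n ^ s * (Q * n * (Q * n))
            ≤⟨ +-mono-≤ (*-monoʳ-≤ (n ^ s) (*-monoʳ-≤ s hZ)) (*-monoʳ-≤ (n ^ s) (≤-trans (≤-reflexive (lem₂ Q n)) (*-monoˡ-≤ n hY))) ⟩
          n ^ s * (s * (Y * n)) + n ^ s * (s * Y * n)
            ≡⟨ lem₃ (n ^ s) s Y n ⟩
          2 * n * (s * Y) * n ^ s ∎)
        where
        open ≤-Reasoning
        lem₁ : ∀ n s Y Q B → 2 * n * (s * Y) * (Q * B) ≡ 2 * (Q * n) * (s * (Y * B))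
        lem₁ = solve-∀
        lem₂ : ∀ Q n → Q * n * (Q * n) ≡ Q * Q * n * n
        lem₂ = solve-∀
        lem₃ : ∀ p s Y n → p * (s * (Y * n)) + p * (s * Y * n) ≡ 2 * n * (s * Y) * p
        lem₃ = solve-∀
        sY≢0 : s * Y ≢ 0
        sY≢0 eq = ≢-nonZero⁻¹ (Q * Q * n) {{m*n≢0 (Q * Q) n {{m*n≢0 Q Q}}}} (n≤0⇒n≡0 (subst (Q * Q * n ≤_) eq hY))

  -- The sequences with sum c are split by the side of their first vertex. Exchanging a vertex
  -- beneath t for one above makes the sum exceed c, and exchanging one above for one beneath makes
  -- it drop below c; hence the two events.
  anticoncentration : ∀ s Q c .{{_ : NonZero n}} .{{_ : NonZero Q}} →
    Q * Q * n ≤ s * sum above → Q * Q * n ≤ s * sum beneath →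
    Q * ∑Seq s (λ x → ⟦ sumL h x ≟ c ⟧) ≤ 2 * n ^ s
  anticoncentration zero      Q c hH hL = contradiction (n≤0⇒n≡0 hH) (≢-nonZero⁻¹ (Q * Q * n) {{m*n≢0 (Q * Q) n {{m*n≢0 Q Q}}}})
  anticoncentration s@(suc r) Q c hH hL = begin
      Q * ∑Seq s (λ x → ⟦ sumL h x ≟ c ⟧)
        ≡⟨ cong (Q *_) (trans (sym (∑Seq-sum r (λ a v → hit v a))) (trans (∑Seq-cong r λ a → trans (sum-cong-≗ λ v → part v a) (∑-distrib-+ (λ v → beneath v * hit v a) _)) (∑Seq-+ r (λ a → sum (λ v → beneath v * hit v a)) _))) ⟩
      Q * (Bᵇ + Bᵃ)
        ≡⟨ *-distribˡ-+ Q Bᵇ Bᵃ ⟩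
      Q * Bᵇ + Q * Bᵃ
        ≤⟨ +-mono-≤
             (one-side r Q Bᵇ H L hH (*-monoʳ-≤ H (≤-trans (m≤n+m L H) (≤-reflexive ∑above+∑below)))
               (≤-trans (≤-reflexive (cong (λ z → 2 * (Q * n) * (s * z)) (sym J₁))) (covariance r (Q * n) (λ a → ⟦ c <? sumL h a ⟧) (λ _ v a → hit v a)
                 (λ p → cong (λ z → ⟦ c <? z ⟧) (sumL-↭ h p)) (λ a → bit≤1 _) jump₁)))
             (one-side r Q Bᵃ L H hL (*-monoʳ-≤ L (≤-trans (m≤m+n H L) (≤-reflexive ∑above+∑below)))
               (≤-trans (≤-reflexive (cong (λ z → 2 * (Q * n) * (s * z)) (sym J₂))) (≤-trans (covariance r (Q * n) (λ a → ⟦ c ≤? sumL h a ⟧) (λ u _ a → hit u a)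
                 (λ p → cong (λ z → ⟦ c ≤? z ⟧) (sumL-↭ h p)) (λ a → bit≤1 _) jump₂)
                   (≤-reflexive (cong (λ z → n ^ s * (s * z) + n ^ s * (Q * n * (Q * n))) (*-comm H L)))))) ⟩
      n ^ s + n ^ s
        ≡⟨ cong (n ^ s +_) (sym (+-identityʳ (n ^ s))) ⟩
      2 * n ^ s ∎
    where
    open ≤-Reasoning
    hit : Fin n → List (Fin n) → ℕ
    hit v a = ⟦ h v + sumL h a ≟ c ⟧
    Bᵇ = ∑Seq r (λ a → sum (λ v → beneath v * hit v a))
    Bᵃ = ∑Seq r (λ a → sum (λ v → above v * hit v a))
    part : ∀ v a → hit v a ≡ beneath v * hit v a + above v * hit v a
    part v a = trans (sym (+-identityʳ _)) (trans (cong (_* hit v a) (trans (sym (above+below v)) (+-comm (above v) _))) (*-distribʳ-+ (hit v a) (beneath v) (above v)))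
    J₁ : ∑Seq r (λ a → sum (λ u → sum (λ v → above u * (beneath v * hit v a)))) ≡ H * Bᵇ
    J₁ = trans (∑Seq-cong r λ a → trans (sum-cong-≗ λ u → sym (*-distribˡ-sum (above u) (λ v → beneath v * hit v a)))
        (sym (*-distribʳ-sum (sum (λ v → beneath v * hit v a)) above)))
      (∑Seq-* r H (λ a → sum (λ v → beneath v * hit v a)))
    J₂ : ∑Seq r (λ a → sum (λ u → sum (λ v → above u * (beneath v * hit u a)))) ≡ L * Bᵃ
    J₂ = trans (∑Seq-cong r λ a → trans (∑-comm (λ u v → above u * (beneath v * hit u a)))
        (trans (sum-cong-≗ λ v → trans (sum-cong-≗ λ u → lem (above u) (beneath v) (hit u a)) (sym (*-distribˡ-sum (beneath v) (λ u → above u * hit u a))))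
        (sym (*-distribʳ-sum (sum (λ u → above u * hit u a)) beneath))))
      (∑Seq-* r L (λ a → sum (λ v → above v * hit v a)))
      where
      lem : ∀ a b x → a * (b * x) ≡ b * (a * x)
      lem = solve-∀
    exclusive : ∀ {P P′ R : Set} (p : Dec P) (p′ : Dec P′) (q : Dec R) → (P → R) → (P′ → R) → (P → ¬ P′) → ⟦ p ⟧ + ⟦ p′ ⟧ ≤ ⟦ q ⟧
    exclusive (yes P) (yes P′) q f g ex = contradiction P′ (ex P)
    exclusive (yes P) (no _)   q f g ex = ≤-reflexive (sym (⟦⟧-yes q (f P)))
    exclusive (no _)  p′       q f g ex = ⟦⟧-mono p′ q g
    jump₁ : ∀ u v a → t ≤ h u → h v < t → ⟦ c <? h v + sumL h a ⟧ + hit v a ≤ ⟦ c <? h u + sumL h a ⟧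
    jump₁ u v a t≤ <t = exclusive (c <? h v + sumL h a) (h v + sumL h a ≟ c) (c <? h u + sumL h a)
      (λ c< → <-trans c< (+-monoˡ-< (sumL h a) (<-≤-trans <t t≤)))
      (λ eq → subst (_< h u + sumL h a) eq (+-monoˡ-< (sumL h a) (<-≤-trans <t t≤)))
      (λ c< eq → <-irrefl (sym eq) c<)
    jump₂ : ∀ u v a → t ≤ h u → h v < t → ⟦ c ≤? h v + sumL h a ⟧ + hit u a ≤ ⟦ c ≤? h u + sumL h a ⟧
    jump₂ u v a t≤ <t = exclusive (c ≤? h v + sumL h a) (h u + sumL h a ≟ c) (c ≤? h u + sumL h a)
      (λ c≤ → ≤-trans c≤ (+-monoˡ-≤ (sumL h a) (<⇒≤ (<-≤-trans <t t≤))))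
      (λ eq → ≤-reflexive (sym eq))
      (λ c≤ eq → <-irrefl (sym eq) (≤-<-trans c≤ (+-monoˡ-< (sumL h a) (<-≤-trans <t t≤))))

-- The Efron–Stein inequality

dist² : ℕ → ℕ → ℕ
dist² x y = ∣ x - y ∣ * ∣ x - y ∣

dist²-sym : ∀ x y → dist² x y ≡ dist² y x
dist²-sym x y = cong (λ d → d * d) (∣-∣-comm x y)

-- The right side exceeds the left one by the square of p - q + r - s.
quadrilateral : ∀ p q r s → dist² p r + dist² q s ≤ dist² p q + dist² q r + dist² r s + dist² s p
quadrilateral p q r s = +-cancelʳ-≤ X _ _ (begin
    dist² p r + dist² q s + X
      ≡⟨ lem₁ (dist² p r) (dist² q s) (p * r) (q * s) (p * q) (q * r) (r * s) (s * p) ⟩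
    (dist² p r + 2 * (p * r)) + (dist² q s + 2 * (q * s)) + 2 * (p * q + q * r + r * s + s * p)
      ≡⟨ cong₂ (λ a b → a + b + 2 * (p * q + q * r + r * s + s * p)) (dist²-expand p r) (dist²-expand q s) ⟩
    (p * p + r * r) + (q * q + s * s) + 2 * (p * q + q * r + r * s + s * p)
      ≡⟨ lem₂ p q r s ⟩
    (p * p + r * r) + (q * q + s * s) + 2 * ((p + r) * (q + s))
      ≤⟨ +-monoʳ-≤ ((p * p + r * r) + (q * q + s * s)) (2xy≤x²+y² (p + r) (q + s)) ⟩
    (p * p + r * r) + (q * q + s * s) + ((p + r) * (p + r) + (q + s) * (q + s))
      ≡⟨ lem₃ p q r s ⟩
    (p * p + q * q) + (q * q + r * r) + (r * r + s * s) + (s * s + p * p) + 2 * (p * r + q * s)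
      ≡⟨ cong (_+ 2 * (p * r + q * s)) (cong₂ _+_ (cong₂ _+_ (cong₂ _+_ (dist²-expand p q) (dist²-expand q r)) (dist²-expand r s)) (dist²-expand s p)) ⟨
    (dist² p q + 2 * (p * q)) + (dist² q r + 2 * (q * r)) + (dist² r s + 2 * (r * s)) + (dist² s p + 2 * (s * p)) + 2 * (p * r + q * s)
      ≡⟨ lem₄ (dist² p q) (dist² q r) (dist² r s) (dist² s p) (p * q) (q * r) (r * s) (s * p) (p * r) (q * s) ⟩
    dist² p q + dist² q r + dist² r s + dist² s p + X ∎)
  where
  open ≤-Reasoning
  X = 2 * (p * r + q * s + (p * q + q * r + r * s + s * p))
  lem₁ : ∀ A B pr qs pq qr rs sp → A + B + 2 * (pr + qs + (pq + qr + rs + sp)) ≡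
    (A + 2 * pr) + (B + 2 * qs) + 2 * (pq + qr + rs + sp)
  lem₁ = solve-∀
  lem₂ : ∀ p q r s → (p * p + r * r) + (q * q + s * s) + 2 * (p * q + q * r + r * s + s * p) ≡
    (p * p + r * r) + (q * q + s * s) + 2 * ((p + r) * (q + s))
  lem₂ = solve-∀
  lem₃ : ∀ p q r s → (p * p + r * r) + (q * q + s * s) + ((p + r) * (p + r) + (q + s) * (q + s)) ≡
    (p * p + q * q) + (q * q + r * r) + (r * r + s * s) + (s * s + p * p) + 2 * (p * r + q * s)
  lem₃ = solve-∀
  lem₄ : ∀ A B C D a b c d e f → (A + 2 * a) + (B + 2 * b) + (C + 2 * c) + (D + 2 * d) + 2 * (e + f) ≡
    A + B + C + D + 2 * (e + f + (a + b + c + d))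
  lem₄ = solve-∀

dist²-sandwich : ∀ {m x y a b} → m ≤ x → x ≤ m + a → m ≤ y → y ≤ m + b → dist² x y ≤ a * a + b * b
dist²-sandwich {m} {x} {y} {a} {b} mx xa my yb with ≤-total x y
... | inj₁ x≤y = ≤-trans (subst (λ d → d * d ≤ b * b) (sym (m≤n⇒∣m-n∣≡n∸m x≤y)) (*-mono-≤ le le)) (m≤n+m (b * b) (a * a))
  where
  le : y ∸ x ≤ b
  le = m≤n+o⇒m∸n≤o y x (≤-trans yb (+-monoˡ-≤ b mx))
... | inj₂ y≤x = ≤-trans (subst (λ d → d * d ≤ a * a) (sym (m≤n⇒∣n-m∣≡n∸m y≤x)) (*-mono-≤ le le)) (m≤m+n (a * a) (b * b))
  where
  le : x ∸ y ≤ a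
  le = m≤n+o⇒m∸n≤o x y (≤-trans xa (+-monoˡ-≤ a my))

dist²-gap : ∀ {x y c} → y + c ≤ x → c * c ≤ dist² x y
dist²-gap {x} {y} {c} h = *-mono-≤ le le
  where
  le : c ≤ ∣ x - y ∣
  le = ≤-trans (m+n≤o⇒n≤o∸m h) (m∸n≤∣m-n∣ x y)
    where
    m+n≤o⇒n≤o∸m : y + c ≤ x → c ≤ x ∸ y
    m+n≤o⇒n≤o∸m h = subst (_≤ x ∸ y) (m+n∸m≡n y c) (∸-monoˡ-≤ y h)

module _ {n : ℕ} where

  -- Comparing two independent copies gives twice the usual variance, scaled by n^(2k), and avoids
  -- subtracting a mean.
  variance : ℕ → (List (Fin n) → ℕ) → ℕ
  variance k F = ∑Seq k λ a → ∑Seq k λ b → dist² (F a) (F b)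

  private
    -- `quadrilateral` is applied to the values at `v ∷ a`, `v ∷ b`, `w ∷ b`, `w ∷ a`: the diagonals
    -- change everything, whereas each side changes either the first vertex or the rest.
    coordinate : ∀ k (F : List (Fin n) → ℕ) → variance (suc k) F ≤
      n * sum (λ v → variance k (λ a → F (v ∷ a))) + n ^ k * ∑Seq k (λ a → sum (λ v → sum (λ w → dist² (F (v ∷ a)) (F (w ∷ a)))))
    coordinate k F = *-cancelˡ-≤ 2 (begin
        2 * variance (suc k) F
          ≡⟨ trans (*-distribˡ-sum 2 (λ v → ∑Seq k (λ a → sum (λ w → Q v w a)))) (sum-cong-≗ λ v → trans (cong (2 *_) (∑Seq-sum k (λ a w → Q v w a))) (*-distribˡ-sum 2 (λ w → ∑Seq k (Q v w)))) ⟩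
        sum (λ v → sum (λ w → 2 * ∑Seq k (Q v w)))
          ≤⟨ ∑-mono (λ v → ∑-mono (pair v)) ⟩
        sum (λ v → sum (λ w → V v + V w + 2 * (n ^ k * U v w)))
          ≡⟨ sum-cong-≗ (λ v → trans (∑-distrib-+ (λ w → V v + V w) (λ w → 2 * (n ^ k * U v w)))
               (cong₂ _+_ (trans (∑-distrib-+ (λ _ → V v) V) (cong (_+ sum V) (∑-const n (V v)))) (trans (sym (*-distribˡ-sum 2 (λ w → n ^ k * U v w))) (cong (2 *_) (sym (*-distribˡ-sum (n ^ k) (U v))))))) ⟩
        sum (λ v → n * V v + sum V + 2 * (n ^ k * sum (U v)))
          ≡⟨ ∑-distrib-+ (λ v → n * V v + sum V) (λ v → 2 * (n ^ k * sum (U v))) ⟩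
        sum (λ v → n * V v + sum V) + sum (λ v → 2 * (n ^ k * sum (U v)))
          ≡⟨ cong₂ _+_ (trans (∑-distrib-+ (λ v → n * V v) (λ _ → sum V)) (cong₂ _+_ (sym (*-distribˡ-sum n V)) (∑-const n (sum V))))
               (trans (sym (*-distribˡ-sum 2 (λ v → n ^ k * sum (U v)))) (cong (2 *_) (trans (sym (*-distribˡ-sum (n ^ k) (λ v → sum (U v)))) (cong (n ^ k *_) U-sum)))) ⟩
        (n * sum V + n * sum V) + 2 * (n ^ k * ∑Seq k (λ a → sum (λ v → sum (λ w → dist² (F (v ∷ a)) (F (w ∷ a))))))
          ≡⟨ lem (n * sum V) (n ^ k * _) ⟩
        2 * (n * sum V + n ^ k * ∑Seq k (λ a → sum (λ v → sum (λ w → dist² (F (v ∷ a)) (F (w ∷ a)))))) ∎)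
      where
      open ≤-Reasoning
      lem : ∀ x y → (x + x) + 2 * y ≡ 2 * (x + y)
      lem = solve-∀
      Q : Fin n → Fin n → List (Fin n) → ℕ
      Q v w a = ∑Seq k (λ b → dist² (F (v ∷ a)) (F (w ∷ b)))
      V : Fin n → ℕ
      V v = variance k (λ a → F (v ∷ a))
      U : Fin n → Fin n → ℕ
      U v w = ∑Seq k (λ a → dist² (F (v ∷ a)) (F (w ∷ a)))
      U-sum : sum (λ v → sum (U v)) ≡ ∑Seq k (λ a → sum (λ v → sum (λ w → dist² (F (v ∷ a)) (F (w ∷ a)))))
      U-sum = trans (sum-cong-≗ λ v → sym (∑Seq-sum k (λ a w → dist² (F (v ∷ a)) (F (w ∷ a)))))
        (sym (∑Seq-sum k (λ a v → sum (λ w → dist² (F (v ∷ a)) (F (w ∷ a))))))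
      SS : (List (Fin n) → List (Fin n) → ℕ) → ℕ
      SS f = ∑Seq k λ a → ∑Seq k λ b → f a b
      SS-+ : ∀ f g → SS (λ a b → f a b + g a b) ≡ SS f + SS g
      SS-+ f g = trans (∑Seq-cong k λ a → ∑Seq-+ k (f a) (g a)) (∑Seq-+ k (λ a → ∑Seq k (f a)) (λ a → ∑Seq k (g a)))
      pair : ∀ v w → 2 * ∑Seq k (Q v w) ≤ V v + V w + 2 * (n ^ k * U v w)
      pair v w = begin
        2 * SS (λ a b → dist² (f a) (g b))
          ≡⟨ cong (SS (λ a b → dist² (f a) (g b)) +_) (trans (+-identityʳ _) (∑Seq-comm k k (λ a b → dist² (f a) (g b)))) ⟩
        SS (λ a b → dist² (f a) (g b)) + SS (λ a b → dist² (f b) (g a))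
          ≡⟨ SS-+ (λ a b → dist² (f a) (g b)) (λ a b → dist² (f b) (g a)) ⟨
        SS (λ a b → dist² (f a) (g b) + dist² (f b) (g a))
          ≤⟨ ∑Seq-mono k (λ a _ → ∑Seq-mono k (λ b _ → quadrilateral (f a) (f b) (g b) (g a))) ⟩
        SS (λ a b → dist² (f a) (f b) + dist² (f b) (g b) + dist² (g b) (g a) + dist² (g a) (f a))
          ≡⟨ trans (SS-+ (λ a b → dist² (f a) (f b) + dist² (f b) (g b) + dist² (g b) (g a)) (λ a b → dist² (g a) (f a)))
               (cong (_+ SS (λ a b → dist² (g a) (f a))) (trans (SS-+ (λ a b → dist² (f a) (f b) + dist² (f b) (g b)) (λ a b → dist² (g b) (g a)))
                 (cong (_+ SS (λ a b → dist² (g b) (g a))) (SS-+ (λ a b → dist² (f a) (f b)) (λ a b → dist² (f b) (g b)))))) ⟩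
        V v + SS (λ a b → dist² (f b) (g b)) + SS (λ a b → dist² (g b) (g a)) + SS (λ a b → dist² (g a) (f a))
          ≡⟨ cong₂ _+_ (cong₂ _+_ (cong (V v +_) (∑Seq-const k (U v w))) (∑Seq-comm k k (λ a b → dist² (g b) (g a))))
               (trans (∑Seq-cong k λ a → trans (∑Seq-const k (dist² (g a) (f a))) (cong (n ^ k *_) (dist²-sym (g a) (f a)))) (∑Seq-* k (n ^ k) (λ a → dist² (f a) (g a)))) ⟩
        V v + n ^ k * U v w + V w + n ^ k * U v w
          ≡⟨ lem₂ (V v) (n ^ k * U v w) (V w) ⟩
        V v + V w + 2 * (n ^ k * U v w) ∎
        where
        f g : List (Fin n) → ℕ
        f a = F (v ∷ a)
        g a = F (w ∷ a)
        lem₂ : ∀ x y z → x + y + z + y ≡ x + z + 2 * y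
        lem₂ = solve-∀

  -- Induction over the positions. The cost of exchanging v for w is a sum of one term for v and one
  -- for w, so that each can be averaged as a fresh vertex against the others.
  efron-stein : ∀ k (F : List (Fin n) → ℕ) (g : Fin n → List (Fin n) → ℕ) →
    (∀ x v w y → dist² (F (x ++ v ∷ y)) (F (x ++ w ∷ y)) ≤ g v (x ++ y) + g w (x ++ y)) →
    variance (suc k) F ≤ 2 * (suc k * (n ^ suc k * sum (λ v → ∑Seq k (g v))))
  efron-stein k F g h = ≤-trans (coordinate k F) (≤-trans (+-monoʳ-≤ (n * sum (λ v → variance k (λ a → F (v ∷ a)))) (*-monoʳ-≤ (n ^ k) single)) (rest k F g h))
    where
    single : ∑Seq k (λ a → sum (λ v → sum (λ w → dist² (F (v ∷ a)) (F (w ∷ a))))) ≤ 2 * (n * sum (λ v → ∑Seq k (g v)))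
    single = begin
      ∑Seq k (λ a → sum (λ v → sum (λ w → dist² (F (v ∷ a)) (F (w ∷ a)))))
        ≤⟨ ∑Seq-mono k (λ a _ → ∑-mono (λ v → ∑-mono (λ w → h [] v w a))) ⟩
      ∑Seq k (λ a → sum (λ v → sum (λ w → g v a + g w a)))
        ≡⟨ ∑Seq-cong k (λ a → trans (sum-cong-≗ (λ v → trans (∑-distrib-+ (λ _ → g v a) (λ w → g w a)) (cong (_+ sum (λ w → g w a)) (∑-const n (g v a)))))
             (trans (∑-distrib-+ (λ v → n * g v a) (λ _ → sum (λ w → g w a))) (cong₂ _+_ (sym (*-distribˡ-sum n (λ v → g v a))) (∑-const n (sum (λ w → g w a)))))) ⟩
      ∑Seq k (λ a → n * sum (λ v → g v a) + n * sum (λ v → g v a))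
        ≡⟨ ∑Seq-cong k (λ a → cong (n * sum (λ v → g v a) +_) (sym (+-identityʳ _))) ⟩
      ∑Seq k (λ a → 2 * (n * sum (λ v → g v a)))
        ≡⟨ trans (∑Seq-* k 2 (λ a → n * sum (λ v → g v a))) (cong (2 *_) (trans (∑Seq-* k n (λ a → sum (λ v → g v a))) (cong (n *_) (∑Seq-sum k (λ a v → g v a))))) ⟩
      2 * (n * sum (λ v → ∑Seq k (g v))) ∎
      where open ≤-Reasoning
    rest : ∀ k (F : List (Fin n) → ℕ) (g : Fin n → List (Fin n) → ℕ) →
      (∀ x v w y → dist² (F (x ++ v ∷ y)) (F (x ++ w ∷ y)) ≤ g v (x ++ y) + g w (x ++ y)) →
      n * sum (λ v → variance k (λ a → F (v ∷ a))) + n ^ k * (2 * (n * sum (λ v → ∑Seq k (g v)))) ≤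
      2 * (suc k * (n ^ suc k * sum (λ v → ∑Seq k (g v))))
    rest zero    F g h = ≤-reflexive (trans (cong (λ z → n * z + 1 * (2 * (n * sum (λ v → g v []))))
        (trans (sum-cong-≗ λ v → cong (λ d → d * d) (∣n-n∣≡0 (F (v ∷ [])))) (trans (∑-const n 0) (*-zeroʳ n)))) (lem n (sum (λ v → g v []))))
      where
      lem : ∀ n x → n * 0 + 1 * (2 * (n * x)) ≡ 2 * (1 * (n * 1 * x))
      lem = solve-∀
    rest (suc k) F g h = begin
        n * sum (λ v → variance (suc k) (λ a → F (v ∷ a))) + n ^ suc k * (2 * (n * S))
          ≤⟨ +-monoˡ-≤ (n ^ suc k * (2 * (n * S))) (*-monoʳ-≤ n (∑-mono λ v → efron-stein k (λ a → F (v ∷ a)) (λ w a → g w (v ∷ a)) (λ x → h (v ∷ x)))) ⟩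
        n * sum (λ v → 2 * (suc k * (n ^ suc k * sum (λ w → ∑Seq k (λ a → g w (v ∷ a)))))) + n ^ suc k * (2 * (n * S))
          ≡⟨ cong (λ z → n * z + n ^ suc k * (2 * (n * S))) (trans (sum-cong-≗ λ v → lem₁ (suc k) (n ^ suc k) (sum (λ w → ∑Seq k (λ a → g w (v ∷ a)))))
               (trans (sym (*-distribˡ-sum (2 * suc k * n ^ suc k) (λ v → sum (λ w → ∑Seq k (λ a → g w (v ∷ a))))))
                 (cong (2 * suc k * n ^ suc k *_) (∑-comm (λ v w → ∑Seq k (λ a → g w (v ∷ a))))))) ⟩
        n * (2 * suc k * n ^ suc k * S) + n ^ suc k * (2 * (n * S))
          ≡⟨ lem₂ n (suc k) (n ^ suc k) S ⟩
        2 * (suc (suc k) * (n ^ suc (suc k) * S)) ∎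
      where
      open ≤-Reasoning
      S = sum (λ v → ∑Seq (suc k) (g v))
      lem₁ : ∀ k p x → 2 * (k * (p * x)) ≡ 2 * k * p * x
      lem₁ = solve-∀
      lem₂ : ∀ n k p x → n * (2 * k * p * x) + p * (2 * (n * x)) ≡ 2 * (suc k * (n * p * x))
      lem₂ = solve-∀

-- Light and heavy vertices

edges-cong : ∀ {n} {ω ω′ : Fin n → Fin n → ℕ} → (∀ u v → ω u v ≡ ω′ u v) → ∀ a → edges ω a ≡ edges ω′ a
edges-cong h []      = refl
edges-cong h (v ∷ a) = cong₂ _+_ (sumL-cong (h v) a) (edges-cong h a)

edges-+ : ∀ {n} (ω ω′ : Fin n → Fin n → ℕ) a → edges (λ u v → ω u v + ω′ u v) a ≡ edges ω a + edges ω′ a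
edges-+ ω ω′ []      = refl
edges-+ ω ω′ (v ∷ a) = trans (cong₂ _+_ (sumL-+ (ω v) (ω′ v) a) (edges-+ ω ω′ a))
    (lem (deg ω a v) (deg ω′ a v) (edges ω a) (edges ω′ a))
  where
  lem : ∀ a b c d → a + b + (c + d) ≡ a + c + (b + d)
  lem = solve-∀

edges-symmetrise : ∀ {n} (ρ : Fin n → Fin n → ℕ) → (∀ v → ρ v v ≡ 0) → ∀ a →
  edges (λ u v → ρ u v + ρ v u) a ≡ sumL (deg ρ a) a
edges-symmetrise ρ irr []      = refl
edges-symmetrise ρ irr (v ∷ a) = begin
    sumL (λ u → ρ v u + ρ u v) a + edges (λ u v → ρ u v + ρ v u) a
      ≡⟨ cong₂ _+_ (sumL-+ (ρ v) (λ u → ρ u v) a) (edges-symmetrise ρ irr a) ⟩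
    deg ρ a v + sumL (λ u → ρ u v) a + sumL (deg ρ a) a
      ≡⟨ +-assoc (deg ρ a v) _ _ ⟩
    deg ρ a v + (sumL (λ u → ρ u v) a + sumL (deg ρ a) a)
      ≡⟨ cong₂ _+_ (sym (cong (_+ deg ρ a v) (irr v))) (sym (sumL-+ (λ u → ρ u v) (deg ρ a) a)) ⟩
    (ρ v v + deg ρ a v) + sumL (λ u → ρ u v + deg ρ a u) a ∎
  where open ≡-Reasoning

module _ {n : ℕ} (G : Graph n) where

  A : Fin n → Fin n → ℕ
  A = weight G

  A-sym : ∀ u v → A u v ≡ A v u
  A-sym u v = cong bit (adj-sym G u v)

  A-irrefl : ∀ v → A v v ≡ 0
  A-irrefl v = cong bit (adj-irrefl G v)

  A≤1 : ∀ u v → A u v ≤ 1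
  A≤1 u v = bit≤1 (adj G u v)

  A-idem : ∀ u v → A u v * A u v ≡ A u v
  A-idem u v = bit-idem (adj G u v)

  degree : Fin n → ℕ
  degree v = sum (A v)

  module Light (g : ℕ) where

    light heavy : Fin n → ℕ
    light v = ⟦ g * degree v <? n ⟧
    heavy v = ⟦ n ≤? g * degree v ⟧

    light-or-heavy : ∀ v → (light v ≡ 1 × heavy v ≡ 0) ⊎ (light v ≡ 0 × heavy v ≡ 1)
    light-or-heavy v with g * degree v <? n
    ... | yes <n = inj₁ (⟦⟧-yes (g * degree v <? n) <n , ⟦⟧-no (n ≤? g * degree v) (<⇒≱ <n))
    ... | no ≮n  = inj₂ (⟦⟧-no (g * degree v <? n) ≮n , ⟦⟧-yes (n ≤? g * degree v) (≮⇒≥ ≮n))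

    light≤1 : ∀ v → light v ≤ 1
    light≤1 v = bit≤1 (does (g * degree v <? n))

    light-idem : ∀ v → light v * light v ≡ light v
    light-idem v = bit-idem (does (g * degree v <? n))

    ll ρ hh : Fin n → Fin n → ℕ
    ll u v = light u * (light v * A u v)
    ρ  u v = light u * (heavy v * A u v)
    hh u v = heavy u * (heavy v * A u v)

    ll-sym : ∀ u v → ll u v ≡ ll v u
    ll-sym u v = trans (cong (λ z → light u * (light v * z)) (A-sym u v)) (lem (light u) (light v) (A v u))
      where
      lem : ∀ a b c → a * (b * c) ≡ b * (a * c)
      lem = solve-∀

    ll-irrefl : ∀ v → ll v v ≡ 0
    ll-irrefl v = trans (cong (λ z → light v * (light v * z)) (A-irrefl v)) (lem (light v))
      where
      lem : ∀ a → a * (a * 0) ≡ 0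
      lem = solve-∀

    ρ-irrefl : ∀ v → ρ v v ≡ 0
    ρ-irrefl v = trans (cong (λ z → light v * (heavy v * z)) (A-irrefl v)) (lem (light v) (heavy v))
      where
      lem : ∀ a b → a * (b * 0) ≡ 0
      lem = solve-∀

    ll-idem : ∀ u v → ll u v * ll u v ≡ ll u v
    ll-idem u v = trans (lem (light u) (light v) (A u v))
      (cong₂ _*_ (light-idem u) (cong₂ _*_ (light-idem v) (A-idem u v)))
      where
      lem : ∀ a b c → a * (b * c) * (a * (b * c)) ≡ a * a * (b * b * (c * c))
      lem = solve-∀

    L H : List (Fin n) → Fin n → ℕ
    L = deg ll
    H a v = sumL (λ u → heavy u * A v u) a

    heavies : List (Fin n) → ℕ
    heavies = sumL heavy

    H≤heavies : ∀ a v → H a v ≤ heavies a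
    H≤heavies a v = sumL-mono (λ u → ≤-trans (*-monoʳ-≤ (heavy u) (A≤1 v u)) (≤-reflexive (*-identityʳ _))) a

    deg-split : ∀ a v → light v ≡ 1 → deg A a v ≡ L a v + H a v
    deg-split a v lv = trans (sumL-cong point a) (sumL-+ (ll v) (λ u → heavy u * A v u) a)
      where
      point : ∀ u → A v u ≡ ll v u + heavy u * A v u
      point u with light-or-heavy u
      ... | inj₁ (lu , hu) rewrite lv | lu | hu = lem (A v u)
        where
        lem : ∀ x → x ≡ 1 * (1 * x) + 0
        lem = solve-∀
      ... | inj₂ (lu , hu) rewrite lv | lu | hu = lem (A v u)
        where
        lem : ∀ x → x ≡ 1 * 0 + 1 * x
        lem = solve-∀

    H≤deg : ∀ a v → H a v ≤ deg A a v
    H≤deg a v = sumL-mono (λ u → ≤-trans (*-monoˡ-≤ (A v u) (bit≤1 (does (n ≤? g * degree u)))) (≤-reflexive (+-identityʳ _))) a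

    edges-split : ∀ a → edges A a ≡ edges ll a + sumL (λ u → light u * H a u) a + edges hh a
    edges-split a = trans (edges-cong point a) (trans (edges-+ (λ u v → ll u v + (ρ u v + ρ v u)) hh a)
        (cong (_+ edges hh a) (trans (edges-+ ll (λ u v → ρ u v + ρ v u) a)
          (cong (edges ll a +_) (trans (edges-symmetrise ρ ρ-irrefl a) (sumL-cong (λ u → sumL-* (light u) (λ v → heavy v * A u v) a) a))))))
      where
      point : ∀ u v → A u v ≡ ll u v + (ρ u v + ρ v u) + hh u v
      point u v rewrite A-sym v u with light-or-heavy u | light-or-heavy v
      ... | inj₁ (lu , hu) | inj₁ (lv , hv) rewrite lu | hu | lv | hv = lem (A u v)
        where
        lem : ∀ x → x ≡ 1 * (1 * x) + (1 * 0 + 1 * 0) + 0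
        lem = solve-∀
      ... | inj₁ (lu , hu) | inj₂ (lv , hv) rewrite lu | hu | lv | hv = lem (A u v)
        where
        lem : ∀ x → x ≡ 1 * 0 + (1 * (1 * x) + 0) + 0
        lem = solve-∀
      ... | inj₂ (lu , hu) | inj₁ (lv , hv) rewrite lu | hu | lv | hv = lem (A u v)
        where
        lem : ∀ x → x ≡ 0 + (0 + 1 * (1 * x)) + 1 * 0
        lem = solve-∀
      ... | inj₂ (lu , hu) | inj₂ (lv , hv) rewrite lu | hu | lv | hv = lem (A u v)
        where
        lem : ∀ x → x ≡ 0 + (0 + 0) + 1 * (1 * x)
        lem = solve-∀

    edges-hh : ∀ a → edges hh a ≤ heavies a * heavies a
    edges-hh []      = z≤n
    edges-hh (v ∷ a) = begin
      deg hh a v + edges hh a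
        ≤⟨ +-mono-≤ (≤-trans (≤-reflexive (sumL-* (heavy v) (λ u → heavy u * A v u) a)) (*-monoʳ-≤ (heavy v) (H≤heavies a v))) (edges-hh a) ⟩
      heavy v * heavies a + heavies a * heavies a
        ≤⟨ m≤m+n _ (heavy v * (heavy v + heavies a)) ⟩
      heavy v * heavies a + heavies a * heavies a + heavy v * (heavy v + heavies a)
        ≡⟨ lem (heavy v) (heavies a) ⟩
      (heavy v + heavies a) * (heavy v + heavies a) ∎
      where
      open ≤-Reasoning
      lem : ∀ h N → h * N + N * N + h * (h + N) ≡ (h + N) * (h + N)
      lem = solve-∀

    module _ (t : ℕ) where

      -- If every vertex has t neighbours in a, then W a counts the edges between light and heavy
      -- vertices, although it depends on the light ones only.
      W F : List (Fin n) → ℕ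
      W a = sumL (λ u → light u * (t ∸ L a u)) a
      F a = edges ll a + W a

      F-↭ : Invariant F
      F-↭ {a} {b} p = cong₂ _+_ (edges-↭ ll ll-sym p)
        (trans (sumL-cong (λ u → cong (λ z → light u * (t ∸ z)) (deg-↭ ll u p)) a) (sumL-↭ (λ u → light u * (t ∸ L b u)) p))

      private
        W′ : Fin n → List (Fin n) → ℕ
        W′ v a = sumL (λ u → light u * (t ∸ (ll u v + L a u))) a

      F-upper : ∀ v a → F (v ∷ a) ≤ F a + (t + L a v)
      F-upper v a = begin
          L a v + edges ll a + (light v * (t ∸ L (v ∷ a) v) + W′ v a)
            ≤⟨ +-monoʳ-≤ (L a v + edges ll a) (+-mono-≤ (*-mono-≤ (light≤1 v) (m∸n≤m t (L (v ∷ a) v)))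
                 (sumL-mono (λ u → *-monoʳ-≤ (light u) (∸-monoʳ-≤ t (m≤n+m (L a u) (ll u v)))) a)) ⟩
          L a v + edges ll a + (1 * t + W a)
            ≡⟨ lem (L a v) (edges ll a) t (W a) ⟩
          F a + (t + L a v) ∎
        where
        open ≤-Reasoning
        lem : ∀ l e t w → l + e + (1 * t + w) ≡ e + w + (t + l)
        lem = solve-∀

      -- Adding v lowers only the deficits of its light neighbours, by at most one each, and each of
      -- these entries also gives a new light edge.
      F-lower : ∀ v a → F a ≤ F (v ∷ a)
      F-lower v a = begin
          edges ll a + W a
            ≤⟨ +-monoʳ-≤ (edges ll a) (≤-trans (sumL-mono point a) (≤-reflexive (trans (sumL-+ (λ u → ll u v) _ a)
                 (cong (_+ W′ v a) (sumL-cong (λ u → ll-sym u v) a))))) ⟩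
          edges ll a + (L a v + W′ v a)
            ≤⟨ m≤m+n _ (light v * (t ∸ L (v ∷ a) v)) ⟩
          edges ll a + (L a v + W′ v a) + light v * (t ∸ L (v ∷ a) v)
            ≡⟨ lem (edges ll a) (L a v) (W′ v a) _ ⟩
          L a v + edges ll a + (light v * (t ∸ L (v ∷ a) v) + W′ v a) ∎
        where
        open ≤-Reasoning
        lem : ∀ e l w x → e + (l + w) + x ≡ l + e + (x + w)
        lem = solve-∀
        point : ∀ u → light u * (t ∸ L a u) ≤ ll u v + light u * (t ∸ (ll u v + L a u))
        point u = truncate (light u) (light≤1 u) (ll u v) (L a u)
          where
          truncate : ∀ l → l ≤ 1 → ∀ c x → l * (t ∸ x) ≤ c + l * (t ∸ (c + x))
          truncate zero          _        c x = z≤n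
          truncate (suc (suc _)) (s≤s ()) c x
          truncate (suc zero)    _        c x = begin
            1 * (t ∸ x)
              ≡⟨ +-identityʳ _ ⟩
            t ∸ x
              ≤⟨ m≤n+m∸n (t ∸ x) c ⟩
            c + (t ∸ x ∸ c)
              ≡⟨ cong (c +_) (trans (∸-+-assoc t x c) (trans (cong (t ∸_) (+-comm x c)) (sym (+-identityʳ _)))) ⟩
            c + 1 * (t ∸ (c + x)) ∎

      F-lipschitz : ∀ x v w y → dist² (F (x ++ v ∷ y)) (F (x ++ w ∷ y)) ≤
        (t + L (x ++ y) v) * (t + L (x ++ y) v) + (t + L (x ++ y) w) * (t + L (x ++ y) w)
      F-lipschitz x v w y = subst₂ (λ p q → dist² p q ≤ (t + L (x ++ y) v) * (t + L (x ++ y) v) + (t + L (x ++ y) w) * (t + L (x ++ y) w)) (sym (F-↭ (shift v x y))) (sym (F-↭ (shift w x y)))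
        (dist²-sandwich (F-lower v (x ++ y)) (F-upper v (x ++ y)) (F-lower w (x ++ y)) (F-upper w (x ++ y)))

    edges-lipschitz : ∀ x v w y → dist² (edges ll (x ++ v ∷ y)) (edges ll (x ++ w ∷ y)) ≤
      L (x ++ y) v * L (x ++ y) v + L (x ++ y) w * L (x ++ y) w
    edges-lipschitz x v w y = subst₂ (λ p q → dist² p q ≤ L (x ++ y) v * L (x ++ y) v + L (x ++ y) w * L (x ++ y) w) (sym (edges-↭ ll ll-sym (shift v x y))) (sym (edges-↭ ll ll-sym (shift w x y)))
      (dist²-sandwich (lower v) (upper v) (lower w) (upper w))
      where
      lower : ∀ v → edges ll (x ++ y) ≤ edges ll (v ∷ x ++ y)
      lower v = m≤n+m _ _
      upper : ∀ v → edges ll (v ∷ x ++ y) ≤ edges ll (x ++ y) + L (x ++ y) v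
      upper v = ≤-reflexive (+-comm (L (x ++ y) v) _)

    X : Fin n → ℕ
    X v = sum (ll v)

    Λ : ℕ
    Λ = sum X

    g*X≤n : ∀ v → g * X v ≤ n
    g*X≤n v with light-or-heavy v
    ... | inj₂ (lv , _) = ≤-trans (≤-reflexive (trans (cong (g *_) (trans (sum-cong-≗ {n} λ u → cong (_* (light u * A v u)) lv) (trans (∑-const n 0) (*-zeroʳ n)))) (*-zeroʳ g))) z≤n
    ... | inj₁ (lv , _) with g * degree v <? n
    ...   | yes <n = ≤-trans (*-monoʳ-≤ g (∑-mono {n} λ u → ≤-trans (*-mono-≤ (light≤1 v) (*-monoˡ-≤ (A v u) (light≤1 u))) (≤-reflexive (lem (A v u))))) (<⇒≤ <n)
      where
      lem : ∀ x → 1 * (1 * x) ≡ x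
      lem = solve-∀
    ...   | no ≮n = contradiction (trans (sym lv) (⟦⟧-no (g * degree v <? n) ≮n)) λ ()

    S₂ : ℕ → ℕ
    S₂ k = sum λ v → ∑Seq k λ a → L a v * L a v

    -- For a light vertex p = X v / n is at most 1/g, so the second moment of its light degree is at
    -- most kp + k²p² ≤ kp(1 + k/g), which is linear in `X v`.
    S₂-bound : ∀ k .{{_ : NonZero n}} → g * (n * S₂ k) ≤ n ^ k * (k * (g + k) * Λ)
    S₂-bound k = *-cancelˡ-≤ n (begin
        n * (g * (n * S₂ k))
          ≡⟨ lem₁ n g (S₂ k) ⟩
        g * (n * n) * S₂ k
          ≡⟨ *-distribˡ-sum (g * (n * n)) (λ v → ∑Seq k (λ a → L a v * L a v)) ⟩
        sum (λ v → g * (n * n) * ∑Seq k (λ a → L a v * L a v))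
          ≤⟨ ∑-mono point ⟩
        sum (λ v → n * (n ^ k * (k * (g + k))) * X v)
          ≡⟨ *-distribˡ-sum (n * (n ^ k * (k * (g + k)))) X ⟨
        n * (n ^ k * (k * (g + k))) * Λ
          ≡⟨ lem₃ n (n ^ k) (k * (g + k)) Λ ⟩
        n * (n ^ k * (k * (g + k) * Λ)) ∎)
      where
      open ≤-Reasoning
      lem₁ : ∀ n g x → n * (g * (n * x)) ≡ g * (n * n) * x
      lem₁ = solve-∀
      lem₂ : ∀ n p k g x → g * (p * (k * (n * x) + k * k * (x * x))) ≡ p * k * n * g * x + p * k * k * x * (g * x)
      lem₂ = solve-∀
      lem₃ : ∀ n p k x → n * (p * k) * x ≡ n * (p * (k * x))
      lem₃ = solve-∀
      lem₄ : ∀ n p k g x → p * k * n * g * x + p * k * k * x * n ≡ n * (p * (k * (g + k))) * x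
      lem₄ = solve-∀
      point : ∀ v → g * (n * n) * ∑Seq k (λ a → L a v * L a v) ≤ n * (n ^ k * (k * (g + k))) * X v
      point v = begin
        g * (n * n) * ∑Seq k (λ a → L a v * L a v)
          ≡⟨ *-assoc g (n * n) _ ⟩
        g * (n * n * ∑Seq k (λ a → L a v * L a v))
          ≤⟨ *-monoʳ-≤ g (≤-trans (m≤m+n _ _) (≤-reflexive (∑Seq-sumL-square (ll v) (ll-idem v) k))) ⟩
        g * (n ^ k * (k * (n * X v) + k * k * (X v * X v)))
          ≡⟨ lem₂ n (n ^ k) k g (X v) ⟩
        n ^ k * k * n * g * X v + n ^ k * k * k * X v * (g * X v)
          ≤⟨ +-monoʳ-≤ (n ^ k * k * n * g * X v) (*-monoʳ-≤ (n ^ k * k * k * X v) (g*X≤n v)) ⟩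
        n ^ k * k * n * g * X v + n ^ k * k * k * X v * n
          ≡⟨ lem₄ n (n ^ k) k g (X v) ⟩
        n * (n ^ k * (k * (g + k))) * X v ∎

    F-variance : ∀ t k → variance (suc k) (F t) ≤ 4 * (suc k * (n ^ suc k * (n ^ suc k * (t * t) + S₂ k)))
    F-variance t k = begin
        variance (suc k) (F t)
          ≤⟨ efron-stein k (F t) (λ v a → (t + L a v) * (t + L a v)) (F-lipschitz t) ⟩
        2 * (suc k * (n ^ suc k * sum (λ v → ∑Seq k (λ a → (t + L a v) * (t + L a v)))))
          ≤⟨ *-monoʳ-≤ 2 (*-monoʳ-≤ (suc k) (*-monoʳ-≤ (n ^ suc k) bound)) ⟩
        2 * (suc k * (n ^ suc k * (2 * (n ^ suc k * (t * t) + S₂ k))))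
          ≡⟨ lem (suc k) (n ^ suc k) _ ⟩
        4 * (suc k * (n ^ suc k * (n ^ suc k * (t * t) + S₂ k))) ∎
      where
      open ≤-Reasoning
      lem : ∀ k p x → 2 * (k * (p * (2 * x))) ≡ 4 * (k * (p * x))
      lem = solve-∀
      square : ∀ x y → (x + y) * (x + y) ≤ 2 * (x * x) + 2 * (y * y)
      square x y = ≤-trans (≤-reflexive (lem₁ x y)) (≤-trans (+-monoʳ-≤ (x * x + y * y) (2xy≤x²+y² x y)) (≤-reflexive (lem₂ (x * x) (y * y))))
        where
        lem₁ : ∀ x y → (x + y) * (x + y) ≡ x * x + y * y + 2 * (x * y)
        lem₁ = solve-∀
        lem₂ : ∀ x y → x + y + (x + y) ≡ 2 * x + 2 * y
        lem₂ = solve-∀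
      bound : sum (λ v → ∑Seq k (λ a → (t + L a v) * (t + L a v))) ≤ 2 * (n ^ suc k * (t * t) + S₂ k)
      bound = begin
        sum (λ v → ∑Seq k (λ a → (t + L a v) * (t + L a v)))
          ≤⟨ ∑-mono (λ v → ∑Seq-mono k (λ a _ → square t (L a v))) ⟩
        sum (λ v → ∑Seq k (λ a → 2 * (t * t) + 2 * (L a v * L a v)))
          ≡⟨ sum-cong-≗ (λ v → trans (∑Seq-+ k (λ _ → 2 * (t * t)) (λ a → 2 * (L a v * L a v)))
               (cong₂ _+_ (∑Seq-const k (2 * (t * t))) (∑Seq-* k 2 (λ a → L a v * L a v)))) ⟩
        sum (λ v → n ^ k * (2 * (t * t)) + 2 * ∑Seq k (λ a → L a v * L a v))
          ≡⟨ trans (∑-distrib-+ {n} (λ _ → n ^ k * (2 * (t * t))) (λ v → 2 * ∑Seq k (λ a → L a v * L a v)))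
               (cong₂ _+_ (∑-const n (n ^ k * (2 * (t * t)))) (sym (*-distribˡ-sum 2 (λ v → ∑Seq k (λ a → L a v * L a v))))) ⟩
        n * (n ^ k * (2 * (t * t))) + 2 * S₂ k
          ≡⟨ lem₃ n (n ^ k) (t * t) (S₂ k) ⟩
        2 * (n ^ suc k * (t * t) + S₂ k) ∎
        where
        lem₃ : ∀ n p x s → n * (p * (2 * x)) + 2 * s ≡ 2 * (n * p * x + s)
        lem₃ = solve-∀

    mean-edges : ∀ k → n * (2 * ∑Seq (suc k) (edges ll)) ≡ n ^ k * (suc k * k * Λ)
    mean-edges k = begin
        n * (2 * ∑Seq (suc k) (edges ll))
          ≡⟨ cong (n *_) (trans (sym (∑Seq-* (suc k) 2 (edges ll))) (∑Seq-cong (suc k) λ a → sym (handshake ll ll-sym ll-irrefl a))) ⟩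
        n * ∑Seq (suc k) (λ a → sumL (L a) a)
          ≡⟨ cong (n *_) (∑Seq-sumL k (λ u a → L a u) (deg-↭ ll)) ⟩
        n * (suc k * sum (λ u → ∑Seq k (λ r → L (u ∷ r) u)))
          ≡⟨ cong (λ z → n * (suc k * z)) (sum-cong-≗ λ u → ∑Seq-cong k λ r → deg-self ll ll-sym ll-irrefl u r) ⟩
        n * (suc k * sum (λ u → ∑Seq k (λ r → L r u)))
          ≡⟨ trans (lem₁ n (suc k) _) (cong (suc k *_) (*-distribˡ-sum n (λ u → ∑Seq k (λ r → L r u)))) ⟩
        suc k * sum (λ u → n * ∑Seq k (λ r → L r u))
          ≡⟨ cong (suc k *_) (sum-cong-≗ λ u → trans (∑Seq-sumL-mean (ll u) k) (sym (*-assoc (n ^ k) k (X u)))) ⟩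
        suc k * sum (λ u → n ^ k * k * X u)
          ≡⟨ cong (suc k *_) (sym (*-distribˡ-sum (n ^ k * k) X)) ⟩
        suc k * (n ^ k * k * Λ)
          ≡⟨ lem₂ (suc k) (n ^ k) k Λ ⟩
        n ^ k * (suc k * k * Λ) ∎
      where
      open ≡-Reasoning
      lem₁ : ∀ n k x → n * (k * x) ≡ k * (n * x)
      lem₁ = solve-∀
      lem₂ : ∀ a p k x → a * (p * k * x) ≡ p * (a * k * x)
      lem₂ = solve-∀

    -- Chebyshev's inequality: as edges ll is at most ℓ with probability at least 1 / m,
    -- its mean cannot exceed 2 M.
    Λ-bound : ∀ k ℓ m M .{{_ : NonZero n}} .{{_ : NonZero g}} → 2 * ℓ ≤ M → 4 * (m * suc k) < M →
      n ^ suc k ≤ m * ∑Seq (suc k) (λ a → ⟦ edges ll a ≤? ℓ ⟧) → suc k * k * Λ ≤ 4 * M * (n * n)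
    Λ-bound k ℓ m M 2ℓ≤M mk<M likely = ≮⇒≥ λ Θ> → <⇒≱ mk<M (large Θ>)
      where
      open ≤-Reasoning
      Θ = suc k * k * Λ
      E = edges ll
      K = suc k
      dev : List (Fin n) → ℕ
      dev y = ∑Seq K (λ x → dist² (E x) (E y))
      tangents : ∀ y → 2 * M * ∑Seq K E ≤ dev y + n ^ K * (M * M + 2 * M * E y)
      tangents y = begin
        2 * M * ∑Seq K E
          ≡⟨ ∑Seq-* K (2 * M) E ⟨
        ∑Seq K (λ x → 2 * M * E x)
          ≤⟨ ∑Seq-mono K (λ x _ → ≤-trans (tangent M (E x) (E y)) (≤-reflexive (+-assoc (dist² (E x) (E y)) (M * M) _))) ⟩
        ∑Seq K (λ x → dist² (E x) (E y) + (M * M + 2 * M * E y))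
          ≡⟨ trans (∑Seq-+ K (λ x → dist² (E x) (E y)) (λ _ → M * M + 2 * M * E y)) (cong (dev y +_) (∑Seq-const {n} K (M * M + 2 * M * E y))) ⟩
        dev y + n ^ K * (M * M + 2 * M * E y) ∎
      module _ (Θ> : 4 * M * (n * n) < Θ) where
        -- As 2ℓ ≤ M, the terms `M * M` and `2 * M * E y` use up only half of the mean; the other
        -- half must come from the deviation.
        point : ∀ y → E y ≤ ℓ → M * (n ^ k * Θ) ≤ 2 * (n * dev y)
        point y Ey = +-cancelʳ-≤ (M * (n ^ k * Θ)) _ _ (begin
          M * (n ^ k * Θ) + M * (n ^ k * Θ)
            ≡⟨ cong (λ z → M * z + M * z) (mean-edges k) ⟨
          M * (n * (2 * ∑Seq K E)) + M * (n * (2 * ∑Seq K E))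
            ≡⟨ lem₁ M n (∑Seq K E) ⟩
          2 * (n * (2 * M * ∑Seq K E))
            ≤⟨ *-monoʳ-≤ 2 (*-monoʳ-≤ n (tangents y)) ⟩
          2 * (n * (dev y + n ^ K * (M * M + 2 * M * E y)))
            ≤⟨ *-monoʳ-≤ 2 (*-monoʳ-≤ n (+-monoʳ-≤ (dev y) (*-monoʳ-≤ (n ^ K) (+-monoʳ-≤ (M * M) square)))) ⟩
          2 * (n * (dev y + n ^ K * (M * M + M * M)))
            ≡⟨ lem₂ n (dev y) (n ^ k) M ⟩
          2 * (n * dev y) + M * (n ^ k * (4 * M * (n * n)))
            ≤⟨ +-monoʳ-≤ (2 * (n * dev y)) (*-monoʳ-≤ M (*-monoʳ-≤ (n ^ k) (<⇒≤ Θ>))) ⟩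
          2 * (n * dev y) + M * (n ^ k * Θ) ∎)
          where
          square : 2 * M * E y ≤ M * M
          square = ≤-trans (≤-reflexive (lem₃ M (E y))) (*-monoʳ-≤ M (≤-trans (*-monoʳ-≤ 2 Ey) 2ℓ≤M))
            where
            lem₃ : ∀ M e → 2 * M * e ≡ M * (2 * e)
            lem₃ = solve-∀
          lem₁ : ∀ M n e → M * (n * (2 * e)) + M * (n * (2 * e)) ≡ 2 * (n * (2 * M * e))
          lem₁ = solve-∀
          lem₂ : ∀ n d p M → 2 * (n * (d + n * p * (M * M + M * M))) ≡ 2 * (n * d) + M * (p * (4 * M * (n * n)))
          lem₂ = solve-∀
        total : n ^ K * (M * (n ^ k * Θ)) ≤ n ^ K * (m * (4 * (n * (K * S₂ k))))
        total = begin
          n ^ K * (M * (n ^ k * Θ))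
            ≤⟨ *-monoˡ-≤ (M * (n ^ k * Θ)) likely ⟩
          m * ∑Seq K (λ a → ⟦ E a ≤? ℓ ⟧) * (M * (n ^ k * Θ))
            ≡⟨ trans (*-assoc m _ _) (cong (m *_) (sym (∑Seq-*ʳ K (M * (n ^ k * Θ)) (λ a → ⟦ E a ≤? ℓ ⟧)))) ⟩
          m * ∑Seq K (λ a → ⟦ E a ≤? ℓ ⟧ * (M * (n ^ k * Θ)))
            ≤⟨ *-monoʳ-≤ m (∑Seq-mono K (λ y _ → ⟦⟧*-≤ (E y ≤? ℓ) (point y))) ⟩
          m * ∑Seq K (λ y → 2 * (n * dev y))
            ≡⟨ cong (m *_) (trans (∑Seq-* K 2 (λ y → n * dev y)) (cong (2 *_) (trans (∑Seq-* K n dev) (cong (n *_) (∑Seq-comm K K (λ y x → dist² (E x) (E y))))))) ⟩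
          m * (2 * (n * variance K E))
            ≤⟨ *-monoʳ-≤ m (*-monoʳ-≤ 2 (*-monoʳ-≤ n (efron-stein k E (λ v a → L a v * L a v) edges-lipschitz))) ⟩
          m * (2 * (n * (2 * (K * (n ^ K * S₂ k)))))
            ≡⟨ lem m n K (n ^ K) (S₂ k) ⟩
          n ^ K * (m * (4 * (n * (K * S₂ k)))) ∎
          where
          lem : ∀ m n K p s → m * (2 * (n * (2 * (K * (p * s))))) ≡ p * (m * (4 * (n * (K * s))))
          lem = solve-∀
        Θ≢0 : NonZero Θ
        Θ≢0 = >-nonZero (≤-<-trans z≤n Θ>)
        -- By `S₂-bound` the variance of the number of light edges is at most of order K times its
        -- mean. Both sides are thus proportional to Θ, which cancels.
        large : M ≤ 4 * (m * K)
        large = *-cancelˡ-≤ (g * (n ^ k * Θ)) {{m*n≢0 g (n ^ k * Θ) {{it}} {{m*n≢0 (n ^ k) Θ {{m^n≢0 n k}} {{Θ≢0}}}}}} (begin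
          g * (n ^ k * Θ) * M
            ≡⟨ lem₁ g (n ^ k * Θ) M ⟩
          g * (M * (n ^ k * Θ))
            ≤⟨ *-monoʳ-≤ g (*-cancelˡ-≤ (n ^ K) {{m^n≢0 n K}} total) ⟩
          g * (m * (4 * (n * (K * S₂ k))))
            ≡⟨ lem₂ g m n K (S₂ k) ⟩
          4 * (m * K) * (g * (n * S₂ k))
            ≤⟨ *-monoʳ-≤ (4 * (m * K)) (S₂-bound k) ⟩
          4 * (m * K) * (n ^ k * (k * (g + k) * Λ))
            ≤⟨ *-monoʳ-≤ (4 * (m * K)) (*-monoʳ-≤ (n ^ k) (*-monoˡ-≤ Λ (*-monoʳ-≤ k g+k≤))) ⟩
          4 * (m * K) * (n ^ k * (k * (g * K) * Λ))
            ≡⟨ lem₃ (4 * (m * K)) (n ^ k) k g K Λ ⟩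
          g * (n ^ k * Θ) * (4 * (m * K)) ∎)
          where
          it : NonZero g
          it = recompute-nonZero g
            where
            recompute-nonZero : ∀ g .{{_ : NonZero g}} → NonZero g
            recompute-nonZero (suc _) = _
          lem₁ : ∀ g x M → g * x * M ≡ g * (M * x)
          lem₁ = solve-∀
          lem₂ : ∀ g m n K s → g * (m * (4 * (n * (K * s)))) ≡ 4 * (m * K) * (g * (n * s))
          lem₂ = solve-∀
          lem₃ : ∀ a p k g K l → a * (p * (k * (g * K) * l)) ≡ g * (p * (K * k * l)) * a
          lem₃ = solve-∀
          g+k≤ : g + k ≤ g * K
          g+k≤ = ≤-trans (+-monoʳ-≤ g (m≤n*m k g)) (≤-reflexive (sym (*-suc g k)))

-- Low and high sequences

scaled : ∀ c {q b x P} .{{_ : NonZero b}} → q * x ≤ b * P → c * b ≤ q → c * x ≤ P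
scaled c {q} {b} {x} {P} qx≤ cb≤ = *-cancelˡ-≤ b (begin
    b * (c * x)  ≡⟨ lem b c x ⟩
    c * b * x    ≤⟨ *-monoˡ-≤ x cb≤ ⟩
    q * x        ≤⟨ qx≤ ⟩
    b * P        ∎)
  where
  open ≤-Reasoning
  lem : ∀ b c x → b * (c * x) ≡ c * b * x
  lem = solve-∀

module Threshold {n : ℕ} (G : Graph n) (g g′ t : ℕ) where
  open Light G g
  private Aᴳ = A G

  rich poor : List (Fin n) → Fin n → ℕ
  rich a = above (deg Aᴳ a) t
  poor a = beneath (deg Aᴳ a) t

  low high : List (Fin n) → ℕ
  low a = ⟦ g′ * sum (rich a) ≤? n ⟧
  high a = ⟦ g′ * sum (poor a) ≤? n ⟧

  -- Only light entries are counted as poor: making an entry fresh means deleting it, which changes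
  -- the degrees of all its neighbours, and these are few only for a light entry.
  richIn poorIn : List (Fin n) → ℕ
  richIn a = sumL (rich a) a
  poorIn a = sumL (λ u → light u * poor a u) a

  deg-inv : ∀ u → Invariant (λ a → deg Aᴳ a u)
  deg-inv = deg-↭ Aᴳ

  rich-inv : ∀ u → Invariant (λ a → rich a u)
  rich-inv u p = cong (λ z → ⟦ t ≤? z ⟧) (deg-inv u p)

  poor-inv : ∀ u → Invariant (λ a → poor a u)
  poor-inv u p = cong (λ z → ⟦ z <? t ⟧) (deg-inv u p)

  low-inv : Invariant low
  low-inv p = cong (λ z → ⟦ g′ * z ≤? n ⟧) (sum-cong-≗ λ u → rich-inv u p)

  high-inv : Invariant high
  high-inv p = cong (λ z → ⟦ g′ * z ≤? n ⟧) (sum-cong-≗ λ u → poor-inv u p)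

  -- Double counting of the adjacent pairs of a heavy entry and a vertex: every heavy entry has at
  -- least n/g neighbours, every vertex that is not rich has fewer than t neighbours in the
  -- sequence, and the at most n/(2g) rich vertices absorb only half of the pairs.
  heavies-bound : ∀ a .{{_ : NonZero n}} → 2 * g ≤ g′ → g′ * sum (rich a) ≤ n → heavies a ≤ 2 * (g * t)
  heavies-bound a 2g≤g′ lo = *-cancelˡ-≤ n (+-cancelʳ-≤ (n * N) _ _ (begin
      n * N + n * N
        ≡⟨ lem₁ n N ⟩
      2 * (n * N)
        ≤⟨ *-monoʳ-≤ 2 count ⟩
      2 * (g * (n * t + sum (rich a) * N))
        ≡⟨ lem₂ g n t (sum (rich a)) N ⟩
      n * (2 * (g * t)) + 2 * g * sum (rich a) * N
        ≤⟨ +-monoʳ-≤ (n * (2 * (g * t))) (*-monoˡ-≤ N (≤-trans (*-monoˡ-≤ (sum (rich a)) 2g≤g′) lo)) ⟩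
      n * (2 * (g * t)) + n * N ∎))
    where
    open ≤-Reasoning
    N = heavies a
    lem₁ : ∀ n N → n * N + n * N ≡ 2 * (n * N)
    lem₁ = solve-∀
    lem₂ : ∀ g n t x N → 2 * (g * (n * t + x * N)) ≡ n * (2 * (g * t)) + 2 * g * x * N
    lem₂ = solve-∀
    H-sum : sum (H a) ≡ sumL (λ u → heavy u * degree G u) a
    H-sum = trans (sym (sumL-sum (λ u v → heavy u * Aᴳ v u) a))
      (sumL-cong (λ u → trans (sym (*-distribˡ-sum (heavy u) (λ v → Aᴳ v u))) (cong (heavy u *_) (sum-cong-≗ λ v → A-sym G v u))) a)
    point : ∀ w → H a w ≤ t + rich a w * N
    point w with t ≤? deg Aᴳ a w
    ... | yes t≤ = ≤-trans (H≤heavies a w) (≤-trans (≤-reflexive (sym (trans (cong (_* N) (⟦⟧-yes (t ≤? deg Aᴳ a w) t≤)) (+-identityʳ N)))) (m≤n+m _ t))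
    ... | no t≰ = ≤-trans (≤-trans (H≤deg a w) (<⇒≤ (≰⇒> t≰))) (m≤m+n t _)
    count : n * N ≤ g * (n * t + sum (rich a) * N)
    count = begin
      n * N
        ≡⟨ sumL-* n heavy a ⟨
      sumL (λ u → n * heavy u) a
        ≤⟨ sumL-mono (λ u → ≤-trans (≤-reflexive (*-comm n (heavy u))) (⟦⟧*-≤ (n ≤? g * degree G u) (λ le → ≤-trans le (≤-reflexive (sym (trans (cong (λ z → g * (z * degree G u)) (⟦⟧-yes (n ≤? g * degree G u) le)) (cong (g *_) (+-identityʳ _)))))))) a ⟩
      sumL (λ u → g * (heavy u * degree G u)) a
        ≡⟨ trans (sumL-* g (λ u → heavy u * degree G u) a) (cong (g *_) (sym H-sum)) ⟩
      g * sum (H a)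
        ≤⟨ *-monoʳ-≤ g (≤-trans (∑-mono point) (≤-reflexive (trans (∑-distrib-+ (λ _ → t) (λ w → rich a w * N)) (cong₂ _+_ (∑-const n t) (sym (*-distribʳ-sum N (rich a))))))) ⟩
      g * (n * t + sum (rich a) * N) ∎

  -- A light entry that is not rich has light and heavy degree summing to less than t, so its
  -- deficit `t ∸ L a u` exceeds its heavy degree by at least one. These ones add up to `length a`,
  -- except at the heavy and rich entries; a rich one may also lose its up to B edges to heavy
  -- entries.
  low-F : ∀ a B → heavies a ≤ B → edges Aᴳ a + length a ≤ F t a + (B + richIn a + richIn a * B + B * B)
  low-F a B N≤B = begin
      edges Aᴳ a + length a
        ≡⟨ cong₂ _+_ (edges-split a) (length-sumL a) ⟩
      edges ll a + sumL (λ u → light u * H a u) a + edges hh a + sumL (λ _ → 1) a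
        ≡⟨ trans (lem₁ (edges ll a) (sumL (λ u → light u * H a u) a) (edges hh a) (sumL (λ _ → 1) a)) (cong (λ z → edges ll a + z + edges hh a) (sym (sumL-+ (λ u → light u * H a u) (λ _ → 1) a))) ⟩
      edges ll a + sumL (λ u → light u * H a u + 1) a + edges hh a
        ≤⟨ +-mono-≤ (+-monoʳ-≤ (edges ll a) (sumL-mono point a)) (≤-trans (edges-hh a) (*-mono-≤ N≤B N≤B)) ⟩
      edges ll a + sumL (λ u → light u * (t ∸ L a u) + (heavy u + (rich a u + B * rich a u))) a + B * B
        ≡⟨ cong (λ z → edges ll a + z + B * B) (trans (sumL-+ (λ u → light u * (t ∸ L a u)) _ a) (cong (W t a +_)
             (trans (sumL-+ heavy _ a) (cong (heavies a +_) (trans (sumL-+ (rich a) (λ u → B * rich a u) a) (cong (richIn a +_) (sumL-* B (rich a) a))))))) ⟩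
      edges ll a + (W t a + (heavies a + (richIn a + B * richIn a))) + B * B
        ≤⟨ +-monoˡ-≤ (B * B) (+-monoʳ-≤ (edges ll a) (+-monoʳ-≤ (W t a) (+-monoˡ-≤ (richIn a + B * richIn a) N≤B))) ⟩
      edges ll a + (W t a + (B + (richIn a + B * richIn a))) + B * B
        ≡⟨ lem₂ (edges ll a) (W t a) B (richIn a) ⟩
      F t a + (B + richIn a + richIn a * B + B * B) ∎
    where
    open ≤-Reasoning
    lem₁ : ∀ a b c d → a + b + c + d ≡ a + (b + d) + c
    lem₁ = solve-∀
    lem₂ : ∀ e w B r → e + (w + (B + (r + B * r))) + B * B ≡ e + w + (B + r + r * B + B * B)
    lem₂ = solve-∀
    point : ∀ u → light u * H a u + 1 ≤ light u * (t ∸ L a u) + (heavy u + (rich a u + B * rich a u))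
    point u = help (light-or-heavy u)
      where
      H≤B : H a u ≤ B
      H≤B = ≤-trans (H≤heavies a u) N≤B
      help : (light u ≡ 1 × heavy u ≡ 0) ⊎ (light u ≡ 0 × heavy u ≡ 1) →
        light u * H a u + 1 ≤ light u * (t ∸ L a u) + (heavy u + (rich a u + B * rich a u))
      help (inj₂ (lu , hu)) = subst₂ (λ x y → x * H a u + 1 ≤ x * (t ∸ L a u) + (y + (rich a u + B * rich a u))) (sym lu) (sym hu) (s≤s z≤n)
      help (inj₁ (lu , hu)) with t ≤? deg Aᴳ a u
      ... | yes t≤ = subst (λ z → light u * H a u + 1 ≤ light u * (t ∸ L a u) + (heavy u + (z + B * z))) (sym (⟦⟧-yes (t ≤? deg Aᴳ a u) t≤))
        (≤-trans (+-monoˡ-≤ 1 (≤-trans (*-mono-≤ (light≤1 u) H≤B) (≤-reflexive (+-identityʳ B))))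
          (≤-trans (≤-reflexive (lem₃ B)) (≤-trans (m≤n+m (1 + B * 1) (heavy u)) (m≤n+m _ (light u * (t ∸ L a u))))))
        where
        lem₃ : ∀ B → B + 1 ≡ 1 + B * 1
        lem₃ = solve-∀
      ... | no t≰ = subst (λ z → z * H a u + 1 ≤ z * (t ∸ L a u) + (heavy u + (rich a u + B * rich a u))) (sym lu)
        (≤-trans (≤-trans (≤-reflexive (lem₄ (H a u))) (≤-trans (m+n≤o⇒m≤o∸n (suc (H a u)) (≤-trans (≤-reflexive (trans (cong suc (+-comm (H a u) (L a u))) (cong suc (sym (deg-split a u lu))))) (≰⇒> t≰))) (≤-reflexive (sym (+-identityʳ _))))) (m≤m+n _ _))
        where
        lem₄ : ∀ h → 1 * h + 1 ≡ suc h
        lem₄ = solve-∀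

  -- A light entry with at least t neighbours has a deficit of at most its heavy degree, so W is
  -- paid for by the edges between light and heavy entries, up to t for every poor light entry.
  high-F : ∀ a → F t a ≤ edges Aᴳ a + t * poorIn a
  high-F a = begin
      edges ll a + W t a
        ≤⟨ +-monoʳ-≤ (edges ll a) (sumL-mono point a) ⟩
      edges ll a + sumL (λ u → light u * H a u + t * (light u * poor a u)) a
        ≡⟨ cong (edges ll a +_) (trans (sumL-+ (λ u → light u * H a u) _ a) (cong (sumL (λ u → light u * H a u) a +_) (sumL-* t (λ u → light u * poor a u) a))) ⟩
      edges ll a + (sumL (λ u → light u * H a u) a + t * poorIn a)
        ≤⟨ m≤m+n _ (edges hh a) ⟩
      edges ll a + (sumL (λ u → light u * H a u) a + t * poorIn a) + edges hh a
        ≡⟨ lem (edges ll a) (sumL (λ u → light u * H a u) a) (t * poorIn a) (edges hh a) ⟩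
      edges ll a + sumL (λ u → light u * H a u) a + edges hh a + t * poorIn a
        ≡⟨ cong (_+ t * poorIn a) (edges-split a) ⟨
      edges Aᴳ a + t * poorIn a ∎
    where
    open ≤-Reasoning
    lem : ∀ a b c d → a + (b + c) + d ≡ a + b + d + c
    lem = solve-∀
    point : ∀ u → light u * (t ∸ L a u) ≤ light u * H a u + t * (light u * poor a u)
    point u with light-or-heavy u
    ... | inj₂ (lu , hu) = subst (λ z → z * (t ∸ L a u) ≤ light u * H a u + t * (light u * poor a u)) (sym lu) z≤n
    ... | inj₁ (lu , hu) with deg Aᴳ a u <? t
    ...   | yes <t = ≤-trans (*-mono-≤ (light≤1 u) (m∸n≤m t (L a u))) (≤-trans (≤-reflexive
      (trans (+-identityʳ t) (trans (sym (*-identityʳ t)) (cong (t *_) (sym (cong₂ _*_ lu (⟦⟧-yes (deg Aᴳ a u <? t) <t))))))) (m≤n+m _ _))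
    ...   | no ≮t = ≤-trans (*-monoʳ-≤ (light u) (m≤n+o⇒m∸n≤o t (L a u) (subst (t ≤_) (deg-split a u lu) (≮⇒≥ ≮t)))) (m≤m+n _ _)

  low-fresh : ∀ a → g′ * (low a * sum (rich a)) ≤ n
  low-fresh a = ≤-trans (≤-reflexive (lem g′ (low a) (sum (rich a)))) (⟦⟧*-≤ (g′ * sum (rich a) ≤? n) id)
    where
    lem : ∀ a b c → a * (b * c) ≡ b * (a * c)
    lem = solve-∀

  high-fresh : ∀ a → g′ * (high a * sum (poor a)) ≤ n
  high-fresh a = ≤-trans (≤-reflexive (lem g′ (high a) (sum (poor a)))) (⟦⟧*-≤ (g′ * sum (poor a) ≤? n) id)
    where
    lem : ∀ a b c → a * (b * c) ≡ b * (a * c)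
    lem = solve-∀

  deg-head : ∀ u r → deg Aᴳ (u ∷ r) u ≡ deg Aᴳ r u
  deg-head = deg-self Aᴳ (A-sym G) (A-irrefl G)

  -- A vertex of a random sequence is fresh for the sequence of the other ones.
  exchange-head : ∀ c k (ψ : Fin n → List (Fin n) → ℕ) b → (∀ u → Invariant (ψ u)) →
    (∀ r → c * sum (λ u → ψ u (u ∷ r)) ≤ b) →
    c * ∑Seq (suc k) (λ a → sumL (λ u → ψ u a) a) ≤ suc k * (n ^ k * b)
  exchange-head c k ψ b inv h = begin
      c * ∑Seq (suc k) (λ a → sumL (λ u → ψ u a) a)
        ≡⟨ cong (c *_) (trans (∑Seq-sumL k ψ inv) (cong (suc k *_) (sym (∑Seq-sum k (λ r u → ψ u (u ∷ r)))))) ⟩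
      c * (suc k * ∑Seq k (λ r → sum (λ u → ψ u (u ∷ r))))
        ≡⟨ trans (lem c (suc k) _) (cong (suc k *_) (sym (∑Seq-* k c (λ r → sum (λ u → ψ u (u ∷ r)))))) ⟩
      suc k * ∑Seq k (λ r → c * sum (λ u → ψ u (u ∷ r)))
        ≤⟨ *-monoʳ-≤ (suc k) (≤-trans (∑Seq-mono k (λ r _ → h r)) (≤-reflexive (∑Seq-const k b))) ⟩
      suc k * (n ^ k * b) ∎
    where
    open ≤-Reasoning
    lem : ∀ a b c → a * (b * c) ≡ b * (a * c)
    lem = solve-∀

  -- Deleting an entry only lowers degrees, so the rest is still low, and the degree of the entry
  -- itself is unchanged as there are no loops. It is then a fresh vertex, rich with probability at
  -- most 1/g′.
  low-richIn : ∀ k → g′ * ∑Seq (suc k) (λ a → low a * richIn a) ≤ suc k * n ^ suc k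
  low-richIn k = ≤-trans (≤-reflexive (cong (g′ *_) (∑Seq-cong (suc k) λ a → sym (sumL-* (low a) (rich a) a))))
      (≤-trans (exchange-head g′ k (λ u a → low a * rich a u) n (λ u p → cong₂ _*_ (low-inv p) (rich-inv u p)) bound)
        (≤-reflexive (cong (suc k *_) (*-comm (n ^ k) n))))
    where
    bound : ∀ r → g′ * sum (λ u → low (u ∷ r) * rich (u ∷ r) u) ≤ n
    bound r = ≤-trans (*-monoʳ-≤ g′ (≤-trans (∑-mono λ u → *-mono-≤ (low-tail u) (≤-reflexive (cong (λ z → ⟦ t ≤? z ⟧) (deg-head u r))))
        (≤-reflexive (sym (*-distribˡ-sum (low r) (rich r)))))) (low-fresh r)
      where
      low-tail : ∀ u → low (u ∷ r) ≤ low r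
      low-tail u = ⟦⟧-mono (g′ * sum (rich (u ∷ r)) ≤? n) (g′ * sum (rich r) ≤? n)
        (≤-trans (*-monoʳ-≤ g′ (∑-mono λ w → ⟦⟧-mono (t ≤? deg Aᴳ r w) (t ≤? deg Aᴳ (u ∷ r) w) (λ le → ≤-trans le (deg-∷ Aᴳ u r w)))))

  -- Deleting a light entry makes at most n/g further vertices poor, so the rest has at most 2n/g
  -- poor vertices. A rest with more of them contributes nothing.
  high-poorIn : ∀ k → g ≤ g′ → g * ∑Seq (suc k) (λ a → high a * poorIn a) ≤ suc k * (2 * n ^ suc k)
  high-poorIn k g≤g′ = ≤-trans (≤-reflexive (cong (g *_) (∑Seq-cong (suc k) λ a → sym (sumL-* (high a) (λ u → light u * poor a u) a))))
      (≤-trans (exchange-head g k (λ u a → high a * (light u * poor a u)) (2 * n) (λ u p → cong₂ (λ x y → x * (light u * y)) (high-inv p) (poor-inv u p)) bound)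
        (≤-reflexive (cong (suc k *_) (lem (n ^ k) n))))
    where
    lem : ∀ p n → p * (2 * n) ≡ 2 * (n * p)
    lem = solve-∀
    bound : ∀ r → g * sum (λ u → high (u ∷ r) * (light u * poor (u ∷ r) u)) ≤ 2 * n
    bound r with g * sum (poor r) ≤? 2 * n
    ... | yes few = ≤-trans (*-monoʳ-≤ g (∑-mono λ u → ≤-trans (*-mono-≤ (bit≤1 (does (g′ * sum (poor (u ∷ r)) ≤? n))) (*-mono-≤ (light≤1 u) (≤-reflexive (cong (λ z → ⟦ z <? t ⟧) (deg-head u r)))))
        (≤-reflexive (lem₁ (poor r u))))) few
      where
      lem₁ : ∀ x → 1 * (1 * x) ≡ x
      lem₁ = solve-∀
    ... | no many = ≤-trans (≤-reflexive (trans (cong (g *_) (trans (sum-cong-≗ {n} none) (trans (∑-const n 0) (*-zeroʳ n)))) (*-zeroʳ g))) z≤n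
      where
      none : ∀ u → high (u ∷ r) * (light u * poor (u ∷ r) u) ≡ 0
      none u with g * degree G u <? n
      ... | no ≮n = trans (cong (λ z → high (u ∷ r) * (z * poor (u ∷ r) u)) (⟦⟧-no (g * degree G u <? n) ≮n)) (*-zeroʳ (high (u ∷ r)))
      ... | yes <n = cong (_* (light u * poor (u ∷ r) u)) (⟦⟧-no (g′ * sum (poor (u ∷ r)) ≤? n) λ hi → many (begin
          g * sum (poor r)
            ≤⟨ *-monoʳ-≤ g (≤-trans (∑-mono step) (≤-reflexive (∑-distrib-+ (poor (u ∷ r)) (Aᴳ u)))) ⟩
          g * (sum (poor (u ∷ r)) + degree G u)
            ≡⟨ *-distribˡ-+ g (sum (poor (u ∷ r))) (degree G u) ⟩
          g * sum (poor (u ∷ r)) + g * degree G u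
            ≤⟨ +-mono-≤ (≤-trans (*-monoˡ-≤ _ g≤g′) hi) (<⇒≤ <n) ⟩
          n + n
            ≡⟨ cong (n +_) (sym (+-identityʳ n)) ⟩
          2 * n ∎))
        where
        open ≤-Reasoning
        step : ∀ w → poor r w ≤ poor (u ∷ r) w + Aᴳ u w
        step w with adj G w u in eq
        ... | false rewrite A-sym G u w | eq = ≤-reflexive (sym (+-identityʳ _))
        ... | true  rewrite A-sym G u w | eq = ≤-trans (bit≤1 (does (deg Aᴳ r w <? t))) (m≤n+m 1 _)

-- Degrees in a window

∑∑ : ∀ {n} (s k : ℕ) → (List (Fin n) → List (Fin n) → ℕ) → ℕ
∑∑ s k f = ∑Seq s λ x → ∑Seq k λ y → f x y

∑∑-mono : ∀ {n} s k {f g : List (Fin n) → List (Fin n) → ℕ} →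
  (∀ x y → length x ≡ s → length y ≡ k → f x y ≤ g x y) → ∑∑ s k f ≤ ∑∑ s k g
∑∑-mono s k h = ∑Seq-mono s λ x lx → ∑Seq-mono k λ y ly → h x y lx ly

∑∑-+ : ∀ {n} s k (f g : List (Fin n) → List (Fin n) → ℕ) → ∑∑ s k (λ x y → f x y + g x y) ≡ ∑∑ s k f + ∑∑ s k g
∑∑-+ s k f g = trans (∑Seq-cong s λ x → ∑Seq-+ k (f x) (g x)) (∑Seq-+ s (λ x → ∑Seq k (f x)) (λ x → ∑Seq k (g x)))

∑∑-* : ∀ {n} s k c (f : List (Fin n) → List (Fin n) → ℕ) → ∑∑ s k (λ x y → c * f x y) ≡ c * ∑∑ s k f
∑∑-* s k c f = trans (∑Seq-cong s λ x → ∑Seq-* k c (f x)) (∑Seq-* s c (λ x → ∑Seq k (f x)))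

∑∑-right : ∀ {n} s k (f : List (Fin n) → ℕ) → ∑∑ s k (λ _ y → f y) ≡ n ^ s * ∑Seq k f
∑∑-right s k f = ∑Seq-const s (∑Seq k f)

module Window {n : ℕ} (G : Graph n) (ℓ : ℕ) where
  private Aᴳ = A G

  S : List (Fin n) → ℕ
  S a = ⟦ edges Aᴳ a ≟ ℓ ⟧

  S-inv : Invariant S
  S-inv p = cong (λ z → ⟦ z ≟ ℓ ⟧) (edges-↭ Aᴳ (A-sym G) p)

  S*edges : ∀ a → S a * edges Aᴳ a ≤ ℓ
  S*edges a = ⟦⟧*-≤ (edges Aᴳ a ≟ ℓ) ≤-reflexive

  S*2edges : ∀ k → ∑Seq k (λ a → S a * (2 * edges Aᴳ a)) ≤ 2 * ℓ * n ^ k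
  S*2edges k = ≤-trans (∑Seq-mono k λ a _ → ≤-trans (≤-reflexive (lem (S a) (edges Aᴳ a))) (*-monoʳ-≤ 2 (S*edges a)))
      (≤-reflexive (trans (∑Seq-const k (2 * ℓ)) (*-comm (n ^ k) (2 * ℓ))))
    where
    lem : ∀ s e → s * (2 * e) ≡ 2 * (s * e)
    lem = solve-∀

  headDegree : ℕ → ℕ
  headDegree N = sum λ u → ∑Seq N λ a → S (u ∷ a) * deg Aᴳ a u

  sum-degrees : ∀ j (f : List (Fin n) → ℕ) → Invariant f →
    ∑Seq (suc j) (λ x → f x * (2 * edges Aᴳ x)) ≡ suc j * sum (λ u → ∑Seq j (λ r → f (u ∷ r) * deg Aᴳ r u))
  sum-degrees j f inv = trans
    (∑Seq-cong (suc j) λ x → trans (cong (f x *_) (sym (handshake Aᴳ (A-sym G) (A-irrefl G) x))) (sym (sumL-* (f x) (deg Aᴳ x) x)))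
    (trans (∑Seq-sumL j (λ u x → f x * deg Aᴳ x u) (λ u p → cong₂ _*_ (inv p) (deg-↭ Aᴳ u p)))
      (cong (suc j *_) (sum-cong-≗ λ u → ∑Seq-cong j λ r → cong (f (u ∷ r) *_) (deg-self Aᴳ (A-sym G) (A-irrefl G) u r))))

  headDegree-bound : ∀ N → suc N * headDegree N ≤ 2 * ℓ * n ^ suc N
  headDegree-bound N = ≤-trans (≤-reflexive (sym (sum-degrees N S S-inv))) (S*2edges (suc N))

  sum-pairs : ∀ j (f : List (Fin n) → ℕ) → Invariant f →
    ∑Seq (suc (suc j)) (λ x → f x * (2 * edges Aᴳ x)) ≡
    suc (suc j) * (suc j * sum (λ u → sum (λ v → ∑Seq j (λ r → f (u ∷ v ∷ r) * Aᴳ u v))))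
  sum-pairs j f inv = trans (sum-degrees (suc j) f inv) (cong (suc (suc j) *_)
    (trans (sum-cong-≗ λ u → trans (∑Seq-cong (suc j) λ r → sym (sumL-* (f (u ∷ r)) (Aᴳ u) r))
        (∑Seq-sumL j (λ v r → f (u ∷ r) * Aᴳ u v) (λ v p → cong (_* Aᴳ u v) (inv (↭.prep u p)))))
      (sym (*-distribˡ-sum (suc j) (λ u → sum (λ v → ∑Seq j (λ r → f (u ∷ v ∷ r) * Aᴳ u v)))))))

  module _ (r K : ℕ) where
    private
      s k : ℕ
      s = suc (suc r)
      k = s + K

    -- By exchangeability all ordered pairs of positions are equally likely to be edges, and s(s -
    -- 1) of the k(k - 1) pairs lie in the window.
    window-edges : k * (suc r + K) * ∑∑ s K (λ x y → S (x ++ y) * (2 * edges Aᴳ x)) ≤ s * suc r * (2 * ℓ) * n ^ k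
    window-edges = begin
        k * (suc r + K) * ∑∑ s K (λ x y → S (x ++ y) * (2 * edges Aᴳ x))
          ≡⟨ cong (k * (suc r + K) *_) window ⟩
        k * (suc r + K) * (s * (suc r * Y))
          ≡⟨ lem k (suc r + K) s (suc r) Y ⟩
        s * suc r * (k * ((suc r + K) * Y))
          ≡⟨ cong (s * suc r *_) (sum-pairs (r + K) S S-inv) ⟨
        s * suc r * ∑Seq k (λ a → S a * (2 * edges Aᴳ a))
          ≤⟨ *-monoʳ-≤ (s * suc r) (S*2edges k) ⟩
        s * suc r * (2 * ℓ * n ^ k)
          ≡⟨ *-assoc (s * suc r) (2 * ℓ) (n ^ k) ⟨
        s * suc r * (2 * ℓ) * n ^ k ∎
      where
      open ≤-Reasoning
      lem : ∀ a b c d y → a * b * (c * (d * y)) ≡ c * d * (a * (b * y))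
      lem = solve-∀
      Y = sum (λ u → sum (λ v → ∑Seq (r + K) (λ a → S (u ∷ v ∷ a) * Aᴳ u v)))
      Z : List (Fin n) → ℕ
      Z y = sum (λ u → sum (λ v → ∑Seq r (λ a → S (u ∷ v ∷ a ++ y) * Aᴳ u v)))
      Z-sum : ∑Seq K Z ≡ Y
      Z-sum = trans (∑Seq-sum K (λ y u → sum (λ v → ∑Seq r (λ a → S (u ∷ v ∷ a ++ y) * Aᴳ u v))))
        (sum-cong-≗ λ u → trans (∑Seq-sum K (λ y v → ∑Seq r (λ a → S (u ∷ v ∷ a ++ y) * Aᴳ u v)))
          (sum-cong-≗ λ v → trans (∑Seq-comm K r (λ y a → S (u ∷ v ∷ a ++ y) * Aᴳ u v))
            (sym (∑Seq-++ r K (λ a → S (u ∷ v ∷ a) * Aᴳ u v)))))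
      window : ∑∑ s K (λ x y → S (x ++ y) * (2 * edges Aᴳ x)) ≡ s * (suc r * Y)
      window = begin-equality
        ∑∑ s K (λ x y → S (x ++ y) * (2 * edges Aᴳ x))
          ≡⟨ ∑Seq-comm s K (λ x y → S (x ++ y) * (2 * edges Aᴳ x)) ⟩
        ∑Seq K (λ y → ∑Seq s (λ x → S (x ++ y) * (2 * edges Aᴳ x)))
          ≡⟨ ∑Seq-cong K (λ y → sum-pairs r (λ x → S (x ++ y)) (λ p → S-inv (++⁺ʳ y p))) ⟩
        ∑Seq K (λ y → s * (suc r * Z y))
          ≡⟨ ∑Seq-* K s (λ y → suc r * Z y) ⟩
        s * ∑Seq K (λ y → suc r * Z y)
          ≡⟨ cong (s *_) (∑Seq-* K (suc r) Z) ⟩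
        s * (suc r * ∑Seq K Z)
          ≡⟨ cong (λ z → s * (suc r * z)) Z-sum ⟩
        s * (suc r * Y) ∎

    window-degrees : ∑∑ s K (λ x y → S (x ++ y) * sumL (deg Aᴳ y) x) ≤ s * headDegree (suc r + K)
    window-degrees = begin
        ∑∑ s K (λ x y → S (x ++ y) * sumL (deg Aᴳ y) x)
          ≡⟨ ∑Seq-comm s K (λ x y → S (x ++ y) * sumL (deg Aᴳ y) x) ⟩
        ∑Seq K (λ y → ∑Seq s (λ x → S (x ++ y) * sumL (deg Aᴳ y) x))
          ≡⟨ ∑Seq-cong K each ⟩
        ∑Seq K (λ y → s * Y y)
          ≡⟨ ∑Seq-* K s Y ⟩
        s * ∑Seq K Y
          ≡⟨ cong (s *_) (trans (∑Seq-sum K (λ y u → ∑Seq (suc r) (λ a → S (u ∷ a ++ y) * deg Aᴳ y u)))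
               (sum-cong-≗ λ u → ∑Seq-comm K (suc r) (λ y a → S (u ∷ a ++ y) * deg Aᴳ y u))) ⟩
        s * sum (λ u → ∑∑ (suc r) K (λ a y → S (u ∷ a ++ y) * deg Aᴳ y u))
          ≤⟨ *-monoʳ-≤ s (∑-mono λ u → ≤-trans (∑∑-mono (suc r) K λ a y _ _ → *-monoʳ-≤ (S (u ∷ a ++ y)) (≤-trans (m≤n+m (deg Aᴳ y u) (deg Aᴳ a u)) (≤-reflexive (sym (deg-++ Aᴳ a y u)))))
               (≤-reflexive (sym (∑Seq-++ (suc r) K (λ a → S (u ∷ a) * deg Aᴳ a u))))) ⟩
        s * headDegree (suc r + K) ∎
      where
      open ≤-Reasoning
      Y : List (Fin n) → ℕ
      Y y = sum (λ u → ∑Seq (suc r) (λ a → S (u ∷ a ++ y) * deg Aᴳ y u))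
      each : ∀ y → ∑Seq s (λ x → S (x ++ y) * sumL (deg Aᴳ y) x) ≡ s * Y y
      each y = trans (∑Seq-cong s λ x → sym (sumL-* (S (x ++ y)) (deg Aᴳ y) x))
        (∑Seq-sumL (suc r) (λ u x → S (x ++ y) * deg Aᴳ y u) (λ u p → cong (_* deg Aᴳ y u) (S-inv (++⁺ʳ y p))))

-- The sets with ℓ edges outside of which most vertices have fewer than t neighbours, and those
-- outside of which most vertices have at least t neighbours, cannot both be likely: F t is
-- larger by about K on the former ones, but it is concentrated.
module Gap {n : ℕ} (G : Graph n) (ℓ g g′ t m r k′ B X X′ Z M c : ℕ)
  .{{_ : NonZero n}} .{{_ : NonZero g}} .{{_ : NonZero ℓ}} .{{_ : NonZero m}} where
  open Light G g hiding (X)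
  open Threshold G g g′ t
  open Window G ℓ
  private
    Aᴳ = A G
    s K k P : ℕ
    s = suc (suc r)
    K = suc k′
    k = s + K
    P = n ^ s * n ^ K
    n^k≡P : n ^ k ≡ P
    n^k≡P = ^-distribˡ-+-* n s K
    -- The errors in comparing `F t` with ℓ + K and with ℓ: Z bounds the edges between window and y,
    -- B the heavy, X the rich and X′ the poor light entries of y.
    R R′ : ℕ
    R = Z + (B + X + X * B + B * B)
    R′ = t * X′

  module _
    (2g≤g′ : 2 * g ≤ g′) (2gt≤B : 2 * (g * t) ≤ B)
    (hX : 6 * m * K ≤ g′ * suc X)
    (hZ : 6 * m * (s * (2 * ℓ)) ≤ suc Z * k)
    (hE : 6 * m * (s * suc r * (2 * ℓ)) ≤ 2 * (k * (suc r + K)))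
    (hX′ : 2 * m * (2 * K) ≤ g * suc X′)
    (hc : R + R′ + c ≤ K)
    (2ℓ≤M : 2 * ℓ ≤ M) (mK<M : 4 * (m * K) < M)
    (hv : 16 * (m * m) * (g * K * (t * t) + 4 * M * (g + K)) < g * (c * c))
    where

    windowEdge : ℕ
    windowEdge = ∑∑ s K (λ x y → S (x ++ y) * ⟦ 0 <? edges Aᴳ x ⟧)

    windowEdge-bound : 6 * m * windowEdge ≤ P
    windowEdge-bound = scaled (6 * m) {{m*n≢0 (s * suc r) (2 * ℓ) {{_}} {{m*n≢0 2 ℓ}}}} (begin
        2 * (k * (suc r + K)) * windowEdge
          ≡⟨ trans (lem₁ (k * (suc r + K)) windowEdge) (cong (k * (suc r + K) *_) (sym (∑∑-* s K 2 (λ x y → S (x ++ y) * ⟦ 0 <? edges Aᴳ x ⟧)))) ⟩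
        k * (suc r + K) * ∑∑ s K (λ x y → 2 * (S (x ++ y) * ⟦ 0 <? edges Aᴳ x ⟧))
          ≤⟨ *-monoʳ-≤ (k * (suc r + K)) (∑∑-mono s K λ x y _ _ → ≤-trans (≤-reflexive (lem₂ (S (x ++ y)) ⟦ 0 <? edges Aᴳ x ⟧)) (*-monoʳ-≤ (S (x ++ y)) (*-monoʳ-≤ 2 (⟦⟧-≤ (0 <? edges Aᴳ x) id)))) ⟩
        k * (suc r + K) * ∑∑ s K (λ x y → S (x ++ y) * (2 * edges Aᴳ x))
          ≤⟨ window-edges r K ⟩
        s * suc r * (2 * ℓ) * n ^ k
          ≡⟨ cong (s * suc r * (2 * ℓ) *_) n^k≡P ⟩
        s * suc r * (2 * ℓ) * P ∎) hE
      where
      open ≤-Reasoning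
      lem₁ : ∀ a b → 2 * a * b ≡ a * (2 * b)
      lem₁ = solve-∀
      lem₂ : ∀ a b → 2 * (a * b) ≡ a * (2 * b)
      lem₂ = solve-∀

    private
      windowDeg : ℕ
      windowDeg = ∑∑ s K (λ x y → S (x ++ y) * ⟦ Z <? sumL (deg Aᴳ y) x ⟧)

      windowDeg-bound : 6 * m * windowDeg ≤ P
      windowDeg-bound = scaled (6 * m) {{m*n≢0 s (2 * ℓ) {{_}} {{m*n≢0 2 ℓ}}}} (begin
          suc Z * k * windowDeg
            ≡⟨ trans (lem₁ (suc Z) k windowDeg) (cong (k *_) (sym (∑∑-* s K (suc Z) (λ x y → S (x ++ y) * ⟦ Z <? sumL (deg Aᴳ y) x ⟧)))) ⟩
          k * ∑∑ s K (λ x y → suc Z * (S (x ++ y) * ⟦ Z <? sumL (deg Aᴳ y) x ⟧))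
            ≤⟨ *-monoʳ-≤ k (∑∑-mono s K λ x y _ _ → ≤-trans (≤-reflexive (lem₂ (suc Z) (S (x ++ y)) ⟦ Z <? sumL (deg Aᴳ y) x ⟧)) (*-monoʳ-≤ (S (x ++ y)) (markov Z (sumL (deg Aᴳ y) x)))) ⟩
          k * ∑∑ s K (λ x y → S (x ++ y) * sumL (deg Aᴳ y) x)
            ≤⟨ *-monoʳ-≤ k (window-degrees r K) ⟩
          k * (s * headDegree (suc r + K))
            ≡⟨ lem₃ k s (headDegree (suc r + K)) ⟩
          s * (k * headDegree (suc r + K))
            ≤⟨ *-monoʳ-≤ s (headDegree-bound (suc r + K)) ⟩
          s * (2 * ℓ * n ^ k)
            ≡⟨ trans (sym (*-assoc s (2 * ℓ) (n ^ k))) (cong (s * (2 * ℓ) *_) n^k≡P) ⟩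
          s * (2 * ℓ) * P ∎) hZ
        where
        open ≤-Reasoning
        lem₁ : ∀ z k x → z * k * x ≡ k * (z * x)
        lem₁ = solve-∀
        lem₂ : ∀ z a b → z * (a * b) ≡ a * (b * z)
        lem₂ = solve-∀
        lem₃ : ∀ a b c → a * (b * c) ≡ b * (a * c)
        lem₃ = solve-∀

      lowExc : ℕ
      lowExc = n ^ s * ∑Seq K (λ y → low y * ⟦ X <? richIn y ⟧)

      lowExc-bound : 6 * m * lowExc ≤ P
      lowExc-bound = ≤-trans (≤-reflexive (lem (6 * m) (n ^ s) _)) (*-monoʳ-≤ (n ^ s) (scaled (6 * m) {b = K} (begin
          g′ * suc X * ∑Seq K (λ y → low y * ⟦ X <? richIn y ⟧)
            ≡⟨ trans (*-assoc g′ (suc X) _) (cong (g′ *_) (sym (∑Seq-* K (suc X) (λ y → low y * ⟦ X <? richIn y ⟧)))) ⟩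
          g′ * ∑Seq K (λ y → suc X * (low y * ⟦ X <? richIn y ⟧))
            ≤⟨ *-monoʳ-≤ g′ (∑Seq-mono K λ y _ → ≤-trans (≤-reflexive (lem₂ (suc X) (low y) ⟦ X <? richIn y ⟧)) (*-monoʳ-≤ (low y) (markov X (richIn y)))) ⟩
          g′ * ∑Seq K (λ y → low y * richIn y)
            ≤⟨ low-richIn k′ ⟩
          K * n ^ K ∎) hX))
        where
        open ≤-Reasoning
        lem : ∀ a b c → a * (b * c) ≡ b * (a * c)
        lem = solve-∀
        lem₂ : ∀ z a b → z * (a * b) ≡ a * (b * z)
        lem₂ = solve-∀

      highExc : ℕ
      highExc = n ^ s * ∑Seq K (λ y → high y * ⟦ X′ <? poorIn y ⟧)

      highExc-bound : 2 * m * highExc ≤ P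
      highExc-bound = ≤-trans (≤-reflexive (lem (2 * m) (n ^ s) _)) (*-monoʳ-≤ (n ^ s) (scaled (2 * m) {b = 2 * K} (begin
          g * suc X′ * ∑Seq K (λ y → high y * ⟦ X′ <? poorIn y ⟧)
            ≡⟨ trans (*-assoc g (suc X′) _) (cong (g *_) (sym (∑Seq-* K (suc X′) (λ y → high y * ⟦ X′ <? poorIn y ⟧)))) ⟩
          g * ∑Seq K (λ y → suc X′ * (high y * ⟦ X′ <? poorIn y ⟧))
            ≤⟨ *-monoʳ-≤ g (∑Seq-mono K λ y _ → ≤-trans (≤-reflexive (lem₂ (suc X′) (high y) ⟦ X′ <? poorIn y ⟧)) (*-monoʳ-≤ (high y) (markov X′ (poorIn y)))) ⟩
          g * ∑Seq K (λ y → high y * poorIn y)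
            ≤⟨ high-poorIn k′ (≤-trans (m≤m+n g _) 2g≤g′) ⟩
          K * (2 * n ^ K)
            ≡⟨ lem₃ K (n ^ K) ⟩
          2 * K * n ^ K ∎) hX′))
        where
        open ≤-Reasoning
        lem : ∀ a b c → a * (b * c) ≡ b * (a * c)
        lem = solve-∀
        lem₂ : ∀ z a b → z * (a * b) ≡ a * (b * z)
        lem₂ = solve-∀
        lem₃ : ∀ k p → k * (2 * p) ≡ 2 * k * p
        lem₃ = solve-∀

      largeF smallF : List (Fin n) → ℕ
      largeF y = ⟦ ℓ + K ≤? F t y + R ⟧
      smallF y = ⟦ F t y ≤? ℓ + R′ ⟧

      first-suffices : ∀ {a b c d} → 1 ≤ a → 1 ≤ a + b + c + d
      first-suffices {a} h = ≤-trans h (≤-trans (m≤m+n a _) (≤-trans (m≤m+n _ _) (m≤m+n _ _)))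

      low-point : ∀ x y → length y ≡ K → S (x ++ y) * low y ≤
        largeF y + low y * ⟦ X <? richIn y ⟧ + S (x ++ y) * ⟦ Z <? sumL (deg Aᴳ y) x ⟧ + S (x ++ y) * ⟦ 0 <? edges Aᴳ x ⟧
      low-point x y len = ⟦⟧*-≤ (edges Aᴳ (x ++ y) ≟ ℓ) λ eq → ⟦⟧-≤ (g′ * sum (rich y) ≤? n) λ lo →
          let S≡1 = ⟦⟧-yes (edges Aᴳ (x ++ y) ≟ ℓ) eq ; low≡1 = ⟦⟧-yes (g′ * sum (rich y) ≤? n) lo in cases eq lo S≡1 low≡1
        where
        cases : edges Aᴳ (x ++ y) ≡ ℓ → g′ * sum (rich y) ≤ n → S (x ++ y) ≡ 1 → low y ≡ 1 → 1 ≤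
          largeF y + low y * ⟦ X <? richIn y ⟧ + S (x ++ y) * ⟦ Z <? sumL (deg Aᴳ y) x ⟧ + S (x ++ y) * ⟦ 0 <? edges Aᴳ x ⟧
        cases eq lo S≡1 low≡1 with X <? richIn y
        ... | yes X< = ≤-trans (≤-reflexive (sym (cong₂ _*_ low≡1 (⟦⟧-yes (X <? richIn y) X<)))) (≤-trans (m≤n+m _ (largeF y)) (≤-trans (m≤m+n _ _) (m≤m+n _ _)))
        ... | no X≮ with Z <? sumL (deg Aᴳ y) x
        ...   | yes Z< = ≤-trans (≤-reflexive (sym (cong₂ _*_ S≡1 (⟦⟧-yes (Z <? sumL (deg Aᴳ y) x) Z<)))) (≤-trans (m≤n+m _ (largeF y + low y * _)) (m≤m+n _ _))
        ...   | no Z≮ with 0 <? edges Aᴳ x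
        ...     | yes 0< = ≤-trans (≤-reflexive (sym (cong₂ _*_ S≡1 (⟦⟧-yes (0 <? edges Aᴳ x) 0<)))) (m≤n+m _ (largeF y + low y * _ + S (x ++ y) * _))
        ...     | no 0≮ = first-suffices {largeF y} (≤-reflexive (sym (⟦⟧-yes (ℓ + K ≤? F t y + R) (begin
            ℓ + K
              ≡⟨ cong₂ _+_ (trans (sym eq) (edges-++ Aᴳ x y)) (sym len) ⟩
            edges Aᴳ x + sumL (deg Aᴳ y) x + edges Aᴳ y + length y
              ≤⟨ +-monoˡ-≤ (length y) (+-monoˡ-≤ (edges Aᴳ y) (+-mono-≤ (≮⇒≥ 0≮) (≮⇒≥ Z≮))) ⟩
            Z + edges Aᴳ y + length y
              ≡⟨ +-assoc Z (edges Aᴳ y) (length y) ⟩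
            Z + (edges Aᴳ y + length y)
              ≤⟨ +-monoʳ-≤ Z (low-F y B (≤-trans (heavies-bound y 2g≤g′ lo) 2gt≤B)) ⟩
            Z + (F t y + (B + richIn y + richIn y * B + B * B))
              ≤⟨ +-monoʳ-≤ Z (+-monoʳ-≤ (F t y) (+-monoˡ-≤ (B * B) (+-mono-≤ (+-monoʳ-≤ B (≮⇒≥ X≮)) (*-monoˡ-≤ B (≮⇒≥ X≮))))) ⟩
            Z + (F t y + (B + X + X * B + B * B))
              ≡⟨ lem Z (F t y) (B + X + X * B + B * B) ⟩
            F t y + R ∎))))
          where
          open ≤-Reasoning
          lem : ∀ a b c → a + (b + c) ≡ b + (a + c)
          lem = solve-∀

      -- Here an upper bound for `F t` is wanted, and y spans at most the ℓ edges of the whole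
      -- sequence, so the window causes no error.
      high-point : ∀ x y → S (x ++ y) * high y ≤ smallF y + high y * ⟦ X′ <? poorIn y ⟧
      high-point x y = ⟦⟧*-≤ (edges Aᴳ (x ++ y) ≟ ℓ) λ eq → ⟦⟧-≤ (g′ * sum (poor y) ≤? n) λ hi → cases eq (⟦⟧-yes (g′ * sum (poor y) ≤? n) hi)
        where
        cases : edges Aᴳ (x ++ y) ≡ ℓ → high y ≡ 1 → 1 ≤ smallF y + high y * ⟦ X′ <? poorIn y ⟧
        cases eq high≡1 with X′ <? poorIn y
        ... | yes X< = ≤-trans (≤-reflexive (sym (cong₂ _*_ high≡1 (⟦⟧-yes (X′ <? poorIn y) X<)))) (m≤n+m _ (smallF y))
        ... | no X≮ = ≤-trans (≤-reflexive (sym (⟦⟧-yes (F t y ≤? ℓ + R′) (≤-trans (high-F y) (+-mono-≤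
            (≤-trans (m≤n+m _ (edges Aᴳ x + sumL (deg Aᴳ y) x)) (≤-reflexive (trans (sym (edges-++ Aᴳ x y)) eq))) (*-monoʳ-≤ t (≮⇒≥ X≮))))))) (m≤m+n (smallF y) _)

      E₂ : (List (Fin n) → ℕ) → ℕ
      E₂ f = ∑∑ s K (λ x y → S (x ++ y) * f y)

      low-sum : E₂ low ≤ n ^ s * ∑Seq K largeF + lowExc + windowDeg + windowEdge
      low-sum = ≤-trans (∑∑-mono s K λ x y _ → low-point x y) (≤-reflexive
        (trans (∑∑-+ s K (λ x y → largeF y + low y * ⟦ X <? richIn y ⟧ + S (x ++ y) * ⟦ Z <? sumL (deg Aᴳ y) x ⟧) (λ x y → S (x ++ y) * ⟦ 0 <? edges Aᴳ x ⟧))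
          (cong (_+ windowEdge) (trans (∑∑-+ s K (λ x y → largeF y + low y * ⟦ X <? richIn y ⟧) (λ x y → S (x ++ y) * ⟦ Z <? sumL (deg Aᴳ y) x ⟧))
            (cong (_+ windowDeg) (trans (∑∑-+ s K (λ _ y → largeF y) (λ _ y → low y * ⟦ X <? richIn y ⟧))
              (cong₂ _+_ (∑∑-right s K largeF) (∑∑-right s K (λ y → low y * ⟦ X <? richIn y ⟧)))))))))

      high-sum : E₂ high ≤ n ^ s * ∑Seq K smallF + highExc
      high-sum = ≤-trans (∑∑-mono s K λ x y _ _ → high-point x y) (≤-reflexive
        (trans (∑∑-+ s K (λ _ y → smallF y) (λ _ y → high y * ⟦ X′ <? poorIn y ⟧))
          (cong₂ _+_ (∑∑-right s K smallF) (∑∑-right s K (λ y → high y * ⟦ X′ <? poorIn y ⟧)))))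

      n^s≢0 : NonZero (n ^ s)
      n^s≢0 = m^n≢0 n s

      -- Three exceptional events of probability at most 1/(6m) each use up only half of the
      -- probability 1/m.
      largeF-likely : P ≤ m * E₂ low → n ^ K ≤ 2 * m * ∑Seq K largeF
      largeF-likely h = *-cancelˡ-≤ (n ^ s) {{n^s≢0}} (*-cancelˡ-≤ 3 (+-cancelʳ-≤ (P + P + P) _ _ (begin
          3 * P + (P + P + P)
            ≡⟨ lem₁ P ⟩
          6 * P
            ≤⟨ *-monoʳ-≤ 6 (≤-trans h (*-monoʳ-≤ m low-sum)) ⟩
          6 * (m * (n ^ s * ∑Seq K largeF + lowExc + windowDeg + windowEdge))
            ≡⟨ lem₂ m (n ^ s) (∑Seq K largeF) lowExc windowDeg windowEdge ⟩
          3 * (n ^ s * (2 * m * ∑Seq K largeF)) + (6 * m * lowExc + 6 * m * windowDeg + 6 * m * windowEdge)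
            ≤⟨ +-monoʳ-≤ (3 * (n ^ s * (2 * m * ∑Seq K largeF))) (+-mono-≤ (+-mono-≤ lowExc-bound windowDeg-bound) windowEdge-bound) ⟩
          3 * (n ^ s * (2 * m * ∑Seq K largeF)) + (P + P + P) ∎)))
        where
        open ≤-Reasoning
        lem₁ : ∀ p → 3 * p + (p + p + p) ≡ 6 * p
        lem₁ = solve-∀
        lem₂ : ∀ m q l a b c → 6 * (m * (q * l + a + b + c)) ≡ 3 * (q * (2 * m * l)) + (6 * m * a + 6 * m * b + 6 * m * c)
        lem₂ = solve-∀

      smallF-likely : P ≤ m * E₂ high → n ^ K ≤ 2 * m * ∑Seq K smallF
      smallF-likely h = *-cancelˡ-≤ (n ^ s) {{n^s≢0}} (+-cancelʳ-≤ P _ _ (begin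
          P + P
            ≡⟨ cong (P +_) (sym (+-identityʳ P)) ⟩
          2 * P
            ≤⟨ *-monoʳ-≤ 2 (≤-trans h (*-monoʳ-≤ m high-sum)) ⟩
          2 * (m * (n ^ s * ∑Seq K smallF + highExc))
            ≡⟨ lem m (n ^ s) (∑Seq K smallF) highExc ⟩
          n ^ s * (2 * m * ∑Seq K smallF) + 2 * m * highExc
            ≤⟨ +-monoʳ-≤ (n ^ s * (2 * m * ∑Seq K smallF)) highExc-bound ⟩
          n ^ s * (2 * m * ∑Seq K smallF) + P ∎))
        where
        open ≤-Reasoning
        lem : ∀ m q l a → 2 * (m * (q * l + a)) ≡ q * (2 * m * l) + 2 * m * a
        lem = solve-∀

      ll-likely : P ≤ m * E₂ low → n ^ K ≤ m * ∑Seq K (λ y → ⟦ edges ll y ≤? ℓ ⟧)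
      ll-likely h = *-cancelˡ-≤ (n ^ s) {{n^s≢0}} (begin
          P
            ≤⟨ h ⟩
          m * E₂ low
            ≤⟨ *-monoʳ-≤ m (∑∑-mono s K λ x y _ _ → ⟦⟧*-≤ (edges Aᴳ (x ++ y) ≟ ℓ) λ eq →
                 ≤-trans (bit≤1 (does (g′ * sum (rich y) ≤? n))) (≤-reflexive (sym (⟦⟧-yes (edges ll y ≤? ℓ) (few x y eq))))) ⟩
          m * ∑∑ s K (λ _ y → ⟦ edges ll y ≤? ℓ ⟧)
            ≡⟨ trans (cong (m *_) (∑∑-right s K (λ y → ⟦ edges ll y ≤? ℓ ⟧))) (lem m (n ^ s) _) ⟩
          n ^ s * (m * ∑Seq K (λ y → ⟦ edges ll y ≤? ℓ ⟧)) ∎)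
        where
        open ≤-Reasoning
        lem : ∀ a b c → a * (b * c) ≡ b * (a * c)
        lem = solve-∀
        few : ∀ x y → edges Aᴳ (x ++ y) ≡ ℓ → edges ll y ≤ ℓ
        few x y eq = ≤-trans (≤-trans (m≤m+n (edges ll y) _) (≤-trans (m≤m+n _ (edges hh y)) (≤-reflexive (sym (edges-split y)))))
          (≤-trans (m≤n+m _ (edges Aᴳ x + sumL (deg Aᴳ y) x)) (≤-reflexive (trans (sym (edges-++ Aᴳ x y)) eq)))

      -- For independent y and z, the value at y is large and that at z small with probability at
      -- least 1/(4m²), and then the two values differ by at least c.
      separated : n ^ K ≤ 2 * m * ∑Seq K largeF → n ^ K ≤ 2 * m * ∑Seq K smallF →
        n ^ K * (n ^ K * (c * c)) ≤ 4 * (m * m) * variance K (F t)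
      separated h₁ h₂ = begin
          n ^ K * (n ^ K * (c * c))
            ≤⟨ *-mono-≤ h₁ (*-monoˡ-≤ (c * c) h₂) ⟩
          2 * m * ∑Seq K largeF * (2 * m * ∑Seq K smallF * (c * c))
            ≡⟨ lem m (∑Seq K largeF) (∑Seq K smallF) (c * c) ⟩
          4 * (m * m) * (∑Seq K largeF * (∑Seq K smallF * (c * c)))
            ≡⟨ cong (4 * (m * m) *_) (trans (sym (∑Seq-*ʳ K (∑Seq K smallF * (c * c)) largeF)) (∑Seq-cong K λ y →
                 trans (cong (largeF y *_) (sym (∑Seq-*ʳ K (c * c) smallF))) (sym (∑Seq-* K (largeF y) (λ z → smallF z * (c * c)))))) ⟩
          4 * (m * m) * ∑∑ K K (λ y z → largeF y * (smallF z * (c * c)))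
            ≤⟨ *-monoʳ-≤ (4 * (m * m)) (∑∑-mono K K λ y z _ _ → ⟦⟧*-≤ (ℓ + K ≤? F t y + R) λ la → ⟦⟧*-≤ (F t z ≤? ℓ + R′) λ sm →
                 dist²-gap {F t y} {F t z} {c} (+-cancelʳ-≤ R (F t z + c) (F t y) (apart (F t y) (F t z) la sm))) ⟩
          4 * (m * m) * variance K (F t) ∎
        where
        open ≤-Reasoning
        lem : ∀ m a b c → 2 * m * a * (2 * m * b * c) ≡ 4 * (m * m) * (a * (b * c))
        lem = solve-∀
        lem₂ : ∀ l r c R → l + r + c + R ≡ l + (R + r + c)
        lem₂ = solve-∀
        apart : ∀ x z → ℓ + K ≤ x + R → z ≤ ℓ + R′ → z + c + R ≤ x + R
        apart x z la sm = begin
          z + c + R          ≤⟨ +-monoˡ-≤ R (+-monoˡ-≤ c sm) ⟩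
          ℓ + R′ + c + R     ≡⟨ lem₂ ℓ R′ c R ⟩
          ℓ + (R + R′ + c)   ≤⟨ +-monoʳ-≤ ℓ hc ⟩
          ℓ + K              ≤⟨ la ⟩
          x + R              ∎

      -- In the Efron-Stein bound the term with t² comes from the deficits; the term with M comes
      -- from the light degrees, through the bound on Λ.
      concentrated : suc k′ * k′ * Λ ≤ 4 * M * (n * n) → n ^ K * (n ^ K * (c * c)) ≤ 4 * (m * m) * variance K (F t) →
        g * (c * c) ≤ 16 * (m * m) * (g * K * (t * t) + 4 * M * (g + K))
      concentrated hΛ hs = *-cancelˡ-≤ (n ^ K) {{m^n≢0 n K}} (*-cancelˡ-≤ (n ^ K) {{m^n≢0 n K}} (begin
          n ^ K * (n ^ K * (g * (c * c)))
            ≡⟨ lem₁ (n ^ K) g (c * c) ⟩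
          g * (n ^ K * (n ^ K * (c * c)))
            ≤⟨ *-monoʳ-≤ g (≤-trans hs (*-monoʳ-≤ (4 * (m * m)) (F-variance t k′))) ⟩
          g * (4 * (m * m) * (4 * (K * (n ^ K * (n ^ K * (t * t) + S₂ k′)))))
            ≡⟨ lem₂ g (m * m) K (n ^ K) (t * t) (S₂ k′) ⟩
          n ^ K * (16 * (m * m) * (n ^ K * (g * K * (t * t)) + g * K * S₂ k′))
            ≤⟨ *-monoʳ-≤ (n ^ K) (*-monoʳ-≤ (16 * (m * m)) (+-monoʳ-≤ (n ^ K * (g * K * (t * t))) second)) ⟩
          n ^ K * (16 * (m * m) * (n ^ K * (g * K * (t * t)) + n ^ K * (4 * M * (g + K))))
            ≡⟨ lem₃ (n ^ K) (m * m) (g * K * (t * t)) (4 * M * (g + K)) ⟩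
          n ^ K * (n ^ K * (16 * (m * m) * (g * K * (t * t) + 4 * M * (g + K)))) ∎))
        where
        open ≤-Reasoning
        lem₁ : ∀ p g c → p * (p * (g * c)) ≡ g * (p * (p * c))
        lem₁ = solve-∀
        lem₂ : ∀ g m K p t s → g * (4 * m * (4 * (K * (p * (p * t + s))))) ≡ p * (16 * m * (p * (g * K * t) + g * K * s))
        lem₂ = solve-∀
        lem₃ : ∀ p m a b → p * (16 * m * (p * a + p * b)) ≡ p * (p * (16 * m * (a + b)))
        lem₃ = solve-∀
        lem₄ : ∀ n g K s → n * (g * K * s) ≡ K * (g * (n * s))
        lem₄ = solve-∀
        lem₅ : ∀ p k g K L → K * (p * (k * (g + k) * L)) ≡ p * (g + k) * (K * k * L)
        lem₅ = solve-∀
        lem₆ : ∀ p gk M n → p * gk * (4 * M * (n * n)) ≡ n * (n * p * (4 * M * gk))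
        lem₆ = solve-∀
        second : g * K * S₂ k′ ≤ n ^ K * (4 * M * (g + K))
        second = *-cancelˡ-≤ n (begin
          n * (g * K * S₂ k′)
            ≡⟨ lem₄ n g K (S₂ k′) ⟩
          K * (g * (n * S₂ k′))
            ≤⟨ *-monoʳ-≤ K (S₂-bound k′) ⟩
          K * (n ^ k′ * (k′ * (g + k′) * Λ))
            ≡⟨ lem₅ (n ^ k′) k′ g K Λ ⟩
          n ^ k′ * (g + k′) * (K * k′ * Λ)
            ≤⟨ *-monoʳ-≤ (n ^ k′ * (g + k′)) hΛ ⟩
          n ^ k′ * (g + k′) * (4 * M * (n * n))
            ≤⟨ *-monoˡ-≤ (4 * M * (n * n)) (*-monoʳ-≤ (n ^ k′) (+-monoʳ-≤ g (n≤1+n k′))) ⟩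
          n ^ k′ * (g + K) * (4 * M * (n * n))
            ≡⟨ lem₆ (n ^ k′) (g + K) M n ⟩
          n * (n ^ K * (4 * M * (g + K))) ∎)

    gap : P ≤ m * ∑∑ s K (λ x y → S (x ++ y) * low y) → ¬ (P ≤ m * ∑∑ s K (λ x y → S (x ++ y) * high y))
    gap h₁ h₂ = <⇒≱ hv (concentrated (Λ-bound k′ ℓ m M 2ℓ≤M mK<M (ll-likely h₁)) (separated (largeF-likely h₁) (smallF-likely h₂)))

-- The degree of the last vertex

module _ {n : ℕ} (G : Graph n) where
  private Aᴳ = A G

  -- If the last vertex of the sequence is not adjacent to w, the sequence is settled for Φ =
  -- `deg Aᴳ a w`, so the blocking bound applies. If w has degree d, each entry is adjacent to it
  -- with probability d/K on average, at most 1/m.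
  degree-atom : ∀ w d k m → 1 ≤ d → m * d ≤ suc k →
    suc k ^ suc k * (m * ∑Seq (suc k) (λ a → ⟦ deg Aᴳ a w ≟ d ⟧)) ≤ m * (k * n) ^ suc k + suc k ^ suc k * n ^ suc k
  degree-atom w d k m 1≤d md≤K = begin
      K ^ K * (m * ∑Seq K hit)
        ≤⟨ *-monoʳ-≤ (K ^ K) (*-cancelˡ-≤ K scaled-atom) ⟩
      K ^ K * (m * ∑Seq K st + n ^ K)
        ≡⟨ lem₁ (K ^ K) m (∑Seq K st) (n ^ K) ⟩
      m * (K ^ K * ∑Seq K st) + K ^ K * n ^ K
        ≤⟨ +-monoˡ-≤ (K ^ K * n ^ K) (*-monoʳ-≤ m (settled-bound Φ d Φ-mono Φ-super k 1≤d)) ⟩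
      m * (k * n) ^ K + K ^ K * n ^ K ∎
    where
    open ≤-Reasoning
    K = suc k
    Φ : List (Fin n) → ℕ
    Φ a = deg Aᴳ a w
    Φ-mono : ∀ u t → Φ t ≤ Φ (u ∷ t)
    Φ-mono u t = deg-∷ Aᴳ u t w
    Φ-super : ∀ c u t → Φ (c ++ t) + Φ (u ∷ t) ≤ Φ (c ++ u ∷ t) + Φ t
    Φ-super c u t = ≤-reflexive (trans (cong (_+ Φ (u ∷ t)) (deg-++ Aᴳ c t w))
      (trans (lem (Φ c) (Φ t) (Φ (u ∷ t))) (cong (_+ Φ t) (sym (deg-++ Aᴳ c (u ∷ t) w)))))
      where
      lem : ∀ a b c → a + b + c ≡ a + c + b
      lem = solve-∀
    st : List (Fin n) → ℕ
    st = settled Φ d Φ-mono Φ-super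
    hit : List (Fin n) → ℕ
    hit a = ⟦ Φ a ≟ d ⟧
    lem₁ : ∀ p m s q → p * (m * s + q) ≡ m * (p * s) + p * q
    lem₁ = solve-∀
    Y = sum (λ v → ∑Seq k (λ b → Aᴳ w v * hit (v ∷ b)))
    split-head : ∑Seq K hit ≤ ∑Seq K st + Y
    split-head = ≤-trans (∑-mono λ v → ≤-trans (∑Seq-mono k λ b _ → point v b) (≤-reflexive (∑Seq-+ k (λ b → st (v ∷ b)) (λ b → Aᴳ w v * hit (v ∷ b)))))
      (≤-reflexive (∑-distrib-+ (λ v → ∑Seq k (λ b → st (v ∷ b))) (λ v → ∑Seq k (λ b → Aᴳ w v * hit (v ∷ b)))))
      where
      point : ∀ v b → hit (v ∷ b) ≤ st (v ∷ b) + Aᴳ w v * hit (v ∷ b)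
      point v b with adj G w v
      ... | true  = ≤-trans (≤-reflexive (sym (+-identityʳ ⟦ 1 + Φ b ≟ d ⟧))) (m≤n+m (1 * ⟦ 1 + Φ b ≟ d ⟧) (⟦ Φ b ≟ d ⟧ * ⟦ 1 + Φ b ≟ d ⟧))
      ... | false = ≤-trans (≤-reflexive (sym (bit-idem (does (Φ b ≟ d))))) (m≤m+n _ 0)
    Y-bound : K * Y ≤ d * n ^ K
    Y-bound = begin
      K * Y
        ≡⟨ ∑Seq-sumL k (λ v a → Aᴳ w v * hit a) (λ v p → cong (λ z → Aᴳ w v * ⟦ z ≟ d ⟧) (deg-↭ Aᴳ w p)) ⟨
      ∑Seq K (λ a → sumL (λ v → Aᴳ w v * hit a) a)
        ≤⟨ ∑Seq-mono K (λ a _ → ≤-trans (≤-reflexive (trans (sumL-cong (λ v → *-comm (Aᴳ w v) (hit a)) a) (sumL-* (hit a) (Aᴳ w) a))) (⟦⟧*-≤ (Φ a ≟ d) ≤-reflexive)) ⟩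
      ∑Seq {n} K (λ _ → d)
        ≡⟨ trans (∑Seq-const {n} K d) (*-comm (n ^ K) d) ⟩
      d * n ^ K ∎
    scaled-atom : K * (m * ∑Seq K hit) ≤ K * (m * ∑Seq K st + n ^ K)
    scaled-atom = begin
      K * (m * ∑Seq K hit)
        ≤⟨ *-monoʳ-≤ K (*-monoʳ-≤ m split-head) ⟩
      K * (m * (∑Seq K st + Y))
        ≡⟨ lem₂ K m (∑Seq K st) Y ⟩
      K * (m * ∑Seq K st) + m * (K * Y)
        ≤⟨ +-monoʳ-≤ (K * (m * ∑Seq K st)) (≤-trans (*-monoʳ-≤ m Y-bound) (≤-trans (≤-reflexive (sym (*-assoc m d (n ^ K)))) (*-monoˡ-≤ (n ^ K) md≤K))) ⟩
      K * (m * ∑Seq K st) + K * n ^ K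
        ≡⟨ *-distribˡ-+ K (m * ∑Seq K st) (n ^ K) ⟨
      K * (m * ∑Seq K st + n ^ K) ∎
      where
      lem₂ : ∀ k m s y → k * (m * (s + y)) ≡ k * (m * s) + m * (k * y)
      lem₂ = solve-∀

  edges-super : ∀ c u t → edges Aᴳ (c ++ t) + edges Aᴳ (u ∷ t) ≤ edges Aᴳ (c ++ u ∷ t) + edges Aᴳ t
  edges-super c u t = begin
      edges Aᴳ (c ++ t) + (deg Aᴳ t u + edges Aᴳ t)
        ≡⟨ lem (edges Aᴳ (c ++ t)) (deg Aᴳ t u) (edges Aᴳ t) ⟩
      deg Aᴳ t u + edges Aᴳ (c ++ t) + edges Aᴳ t
        ≤⟨ +-monoˡ-≤ (edges Aᴳ t) (+-monoˡ-≤ (edges Aᴳ (c ++ t)) (≤-trans (m≤n+m _ (deg Aᴳ c u)) (≤-reflexive (sym (deg-++ Aᴳ c t u))))) ⟩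
      edges Aᴳ (u ∷ c ++ t) + edges Aᴳ t
        ≡⟨ cong (_+ edges Aᴳ t) (edges-↭ Aᴳ (A-sym G) (shift u c t)) ⟨
      edges Aᴳ (c ++ u ∷ t) + edges Aᴳ t ∎
    where
    open ≤-Reasoning
    lem : ∀ a b c → a + (b + c) ≡ b + a + c
    lem = solve-∀

-- Search for the typical degree of the last vertex

headDeg : ∀ {n} → Graph n → List (Fin n) → List (Fin n) → ℕ
headDeg G []      y = 0
headDeg G (u ∷ _) y = deg (A G) y u

module Assembly {n : ℕ} (G : Graph n) (ℓ g g′ m r k′ T : ℕ) .{{_ : NonZero n}} .{{_ : NonZero m}} where
  open Window G ℓ
  private
    Aᴳ = A G
    s K k P : ℕ
    s = suc (suc r)
    K = suc k′
    k = s + K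
    P = n ^ s * n ^ K
    module Th (t : ℕ) = Threshold G g g′ t

  E₂ : (List (Fin n) → List (Fin n) → ℕ) → ℕ
  E₂ f = ∑∑ s K (λ x y → S (x ++ y) * f x y)

  module _
    (dichotomy : ∀ t → 1 ≤ t → t ≤ T → (m * E₂ (λ _ y → Th.low t y) ≤ P) ⊎ (m * E₂ (λ _ y → Th.high t y) ≤ P))
    (hEdge : m * E₂ (λ x _ → ⟦ 0 <? edges Aᴳ x ⟧) ≤ P)
    (hs : 2 * m * (2 * m) * g′ ≤ s) (m≤g′ : m ≤ g′) (mT≤K : m * T ≤ K) (hT : 2 * ℓ * m ≤ T * k) (1≤ℓ : 1 ≤ ℓ)
    where

    private
      edgy : ℕ
      edgy = E₂ (λ x _ → ⟦ 0 <? edges Aᴳ x ⟧)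

      -- Only neighbours in y are counted, because the head is independent of y; neighbours inside
      -- the window are covered by `edgy`.
      UL UH UE : ℕ → ℕ
      UL t = E₂ (λ x y → ⟦ headDeg G x y <? t ⟧)
      UH t = E₂ (λ x y → ⟦ t ≤? headDeg G x y ⟧)
      UE t = E₂ (λ x y → ⟦ headDeg G x y ≟ t ⟧)

      module _ (t : ℕ) where
        open Th t

        neither : List (Fin n) → ℕ
        neither y = ⟦ n <? g′ * sum (rich y) ⟧ * ⟦ n <? g′ * sum (poor y) ⟧

        Σ=ℓ : List (Fin n) → List (Fin n) → ℕ
        Σ=ℓ x y = ⟦ sumL (deg Aᴳ y) x ≟ ℓ ∸ edges Aᴳ y ⟧

        mid : ℕ
        mid = ∑∑ s K (λ x y → neither y * Σ=ℓ x y)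

        -- If y is neither low nor high, more than n/g′ vertices lie on either side of t, and Q = 2m
        -- is the level of anticoncentration allowed by s ≥ (2m)²g′. A window without edges has to
        -- hit the degree sum in `Σ=ℓ` exactly.
        mid-bound : m * mid ≤ P
        mid-bound = *-cancelˡ-≤ 2 (begin
            2 * (m * mid)
              ≡⟨ trans (sym (*-assoc 2 m mid)) (cong (2 * m *_) (∑Seq-comm s K (λ x y → neither y * Σ=ℓ x y))) ⟩
            2 * m * ∑Seq K (λ y → ∑Seq s (λ x → neither y * Σ=ℓ x y))
              ≡⟨ ∑Seq-* K (2 * m) (λ y → ∑Seq s (λ x → neither y * Σ=ℓ x y)) ⟨
            ∑Seq K (λ y → 2 * m * ∑Seq s (λ x → neither y * Σ=ℓ x y))
              ≤⟨ ∑Seq-mono K (λ y _ → each y) ⟩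
            ∑Seq {n} K (λ _ → 2 * n ^ s)
              ≡⟨ trans (∑Seq-const {n} K (2 * n ^ s)) (lem (n ^ K) (n ^ s)) ⟩
            2 * P ∎)
          where
          open ≤-Reasoning
          lem : ∀ a b → a * (2 * b) ≡ 2 * (b * a)
          lem = solve-∀
          enough : ∀ c → n < g′ * c → 2 * m * (2 * m) * n ≤ s * c
          enough c h = ≤-trans (*-monoʳ-≤ (2 * m * (2 * m)) (<⇒≤ h)) (≤-trans (≤-reflexive (sym (*-assoc (2 * m * (2 * m)) g′ c))) (*-monoˡ-≤ c hs))
          each : ∀ y → 2 * m * ∑Seq s (λ x → neither y * Σ=ℓ x y) ≤ 2 * n ^ s
          each y = ≤-trans (≤-reflexive (trans (cong (2 * m *_) (∑Seq-* s (neither y) (λ x → Σ=ℓ x y))) (lem₂ (2 * m) ⟦ n <? g′ * sum (rich y) ⟧ ⟦ n <? g′ * sum (poor y) ⟧ _)))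
            (⟦⟧*-≤ (n <? g′ * sum (rich y)) λ ri → ⟦⟧*-≤ (n <? g′ * sum (poor y)) λ po →
              anticoncentration (deg Aᴳ y) t s (2 * m) (ℓ ∸ edges Aᴳ y) {{it}} {{m*n≢0 2 m}} (enough _ ri) (enough _ po))
            where
            it : NonZero n
            it = >-nonZero (n≢0⇒n>0 (≢-nonZero⁻¹ n))
            lem₂ : ∀ a b c x → a * (b * c * x) ≡ b * (c * (a * x))
            lem₂ = solve-∀

        S-mid : ∀ x y → S (x ++ y) ≤ S (x ++ y) * ⟦ 0 <? edges Aᴳ x ⟧ + Σ=ℓ x y
        S-mid x y = ⟦⟧-≤ (edges Aᴳ (x ++ y) ≟ ℓ) λ eq → cases eq (⟦⟧-yes (edges Aᴳ (x ++ y) ≟ ℓ) eq)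
          where
          cases : edges Aᴳ (x ++ y) ≡ ℓ → S (x ++ y) ≡ 1 → 1 ≤ S (x ++ y) * ⟦ 0 <? edges Aᴳ x ⟧ + Σ=ℓ x y
          cases eq S≡1 with 0 <? edges Aᴳ x
          ... | yes 0< = ≤-trans (≤-reflexive (sym (cong₂ _*_ S≡1 (⟦⟧-yes (0 <? edges Aᴳ x) 0<)))) (m≤m+n _ _)
          ... | no 0≮ = ≤-trans (≤-reflexive (sym (⟦⟧-yes (sumL (deg Aᴳ y) x ≟ ℓ ∸ edges Aᴳ y)
                (trans (sym (m+n∸n≡m (sumL (deg Aᴳ y) x) (edges Aᴳ y))) (cong (_∸ edges Aᴳ y)
                  (trans (cong (λ z → z + sumL (deg Aᴳ y) x + edges Aᴳ y) (sym (n≤0⇒n≡0 (≮⇒≥ 0≮)))) (trans (sym (edges-++ Aᴳ x y)) eq))))))) (m≤n+m _ _)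

        module _ (q : List (Fin n) → List (Fin n) → ℕ) (q≤1 : ∀ x y → q x y ≤ 1) where

          three-way : ∀ (good bad : List (Fin n) → ℕ) →
            (∀ y → 1 ≤ good y + bad y + neither y) →
            E₂ q ≤ E₂ (λ _ y → good y) + ∑∑ s K (λ x y → q x y * bad y) + (edgy + mid)
          three-way good bad cover = ≤-trans (∑∑-mono s K λ x y _ _ → point x y)
              (≤-reflexive (trans (∑∑-+ s K (λ x y → S (x ++ y) * good y + q x y * bad y) (λ x y → S (x ++ y) * ⟦ 0 <? edges Aᴳ x ⟧ + neither y * Σ=ℓ x y))
                (cong₂ _+_ (∑∑-+ s K (λ x y → S (x ++ y) * good y) (λ x y → q x y * bad y)) (∑∑-+ s K (λ x y → S (x ++ y) * ⟦ 0 <? edges Aᴳ x ⟧) (λ x y → neither y * Σ=ℓ x y)))))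
            where
            open ≤-Reasoning
            point : ∀ x y → S (x ++ y) * q x y ≤
              (S (x ++ y) * good y + q x y * bad y) + (S (x ++ y) * ⟦ 0 <? edges Aᴳ x ⟧ + neither y * Σ=ℓ x y)
            point x y with good y in gd | bad y in bd | neither y in ne | cover y
            ... | suc a | _ | _ | _ = ≤-trans (*-monoʳ-≤ (S (x ++ y)) (≤-trans (q≤1 x y) (s≤s z≤n))) (≤-trans (m≤m+n _ _) (m≤m+n _ _))
            ... | zero | suc b | _ | _ = ≤-trans (≤-trans (*-mono-≤ (bit≤1 (does (edges Aᴳ (x ++ y) ≟ ℓ))) (≤-refl {q x y})) (≤-trans (≤-reflexive (*-comm 1 (q x y))) (*-monoʳ-≤ (q x y) (s≤s (z≤n {b})))))
              (≤-trans (m≤n+m _ (S (x ++ y) * 0)) (m≤m+n _ _))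
            ... | zero | zero | suc c | _ = ≤-trans (≤-trans (*-monoʳ-≤ (S (x ++ y)) (q≤1 x y)) (≤-trans (≤-reflexive (*-identityʳ _)) (≤-trans (S-mid x y) (+-monoʳ-≤ (S (x ++ y) * ⟦ 0 <? edges Aᴳ x ⟧) (m≤m+n (Σ=ℓ x y) (c * Σ=ℓ x y)))))) (m≤n+m (S (x ++ y) * ⟦ 0 <? edges Aᴳ x ⟧ + suc c * Σ=ℓ x y) (S (x ++ y) * 0 + q x y * 0))
            ... | zero | zero | zero | ()

        cover-low : ∀ y → 1 ≤ low y + high y + neither y
        cover-low y with g′ * sum (rich y) ≤? n | g′ * sum (poor y) ≤? n
        ... | yes lo | _ = ≤-trans (≤-reflexive (sym (⟦⟧-yes (g′ * sum (rich y) ≤? n) lo))) (≤-trans (m≤m+n _ (high y)) (m≤m+n _ _))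
        ... | no _ | yes hi = ≤-trans (≤-reflexive (sym (⟦⟧-yes (g′ * sum (poor y) ≤? n) hi))) (≤-trans (m≤n+m _ (low y)) (m≤m+n _ _))
        ... | no lo | no hi = ≤-trans (≤-reflexive (sym (cong₂ _*_ (⟦⟧-yes (n <? g′ * sum (rich y)) (≰⇒> lo)) (⟦⟧-yes (n <? g′ * sum (poor y)) (≰⇒> hi))))) (m≤n+m _ (low y + high y))

        cover-high : ∀ y → 1 ≤ high y + low y + neither y
        cover-high y = subst (λ z → 1 ≤ z + neither y) (+-comm (low y) (high y)) (cover-low y)

        -- The head of x is independent of y, and for y with `f y` the vertices in `h y` are at most
        -- a proportion 1/g′ ≤ 1/m.
        fresh-bound : ∀ (f : List (Fin n) → ℕ) (h : List (Fin n) → Fin n → ℕ) →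
          (∀ y → g′ * (f y * sum (h y)) ≤ n) →
          (q : List (Fin n) → List (Fin n) → ℕ) → (∀ u x y → q (u ∷ x) y ≡ h y u) →
          m * ∑∑ s K (λ x y → q x y * f y) ≤ P
        fresh-bound f h hf q hq = ≤-trans (*-monoˡ-≤ (∑∑ s K (λ x y → q x y * f y)) m≤g′) (begin
            g′ * ∑∑ s K (λ x y → q x y * f y)
              ≡⟨ cong (g′ *_) (∑Seq-comm s K (λ x y → q x y * f y)) ⟩
            g′ * ∑Seq K (λ y → ∑Seq s (λ x → q x y * f y))
              ≡⟨ cong (g′ *_) (∑Seq-cong K λ y → trans (sum-cong-≗ λ u → trans (∑Seq-cong (suc r) λ x → trans (cong (_* f y) (hq u x y)) (*-comm (h y u) (f y))) (∑Seq-const {n} (suc r) (f y * h y u)))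
                   (trans (sym (*-distribˡ-sum (n ^ suc r) (λ u → f y * h y u))) (cong (n ^ suc r *_) (sym (*-distribˡ-sum (f y) (h y)))))) ⟩
            g′ * ∑Seq K (λ y → n ^ suc r * (f y * sum (h y)))
              ≡⟨ trans (cong (g′ *_) (∑Seq-* K (n ^ suc r) (λ y → f y * sum (h y)))) (trans (lem g′ (n ^ suc r) _) (cong (n ^ suc r *_) (sym (∑Seq-* K g′ (λ y → f y * sum (h y)))))) ⟩
            n ^ suc r * ∑Seq K (λ y → g′ * (f y * sum (h y)))
              ≤⟨ *-monoʳ-≤ (n ^ suc r) (≤-trans (∑Seq-mono K λ y _ → hf y) (≤-reflexive (∑Seq-const {n} K n))) ⟩
            n ^ suc r * (n ^ K * n)
              ≡⟨ lem₂ (n ^ suc r) (n ^ K) n ⟩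
            P ∎)
          where
          open ≤-Reasoning
          lem : ∀ a b c → a * (b * c) ≡ b * (a * c)
          lem = solve-∀
          lem₂ : ∀ a b n → a * (b * n) ≡ n * a * b
          lem₂ = solve-∀

        collect : ∀ {U a b} → U ≤ a + b + (edgy + mid) → m * a ≤ P → m * b ≤ P → m * U ≤ 4 * P
        collect {U} {a} {b} hU ha hb = begin
            m * U                                       ≤⟨ *-monoʳ-≤ m hU ⟩
            m * (a + b + (edgy + mid))                  ≡⟨ lem m a b edgy mid ⟩
            m * a + (m * b + (m * edgy + (m * mid + 0))) ≤⟨ +-mono-≤ ha (+-mono-≤ hb (+-mono-≤ hEdge (+-mono-≤ mid-bound z≤n))) ⟩
            4 * P                                       ∎
          where
          open ≤-Reasoning
          lem : ∀ m a b c d → m * (a + b + (c + d)) ≡ m * a + (m * b + (m * c + (m * d + 0)))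
          lem = solve-∀

        -- Unless one of four rare events occurs, y is high and the head, being independent of y,
        -- has at least t neighbours in it. The case of `UH-small` is symmetric.
        UL-small : m * E₂ (λ _ y → low y) ≤ P → m * UL t ≤ 4 * P
        UL-small h = collect (three-way (λ x y → ⟦ headDeg G x y <? t ⟧) (λ x y → bit≤1 _) low high cover-low) h
          (fresh-bound high poor high-fresh (λ x y → ⟦ headDeg G x y <? t ⟧) (λ u x y → refl))

        UH-small : m * E₂ (λ _ y → high y) ≤ P → m * UH t ≤ 4 * P
        UH-small h = collect (three-way (λ x y → ⟦ t ≤? headDeg G x y ⟧) (λ x y → bit≤1 _) high low cover-high) h
          (fresh-bound low rich low-fresh (λ x y → ⟦ t ≤? headDeg G x y ⟧) (λ u x y → refl))

      UL-zero : m * UL 0 ≤ 4 * P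
      UL-zero = ≤-trans (*-monoʳ-≤ m (∑∑-mono s K {g = λ _ _ → 0} λ x y _ _ → ≤-reflexive (*-zeroʳ (S (x ++ y)))))
        (≤-trans (≤-reflexive (trans (cong (m *_) (trans (∑∑-right {n} s K (λ _ → 0)) (trans (cong (n ^ s *_) (trans (∑Seq-const {n} K 0) (*-zeroʳ (n ^ K)))) (*-zeroʳ (n ^ s))))) (*-zeroʳ m))) z≤n)

      UH-top : m * UH (suc T) ≤ 4 * P
      UH-top = *-cancelˡ-≤ (T * k) {{m*n≢0 T k {{T≢0}}}} (begin
          T * k * (m * UH (suc T))
            ≤⟨ *-monoˡ-≤ (m * UH (suc T)) (*-monoˡ-≤ k (n≤1+n T)) ⟩
          suc T * k * (m * UH (suc T))
            ≡⟨ trans (lem₁ (suc T) k m (UH (suc T))) (cong (λ z → k * (m * z)) (sym (∑∑-* s K (suc T) (λ x y → S (x ++ y) * ⟦ suc T ≤? headDeg G x y ⟧)))) ⟩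
          k * (m * ∑∑ s K (λ x y → suc T * (S (x ++ y) * ⟦ suc T ≤? headDeg G x y ⟧)))
            ≤⟨ *-monoʳ-≤ k (*-monoʳ-≤ m (∑∑-mono s K λ x y _ _ → ≤-trans (≤-reflexive (lem₂ (suc T) (S (x ++ y)) ⟦ suc T ≤? headDeg G x y ⟧))
                 (*-monoʳ-≤ (S (x ++ y)) (⟦⟧*-≤ (suc T ≤? headDeg G x y) id)))) ⟩
          k * (m * E₂ (headDeg G))
            ≤⟨ *-monoʳ-≤ k (*-monoʳ-≤ m head-sum) ⟩
          k * (m * headDegree (suc r + K))
            ≡⟨ lem₃ k m (headDegree (suc r + K)) ⟩
          m * (k * headDegree (suc r + K))
            ≤⟨ *-monoʳ-≤ m (headDegree-bound (suc r + K)) ⟩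
          m * (2 * ℓ * n ^ k)
            ≡⟨ trans (lem₄ m (2 * ℓ) (n ^ k)) (cong (2 * ℓ * m *_) (^-distribˡ-+-* n s K)) ⟩
          2 * ℓ * m * P
            ≤⟨ *-mono-≤ hT (m≤m+n P _) ⟩
          T * k * (4 * P) ∎)
        where
        open ≤-Reasoning
        T≢0 : NonZero T
        T≢0 = ≢-nonZero λ { refl → <⇒≱ (≤-trans 1≤ℓ (≤-trans (m≤m+n ℓ _) (m≤m*n (2 * ℓ) m))) hT }
        lem₁ : ∀ t k m u → t * k * (m * u) ≡ k * (m * (t * u))
        lem₁ = solve-∀
        lem₂ : ∀ t a b → t * (a * b) ≡ a * (b * t)
        lem₂ = solve-∀
        lem₃ : ∀ a b c → a * (b * c) ≡ b * (a * c)
        lem₃ = solve-∀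
        lem₄ : ∀ m l p → m * (l * p) ≡ l * m * p
        lem₄ = solve-∀
        head-sum : E₂ (headDeg G) ≤ headDegree (suc r + K)
        head-sum = ∑-mono λ u → ≤-trans (∑∑-mono (suc r) K λ a y _ _ → *-monoʳ-≤ (S (u ∷ a ++ y)) (≤-trans (m≤n+m (deg Aᴳ y u) (deg Aᴳ a u)) (≤-reflexive (sym (deg-++ Aᴳ a y u)))))
          (≤-reflexive (sym (∑Seq-++ (suc r) K (λ a → S (u ∷ a) * deg Aᴳ a u))))

      -- The threshold descends from T. While high sequences are the rare ones, degrees at or above
      -- the threshold are rare too; at the first threshold with rare low sequences, smaller degrees
      -- are also rare and d is found. Below 0 there is no degree at all, so the search ends there
      -- at the latest.
      search : ∀ t → t ≤ T → m * UH (suc t) ≤ 4 * P → Σ ℕ λ d → d ≤ T × m * UL d ≤ 4 * P × m * UH (suc d) ≤ 4 * P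
      search zero    _   h = 0 , z≤n , UL-zero , h
      search (suc t) t≤T h with dichotomy (suc t) (s≤s z≤n) t≤T
      ... | inj₁ lo = suc t , t≤T , UL-small (suc t) lo , h
      ... | inj₂ hi = search t (≤-trans (n≤1+n t) t≤T) (UH-small (suc t) hi)

      total : ∀ d → ∑Seq k S ≤ UL d + UE d + UH (suc d)
      total d = ≤-trans (≤-reflexive (∑Seq-++ s K S)) (≤-trans (∑∑-mono s K {f = λ x y → S (x ++ y)} λ x y _ _ → point x y)
          (≤-reflexive (trans (∑∑-+ s K (λ x y → S (x ++ y) * ⟦ headDeg G x y <? d ⟧ + S (x ++ y) * ⟦ headDeg G x y ≟ d ⟧) (λ x y → S (x ++ y) * ⟦ suc d ≤? headDeg G x y ⟧))
            (cong (_+ UH (suc d)) (∑∑-+ s K (λ x y → S (x ++ y) * ⟦ headDeg G x y <? d ⟧) (λ x y → S (x ++ y) * ⟦ headDeg G x y ≟ d ⟧))))))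
        where
        trichotomy : ∀ h → 1 ≤ ⟦ h <? d ⟧ + ⟦ h ≟ d ⟧ + ⟦ suc d ≤? h ⟧
        trichotomy h with h <? d
        ... | yes p = ≤-trans (≤-reflexive (sym (⟦⟧-yes (h <? d) p))) (≤-trans (m≤m+n _ ⟦ h ≟ d ⟧) (m≤m+n _ _))
        ... | no p with h ≟ d
        ...   | yes q = ≤-trans (≤-reflexive (sym (⟦⟧-yes (h ≟ d) q))) (≤-trans (m≤n+m _ ⟦ h <? d ⟧) (m≤m+n _ _))
        ...   | no q = ≤-trans (≤-reflexive (sym (⟦⟧-yes (suc d ≤? h) (≤∧≢⇒< (≮⇒≥ p) (q ∘ sym))))) (m≤n+m _ (⟦ h <? d ⟧ + ⟦ h ≟ d ⟧))
        point : ∀ x y → S (x ++ y) ≤ S (x ++ y) * ⟦ headDeg G x y <? d ⟧ + S (x ++ y) * ⟦ headDeg G x y ≟ d ⟧ + S (x ++ y) * ⟦ suc d ≤? headDeg G x y ⟧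
        point x y = ≤-trans (≤-reflexive (sym (*-identityʳ (S (x ++ y))))) (≤-trans (*-monoʳ-≤ (S (x ++ y)) (trichotomy (headDeg G x y)))
          (≤-reflexive (lem (S (x ++ y)) ⟦ headDeg G x y <? d ⟧ ⟦ headDeg G x y ≟ d ⟧ ⟦ suc d ≤? headDeg G x y ⟧)))
          where
          lem : ∀ s a b c → s * (a + b + c) ≡ s * a + s * b + s * c
          lem = solve-∀

      -- The probability is at most (i/(i + 1))^(i + 1) + c/m. The index is existential because
      -- degree 0 is treated with k steps and positive degrees with K steps; the main term is at
      -- most 1/e for every i.
      Bound : ℕ → ℕ → Set
      Bound c X = Σ ℕ λ i → m * (suc i ^ suc i * X) ≤ (m * i ^ suc i + c * suc i ^ suc i) * n ^ k

      -- If the window spans no edge and the head has no neighbour in y, the head is isolated and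
      -- the rest has ℓ edges already: the sequence is settled for the number of edges.
      UE-zero : Bound 1 (UE 0)
      UE-zero = suc r + K , (begin
          m * (k ^ k * UE 0)
            ≤⟨ *-monoʳ-≤ m (*-monoʳ-≤ (k ^ k) isolated) ⟩
          m * (k ^ k * (∑Seq k st + edgy))
            ≡⟨ lem m (k ^ k) (∑Seq k st) edgy ⟩
          m * (k ^ k * ∑Seq k st) + k ^ k * (m * edgy)
            ≤⟨ +-mono-≤ (*-monoʳ-≤ m (settled-bound (edges Aᴳ) ℓ e-mono (edges-super G) (suc r + K) 1≤ℓ)) (*-monoʳ-≤ (k ^ k) hEdge) ⟩
          m * ((suc r + K) * n) ^ k + k ^ k * P
            ≡⟨ cong₂ (λ x y → m * x + k ^ k * y) (^-distribʳ-* k (suc r + K) n) (sym (^-distribˡ-+-* n s K)) ⟩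
          m * ((suc r + K) ^ k * n ^ k) + k ^ k * n ^ k
            ≡⟨ lem₂ m ((suc r + K) ^ k) (n ^ k) (k ^ k) ⟩
          (m * (suc r + K) ^ k + 1 * k ^ k) * n ^ k ∎)
        where
        open ≤-Reasoning
        e-mono : ∀ u t → edges Aᴳ t ≤ edges Aᴳ (u ∷ t)
        e-mono u t = m≤n+m _ (deg Aᴳ t u)
        st = settled (edges Aᴳ) ℓ e-mono (edges-super G)
        lem : ∀ m q a b → m * (q * (a + b)) ≡ m * (q * a) + q * (m * b)
        lem = solve-∀
        lem₂ : ∀ m q p t → m * (q * p) + t * p ≡ (m * q + 1 * t) * p
        lem₂ = solve-∀
        point : ∀ u x y → S (u ∷ x ++ y) * ⟦ deg Aᴳ y u ≟ 0 ⟧ ≤ st (u ∷ x ++ y) + S (u ∷ x ++ y) * ⟦ 0 <? edges Aᴳ (u ∷ x) ⟧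
        point u x y = ⟦⟧*-≤ (edges Aᴳ (u ∷ x ++ y) ≟ ℓ) λ eq → ⟦⟧-≤ (deg Aᴳ y u ≟ 0) λ d≡0 → cases eq d≡0
          where
          cases : edges Aᴳ (u ∷ x ++ y) ≡ ℓ → deg Aᴳ y u ≡ 0 → 1 ≤ st (u ∷ x ++ y) + S (u ∷ x ++ y) * ⟦ 0 <? edges Aᴳ (u ∷ x) ⟧
          cases eq d≡0 with 0 <? edges Aᴳ (u ∷ x)
          ... | yes 0< = ≤-trans (≤-reflexive (sym (cong₂ _*_ (⟦⟧-yes (edges Aᴳ (u ∷ x ++ y) ≟ ℓ) eq) (⟦⟧-yes (0 <? edges Aᴳ (u ∷ x)) 0<)))) (m≤n+m _ (st (u ∷ x ++ y)))
          ... | no 0≮ = ≤-trans (≤-reflexive (sym (cong₂ _*_ (⟦⟧-yes (edges Aᴳ (x ++ y) ≟ ℓ) tail≡ℓ) (⟦⟧-yes (edges Aᴳ (u ∷ x ++ y) ≟ ℓ) eq)))) (m≤m+n _ _)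
            where
            degx≡0 : deg Aᴳ x u ≡ 0
            degx≡0 = m+n≡0⇒m≡0 (deg Aᴳ x u) (n≤0⇒n≡0 (≮⇒≥ 0≮))
            tail≡ℓ : edges Aᴳ (x ++ y) ≡ ℓ
            tail≡ℓ = trans (cong (_+ edges Aᴳ (x ++ y)) (sym (trans (deg-++ Aᴳ x y u) (cong₂ _+_ degx≡0 d≡0)))) eq
        isolated : UE 0 ≤ ∑Seq k st + edgy
        isolated = ≤-trans (∑-mono λ u → ∑∑-mono (suc r) K λ x y _ _ → point u x y)
          (≤-reflexive (trans (sum-cong-≗ λ u → ∑∑-+ (suc r) K (λ x y → st (u ∷ x ++ y)) (λ x y → S (u ∷ x ++ y) * ⟦ 0 <? edges Aᴳ (u ∷ x) ⟧))
            (trans (∑-distrib-+ (λ u → ∑∑ (suc r) K (λ x y → st (u ∷ x ++ y))) (λ u → ∑∑ (suc r) K (λ x y → S (u ∷ x ++ y) * ⟦ 0 <? edges Aᴳ (u ∷ x) ⟧)))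
              (cong (_+ edgy) (sum-cong-≗ λ u → sym (∑Seq-++ (suc r) K (λ a → st (u ∷ a))))))))

      -- The condition on the number of edges is dropped: for every fixed head it is already
      -- unlikely enough to have exactly d neighbours in y.
      UE-suc : ∀ d → 1 ≤ d → d ≤ T → Bound 1 (UE d)
      UE-suc d 1≤d d≤T = k′ , (begin
          m * (K ^ K * UE d)
            ≤⟨ *-monoʳ-≤ m (*-monoʳ-≤ (K ^ K) (≤-trans (∑-mono λ u → ∑∑-mono (suc r) K λ x y _ _ → ≤-trans (*-monoˡ-≤ ⟦ deg Aᴳ y u ≟ d ⟧ (bit≤1 (does (edges Aᴳ (u ∷ x ++ y) ≟ ℓ)))) (≤-reflexive (+-identityʳ _)))
                 (≤-reflexive (sum-cong-≗ λ u → ∑∑-right (suc r) K (λ y → ⟦ deg Aᴳ y u ≟ d ⟧))))) ⟩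
          m * (K ^ K * sum (λ u → n ^ suc r * ∑Seq K (λ y → ⟦ deg Aᴳ y u ≟ d ⟧)))
            ≡⟨ trans (cong (m *_) (*-distribˡ-sum (K ^ K) (λ u → n ^ suc r * ∑Seq K (λ y → ⟦ deg Aᴳ y u ≟ d ⟧)))) (*-distribˡ-sum m (λ u → K ^ K * (n ^ suc r * ∑Seq K (λ y → ⟦ deg Aᴳ y u ≟ d ⟧)))) ⟩
          sum (λ u → m * (K ^ K * (n ^ suc r * ∑Seq K (λ y → ⟦ deg Aᴳ y u ≟ d ⟧))))
            ≤⟨ ∑-mono (λ u → ≤-trans (≤-reflexive (lem m (K ^ K) (n ^ suc r) (∑Seq K (λ y → ⟦ deg Aᴳ y u ≟ d ⟧))))
                 (*-monoʳ-≤ (n ^ suc r) (degree-atom G u d k′ m 1≤d (≤-trans (*-monoʳ-≤ m d≤T) mT≤K)))) ⟩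
          sum {n} (λ _ → n ^ suc r * (m * (k′ * n) ^ K + K ^ K * n ^ K))
            ≡⟨ ∑-const n (n ^ suc r * (m * (k′ * n) ^ K + K ^ K * n ^ K)) ⟩
          n * (n ^ suc r * (m * (k′ * n) ^ K + K ^ K * n ^ K))
            ≡⟨ cong (λ z → n * (n ^ suc r * (m * z + K ^ K * n ^ K))) (^-distribʳ-* K k′ n) ⟩
          n * (n ^ suc r * (m * (k′ ^ K * n ^ K) + K ^ K * n ^ K))
            ≡⟨ lem₂ n (n ^ suc r) m (k′ ^ K) (n ^ K) (K ^ K) ⟩
          (m * k′ ^ K + 1 * K ^ K) * P
            ≡⟨ cong ((m * k′ ^ K + 1 * K ^ K) *_) (sym (^-distribˡ-+-* n s K)) ⟩
          (m * k′ ^ K + 1 * K ^ K) * n ^ k ∎)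
        where
        open ≤-Reasoning
        lem : ∀ m q p x → m * (q * (p * x)) ≡ p * (q * (m * x))
        lem = solve-∀
        lem₂ : ∀ n p m a b q → n * (p * (m * (a * b) + q * b)) ≡ (m * a + 1 * q) * (n * p * b)
        lem₂ = solve-∀

      UE-bound : ∀ d → d ≤ T → Bound 1 (UE d)
      UE-bound zero    _   = UE-zero
      UE-bound (suc d) d≤T = UE-suc (suc d) (s≤s z≤n) d≤T

    -- The constant is 4 + 4 + 1: four rare events for smaller degrees, four for larger ones, and
    -- the error term for degree d itself.
    sequence-bound : Bound 9 (∑Seq k S)
    sequence-bound with search T ≤-refl UH-top
    ... | d , d≤T , hL , hH with UE-bound d d≤T
    ...   | i , hE = i , (begin
        m * (Jᴶ * ∑Seq k S)
          ≤⟨ *-monoʳ-≤ m (*-monoʳ-≤ Jᴶ (total d)) ⟩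
        m * (Jᴶ * (UL d + UE d + UH (suc d)))
          ≡⟨ lem m Jᴶ (UL d) (UE d) (UH (suc d)) ⟩
        Jᴶ * (m * UL d) + Jᴶ * (m * UH (suc d)) + m * (Jᴶ * UE d)
          ≤⟨ +-mono-≤ (+-mono-≤ (*-monoʳ-≤ Jᴶ hL) (*-monoʳ-≤ Jᴶ hH)) hE ⟩
        Jᴶ * (4 * P) + Jᴶ * (4 * P) + (m * i ^ suc i + 1 * Jᴶ) * n ^ k
          ≡⟨ cong (λ z → Jᴶ * (4 * z) + Jᴶ * (4 * z) + (m * i ^ suc i + 1 * Jᴶ) * n ^ k) (sym (^-distribˡ-+-* n s K)) ⟩
        Jᴶ * (4 * n ^ k) + Jᴶ * (4 * n ^ k) + (m * i ^ suc i + 1 * Jᴶ) * n ^ k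
          ≡⟨ lem₂ Jᴶ (n ^ k) (m * i ^ suc i) ⟩
        (m * i ^ suc i + 9 * Jᴶ) * n ^ k ∎)
      where
      open ≤-Reasoning
      Jᴶ : ℕ
      Jᴶ = suc i ^ suc i
      lem : ∀ m j a b c → m * (j * (a + b + c)) ≡ j * (m * a) + j * (m * c) + m * (j * b)
      lem = solve-∀
      lem₂ : ∀ j p q → j * (4 * p) + j * (4 * p) + (q + 1 * j) * p ≡ (q + 9 * j) * p
      lem₂ = solve-∀

-- Choice of the parameters

module Parameters (m T g r k′ ℓ : ℕ)
  .{{_ : NonZero m}} .{{_ : NonZero T}} .{{_ : NonZero g}} .{{_ : NonZero ℓ}}
  (128mT≤g : 128 * (m * T) ≤ g) (20480m³T≤g : 4 * (5120 * (m * m * m * T)) ≤ g)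
  (s≡ : suc (suc r) ≡ 2 * m * (2 * m) * (384 * (m * (g * T))))
  (3Ts²≤K : 3 * (T * (suc (suc r) * suc (suc r))) ≤ suc k′)
  (2ℓm≤Tk : 2 * ℓ * m ≤ T * (suc (suc r) + suc k′))
  where

  private
    s K k g′ D w B X′ Z M c : ℕ
    s = suc (suc r)
    K = suc k′
    k = s + K
    g′ = 384 * (m * (g * T))
    D = 64 * (g * T)

    gT≢0 : NonZero (g * T)
    gT≢0 = m*n≢0 g T

    D≢0 : NonZero D
    D≢0 = m*n≢0 64 (g * T) {{_}} {{gT≢0}}

    -- D is g′/(6m), so a low sequence has more than w rich entries with probability at most 1/(6m).
    -- With B = 2gT the product `w * B` is at most K/32, and the gap c is w times D/2, about K/2.
    w = (K ℕ./ D) {{D≢0}}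
    B = 2 * (g * T)
    X′ = 256 * (m * T) * suc w
    Z = 6 * (s * T)
    M = 5 * (m * (K * T))
    c = 32 * (g * T) * w

    0<m : 1 ≤ m
    0<m = n≢0⇒n>0 (≢-nonZero⁻¹ m)
    0<T : 1 ≤ T
    0<T = n≢0⇒n>0 (≢-nonZero⁻¹ T)
    0<g : 1 ≤ g
    0<g = n≢0⇒n>0 (≢-nonZero⁻¹ g)
    0<gT : 1 ≤ g * T
    0<gT = *-mono-≤ 0<g 0<T

    open ≤-Reasoning

    1536gT≤s : 1536 * (g * T) ≤ s
    1536gT≤s = begin
      1536 * (g * T)                            ≡⟨ lem (g * T) ⟩
      2 * 1 * (2 * 1) * (384 * (1 * (g * T)))   ≤⟨ *-mono-≤ (*-mono-≤ (*-monoʳ-≤ 2 0<m) (*-monoʳ-≤ 2 0<m)) (*-monoʳ-≤ 384 (*-monoˡ-≤ (g * T) 0<m)) ⟩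
      2 * m * (2 * m) * (384 * (m * (g * T)))   ≡⟨ s≡ ⟨
      s ∎
      where
      lem : ∀ x → 1536 * x ≡ 2 * 1 * (2 * 1) * (384 * (1 * x))
      lem = solve-∀

    s*s≤K : s * s ≤ K
    s*s≤K = ≤-trans (≤-trans (m≤n*m (s * s) T) (m≤n*m (T * (s * s)) 3)) 3Ts²≤K

    s≤K : s ≤ K
    s≤K = ≤-trans (m≤m*n s s) s*s≤K

    8gT≤s : 8 * (g * T) ≤ s
    8gT≤s = ≤-trans (*-monoˡ-≤ (g * T) {8} {1536} (≤ᵇ⇒≤ 8 1536 _)) 1536gT≤s

    64g²T²≤K : 64 * (g * T * (g * T)) ≤ K
    64g²T²≤K = ≤-trans (≤-trans (≤-reflexive (lem (g * T))) (*-mono-≤ 8gT≤s 8gT≤s)) s*s≤K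
      where
      lem : ∀ x → 64 * (x * x) ≡ 8 * x * (8 * x)
      lem = solve-∀

    D≤K : D ≤ K
    D≤K = ≤-trans (*-monoʳ-≤ 64 (m≤m*n (g * T) (g * T) {{gT≢0}})) 64g²T²≤K

    w*D≤K : w * D ≤ K
    w*D≤K = m/n*n≤m K D {{D≢0}}

    K≤[1+w]*D : K ≤ suc w * D
    K≤[1+w]*D = ≤-trans (≤-reflexive (m≡m%n+[m/n]*n K D {{D≢0}})) (+-monoˡ-≤ (w * D) (<⇒≤ (m%n<n K D {{D≢0}})))

    1≤w : 1 ≤ w
    1≤w = n≢0⇒n>0 λ w≡0 → <⇒≱ (subst (_< D) (sym (trans (m≡m%n+[m/n]*n K D {{D≢0}}) (trans (cong (λ z → (K % D) {{D≢0}} + z * D) w≡0) (+-identityʳ _)))) (m%n<n K D {{D≢0}})) D≤K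

    suc-w≤2w : suc w ≤ 2 * w
    suc-w≤2w = ≤-trans (+-monoˡ-≤ w 1≤w) (≤-reflexive (cong (w +_) (sym (+-identityʳ w))))

    K≤4c : K ≤ 4 * c
    K≤4c = begin
      K                              ≤⟨ K≤[1+w]*D ⟩
      suc w * D                      ≤⟨ *-monoˡ-≤ D suc-w≤2w ⟩
      2 * w * D                      ≡⟨ lem w (g * T) ⟩
      4 * c                          ∎
      where
      lem : ∀ w x → 2 * w * (64 * x) ≡ 4 * (32 * x * w)
      lem = solve-∀

    2ℓ≤M : 2 * ℓ ≤ M
    2ℓ≤M = begin
      2 * ℓ                ≤⟨ m≤m*n (2 * ℓ) m ⟩
      2 * ℓ * m            ≤⟨ 2ℓm≤Tk ⟩
      T * (s + K)          ≤⟨ *-monoʳ-≤ T (+-monoˡ-≤ K s≤K) ⟩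
      T * (K + K)          ≡⟨ lem T K ⟩
      2 * (1 * (K * T))    ≤⟨ *-mono-≤ {2} {5} (≤ᵇ⇒≤ 2 5 _) (*-monoˡ-≤ (K * T) 0<m) ⟩
      M                    ∎
      where
      lem : ∀ T K → T * (K + K) ≡ 2 * (1 * (K * T))
      lem = solve-∀

    4mK<M : 4 * (m * K) < M
    4mK<M = begin-strict
      4 * (m * K)          <⟨ *-monoˡ-< (m * K) {{m*n≢0 m K}} {4} {5} (n<1+n 4) ⟩
      5 * (m * K)          ≤⟨ *-monoʳ-≤ 5 (*-monoʳ-≤ m (m≤m*n K T)) ⟩
      M                    ∎

    2g≤g′ : 2 * g ≤ g′
    2g≤g′ = begin
      2 * g                ≡⟨ lem g ⟩
      2 * (1 * (g * 1))    ≤⟨ *-mono-≤ {2} {384} (≤ᵇ⇒≤ 2 384 _) (*-mono-≤ 0<m (*-monoʳ-≤ g 0<T)) ⟩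
      g′                   ∎
      where
      lem : ∀ g → 2 * g ≡ 2 * (1 * (g * 1))
      lem = solve-∀

    hX : 6 * m * K ≤ g′ * suc w
    hX = ≤-trans (*-monoʳ-≤ (6 * m) K≤[1+w]*D) (≤-reflexive (lem m (suc w) (g * T)))
      where
      lem : ∀ m w x → 6 * m * (w * (64 * x)) ≡ 384 * (m * x) * w
      lem = solve-∀

    hZ : 6 * m * (s * (2 * ℓ)) ≤ suc Z * k
    hZ = begin
      6 * m * (s * (2 * ℓ))   ≡⟨ lem₁ m s ℓ ⟩
      6 * s * (2 * ℓ * m)     ≤⟨ *-monoʳ-≤ (6 * s) 2ℓm≤Tk ⟩
      6 * s * (T * k)         ≡⟨ lem₂ s T k ⟩
      Z * k                   ≤⟨ *-monoˡ-≤ k (n≤1+n Z) ⟩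
      suc Z * k               ∎
      where
      lem₁ : ∀ m s l → 6 * m * (s * (2 * l)) ≡ 6 * s * (2 * l * m)
      lem₁ = solve-∀
      lem₂ : ∀ s T k → 6 * s * (T * k) ≡ 6 * (s * T) * k
      lem₂ = solve-∀

    hE : 6 * m * (s * suc r * (2 * ℓ)) ≤ 2 * (k * (suc r + K))
    hE = begin
      6 * m * (s * suc r * (2 * ℓ))    ≡⟨ lem₁ m s (suc r) ℓ ⟩
      6 * (s * suc r) * (2 * ℓ * m)    ≤⟨ *-mono-≤ (*-monoʳ-≤ 6 (*-monoʳ-≤ s (n≤1+n (suc r)))) 2ℓm≤Tk ⟩
      6 * (s * s) * (T * k)            ≡⟨ lem₂ s T k ⟩
      2 * (k * (3 * (T * (s * s))))    ≤⟨ *-monoʳ-≤ 2 (*-monoʳ-≤ k (≤-trans 3Ts²≤K (m≤n+m K (suc r)))) ⟩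
      2 * (k * (suc r + K))            ∎
      where
      lem₁ : ∀ m s r l → 6 * m * (s * r * (2 * l)) ≡ 6 * (s * r) * (2 * l * m)
      lem₁ = solve-∀
      lem₂ : ∀ s T k → 6 * (s * s) * (T * k) ≡ 2 * (k * (3 * (T * (s * s))))
      lem₂ = solve-∀

    hX′ : 2 * m * (2 * K) ≤ g * suc X′
    hX′ = begin
      2 * m * (2 * K)                ≤⟨ *-monoʳ-≤ (2 * m) (*-monoʳ-≤ 2 K≤[1+w]*D) ⟩
      2 * m * (2 * (suc w * D))      ≡⟨ lem m (suc w) g T ⟩
      g * X′                         ≤⟨ *-monoʳ-≤ g (n≤1+n X′) ⟩
      g * suc X′                     ∎
      where
      lem : ∀ m w g T → 2 * m * (2 * (w * (64 * (g * T)))) ≡ g * (256 * (m * T) * w)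
      lem = solve-∀

    mT≤K : m * T ≤ K
    mT≤K = ≤-trans (≤-trans (m≤n*m (m * T) 128) (≤-trans 128mT≤g (m≤m*n g T))) (≤-trans (m≤n*m (g * T) 64) D≤K)

    module _ (t : ℕ) (t≤T : t ≤ T) where

      hc : Z + (B + w + w * B + B * B) + t * X′ + c ≤ K
      hc = *-cancelˡ-≤ 64 (begin
          64 * (Z + (B + w + w * B + B * B) + t * X′ + c)
            ≤⟨ *-monoʳ-≤ 64 (+-monoˡ-≤ c (+-monoʳ-≤ (Z + (B + w + w * B + B * B)) (*-mono-≤ t≤T (*-monoʳ-≤ (256 * (m * T)) suc-w≤2w)))) ⟩
          64 * (Z + (B + w + w * B + B * B) + T * (256 * (m * T) * (2 * w)) + c)
            ≡⟨ lem s T w (g * T) m ⟩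
          4 * (96 * (s * T)) + (2 * (64 * (g * T)) + w * (64 * 1) + 2 * (w * (64 * (g * T))) + 4 * (64 * (g * T * (g * T)))) + 4 * (w * (64 * (128 * (m * T) * T))) + 32 * (w * (64 * (g * T)))
            ≤⟨ +-mono-≤ (+-mono-≤ (+-mono-≤ (*-monoʳ-≤ 4 Z-m²T²-small) (+-mono-≤ (+-mono-≤ (+-mono-≤ (*-monoʳ-≤ 2 D≤K)
                 (≤-trans (*-monoʳ-≤ w (*-monoʳ-≤ 64 0<gT)) w*D≤K)) (*-monoʳ-≤ 2 w*D≤K)) (*-monoʳ-≤ 4 64g²T²≤K)))
                 (*-monoʳ-≤ 4 (≤-trans (*-monoʳ-≤ w (*-monoʳ-≤ 64 (*-monoˡ-≤ T 128mT≤g))) w*D≤K))) (*-monoʳ-≤ 32 w*D≤K) ⟩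
          -- The budget in units of K/64: 4 for the window, 9 for heavy and rich entries, 4 for poor
          -- ones and 32 for the gap.
          4 * K + (2 * K + K + 2 * K + 4 * K) + 4 * K + 32 * K
            ≡⟨ lem₂ K ⟩
          49 * K
            ≤⟨ *-monoˡ-≤ K {49} {64} (≤ᵇ⇒≤ 49 64 _) ⟩
          64 * K ∎)
        where
        lem : ∀ s T w x m → 64 * (6 * (s * T) + (2 * x + w + w * (2 * x) + 2 * x * (2 * x)) + T * (256 * (m * T) * (2 * w)) + 32 * x * w) ≡
          4 * (96 * (s * T)) + (2 * (64 * x) + w * (64 * 1) + 2 * (w * (64 * x)) + 4 * (64 * (x * x))) + 4 * (w * (64 * (128 * (m * T) * T))) + 32 * (w * (64 * x))
        lem = solve-∀
        lem₂ : ∀ K → 4 * K + (2 * K + K + 2 * K + 4 * K) + 4 * K + 32 * K ≡ 49 * K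
        lem₂ = solve-∀
        32≤s : 32 ≤ s
        32≤s = ≤-trans (≤-trans (≤ᵇ⇒≤ 32 1536 _) (*-monoʳ-≤ 1536 0<gT)) 1536gT≤s
        Z-m²T²-small : 96 * (s * T) ≤ K
        Z-m²T²-small = ≤-trans (≤-reflexive (lem₃ s T)) (≤-trans (*-monoʳ-≤ 3 (*-monoʳ-≤ T (*-monoˡ-≤ s 32≤s))) 3Ts²≤K)
          where
          lem₃ : ∀ s T → 96 * (s * T) ≡ 3 * (T * (32 * s))
          lem₃ = solve-∀

      hv : 16 * (m * m) * (g * K * (t * t) + 4 * M * (g + K)) < g * (c * c)
      hv = *-cancelˡ-< 64 _ _ (begin-strict
          64 * (16 * (m * m) * (g * K * (t * t) + 4 * M * (g + K)))
            ≤⟨ *-monoʳ-≤ 64 (*-monoʳ-≤ (16 * (m * m)) (+-monoˡ-≤ (4 * M * (g + K)) (*-monoʳ-≤ (g * K) (*-mono-≤ t≤T t≤T)))) ⟩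
          64 * (16 * (m * m) * (g * K * (T * T) + 4 * M * (g + K)))
            ≡⟨ lem₁ m g K T ⟩
          g * K * (1024 * (m * T * (m * T))) + g * K * (4 * (5120 * (m * m * m * T))) + K * K * (4 * (5120 * (m * m * m * T)))
            ≤⟨ +-mono-≤ (+-mono-≤ (*-monoʳ-≤ (g * K) m²T²-small) (*-monoʳ-≤ (g * K) (≤-trans 20480m³T≤g (≤-trans (m≤m*n g T) (≤-trans (m≤n*m (g * T) 64) D≤K))))) (*-monoʳ-≤ (K * K) 20480m³T≤g) ⟩
          g * K * K + g * K * K + K * K * g
            ≡⟨ lem₂ g K ⟩
          3 * (g * (K * K))
            <⟨ *-monoˡ-< (g * (K * K)) {{m*n≢0 g (K * K)}} {3} {4} (n<1+n 3) ⟩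
          4 * (g * (K * K))
            ≤⟨ *-monoʳ-≤ 4 (*-monoʳ-≤ g (*-mono-≤ K≤4c K≤4c)) ⟩
          4 * (g * (4 * c * (4 * c)))
            ≡⟨ lem₃ g c ⟩
          64 * (g * (c * c)) ∎)
        where
        lem₁ : ∀ m g K T → 64 * (16 * (m * m) * (g * K * (T * T) + 4 * (5 * (m * (K * T))) * (g + K))) ≡
          g * K * (1024 * (m * T * (m * T))) + g * K * (4 * (5120 * (m * m * m * T))) + K * K * (4 * (5120 * (m * m * m * T)))
        lem₁ = solve-∀
        lem₂ : ∀ g K → g * K * K + g * K * K + K * K * g ≡ 3 * (g * (K * K))
        lem₂ = solve-∀
        lem₃ : ∀ g c → 4 * (g * (4 * c * (4 * c))) ≡ 64 * (g * (c * c))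
        lem₃ = solve-∀
        m²T²-small : 1024 * (m * T * (m * T)) ≤ K
        m²T²-small = begin
          1024 * (m * T * (m * T))
            ≡⟨ lem₄ (m * T) ⟩
          32 * (m * T) * (32 * (m * T))
            ≤⟨ *-mono-≤ 32mT≤gT 32mT≤gT ⟩
          g * T * (g * T)
            ≤⟨ m≤n*m (g * T * (g * T)) 64 ⟩
          64 * (g * T * (g * T))
            ≤⟨ 64g²T²≤K ⟩
          K ∎
          where
          lem₄ : ∀ x → 1024 * (x * x) ≡ 32 * x * (32 * x)
          lem₄ = solve-∀
          32mT≤gT : 32 * (m * T) ≤ g * T
          32mT≤gT = ≤-trans (*-monoˡ-≤ (m * T) {32} {128} (≤ᵇ⇒≤ 32 128 _)) (≤-trans 128mT≤g (m≤m*n g T))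

  sequences-with-ℓ-edges : ∀ {n} .{{_ : NonZero n}} (G : Graph n) →
    Σ ℕ λ i → m * (suc i ^ suc i * ∑Seq k (Window.S G ℓ)) ≤ (m * i ^ suc i + 9 * suc i ^ suc i) * n ^ k
  sequences-with-ℓ-edges {n} G = Assembly.sequence-bound G ℓ g g′ m r k′ T dichotomy edge-bound
      (≤-reflexive (sym s≡)) m≤g′ mT≤K 2ℓm≤Tk (n≢0⇒n>0 (≢-nonZero⁻¹ ℓ))
    where
    open Window G ℓ
    P : ℕ
    P = n ^ s * n ^ K
    m≤g′ : m ≤ g′
    m≤g′ = ≤-trans (≤-reflexive (sym (*-identityʳ m))) (≤-trans (*-monoʳ-≤ m 0<gT) (m≤n*m (m * (g * T)) 384))
    module Gap′ (t : ℕ) = Gap G ℓ g g′ t m r k′ B w X′ Z M c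
    edge-bound : m * ∑∑ s K (λ x y → S (x ++ y) * ⟦ 0 <? edges (A G) x ⟧) ≤ P
    edge-bound = ≤-trans (*-monoˡ-≤ _ (m≤n*m m 6))
      -- The number of edges in the window does not involve the threshold; 0 is a threshold that
      -- meets all the conditions.
      (Gap′.windowEdge-bound 0 2g≤g′ (*-monoʳ-≤ 2 (*-monoʳ-≤ g z≤n)) hX hZ hE hX′ (hc 0 z≤n) 2ℓ≤M 4mK<M (hv 0 z≤n))
    dichotomy : ∀ t → 1 ≤ t → t ≤ T →
      (m * ∑∑ s K (λ x y → S (x ++ y) * Threshold.low G g g′ t y) ≤ P) ⊎
      (m * ∑∑ s K (λ x y → S (x ++ y) * Threshold.high G g g′ t y) ≤ P)
    dichotomy t _ t≤T with ≤-total (m * ∑∑ s K (λ x y → S (x ++ y) * Threshold.low G g g′ t y)) P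
                         | ≤-total (m * ∑∑ s K (λ x y → S (x ++ y) * Threshold.high G g g′ t y)) P
    ... | inj₁ lo | _       = inj₁ lo
    ... | inj₂ _  | inj₁ hi = inj₂ hi
    ... | inj₂ lo | inj₂ hi = contradiction hi
      (Gap′.gap t 2g≤g′ (*-monoʳ-≤ 2 (*-monoʳ-≤ g t≤T)) hX hZ hE hX′ (hc t t≤T) 2ℓ≤M 4mK<M (hv t t≤T) lo)

-- From subsets to sequences

module _ {n : ℕ} where

  toSubset : List (Fin n) → Subset n
  toSubset []      = ⊥
  toSubset (v ∷ a) = toSubset a [ v ]≔ inside

  distinct : List (Fin n) → ℕ
  distinct []      = 1
  distinct (v ∷ a) = bit (not (lookup (toSubset a) v)) * distinct a

∑⊆-empty : ∀ n (f : Subset n → ℕ) → ∑⊆ n (λ B → bit (does (∣ B ∣ ≟ 0)) * f B) ≡ f ⊥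
∑⊆-empty zero    f = +-identityʳ (f []ᵛ)
∑⊆-empty (suc n) f = trans (cong₂ _+_ (∑⊆-empty n (λ B → f (outside ∷ᵛ B))) (∑⊆-0 n)) (+-identityʳ _)

-- Double counting of the pairs of a set of size `suc j` and one of its elements.
∑⊆-peel : ∀ n j (f : Subset n → ℕ) →
  suc j * ∑⊆ n (λ B → bit (does (∣ B ∣ ≟ suc j)) * f B) ≡
  sum (λ v → ∑⊆ n (λ B → bit (does (∣ B ∣ ≟ j)) * (bit (not (lookup B v)) * f (B [ v ]≔ inside))))
∑⊆-peel n j f = begin
    suc j * ∑⊆ n g
      ≡⟨ ∑⊆-* n (suc j) g ⟨
    ∑⊆ n (λ B → suc j * g B)
      ≡⟨ ∑⊆-cong n (λ B → trans (*-comm (suc j) (g B)) (trans (sym (size-bit′ ∣ B ∣ (suc j) (f B)))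
           (trans (*-comm (g B) ∣ B ∣) (trans (cong (_* g B) (sym (sum-inside B))) (*-distribʳ-sum (g B) (λ v → bit (lookup B v))))))) ⟩
    ∑⊆ n (λ B → sum (λ v → bit (lookup B v) * g B))
      ≡⟨ sum-∑⊆ n (λ v B → bit (lookup B v) * g B) ⟨
    sum (λ v → ∑⊆ n (λ B → bit (lookup B v) * g B))
      ≡⟨ sum-cong-≗ (λ v → trans (sym (∑⊆-update n v g)) (∑⊆-cong n (point v))) ⟩
    sum (λ v → ∑⊆ n (λ B → bit (does (∣ B ∣ ≟ j)) * (bit (not (lookup B v)) * f (B [ v ]≔ inside)))) ∎
  where
  open ≡-Reasoning
  g : Subset n → ℕ
  g B = bit (does (∣ B ∣ ≟ suc j)) * f B
  point : ∀ v B → bit (not (lookup B v)) * g (B [ v ]≔ inside) ≡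
    bit (does (∣ B ∣ ≟ j)) * (bit (not (lookup B v)) * f (B [ v ]≔ inside))
  point v B with lookup B v in eq
  ... | inside  = sym (*-zeroʳ (bit (does (∣ B ∣ ≟ j))))
  ... | outside = trans (cong (λ z → 1 * (bit (does (z ≟ suc j)) * f (B [ v ]≔ inside))) (size-update B v eq))
                        (lem (bit (does (∣ B ∣ ≟ j))) (f (B [ v ]≔ inside)))
    where
    lem : ∀ a b → 1 * (a * b) ≡ a * (1 * b)
    lem = solve-∀

-- Every set of size j is listed by j! sequences without repetitions.
∑⊆-∑Seq : ∀ n j (f : Subset n → ℕ) →
  j ! * ∑⊆ n (λ B → bit (does (∣ B ∣ ≟ j)) * f B) ≡ ∑Seq j (λ a → distinct a * f (toSubset a))
∑⊆-∑Seq n zero    f = cong (1 *_) (∑⊆-empty n f)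
∑⊆-∑Seq n (suc j) f = begin
    suc j * j ! * ∑⊆ n (λ B → bit (does (∣ B ∣ ≟ suc j)) * f B)
      ≡⟨ lem (suc j) (j !) _ ⟩
    j ! * (suc j * ∑⊆ n (λ B → bit (does (∣ B ∣ ≟ suc j)) * f B))
      ≡⟨ cong (j ! *_) (∑⊆-peel n j f) ⟩
    j ! * sum (λ v → ∑⊆ n (λ B → bit (does (∣ B ∣ ≟ j)) * f′ v B))
      ≡⟨ *-distribˡ-sum (j !) (λ v → ∑⊆ n (λ B → bit (does (∣ B ∣ ≟ j)) * f′ v B)) ⟩
    sum (λ v → j ! * ∑⊆ n (λ B → bit (does (∣ B ∣ ≟ j)) * f′ v B))
      ≡⟨ sum-cong-≗ (λ v → trans (∑⊆-∑Seq n j (f′ v)) (∑Seq-cong j λ a → lem′ (distinct a) (bit (not (lookup (toSubset a) v))) _)) ⟩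
    sum (λ v → ∑Seq j (λ a → bit (not (lookup (toSubset a) v)) * distinct a * f (toSubset a [ v ]≔ inside))) ∎
  where
  open ≡-Reasoning
  f′ : Fin n → Subset n → ℕ
  f′ v B = bit (not (lookup B v)) * f (B [ v ]≔ inside)
  lem : ∀ a b c → a * b * c ≡ b * (a * c)
  lem = solve-∀
  lem′ : ∀ a b c → a * (b * c) ≡ b * a * c
  lem′ = solve-∀

neighbours : ∀ {n} → Graph n → Subset n → Fin n → ℕ
neighbours G B v = sum λ j → indicator B j * weight G v j

-- Passing to `duplicate G v` gives the added vertex the index zero, so that its row and column
-- split off the quadratic form by computation.
e-update : ∀ {n} (G : Graph n) v B → lookup B v ≡ outside → e[ G , B [ v ]≔ inside ] ≡ neighbours G B v + e[ G , B ]
e-update {n} G v B v∉B = *-cancelˡ-≡ _ _ 2 (begin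
    2 * e[ G , B [ v ]≔ inside ]
      ≡⟨ cong (2 *_) (e-duplicate-inside G v B v∉B) ⟨
    2 * e[ duplicate G v , inside ∷ᵛ B ]
      ≡⟨ trans (cong (e[ duplicate G v , inside ∷ᵛ B ] +_) (+-identityʳ _)) (double-e (duplicate G v) (inside ∷ᵛ B)) ⟩
    (1 * (1 * a v v) + sum (λ j → 1 * (x j * a v j))) + sum (λ i → x i * (1 * a i v) + sum (λ j → x i * (x j * a i j)))
      ≡⟨ cong₂ _+_ (cong₂ _+_ (cong (λ z → 1 * (1 * z)) (A-irrefl G v)) (sum-cong-≗ {n} (λ j → +-identityʳ _)))
           (trans (∑-distrib-+ (λ i → x i * (1 * a i v)) _) (cong₂ _+_ (sum-cong-≗ (λ i → cong (x i *_) (trans (+-identityʳ _) (A-sym G i v))))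
             (sym (double-e G B)))) ⟩
    neighbours G B v + (neighbours G B v + (e[ G , B ] + e[ G , B ]))
      ≡⟨ lem (neighbours G B v) e[ G , B ] ⟩
    2 * (neighbours G B v + e[ G , B ]) ∎)
  where
  open ≡-Reasoning
  a = weight G
  x = indicator B
  lem : ∀ d e → d + (d + (e + e)) ≡ 2 * (d + e)
  lem = solve-∀

neighbours-update : ∀ {n} (G : Graph n) u B v → lookup B u ≡ outside →
  neighbours G (B [ u ]≔ inside) v ≡ weight G v u + neighbours G B v
neighbours-update G u B v u∉B = trans
  (sum-cong-≗ λ j → trans (cong (_* weight G v j) (indicator-update B u u∉B j)) (*-distribʳ-+ (weight G v j) (δ u j) _))
  (trans (∑-distrib-+ (λ j → δ u j * weight G v j) (λ j → indicator B j * weight G v j))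
    (cong (_+ neighbours G B v) (sum-δ u (weight G v))))

distinct-cases : ∀ {n} (G : Graph n) a → (distinct a ≡ 0) ⊎
  (distinct a ≡ 1 × ∣ toSubset a ∣ ≡ length a × e[ G , toSubset a ] ≡ edges (A G) a ×
    (∀ v → neighbours G (toSubset a) v ≡ deg (A G) a v))
distinct-cases {n} G [] = inj₂ (refl , ∣⊥∣≡0 n , e-empty , λ v → ∑-zero (λ j → cong (_* weight G v j) (out j)))
  where
  out : ∀ j → indicator (⊥ {n}) j ≡ 0
  out j = cong bit (lookup-replicate j outside)
  ∑-zero : ∀ {f : Fin n → ℕ} → (∀ j → f j ≡ 0) → sum f ≡ 0
  ∑-zero h = trans (sum-cong-≗ h) (trans (∑-const n 0) (*-zeroʳ n))
  e-empty : e[ G , ⊥ ] ≡ 0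
  e-empty = m+n≡0⇒m≡0 e[ G , ⊥ ] (trans (double-e G ⊥)
    (∑-zero λ i → ∑-zero λ j → cong (_* (indicator (⊥ {n}) j * weight G i j)) (out i)))
distinct-cases G (v ∷ a) with lookup (toSubset a) v in eq | distinct-cases G a
... | inside  | _                   = inj₁ refl
... | outside | inj₁ d≡0            = inj₁ (trans (+-identityʳ _) d≡0)
... | outside | inj₂ (d , l , e , N) = inj₂ (trans (+-identityʳ _) d , trans (size-update (toSubset a) v eq) (cong suc l) ,
  trans (e-update G v (toSubset a) eq) (cong₂ _+_ (N v) e) ,
  λ w → trans (neighbours-update G v (toSubset a) w eq) (cong (weight G w v +_) (N w)))

#≤∑Seq : ∀ {n} (G : Graph n) k ℓ → k ! * #[ G , k , ℓ ] ≤ ∑Seq k (λ a → ⟦ edges (A G) a ≟ ℓ ⟧)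
#≤∑Seq {n} G k ℓ = begin
    k ! * #[ G , k , ℓ ]
      ≡⟨ trans (cong (k ! *_) (#-∑⊆ G k ℓ)) (∑⊆-∑Seq n k (λ B → bit (does (e[ G , B ] ≟ ℓ)))) ⟩
    ∑Seq k (λ a → distinct a * bit (does (e[ G , toSubset a ] ≟ ℓ)))
      ≤⟨ ∑Seq-mono k (λ a _ → point a (distinct-cases G a)) ⟩
    ∑Seq k (λ a → ⟦ edges (A G) a ≟ ℓ ⟧) ∎
  where
  open ≤-Reasoning
  point : ∀ a → (distinct a ≡ 0) ⊎
    (distinct a ≡ 1 × ∣ toSubset a ∣ ≡ length a × e[ G , toSubset a ] ≡ edges (A G) a ×
      (∀ v → neighbours G (toSubset a) v ≡ deg (A G) a v)) →
    distinct a * bit (does (e[ G , toSubset a ] ≟ ℓ)) ≤ ⟦ edges (A G) a ≟ ℓ ⟧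
  point a (inj₁ d≡0) = ≤-trans (≤-reflexive (cong (_* bit (does (e[ G , toSubset a ] ≟ ℓ))) d≡0)) z≤n
  point a (inj₂ (d≡1 , _ , e≡ , _)) = ≤-reflexive (trans (cong₂ (λ x y → x * bit (does (y ≟ ℓ))) d≡1 e≡) (+-identityʳ _))

edgeless : ∀ n → Graph n
edgeless n = record { adj = λ _ _ → false ; adj-sym = λ _ _ → refl ; adj-irrefl = λ _ → refl }

-- The birthday bound: a new vertex repeats one of j earlier ones with probability at most j/n, and
-- the sum of these is bounded crudely by j²/n.
∑Seq-distinct : ∀ n j → n * n ^ j ≤ n * ∑Seq {n} j distinct + j * j * n ^ j
∑Seq-distinct n zero    = m≤m+n (n * 1) _
∑Seq-distinct n (suc j) = begin
    n * (n * n ^ j)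
      ≤⟨ *-monoʳ-≤ n (∑Seq-distinct n j) ⟩
    n * (n * D + j * j * n ^ j)
      ≤⟨ *-monoʳ-≤ n (+-monoˡ-≤ (j * j * n ^ j) step) ⟩
    n * (∑Seq {n} (suc j) distinct + j * n ^ j + j * j * n ^ j)
      ≤⟨ m≤m+n _ (suc j * (n * n ^ j)) ⟩
    n * (∑Seq {n} (suc j) distinct + j * n ^ j + j * j * n ^ j) + suc j * (n * n ^ j)
      ≡⟨ lem n (∑Seq {n} (suc j) distinct) j (n ^ j) ⟩
    n * ∑Seq {n} (suc j) distinct + suc j * suc j * (n * n ^ j) ∎
  where
  open ≤-Reasoning
  D = ∑Seq {n} j distinct
  lem : ∀ n X j p → n * (X + j * p + j * j * p) + suc j * (n * p) ≡ n * X + suc j * suc j * (n * p)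
  lem = solve-∀
  point : ∀ a → length a ≡ j → n * distinct a ≤ sum (λ v → bit (not (lookup (toSubset a) v)) * distinct a) + j
  point a la with distinct-cases (edgeless n) a
  ... | inj₁ d≡0 = ≤-trans (≤-reflexive (trans (cong (n *_) d≡0) (*-zeroʳ n))) z≤n
  ... | inj₂ (d≡1 , l , _) = ≤-reflexive (trans (cong (n *_) d≡1) (trans (*-identityʳ n) (trans (sym (sum-outside (toSubset a)))
    (cong₂ _+_ (sum-cong-≗ λ v → sym (trans (cong (bit (not (lookup (toSubset a) v)) *_) d≡1) (*-identityʳ _))) (trans l la)))))
  step : n * D ≤ ∑Seq {n} (suc j) distinct + j * n ^ j
  step = begin
    n * D
      ≡⟨ ∑Seq-* j n distinct ⟨
    ∑Seq j (λ a → n * distinct a)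
      ≤⟨ ∑Seq-mono j point ⟩
    ∑Seq j (λ a → sum (λ v → bit (not (lookup (toSubset a) v)) * distinct a) + j)
      ≡⟨ trans (∑Seq-+ j (λ a → sum (λ v → bit (not (lookup (toSubset a) v)) * distinct a)) (λ _ → j))
           (cong₂ _+_ (∑Seq-sum j (λ a v → bit (not (lookup (toSubset a) v)) * distinct a)) (trans (∑Seq-const {n} j j) (*-comm (n ^ j) j))) ⟩
    ∑Seq {n} (suc j) distinct + j * n ^ j ∎

n^k≤k!*kSubsets : ∀ n k → n * n ^ k ≤ n * (k ! * length (kSubsets n k)) + k * k * n ^ k
n^k≤k!*kSubsets n k = subst (λ z → n * n ^ k ≤ n * z + k * k * n ^ k) (sym count) (∑Seq-distinct n k)
  where
  count : k ! * length (kSubsets n k) ≡ ∑Seq {n} k distinct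
  count = trans (cong (k ! *_) (trans (kSubsets-∑⊆ n k) (∑⊆-cong n λ B → sym (*-identityʳ _))))
    (trans (∑⊆-∑Seq n k (λ _ → 1)) (∑Seq-cong k λ a → *-identityʳ (distinct a)))

module Constants (m : ℕ) .{{_ : NonZero m}} where

  private
    1≤m : 1 ≤ m
    1≤m = n≢0⇒n>0 (≢-nonZero⁻¹ m)

  abstract
    -- With g = γT and s = σT², the quantity `3 * (T * (s * s)) + s` is at most 4Ts² = CT⁵. The two
    -- summands of γ meet the two lower bounds on g, and σ is (2m)²g′ divided by T².
    γ σ C : ℕ
    γ = 128 * m + 4 * (5120 * (m * m * m))
    σ = 2 * m * (2 * m) * (384 * (m * γ))
    C = 4 * (σ * σ)

    128m≤γ : 128 * m ≤ γ
    128m≤γ = m≤m+n (128 * m) (4 * (5120 * (m * m * m)))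

    20480m³≤γ : 4 * (5120 * (m * m * m)) ≤ γ
    20480m³≤γ = m≤n+m (4 * (5120 * (m * m * m))) (128 * m)

    σ-def : σ ≡ 2 * m * (2 * m) * (384 * (m * γ))
    σ-def = refl

    C-def : C ≡ 4 * (σ * σ)
    C-def = refl

  1≤γ : 1 ≤ γ
  1≤γ = ≤-trans 1≤m (≤-trans (m≤n*m m 128) 128m≤γ)

  2≤σ : 2 ≤ σ
  2≤σ = subst (2 ≤_) (sym σ-def) (≤-trans (≤-trans (*-monoʳ-≤ 2 1≤m) (m≤m*n (2 * m) (2 * m) {{m*n≢0 2 m}}))
    (m≤m*n (2 * m * (2 * m)) (384 * (m * γ)) {{m*n≢0 384 (m * γ) {{_}} {{m*n≢0 m γ {{>-nonZero 1≤m}} {{>-nonZero 1≤γ}}}}}}))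

  1≤C : 1 ≤ C
  1≤C = subst (1 ≤_) (sym C-def) (*-mono-≤ {1} {4} (s≤s z≤n) (*-mono-≤ {1} {σ} {1} {σ} 1≤σ 1≤σ))
    where
    1≤σ : 1 ≤ σ
    1≤σ = ≤-trans (s≤s z≤n) 2≤σ

  sequence-probability : ∀ T k ℓ .{{_ : NonZero T}} .{{_ : NonZero ℓ}} → C * T ^ 5 ≤ k → 2 * ℓ * m ≤ T * k →
    ∀ {n} .{{_ : NonZero n}} (G : Graph n) →
    Σ ℕ λ i → m * (suc i ^ suc i * ∑Seq k (λ a → ⟦ edges (A G) a ≟ ℓ ⟧)) ≤ (m * i ^ suc i + 9 * suc i ^ suc i) * n ^ k
  sequence-probability T k ℓ CT⁵≤k 2ℓm≤Tk {n} G = subst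
      (λ z → Σ ℕ λ i → m * (suc i ^ suc i * ∑Seq z (λ a → ⟦ edges (A G) a ≟ ℓ ⟧)) ≤ (m * i ^ suc i + 9 * suc i ^ suc i) * n ^ z)
      s+K≡k
      (Parameters.sequences-with-ℓ-edges m T g r k′ ℓ {{it}} {{>-nonZero 1≤T}} {{>-nonZero 1≤g}} {{it}} 128mT≤g 20480m³T≤g s-eq
        (≤-trans (≤-reflexive (cong (λ z → 3 * (T * (z * z))) s′≡s)) (≤-trans 3Ts²≤k∸s (≤-reflexive (sym K≡))))
        (≤-trans 2ℓm≤Tk (≤-reflexive (cong (T *_) (sym s+K≡k)))) G)
    where
    open ≤-Reasoning
    it : ∀ {x} .{{_ : NonZero x}} → NonZero x
    it {suc _} = _
    g s r k′ : ℕ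
    g = γ * T
    s = σ * (T * T)
    r = s ∸ 2
    k′ = k ∸ s ∸ 1
    1≤T : 1 ≤ T
    1≤T = n≢0⇒n>0 (≢-nonZero⁻¹ T)
    1≤g : 1 ≤ g
    1≤g = *-mono-≤ 1≤γ 1≤T
    128mT≤g : 128 * (m * T) ≤ g
    128mT≤g = ≤-trans (≤-reflexive (sym (*-assoc 128 m T))) (*-monoˡ-≤ T 128m≤γ)
    20480m³T≤g : 4 * (5120 * (m * m * m * T)) ≤ g
    20480m³T≤g = ≤-trans (≤-reflexive (lem (m * m * m) T)) (*-monoˡ-≤ T 20480m³≤γ)
      where
      lem : ∀ a T → 4 * (5120 * (a * T)) ≡ 4 * (5120 * a) * T
      lem = solve-∀
    2≤s : 2 ≤ s
    2≤s = *-mono-≤ 2≤σ (*-mono-≤ 1≤T 1≤T)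
    s′≡s : suc (suc r) ≡ s
    s′≡s = m+[n∸m]≡n 2≤s
    s-eq : suc (suc r) ≡ 2 * m * (2 * m) * (384 * (m * (g * T)))
    s-eq = trans s′≡s (trans (cong (_* (T * T)) σ-def) (lem (2 * m * (2 * m)) m γ T))
      where
      lem : ∀ a m c T → a * (384 * (m * c)) * (T * T) ≡ a * (384 * (m * (c * T * T)))
      lem = solve-∀
    s≤Ts² : s ≤ T * (s * s)
    s≤Ts² = ≤-trans (m≤m*n s s {{>-nonZero (≤-trans (s≤s z≤n) 2≤s)}}) (m≤n*m (s * s) T)
    3Ts²+s≤k : 3 * (T * (s * s)) + s ≤ k
    3Ts²+s≤k = begin
      3 * (T * (s * s)) + s                  ≤⟨ +-monoʳ-≤ (3 * (T * (s * s))) s≤Ts² ⟩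
      3 * (T * (s * s)) + T * (s * s)        ≡⟨ trans (lem σ T) (cong (_* T ^ 5) (sym C-def)) ⟩
      C * T ^ 5                              ≤⟨ CT⁵≤k ⟩
      k                                      ∎
      where
      lem : ∀ σ T → 3 * (T * (σ * (T * T) * (σ * (T * T)))) + T * (σ * (T * T) * (σ * (T * T))) ≡
        4 * (σ * σ) * (T * (T * (T * (T * (T * 1)))))
      lem = solve-∀
    3Ts²≤k∸s : 3 * (T * (s * s)) ≤ k ∸ s
    3Ts²≤k∸s = m+n≤o⇒m≤o∸n (3 * (T * (s * s))) 3Ts²+s≤k
    K≡ : suc k′ ≡ k ∸ s
    K≡ = m+[n∸m]≡n (≤-trans (≤-trans (s≤s z≤n) 2≤s) (≤-trans s≤Ts² (≤-trans (m≤n*m (T * (s * s)) 3) 3Ts²≤k∸s)))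
    s+K≡k : suc (suc r) + suc k′ ≡ k
    s+K≡k = trans (cong₂ _+_ s′≡s K≡) (m+[n∸m]≡n (≤-trans (m≤n+m s (3 * (T * (s * s)))) 3Ts²+s≤k))

  private
    -- Sequences outnumber those without repetitions by a factor of at most 1 + 1/m. As I ≤ J, this
    -- turns the error 9J into at most 9J + J + 9J = 19J.
    transfer : ∀ I J f # K p E .{{_ : NonZero f}} → I ≤ J → f * # ≤ E → m * (J * E) ≤ (m * I + 9 * J) * p →
      m * p ≤ suc m * (f * K) → m * (J * #) ≤ (m * I + 19 * J) * K
    transfer I J f # K p E I≤J f#≤E bound p≤ = *-cancelˡ-≤ m (*-cancelˡ-≤ f (begin
        f * (m * (m * (J * #)))
          ≡⟨ lem₁ f m J # ⟩
        m * (m * (J * (f * #)))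
          ≤⟨ *-monoʳ-≤ m (*-monoʳ-≤ m (*-monoʳ-≤ J f#≤E)) ⟩
        m * (m * (J * E))
          ≤⟨ *-monoʳ-≤ m bound ⟩
        m * ((m * I + 9 * J) * p)
          ≡⟨ lem₂ m (m * I + 9 * J) p ⟩
        (m * I + 9 * J) * (m * p)
          ≤⟨ *-monoʳ-≤ (m * I + 9 * J) p≤ ⟩
        (m * I + 9 * J) * (suc m * (f * K))
          ≡⟨ lem₃ m I J f K ⟩
        f * ((m * (m * I) + (m * I + 9 * (m * J) + 9 * (1 * J))) * K)
          ≤⟨ *-monoʳ-≤ f (*-monoˡ-≤ K (+-monoʳ-≤ (m * (m * I)) (+-mono-≤ (+-monoˡ-≤ (9 * (m * J)) (*-monoʳ-≤ m I≤J)) (*-monoʳ-≤ 9 (*-monoˡ-≤ J 1≤m))))) ⟩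
        f * ((m * (m * I) + (m * J + 9 * (m * J) + 9 * (m * J))) * K)
          ≡⟨ lem₄ f m I J K ⟩
        f * (m * ((m * I + 19 * J) * K)) ∎))
      where
      open ≤-Reasoning
      lem₁ : ∀ a m j x → a * (m * (m * (j * x))) ≡ m * (m * (j * (a * x)))
      lem₁ = solve-∀
      lem₂ : ∀ a b c → a * (b * c) ≡ b * (a * c)
      lem₂ = solve-∀
      lem₃ : ∀ m i j f k → (m * i + 9 * j) * (suc m * (f * k)) ≡ f * ((m * (m * i) + (m * i + 9 * (m * j) + 9 * (1 * j))) * k)
      lem₃ = solve-∀
      lem₄ : ∀ f m i j k → f * ((m * (m * i) + (m * j + 9 * (m * j) + 9 * (m * j))) * k) ≡ f * (m * ((m * i + 19 * j) * k))
      lem₄ = solve-∀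

    all-distinct : ∀ n k x p .{{_ : NonZero n}} → n * p ≤ n * x + k * k * p → k * k * suc m ≤ n → m * p ≤ suc m * x
    all-distinct n k x p h large = *-cancelˡ-≤ n (+-cancelʳ-≤ (n * p) _ _ (begin
        n * (m * p) + n * p
          ≡⟨ lem₅ n m p ⟩
        suc m * (n * p)
          ≤⟨ *-monoʳ-≤ (suc m) h ⟩
        suc m * (n * x + k * k * p)
          ≡⟨ lem₆ m n x (k * k) p ⟩
        n * (suc m * x) + k * k * suc m * p
          ≤⟨ +-monoʳ-≤ (n * (suc m * x)) (*-monoˡ-≤ p large) ⟩
        n * (suc m * x) + n * p ∎))
      where
      open ≤-Reasoning
      lem₅ : ∀ n m p → n * (m * p) + n * p ≡ suc m * (n * p)
      lem₅ = solve-∀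
      lem₆ : ∀ m n x y p → suc m * (n * x + y * p) ≡ n * (suc m * x) + y * suc m * p
      lem₆ = solve-∀

  subset-probability : ∀ T k ℓ .{{_ : NonZero T}} .{{_ : NonZero ℓ}} → C * T ^ 5 ≤ k → 2 * ℓ * m ≤ T * k →
    ∀ {n} .{{_ : NonZero n}} (G : Graph n) → k * k * suc m ≤ n →
    Σ ℕ λ i → m * (suc i ^ suc i * #[ G , k , ℓ ]) ≤ (m * i ^ suc i + 19 * suc i ^ suc i) * length (kSubsets n k)
  subset-probability T k ℓ CT⁵≤k 2ℓm≤Tk {n} G large =
    let i , bound = sequence-probability T k ℓ CT⁵≤k 2ℓm≤Tk G in
    i , transfer (i ^ suc i) (suc i ^ suc i) (k !) #[ G , k , ℓ ] (length (kSubsets n k)) (n ^ k)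
      (∑Seq k (λ a → ⟦ edges (A G) a ≟ ℓ ⟧)) {{k !≢0}} (^-monoˡ-≤ (suc i) (n≤1+n i)) (#≤∑Seq G k ℓ) bound
      (all-distinct n k (k ! * length (kSubsets n k)) (n ^ k) (n^k≤k!*kSubsets n k) large)

-- Comparison with e

open import Data.Integer.Base using (+_)

-- j! k^j times the partial sum of the exponential series at r / k up to the power j.
expPoly : ℕ → ℕ → ℕ → ℕ
expPoly k zero    r = 1
expPoly k (suc j) r = k * suc j * expPoly k j r + r ^ suc j

suc-^-≤ : ∀ r j → suc r ^ suc j ≤ r ^ suc j + suc j * suc r ^ j
suc-^-≤ r zero    = ≤-reflexive (lem r)
  where
  lem : ∀ r → suc r * 1 ≡ r * 1 + 1 * 1
  lem = solve-∀
suc-^-≤ r (suc j) = begin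
    suc r * suc r ^ suc j
      ≡⟨ lem r (suc r ^ suc j) ⟩
    r * suc r ^ suc j + suc r ^ suc j
      ≤⟨ +-monoˡ-≤ (suc r ^ suc j) (*-monoʳ-≤ r (suc-^-≤ r j)) ⟩
    r * (r ^ suc j + suc j * suc r ^ j) + suc r * suc r ^ j
      ≤⟨ m≤m+n _ (suc j * suc r ^ j) ⟩
    r * (r ^ suc j + suc j * suc r ^ j) + suc r * suc r ^ j + suc j * suc r ^ j
      ≡⟨ lem₂ r j (r ^ suc j) (suc r ^ j) ⟩
    r * r ^ suc j + suc (suc j) * (suc r * suc r ^ j) ∎
  where
  open ≤-Reasoning
  lem : ∀ r x → suc r * x ≡ r * x + x
  lem = solve-∀
  lem₂ : ∀ r j p q → r * (p + suc j * q) + suc r * q + suc j * q ≡ r * p + suc (suc j) * (suc r * q)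
  lem₂ = solve-∀

expPoly-step : ∀ k j r → expPoly k (suc j) (suc r) ≤ expPoly k (suc j) r + suc j * expPoly k j (suc r)
expPoly-step k zero    r = ≤-reflexive (lem k r)
  where
  lem : ∀ k r → k * 1 * 1 + suc r * 1 ≡ k * 1 * 1 + r * 1 + 1 * 1
  lem = solve-∀
expPoly-step k (suc j) r = begin
    k * suc (suc j) * expPoly k (suc j) (suc r) + suc r ^ suc (suc j)
      ≤⟨ +-mono-≤ (*-monoʳ-≤ (k * suc (suc j)) (expPoly-step k j r)) (suc-^-≤ r (suc j)) ⟩
    k * suc (suc j) * (expPoly k (suc j) r + suc j * expPoly k j (suc r)) + (r ^ suc (suc j) + suc (suc j) * suc r ^ suc j)
      ≡⟨ lem k j (expPoly k (suc j) r) (expPoly k j (suc r)) (r ^ suc (suc j)) (suc r ^ suc j) ⟩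
    expPoly k (suc (suc j)) r + suc (suc j) * expPoly k (suc j) (suc r) ∎
  where
  open ≤-Reasoning
  lem : ∀ k j p q x y → k * suc (suc j) * (p + suc j * q) + (x + suc (suc j) * y) ≡
    k * suc (suc j) * p + x + suc (suc j) * (k * suc j * q + y)
  lem = solve-∀

-- For the partial sums of exp at r/k, the increment from r to r + 1 is at most 1/k times the
-- preceding partial sum at the larger argument, hence at most 1/k of the new value. So each step
-- multiplies by at most k/(k - 1), where k = K + 1.
expPoly-ratio : ∀ K j r → K * expPoly (suc K) j (suc r) ≤ suc K * expPoly (suc K) j r
expPoly-ratio K zero    r = ≤-trans (≤-reflexive (*-identityʳ K)) (≤-trans (n≤1+n K) (≤-reflexive (sym (*-identityʳ (suc K)))))
expPoly-ratio K (suc j) r = +-cancelˡ-≤ p⁺ _ _ (begin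
    p⁺ + K * p⁺
      ≤⟨ *-monoʳ-≤ (suc K) (expPoly-step (suc K) j r) ⟩
    suc K * (p + suc j * q)
      ≡⟨ lem (suc K) j p q ⟩
    suc K * suc j * q + suc K * p
      ≤⟨ +-monoˡ-≤ (suc K * p) (m≤m+n (suc K * suc j * q) (suc r ^ suc j)) ⟩
    p⁺ + suc K * p ∎)
  where
  open ≤-Reasoning
  p p⁺ q : ℕ
  p = expPoly (suc K) (suc j) r
  p⁺ = expPoly (suc K) (suc j) (suc r)
  q = expPoly (suc K) j (suc r)
  lem : ∀ k j p q → k * (p + suc j * q) ≡ k * suc j * q + k * p
  lem = solve-∀

expPoly-power : ∀ K j r → K ^ r * expPoly (suc K) j r ≤ suc K ^ r * expPoly (suc K) j 0
expPoly-power K j zero    = ≤-refl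
expPoly-power K j (suc r) = begin
    K * K ^ r * expPoly (suc K) j (suc r)      ≡⟨ lem K (K ^ r) _ ⟩
    K ^ r * (K * expPoly (suc K) j (suc r))    ≤⟨ *-monoʳ-≤ (K ^ r) (expPoly-ratio K j r) ⟩
    K ^ r * (suc K * expPoly (suc K) j r)      ≡⟨ lem₂ (K ^ r) (suc K) _ ⟩
    suc K * (K ^ r * expPoly (suc K) j r)      ≤⟨ *-monoʳ-≤ (suc K) (expPoly-power K j r) ⟩
    suc K * (suc K ^ r * expPoly (suc K) j 0)  ≡⟨ *-assoc (suc K) (suc K ^ r) _ ⟨
    suc K ^ suc r * expPoly (suc K) j 0        ∎
  where
  open ≤-Reasoning
  lem : ∀ a b c → a * b * c ≡ b * (a * c)
  lem = solve-∀
  lem₂ : ∀ a b c → a * (b * c) ≡ b * (a * c)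
  lem₂ = solve-∀

-- j! times the j-th partial sum of the series for e.
eNum : ℕ → ℕ
eNum zero    = 1
eNum (suc j) = suc j * eNum j + 1

expPoly-zero : ∀ k j → expPoly k j 0 ≡ k ^ j * j !
expPoly-zero k zero    = refl
expPoly-zero k (suc j) = trans (+-identityʳ _) (trans (cong (k * suc j *_) (expPoly-zero k j)) (lem k (suc j) (k ^ j) (j !)))
  where
  lem : ∀ k j p f → k * j * (p * f) ≡ k * p * (j * f)
  lem = solve-∀

expPoly-one : ∀ k j → expPoly k j k ≡ k ^ j * eNum j
expPoly-one k zero    = refl
expPoly-one k (suc j) = trans (cong (λ z → k * suc j * z + k ^ suc j) (expPoly-one k j)) (lem k j (k ^ j) (eNum j))
  where
  lem : ∀ k j p e → k * suc j * (p * e) + k * p ≡ k * p * (suc j * e + 1)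
  lem = solve-∀

-- After K + 1 steps from 0 to 1, every partial sum for e is at most ((K + 1)/K)^(K + 1), cleared of
-- denominators to include K = 0. Since this holds for each j, the comparison with 1/e holds at
-- every approximation, without a limit.
eNum-bound : ∀ K j → K ^ suc K * eNum j ≤ suc K ^ suc K * j !
eNum-bound K j = *-cancelˡ-≤ (suc K ^ j) {{m^n≢0 (suc K) j}} (subst₂ _≤_
    (trans (cong (K ^ suc K *_) (expPoly-one (suc K) j)) (lem (K ^ suc K) (suc K ^ j) (eNum j)))
    (trans (cong (suc K ^ suc K *_) (expPoly-zero (suc K) j)) (lem (suc K ^ suc K) (suc K ^ j) (j !)))
    (expPoly-power K j (suc K)))
  where
  lem : ∀ a b c → a * (b * c) ≡ b * (a * c)
  lem = solve-∀

expSum≡eNum/! : ∀ j → expSum j ≡ (+ eNum j / j !) {{j !≢0}}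
expSum≡eNum/! zero    = refl
expSum≡eNum/! (suc j) = trans (cong (ℚ._+ (+ 1 / (suc j !)) {{suc j !≢0}}) (expSum≡eNum/! j))
  (trans (frac-+ (eNum j) (j !) 1 (suc j !) {{j !≢0}} {{suc j !≢0}})
    (frac-≡ (eNum j * suc j ! + 1 * j !) (j ! * suc j !) (eNum (suc j)) (suc j !) {{m*n≢0 (j !) (suc j !) {{j !≢0}} {{suc j !≢0}}}} {{suc j !≢0}}
      (lem j (eNum j) (j !))))
  where
  lem : ∀ j e f → (e * (suc j * f) + 1 * f) * (suc j * f) ≡ (suc j * e + 1) * (f * (suc j * f))
  lem = solve-∀

frac-* : ∀ a b c d .{{_ : NonZero b}} .{{_ : NonZero d}} →
  (+ a / b) ℚ.* (+ c / d) ≡ (+ (a * c) / (b * d)) {{m*n≢0 b d}}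
frac-* a b@(suc _) c d@(suc _) = ℚ.toℚᵘ-injective (begin-equality
  ℚ.toℚᵘ ((+ a / b) ℚ.* (+ c / d))
    ≃⟨ ℚ.toℚᵘ-homo-* (+ a / b) (+ c / d) ⟩
  ℚ.toℚᵘ (+ a / b) ℚᵘ.* ℚ.toℚᵘ (+ c / d)
    ≃⟨ ℚᵘ.*-cong (ℚ.toℚᵘ-fromℚᵘ (+ a ℚᵘ./ b)) (ℚ.toℚᵘ-fromℚᵘ (+ c ℚᵘ./ d)) ⟩
  (+ a ℚᵘ./ b) ℚᵘ.* (+ c ℚᵘ./ d)
    ≃⟨ ℚᵘ.≃-reflexive (cong (λ z → z ℚᵘ./ (b * d)) (sym (ℤ.pos-* a c))) ⟩
  + (a * c) ℚᵘ./ (b * d)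
    ≃⟨ ℚ.toℚᵘ-fromℚᵘ (+ (a * c) ℚᵘ./ (b * d)) ⟨
  ℚ.toℚᵘ (+ (a * c) / (b * d)) ∎)
  where open ℚᵘ.≤-Reasoning

≤-÷ : ∀ p q .{{_ : ℚ.NonZero q}} → 1ℚ ℚ.≤ q → p ℚ.* q ℚ.≤ 1ℚ → p ℚ.≤ 1ℚ ℚ.÷ q
≤-÷ p q 1≤q pq≤1 = subst (ℚ._≤ 1ℚ ℚ.÷ q)
  (trans (ℚ.*-assoc p q (ℚ.1/ q)) (trans (cong (p ℚ.*_) (ℚ.*-inverseʳ q)) (ℚ.*-identityʳ p)))
  (ℚ.*-monoʳ-≤-nonNeg (ℚ.1/ q) {{ℚ.pos⇒nonNeg (ℚ.1/ q) {{recip-pos q (ℚ.positive (ℚ.<-≤-trans (ℚ.positive⁻¹ 1ℚ) 1≤q))}}}} pq≤1)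

÷-≤ : ∀ p q z .{{_ : ℚ.NonZero q}} → 1ℚ ℚ.≤ q → p ℚ.÷ q ℚ.≤ z → p ℚ.≤ z ℚ.* q
÷-≤ p q z 1≤q h = subst (ℚ._≤ z ℚ.* q)
  (trans (ℚ.*-assoc p (ℚ.1/ q) q) (trans (cong (p ℚ.*_) (ℚ.*-inverseˡ q)) (ℚ.*-identityʳ p)))
  (ℚ.*-monoʳ-≤-nonNeg q {{ℚ.nonNegative (ℚ.≤-trans (ℚ.nonNegative⁻¹ 1ℚ) 1≤q)}} h)

power-ratio≤1/e : ∀ i j → (+ (i ^ suc i) / (suc i ^ suc i)) {{m^n≢0 (suc i) (suc i)}} ℚ.≤ seq 1/e j
power-ratio≤1/e i j = ≤-÷ _ (expSum j) {{1≤⇒nonZero (1≤expSum j)}} (1≤expSum j)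
  (subst (ℚ._≤ 1ℚ) (sym (trans (cong ((+ (i ^ suc i) / Jᴶ) ℚ.*_) (expSum≡eNum/! j)) (frac-* (i ^ suc i) Jᴶ (eNum j) (j !))))
    (frac-≤ (i ^ suc i * eNum j) (Jᴶ * j !) 1 1 (subst₂ _≤_ (sym (*-identityʳ _)) (sym (+-identityʳ _)) (eNum-bound i j))))
  where
  Jᴶ : ℕ
  Jᴶ = suc i ^ suc i
  instance
    Jᴶ≢0 : NonZero Jᴶ
    Jᴶ≢0 = m^n≢0 (suc i) (suc i)
    j!≢0 : NonZero (j !)
    j!≢0 = j !≢0
    Jj!≢0 : NonZero (Jᴶ * j !)
    Jj!≢0 = m*n≢0 Jᴶ (j !)

-- Passage to real numbers and to the limit

_∸ᵣ_ : ℝ → ℝ → ℝ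
x ∸ᵣ y = real (λ i → 0ℚ ℚ.⊔ (seq x i ℚ.- seq y i)) λ ε 0<ε →
  let M , close-x = cauchy x (½ ℚ.* ε) (half-pos 0<ε)
      N , close-y = cauchy y (½ ℚ.* ε) (half-pos 0<ε)
  in M ⊔ N , λ i j M⊔N≤i M⊔N≤j →
    let M≤i = ≤-trans (m≤m⊔n M N) M⊔N≤i ; M≤j = ≤-trans (m≤m⊔n M N) M⊔N≤j
        N≤i = ≤-trans (m≤n⊔m M N) M⊔N≤i ; N≤j = ≤-trans (m≤n⊔m M N) M⊔N≤j
    in dist-≤ (one-sided ε 0<ε (seq x i) (seq x j) (seq y i) (seq y j) (dist-≤⁻¹ (close-x i j M≤i M≤j)) (dist-≤⁻¹ (close-y j i N≤j N≤i)))
              (one-sided ε 0<ε (seq x j) (seq x i) (seq y j) (seq y i) (dist-≤⁻¹ (close-x j i M≤j M≤i)) (dist-≤⁻¹ (close-y i j N≤i N≤j)))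
  where
  one-sided : ∀ ε → 0ℚ ℚ.< ε → ∀ a b c d → a ℚ.≤ b ℚ.+ ½ ℚ.* ε → d ℚ.≤ c ℚ.+ ½ ℚ.* ε →
    0ℚ ℚ.⊔ (a ℚ.- c) ℚ.≤ 0ℚ ℚ.⊔ (b ℚ.- d) ℚ.+ ε
  one-sided ε 0<ε a b c d a≤ d≤ = ℚ.⊔-lub
      (ℚ.≤-trans (ℚ.≤-reflexive (sym (ℚ.+-identityʳ 0ℚ))) (ℚ.+-mono-≤ (ℚ.p≤p⊔q 0ℚ (b ℚ.- d)) (ℚ.<⇒≤ 0<ε)))
      (ℚ.≤-trans diff (ℚ.+-monoˡ-≤ ε (ℚ.p≤q⊔p 0ℚ (b ℚ.- d))))
    where
    open ℚ-Solver
    diff : a ℚ.- c ℚ.≤ b ℚ.- d ℚ.+ ε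
    diff = subst₂ ℚ._≤_
      (solve 3 (λ a c d → a :+ d :+ (:- c :+ :- d) := a :- c) refl a c d)
      (trans (solve 4 (λ b c d h → b :+ h :+ (c :+ h) :+ (:- c :+ :- d) := b :- d :+ (h :+ h)) refl b c d (½ ℚ.* ε))
        (cong (b ℚ.- d ℚ.+_) (half+half ε)))
      (ℚ.+-monoˡ-≤ (ℚ.- c ℚ.+ ℚ.- d) (ℚ.+-mono-≤ a≤ d≤))

fraction-bound : ∀ m # K j i .{{_ : NonZero m}} .{{K≢0 : NonZero K}} →
  m * (suc j ^ suc j * #) ≤ (m * j ^ suc j + 19 * suc j ^ suc j) * K →
  (+ # / K) ℚ.≤ seq 1/e i ℚ.+ (+ 19 / m)
fraction-bound m # K j i {{K≢0 = K≢0}} bound = ℚ.≤-trans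
    (subst ((+ # / K) ℚ.≤_) (sym (frac-+ (j ^ suc j) Jᴶ 19 m))
      (frac-≤ # K (j ^ suc j * m + 19 * Jᴶ) (Jᴶ * m) {{K≢0}} {{m*n≢0 Jᴶ m}}
        (subst₂ _≤_ (lem₁ m Jᴶ #) (cong (λ z → (z + 19 * Jᴶ) * K) (*-comm m (j ^ suc j))) bound)))
    (ℚ.+-monoˡ-≤ (+ 19 / m) (power-ratio≤1/e j i))
  where
  Jᴶ : ℕ
  Jᴶ = suc j ^ suc j
  instance
    Jᴶ≢0 : NonZero Jᴶ
    Jᴶ≢0 = m^n≢0 (suc j) (suc j)
  lem₁ : ∀ m j x → m * (j * x) ≡ x * (j * m)
  lem₁ = solve-∀

ind-bound : ∀ m T k ℓ .{{_ : NonZero m}} .{{_ : NonZero T}} .{{_ : NonZero ℓ}} .{{_ : NonZero k}} →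
  Constants.C m * T ^ 5 ≤ k → 2 * ℓ * m ≤ T * k →
  ∀ i → k * k * suc m ≤ i → seq (ind k ℓ) i ℚ.≤ seq 1/e i ℚ.+ (+ 19 / m)
ind-bound m T k ℓ CT⁵≤k 2ℓm≤Tk i large =
    let G , Pr≡I = I-attained (k + i) k ℓ (m≤m+n k i)
        j , bound = Constants.subset-probability m T k ℓ CT⁵≤k 2ℓm≤Tk {{n≢0}} G (≤-trans large (m≤n+m i k))
    in subst (ℚ._≤ seq 1/e i ℚ.+ (+ 19 / m)) Pr≡I
         (fraction-bound m #[ G , k , ℓ ] (length (kSubsets (k + i) k)) j i {{K≢0 = kSubsets-nonZero (m≤m+n k i)}} bound)
  where
  n≢0 : NonZero (k + i)
  n≢0 = >-nonZero (≤-trans (n≢0⇒n>0 (≢-nonZero⁻¹ k)) (m≤m+n k i))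

-- The real inequality is read at a single approximation N: the bound 1/(2M) and a tolerance of
-- 1/(2M) give a quotient of at most 1/M, and the truncated fifth root, raised to the fifth power,
-- is at most its radicand.
growth : ∀ (k ℓ M : ℕ) .{{_ : NonZero M}} .(1≤k : 1 ≤ k) →
  ((+ ℓ / 1) ÷ᵣ k ^6/5) (1≤k^6/5 k 1≤k) ≤ᵣ fromℚ 0ℚ +ᵣ fromℚ ((+ 1 / (2 * M)) {{m*n≢0 2 M}}) →
  (ℓ * M) ^ 5 ≤ k ^ 6
growth k ℓ M 1≤k h = *-cancelʳ-≤ _ _ (suc N ^ 5) {{m^n≢0 (suc N) 5}} (begin
    (ℓ * M) ^ 5 * suc N ^ 5    ≡⟨ ^-distribʳ-* 5 (ℓ * M) (suc N) ⟨
    (ℓ * M * suc N) ^ 5        ≤⟨ ^-monoˡ-≤ 5 ℓMN≤ ⟩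
    root5 ^ 5                  ≤⟨ ⌊root⌋-≤ 5 (k ^ 6 * suc N ^ 5) ⟩
    k ^ 6 * suc N ^ 5          ∎)
  where
  open ≤-Reasoning
  instance
    2M≢0 : NonZero (2 * M)
    2M≢0 = m*n≢0 2 M
  half : ℚ.ℚ
  half = + 1 / (2 * M)
  0<half : 0ℚ ℚ.< half
  0<half = ℚ.positive⁻¹ half {{ℚ.normalize-pos 1 (2 * M)}}
  N : ℕ
  N = proj₁ (h half 0<half)
  root5 : ℕ
  root5 = ⌊root⌋ 5 (k ^ 6 * suc N ^ 5)
  sum-half : 0ℚ ℚ.+ half ℚ.+ half ≡ + 1 / M
  sum-half = trans (cong (ℚ._+ half) (ℚ.+-identityˡ half)) (trans (frac-+ 1 (2 * M) 1 (2 * M))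
    (frac-≡ (1 * (2 * M) + 1 * (2 * M)) (2 * M * (2 * M)) 1 M {{m*n≢0 (2 * M) (2 * M)}} (lem M)))
    where
    lem : ∀ M → (1 * (2 * M) + 1 * (2 * M)) * M ≡ 1 * (2 * M * (2 * M))
    lem = solve-∀
  quotient≤ : ((+ ℓ / 1) ℚ.÷ seq (k ^6/5) N) {{1≤⇒nonZero (1≤k^6/5 k 1≤k N)}} ℚ.≤ + 1 / M
  quotient≤ = subst (λ z → ((+ ℓ / 1) ℚ.÷ seq (k ^6/5) N) {{1≤⇒nonZero (1≤k^6/5 k 1≤k N)}} ℚ.≤ z) sum-half (proj₂ (h half 0<half) N ≤-refl)
  1≤seq : 1ℚ ℚ.≤ seq (k ^6/5) N
  1≤seq = recompute (1ℚ ℚ.≤? seq (k ^6/5) N) (1≤k^6/5 k 1≤k N)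
  ℓMN≤ : ℓ * M * suc N ≤ root5
  ℓMN≤ = subst₂ _≤_ (sym (*-assoc ℓ M (suc N))) (trans (*-identityʳ _) (+-identityʳ root5))
    (frac-≤⁻¹ ℓ 1 (1 * root5) (M * suc N) {{_}} {{m*n≢0 M (suc N)}}
      (subst ((+ ℓ / 1) ℚ.≤_) (frac-* 1 M root5 (suc N))
        (÷-≤ (+ ℓ / 1) (seq (k ^6/5) N) (+ 1 / M) {{1≤⇒nonZero 1≤seq}} 1≤seq quotient≤)))

-- T is the quotient 2ℓm/k rounded down, plus 1. If 2ℓm < k, then T = 1 and C ≤ k suffices;
-- otherwise Tk ≤ 4ℓm, and the fifth power of 4ℓmC is compared with k⁶. This explains the factor
-- `4 * m * C`.
threshold : ∀ m C k ℓ .{{_ : NonZero m}} .{{_ : NonZero k}} → 1 ≤ C → C ≤ k → (ℓ * (4 * m * C)) ^ 5 ≤ k ^ 6 →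
  Σ ℕ λ T → NonZero T × C * T ^ 5 ≤ k × 2 * ℓ * m ≤ T * k
threshold m C k ℓ 1≤C C≤k ℓ-small = suc q , _ , CT⁵≤k , 2ℓm≤Tk
  where
  open ≤-Reasoning
  q : ℕ
  q = 2 * ℓ * m ℕ./ k
  2ℓm≤Tk : 2 * ℓ * m ≤ suc q * k
  2ℓm≤Tk = ≤-trans (≤-reflexive (m≡m%n+[m/n]*n (2 * ℓ * m) k)) (+-monoˡ-≤ (q * k) (<⇒≤ (m%n<n (2 * ℓ * m) k)))
  CT⁵≤k : C * suc q ^ 5 ≤ k
  CT⁵≤k with 2 * ℓ * m <? k
  ... | yes <k = subst (λ z → C * suc z ^ 5 ≤ k) (sym (m<n⇒m/n≡0 <k)) (≤-trans (≤-reflexive (*-identityʳ C)) C≤k)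
  ... | no ≮k = *-cancelʳ-≤ _ _ (k ^ 5) {{m^n≢0 k 5}} (begin
      C * suc q ^ 5 * k ^ 5             ≡⟨ trans (*-assoc C (suc q ^ 5) (k ^ 5)) (cong (C *_) (sym (^-distribʳ-* 5 (suc q) k))) ⟩
      C * (suc q * k) ^ 5               ≤⟨ *-mono-≤ (m≤m*n C (C ^ 4) {{m^n≢0 C 4 {{>-nonZero 1≤C}}}}) (^-monoˡ-≤ 5 Tk≤4ℓm) ⟩
      C ^ 5 * (4 * (ℓ * m)) ^ 5         ≡⟨ ^-distribʳ-* 5 C (4 * (ℓ * m)) ⟨
      (C * (4 * (ℓ * m))) ^ 5           ≡⟨ cong (_^ 5) (lem C ℓ m) ⟩
      (ℓ * (4 * m * C)) ^ 5             ≤⟨ ℓ-small ⟩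
      k ^ 6                             ∎)
    where
    lem : ∀ C l m → C * (4 * (l * m)) ≡ l * (4 * m * C)
    lem = solve-∀
    lem₂ : ∀ l m → 2 * l * m + 2 * l * m ≡ 4 * (l * m)
    lem₂ = solve-∀
    Tk≤4ℓm : suc q * k ≤ 4 * (ℓ * m)
    Tk≤4ℓm = ≤-trans (+-mono-≤ (≮⇒≥ ≮k) (m/n*n≤m (2 * ℓ * m) k)) (≤-reflexive (lem₂ ℓ m))

weaken : ∀ {p q} η → 0ℚ ℚ.< η → p ℚ.≤ q → p ℚ.≤ q ℚ.+ η
weaken {p} {q} η 0<η p≤q = ℚ.≤-trans p≤q (subst (ℚ._≤ q ℚ.+ η) (ℚ.+-identityʳ q) (ℚ.+-monoʳ-≤ q (ℚ.<⇒≤ 0<η)))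

theorem1p4 : (ℓ : ∀ k → .(1 ≤ k) → ℕ) →
    (∀ k .(1≤k : 1 ≤ k) → 1 ≤ ℓ k 1≤k) →
    (λ k 1≤k → ((+ ℓ k 1≤k / 1) ÷ᵣ k ^6/5) (1≤k^6/5 k 1≤k)) ⟶ fromℚ 0ℚ →
    Σ (∀ k → .(1 ≤ k) → ℝ) λ ε →
    (ε ⟶ fromℚ 0ℚ) ×
    (∀ k .(1≤k : 1 ≤ k) → ind k (ℓ k 1≤k) ≤ᵣ 1/e +ᵣ ε k 1≤k)
theorem1p4 ℓ 1≤ℓ ℓ≪k^6/5 = ε , ε⟶0 , bound
  where
  ε : ∀ k → .(1 ≤ k) → ℝ
  -- With the positive part of the difference as error term the upper bound is immediate, and the
  -- content lies in its convergence to 0.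
  ε k 1≤k = ind k (ℓ k 1≤k) ∸ᵣ 1/e

  bound : ∀ k .(1≤k : 1 ≤ k) → ind k (ℓ k 1≤k) ≤ᵣ 1/e +ᵣ ε k 1≤k
  bound k 1≤k η 0<η = 0 , λ i _ → weaken η 0<η (sub-≤⁻¹ (ℚ.p≤q⊔p 0ℚ (seq (ind k (ℓ k 1≤k)) i ℚ.- seq 1/e i)))

  ε⟶0 : ε ⟶ fromℚ 0ℚ
  ε⟶0 η 0<η = proj₁ converges ⊔ C , λ k 1≤k large →
      (λ η′ 0<η′ → k * k * suc m , λ i i-large → weaken η′ 0<η′
        (subst (seq (ε k 1≤k) i ℚ.≤_) (sym (ℚ.+-identityˡ η)) (ℚ.⊔-lub (ℚ.<⇒≤ 0<η) (sub-≤ (close k 1≤k large i i-large))))) ,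
      (λ η′ 0<η′ → 0 , λ i _ → weaken η′ 0<η′ (weaken η 0<η (ℚ.p≤p⊔q 0ℚ (seq (ind k (ℓ k 1≤k)) i ℚ.- seq 1/e i))))
    where
    small19 : ∃ λ N → ∀ n → N ≤ n → (+ 19 / suc n) ℚ.≤ η
    small19 = small 19 η 0<η
    m : ℕ
    -- Chosen so that the total error 19/m is at most η.
    m = suc (proj₁ small19)
    open Constants m using (C; 1≤C)
    M : ℕ
    M = 4 * m * C
    instance
      M≢0 : NonZero M
      M≢0 = m*n≢0 (4 * m) C {{_}} {{>-nonZero 1≤C}}
      2M≢0 : NonZero (2 * M)
      2M≢0 = m*n≢0 2 M
    converges : ∃ λ N → ∀ k .(1≤k : 1 ≤ k) → N ≤ k →
      ((+ ℓ k 1≤k / 1) ÷ᵣ k ^6/5) (1≤k^6/5 k 1≤k) ≤ᵣ fromℚ 0ℚ +ᵣ fromℚ (+ 1 / (2 * M)) ×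
      fromℚ 0ℚ ≤ᵣ ((+ ℓ k 1≤k / 1) ÷ᵣ k ^6/5) (1≤k^6/5 k 1≤k) +ᵣ fromℚ (+ 1 / (2 * M))
    converges = ℓ≪k^6/5 (+ 1 / (2 * M)) (ℚ.positive⁻¹ (+ 1 / (2 * M)) {{ℚ.normalize-pos 1 (2 * M)}})
    close : ∀ k .(1≤k : 1 ≤ k) → proj₁ converges ⊔ C ≤ k → ∀ i → k * k * suc m ≤ i →
      seq (ind k (ℓ k 1≤k)) i ℚ.≤ seq 1/e i ℚ.+ η
    close k 1≤k large i i-large =
      let C≤k = ≤-trans (m≤n⊔m (proj₁ converges) C) large
          k≢0 = >-nonZero (≤-trans 1≤C C≤k)
          ℓ-small = growth k (ℓ k 1≤k) M 1≤k (proj₁ (proj₂ converges k 1≤k (≤-trans (m≤m⊔n (proj₁ converges) C) large)))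
          T , T≢0 , CT⁵≤k , 2ℓm≤Tk = threshold m C k (ℓ k 1≤k) {{_}} {{k≢0}} 1≤C C≤k ℓ-small
      in ℚ.≤-trans (ind-bound m T k (ℓ k 1≤k) {{_}} {{T≢0}} {{>-nonZero (1≤ℓ k 1≤k)}} {{k≢0}} CT⁵≤k 2ℓm≤Tk i i-large)
           (ℚ.+-monoʳ-≤ (seq 1/e i) (proj₂ small19 (proj₁ small19) ≤-refl))
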